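{- Let $k\ge 3$ be an integer and let $G$ be a finite group of odd order. Then there is an integer $v_0=v_0(k,G)$ such that for every integer $v\ge v_0$ satisfying the divisibility conditions $v-1\equiv 0 \pmod{k-1}$ and $v(v-1)\equiv 0\pmod{k(k-1)}$, there exists a $2$-$(v,k,1)$-design whose automorphism group has a subgroup isomorphic to $G$.
   Context: A $2$-$(v,k,1)$-design consists of a set of $v$ points together with a collection of $k$-element subsets of the points (called blocks) such that any two distinct points lie in exactly one block. An automorphism is a permutation of the points mapping the set of blocks onto itself; the automorphisms form the automorphism group of the design. -}

module Defs where

open import Level using (Level; _⊔_)
open import Data.Nat using (ℕ; _≤_; _∸_; _*_)
open import Data.Nat.Divisibility using (_∣_)
open import Data.Fin using (Fin)
open import Data.Fin.Subset using (Subset; _∈_; ∣_∣)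
open import Data.Fin.Permutation using (Permutation′; _⟨$⟩ʳ_; _⟨$⟩ˡ_)
open import Data.Vec using (tabulate; lookup)
open import Data.Product using (Σ; _×_; ∃)
open import Function.Bundles using (Bijection; _⇔_)
open import Algebra.Bundles using (Group)
open import Relation.Nullary using (¬_)
open import Relation.Binary.PropositionalEquality using (_≡_; setoid)

record Design (v k : ℕ) : Set₁ where
  field
    IsBlock   : Subset v → Set
    blockSize : ∀ B → IsBlock B → ∣ B ∣ ≡ k
    unique2   : ∀ (x y : Fin v) → ¬ (x ≡ y) →
                Σ (Subset v) λ B → IsBlock B × x ∈ B × y ∈ B ×
                  (∀ B′ → IsBlock B′ → x ∈ B′ → y ∈ B′ → B′ ≡ B)

image : ∀ {v} → Permutation′ v → Subset v → Subset v
image π B = tabulate (λ i → lookup B (π ⟨$⟩ˡ i))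

IsAutomorphism : ∀ {v k} → Design v k → Permutation′ v → Set
IsAutomorphism D π = ∀ B → IsBlock B ⇔ IsBlock (image π B)
  where open Design D

_≈ₚ_ : ∀ {v} → Permutation′ v → Permutation′ v → Set
π ≈ₚ σ = ∀ i → π ⟨$⟩ʳ i ≡ σ ⟨$⟩ʳ i

-- composition (apply σ first, then π)
_∘ₚ_ : ∀ {v} → Permutation′ v → Permutation′ v → Permutation′ v
π ∘ₚ σ = Data.Fin.Permutation._∘ₚ_ σ π

record GroupEmbeddingIntoAut {c ℓ : Level} (G : Group c ℓ) {v k : ℕ} (D : Design v k)
       : Set (c ⊔ ℓ) where
  open Group G
  field
    ρ         : Carrier → Permutation′ v
    ρ-aut     : ∀ g → IsAutomorphism D (ρ g)
    ρ-cong    : ∀ {g h} → g ≈ h → ρ g ≈ₚ ρ h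
    ρ-hom     : ∀ g h → ρ (g ∙ h) ≈ₚ (ρ g ∘ₚ ρ h)
    ρ-injective : ∀ {g h} → ρ g ≈ₚ ρ h → g ≈ h

FiniteOfOrder : ∀ {c ℓ} → Group c ℓ → ℕ → Set (c ⊔ ℓ)
FiniteOfOrder G n = Bijection (Group.setoid G) (setoid (Fin n))

Odd : ℕ → Set
Odd n = ¬ (2 ∣ n)

{-# OPTIONS --safe #-}
module Submission where

-- Take |G| k groups of points, permuted freely by G in k orbits, and a list of blocks on the set of groups covering every pair
-- of groups equally often. Lifting the blocks along the lines of a transversal design with labels in ℤ/Λ separates the covers of
-- a pair of groups, so that each pair of points in different groups lies in one lifted block. As |G| is odd, no element of G
-- interchanges two groups, so the labels can be chosen compatibly with G and the lifted blocks are permuted by G.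
-- One group of points together with w points fixed by G is then filled with a design that has a hole of size w, the filling is
-- copied by G, and the fixed points carry an arbitrary design.
--
-- The existence of the fillings is a form of Wilson's theorem. For primes p ≡ 1 modulo a large number the second moment method
-- finds a difference family in ℤ/p. Products of such designs give a number H with designs on 1 + m H points for all m ≥ k.
-- If v is admissible, some list of blocks covers every pair of v points 1 + Q n U times, where U counts all blocks: over ℤ the pairs
-- are generated by alternating 4-cycles and blocks, and a negative block is a uniform cover without that block.
-- Lifting this list gives designs in the residue class of v modulo Q, and truncated transversal designs, filled with them,
-- make up the difference.

open import Defs
open import Level using (Level)
open import Data.Bool using (Bool; true; false; if_then_else_; _∧_)
open import Data.Nat using (ℕ; zero; suc; _+_; _*_; _∸_; _^_; _≤_; _<_; z≤n; s≤s; NonZero; _≤?_; _<?_; _!; >-nonZero)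
import Data.Nat as ℕ
import Data.Nat.Properties as ℕₚ
open import Data.Nat.Divisibility using (_∣_; divides; _∣?_)
import Data.Nat.Divisibility as Div
open import Data.Nat.DivMod using (_/_; _%_)
import Data.Nat.DivMod as DM
open import Data.Nat.Primality using (Prime)
import Data.Nat.Primality as Pr
open import Data.Integer.Base using (ℤ; +_; -[1+_]) renaming (_+_ to _+ᶻ_; _*_ to _*ᶻ_; _-_ to _-ᶻ_; -_ to -ᶻ_)
import Data.Integer as ℤ
import Data.Integer.Properties as ℤₚ
import Data.Integer.DivMod as ℤDM
open import Data.Fin using (Fin; zero; suc; toℕ; fromℕ<; combine; remQuot)
import Data.Fin as F
import Data.Fin.Properties as Fₚ
open import Data.Fin.Permutation using (Permutation′; permutation; _⟨$⟩ʳ_; _⟨$⟩ˡ_)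
import Data.Fin.Permutation as Perm
open import Data.Vec using (Vec; []; _∷_; lookup; tabulate)
import Data.Vec as V
import Data.Vec.Properties as Vₚ
open import Data.List using (List; []; _∷_; _++_; length)
import Data.List as List
import Data.List.Properties as Lₚ
open import Data.Product using (Σ; ∃; _×_; _,_; proj₁; proj₂)
open import Data.Product.Function.NonDependent.Propositional using (_×-↔_)
open import Data.Product.Properties using (≡-dec; ,-injectiveˡ; ,-injectiveʳ)
open import Data.Sum using (_⊎_; inj₁; inj₂)
open import Data.Sum.Function.Propositional using (_⊎-↔_)
open import Data.Sum.Properties using (inj₁-injective; inj₂-injective)
open import Data.Empty using (⊥; ⊥-elim)
open import Data.Unit using (⊤; tt)
open import Function using (_∘_; id)
open import Function.Bundles using (_↔_; mk↔ₛ′; Inverse; Bijection; mk⇔)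
open import Data.Fin.Subset using (Subset; _∈_)
import Data.Fin.Subset as Sub
import Function.Properties.Inverse as Inv
open import Algebra.Bundles using (Group)
open import Relation.Nullary using (¬_; Dec; yes; no; does)
open import Relation.Nullary.Decidable using (⌊_⌋; _×-dec_; ¬?; dec-true; dec-false; does-⇔)
open import Relation.Binary.PropositionalEquality using (_≡_; _≢_; refl; sym; trans; cong; cong₂; subst; subst₂; module ≡-Reasoning)
import Data.Nat.Tactic.RingSolver as ℕS
import Data.Integer.Tactic.RingSolver as ℤS
open import Relation.Binary.Definitions using (tri<; tri≈; tri>)
import Data.Bool.Properties as Boolₚ
import Axiom.UniquenessOfIdentityProofs as UIP
import Algebra.Properties.Semiring.Sum ℤₚ.+-*-semiring as Σℤ
import Algebra.Properties.Semiring.Sum ℕₚ.+-*-semiring as Σℕ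
open import Data.Nat.Induction using (<-wellFounded)
open import Induction.WellFounded using (Acc; acc)
import Data.Nat.Coprimality as Cop
import Data.Nat.GCD as GCD
open import Data.Nat.Primality.Factorisation using (factorise)
open import Data.List.Relation.Unary.All using ([]; _∷_)
import Algebra.Properties.CommutativeMonoid.Sum ℤₚ.*-1-commutativeMonoid as Πℤ

-- Clique decompositions, transversal designs and their composition

-- Two obstacles shape the proof. A pair of points of the lifted design must reveal both the cover
-- it comes from and the element of `G` that translated a base block to it. The labels therefore
-- live in ℤ/(|G| l): besides the l covers they record an element of `G` attached equivariantly to
-- each unordered pair of groups of points. An element interchanging two such groups would have to
-- fix that label, although left multiplication is free; this is the only use of odd order. The
-- period `Q` of the sizes obtained depends on the size `w` of the hole, so `w` cannot be adapted to
-- v modulo `Q` in advance. Residues are fixed twice: a design order `w` for the class of v modulo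
-- `H`, and only then a number w₁ = s H + w of fixed points for the class modulo a multiple of `Q`.
-- Truncation is what lets the hole grow from w to w₁. Orders in a prescribed class come from covers
-- of multiplicity λ ≡ 1: the groups of the lift have size a power of λ, so r times that power is
-- still ≡ r. The primes are extracted from numbers a^E - 1, which takes the place of Dirichlet's
-- theorem.

Joins : ∀ {I A : Set} {k} → (I → Fin k → A) → A → A → Set
Joins {I} {A} {k} block x y =
  Σ I λ i → Σ (Fin k) λ p → Σ (Fin k) λ q → p ≢ q × block i p ≡ x × block i q ≡ y

-- An edge decomposition of the graph `E` into complete graphs on `k` vertices: complete graphs give
-- designs, complete multipartite graphs give group divisible designs. Blocks are tuples, and `uniq`
-- compares only their indices; that the slots agree as well follows from `block-injective`.
record Decomp (k : ℕ) (A : Set) (E : A → A → Set) : Set₁ where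
  field
    Index  : Set
    block  : Index → Fin k → A
    irrefl : ∀ {x} → ¬ E x x
    isEdge : ∀ i {p q} → p ≢ q → E (block i p) (block i q)
    find   : ∀ {x y} → E x y → Joins block x y
    uniq   : ∀ {i j p q p′ q′} → p ≢ q → p′ ≢ q′ →
             block i p ≡ block j p′ → block i q ≡ block j q′ → i ≡ j

  block-injective : ∀ {i p q} → block i p ≡ block i q → p ≡ q
  block-injective {i} {p} {q} e with p F.≟ q
  ... | yes r = r
  ... | no n  = ⊥-elim (irrefl (subst (E (block i p)) (sym e) (isEdge i n)))

-- Injectivity is asked on edges rather than on vertices: an edge of the large graph determines its
-- piece and both endpoints in that piece, which is what uniqueness of the composed blocks consumes.
record EdgePartition {A : Set} (E : A → A → Set) {I : Set} (B : I → Set)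
                     (F : ∀ i → B i → B i → Set) : Set where
  field
    emb  : ∀ i → B i → A
    irrefl : ∀ {x} → ¬ E x x
    edge : ∀ i {x y} → F i x y → E (emb i x) (emb i y)
    find : ∀ {x y} → E x y → Σ I λ i → Σ (B i) λ x′ → Σ (B i) λ y′ → F i x′ y′ × emb i x′ ≡ x × emb i y′ ≡ y
    uniq : ∀ {i j x y x′ y′} → F i x y → F j x′ y′ → emb i x ≡ emb j x′ → emb i y ≡ emb j y′ →
           _≡_ {A = Σ I λ i → B i × B i} (i , x , y) (j , x′ , y′)

compose : ∀ {k A E I B F} → EdgePartition {A} E {I} B F → (∀ i → Decomp k (B i) (F i)) → Decomp k A E
compose {k} {A} {E} {I} {B} {F} P D = record
  { Index  = Σ I λ i → Decomp.Index (D i)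
  ; block  = block′
  ; irrefl = P.irrefl
  ; isEdge = λ { (i , m) p≢q → P.edge i (Decomp.isEdge (D i) m p≢q) }
  ; find   = find′
  ; uniq   = λ { {i , m} {j , m′} p≢q p′≢q′ e₁ e₂ →
      same (P.uniq (Decomp.isEdge (D i) m p≢q) (Decomp.isEdge (D j) m′ p′≢q′) e₁ e₂)
           m m′ p≢q p′≢q′ refl refl refl refl }
  }
  where
  module P = EdgePartition P
  block′ : (Σ I λ i → Decomp.Index (D i)) → Fin k → A
  block′ (i , m) p = P.emb i (Decomp.block (D i) m p)
  find′ : ∀ {x y} → E x y → Joins block′ x y
  find′ e with P.find e
  ... | i , x′ , y′ , f , refl , refl with Decomp.find (D i) f
  ... | m , p , q , p≢q , refl , refl = (i , m) , p , q , p≢q , refl , refl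
  same : ∀ {i j x y x′ y′} → _≡_ {A = Σ I λ i → B i × B i} (i , x , y) (j , x′ , y′) →
         ∀ m m′ {p q p′ q′} → p ≢ q → p′ ≢ q′ →
         Decomp.block (D i) m p ≡ x → Decomp.block (D i) m q ≡ y →
         Decomp.block (D j) m′ p′ ≡ x′ → Decomp.block (D j) m′ q′ ≡ y′ → (i , m) ≡ (j , m′)
  same {i} refl m m′ n₁ n₂ e₁ e₂ e₃ e₄ =
    cong (i ,_) (Decomp.uniq (D i) n₁ n₂ (trans e₁ (sym e₃)) (trans e₂ (sym e₄)))

decomp-iso : ∀ {k A B E F} (f : A ↔ B) → let open Inverse f in
             (∀ {x y} → E x y → F (to x) (to y)) → (∀ {x y} → F (to x) (to y) → E x y) →
             Decomp k A E → Decomp k B F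
decomp-iso {k} {A} {B} {E} {F} f E⇒F F⇒E D = record
  { Index  = D.Index
  ; block  = block′
  ; irrefl = λ {x} e → D.irrefl (F⇒E {from x} {from x} (subst (λ z → F z z) (sym (strictlyInverseˡ x)) e))
  ; isEdge = λ i p≢q → E⇒F (D.isEdge i p≢q)
  ; find   = find′
  ; uniq   = λ n₁ n₂ e₁ e₂ → D.uniq n₁ n₂ (inj e₁) (inj e₂)
  }
  where
  open Inverse f
  module D = Decomp D
  inj : ∀ {x y} → to x ≡ to y → x ≡ y
  inj {x} {y} e = trans (sym (strictlyInverseʳ x)) (trans (cong from e) (strictlyInverseʳ y))
  block′ : D.Index → Fin k → B
  block′ i p = to (D.block i p)
  find′ : ∀ {x y} → F x y → Joins block′ x y
  find′ {x} {y} e with D.find (F⇒E {from x} {from y} (subst₂ F (sym (strictlyInverseˡ x)) (sym (strictlyInverseˡ y)) e))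
  ... | i , p , q , p≢q , e₁ , e₂ =
    i , p , q , p≢q , trans (cong to e₁) (strictlyInverseˡ x) , trans (cong to e₂) (strictlyInverseˡ y)

complete-iso : ∀ {k} {A B : Set} → A ↔ B → Decomp k A _≢_ → Decomp k B _≢_
complete-iso f = decomp-iso f (λ n e → n (inj e)) (λ n e → n (cong to e))
  where
  open Inverse f
  inj : ∀ {x y} → to x ≡ to y → x ≡ y
  inj {x} {y} e = trans (sym (strictlyInverseʳ x)) (trans (cong from e) (strictlyInverseʳ y))

GDD : (k u n : ℕ) → Set₁
GDD k u n = Decomp k (Fin u × Fin n) (λ x y → proj₁ x ≢ proj₁ y)

-- An orthogonal array of strength two and index one; the slots are the groups and the lines are the
-- blocks.
record TD (u n : ℕ) : Set₁ where
  field
    Line    : Set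
    at      : Line → Fin u → Fin n
    through : ∀ {x y} → x ≢ y → ∀ a b → Σ Line λ t → at t x ≡ a × at t y ≡ b
    unique  : ∀ {x y} → x ≢ y → ∀ {s t} → at s x ≡ at t x → at s y ≡ at t y → s ≡ t

td-restrict : ∀ {u u′ n} → u′ ≤ u → TD u n → TD u′ n
td-restrict le T = record
  { Line = T.Line
  ; at = λ t x → T.at t (F.inject≤ x le)
  ; through = λ n → T.through (λ e → n (Fₚ.inject≤-injective le le _ _ e))
  ; unique = λ n → T.unique (λ e → n (Fₚ.inject≤-injective le le _ _ e)) }
  where module T = TD T

td-one : ∀ {u} → TD u 1
td-one = record
  { Line = ⊤ ; at = λ _ _ → zero
  ; through = λ { _ zero zero → tt , refl , refl } ; unique = λ _ _ _ → refl }

td-product : ∀ {u m n} → TD u m → TD u n → TD u (m * n)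
td-product {u} {m} {n} S T = record
  { Line = S.Line × T.Line
  ; at = at′
  ; through = through′
  ; unique = λ x≢y e₁ e₂ →
      let (a , b) = Fₚ.combine-injective _ _ _ _ e₁
          (c , d) = Fₚ.combine-injective _ _ _ _ e₂
      in cong₂ _,_ (S.unique x≢y a c) (T.unique x≢y b d) }
  where
  module S = TD S
  module T = TD T
  at′ : S.Line × T.Line → Fin u → Fin (m * n)
  at′ (s , t) x = combine (S.at s x) (T.at t x)
  through′ : ∀ {x y} → x ≢ y → ∀ a b → Σ (S.Line × T.Line) λ t → at′ t x ≡ a × at′ t y ≡ b
  through′ x≢y a b with S.through x≢y (proj₁ (remQuot n a)) (proj₁ (remQuot n b))
                      | T.through x≢y (proj₂ (remQuot {m} n a)) (proj₂ (remQuot {m} n b))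
  ... | s , e₁ , e₂ | t , e₃ , e₄ = (s , t)
    , trans (cong₂ combine e₁ e₃) (Fₚ.combine-remQuot {m} n a)
    , trans (cong₂ combine e₂ e₄) (Fₚ.combine-remQuot {m} n b)

td-power : ∀ {u n} → TD u n → ∀ e → TD u (n ^ e)
td-power T zero    = td-one
td-power T (suc e) = td-product T (td-power T e)

-- Wilson's fundamental construction with constant weight `n`: every block is replaced by the lines
-- of a transversal design on its `k` slots.
inflate : ∀ {k n A E} → Decomp k A E → TD k n → Decomp k (A × Fin n) (λ x y → E (proj₁ x) (proj₁ y))
inflate {k} {n} {A} {E} D T = record
  { Index = D.Index × T.Line
  ; block = block′
  ; irrefl = D.irrefl
  ; isEdge = λ { (i , _) → D.isEdge i }
  ; find = find′
  ; uniq = λ { {i , s} {j , t} n₁ n₂ e₁ e₂ → uniq′ (D.uniq n₁ n₂ (,-injectiveˡ e₁) (,-injectiveˡ e₂)) n₁ e₁ e₂ } }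
  where
  module D = Decomp D
  module T = TD T
  block′ : D.Index × T.Line → Fin k → A × Fin n
  block′ (i , t) p = D.block i p , T.at t p
  find′ : ∀ {x y} → E (proj₁ x) (proj₁ y) → Joins block′ x y
  find′ {_ , a} {_ , b} e with D.find e
  ... | i , p , q , p≢q , refl , refl with T.through p≢q a b
  ... | t , refl , refl = (i , t) , p , q , p≢q , refl , refl
  uniq′ : ∀ {i j s t p q p′ q′} → i ≡ j → p ≢ q →
          block′ (i , s) p ≡ block′ (j , t) p′ → block′ (i , s) q ≡ block′ (j , t) q′ → (i , s) ≡ (j , t)
  uniq′ refl n e₁ e₂ with D.block-injective (,-injectiveˡ e₁) | D.block-injective (,-injectiveˡ e₂)
  ... | refl | refl = cong (_ ,_) (T.unique n (,-injectiveʳ e₁) (,-injectiveʳ e₂))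

gdd-inflate : ∀ {k u m n} → GDD k u m → TD k n → GDD k u (m * n)
gdd-inflate {k} {u} {m} {n} D T = decomp-iso f (λ z → z) (λ z → z) (inflate D T)
  where
  f : ((Fin u × Fin m) × Fin n) ↔ (Fin u × Fin (m * n))
  f = mk↔ₛ′ (λ { ((x , a) , b) → x , combine a b })
            (λ { (x , c) → (x , proj₁ (remQuot n c)) , proj₂ (remQuot {m} n c) })
            (λ { (x , c) → cong (x ,_) (Fₚ.combine-remQuot {m} n c) })
            (λ { ((x , a) , b) → cong (λ z → (x , proj₁ z) , proj₂ z) (Fₚ.remQuot-combine a b) })

-- `S` is kept apart as one additional class because truncation gives it a size different from that
-- of the classes indexed by `C`.
MultipartiteWith : ∀ {C B S : Set} → (C × B) ⊎ S → (C × B) ⊎ S → Set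
MultipartiteWith (inj₁ (c , _)) (inj₁ (d , _)) = c ≢ d
MultipartiteWith (inj₁ _)       (inj₂ _)       = ⊤
MultipartiteWith (inj₂ _)       (inj₁ _)       = ⊤
MultipartiteWith (inj₂ _)       (inj₂ _)       = ⊥

WithHole : ∀ {A W : Set} → A ⊎ W → A ⊎ W → Set
WithHole (inj₁ a) (inj₁ b) = a ≢ b
WithHole (inj₁ _) (inj₂ _) = ⊤
WithHole (inj₂ _) (inj₁ _) = ⊤
WithHole (inj₂ _) (inj₂ _) = ⊥

Incomplete : ℕ → Set → Set → Set₁
Incomplete k A W = Decomp k (A ⊎ W) WithHole

-- Deleting all but s points of one group of a transversal design leaves lines meeting u or u + 1 groups.
module _ {k u h : ℕ} (Du : GDD k u h) (Du₁ : GDD k (suc u) h) {n s : ℕ} (T : TD (suc u) n) (s≤n : s ≤ n) where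
  private
    module T = TD T
    Point = (Fin u × (Fin n × Fin h)) ⊎ (Fin s × Fin h)

    Meets : T.Line → Fin (suc u) → Set
    Meets t zero    = toℕ (T.at t zero) < s
    Meets t (suc _) = ⊤

    Piece : T.Line → Set
    Piece t = Σ (Fin (suc u)) (Meets t) × Fin h

    emb : ∀ t → Piece t → Point
    emb t ((zero , lt) , c)  = inj₂ (fromℕ< lt , c)
    emb t ((suc x , _) , c)  = inj₁ (x , T.at t (suc x) , c)

    Differ : ∀ t → Piece t → Piece t → Set
    Differ t ((x , _) , _) ((y , _) , _) = x ≢ y

    slot : Point → Fin (suc u)
    slot (inj₁ (x , _)) = suc x
    slot (inj₂ _)       = zero
    val : Point → Fin n
    val (inj₁ (_ , a , _)) = a
    val (inj₂ (a , _))     = F.inject≤ a s≤n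
    layer : Point → Fin h
    layer (inj₁ (_ , _ , c)) = c
    layer (inj₂ (_ , c))     = c

    slot-emb : ∀ t z → slot (emb t z) ≡ proj₁ (proj₁ z)
    slot-emb t ((zero , _) , _)  = refl
    slot-emb t ((suc _ , _) , _) = refl
    val-emb : ∀ t z → val (emb t z) ≡ T.at t (proj₁ (proj₁ z))
    val-emb t ((zero , lt) , _)  = Fₚ.toℕ-injective
      (trans (Fₚ.toℕ-inject≤ _ s≤n) (Fₚ.toℕ-fromℕ< lt))
    val-emb t ((suc _ , _) , _) = refl
    layer-emb : ∀ t z → layer (emb t z) ≡ proj₂ z
    layer-emb t ((zero , _) , _)  = refl
    layer-emb t ((suc _ , _) , _) = refl

    Meets-irr : ∀ {t x} (a b : Meets t x) → a ≡ b
    Meets-irr {t} {zero}  a b = ℕₚ.<-irrelevant a b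
    Meets-irr {t} {suc _} tt tt = refl

    piece-≡ : ∀ {t} {z w : Piece t} → proj₁ (proj₁ z) ≡ proj₁ (proj₁ w) → proj₂ z ≡ proj₂ w → z ≡ w
    piece-≡ {t} {(x , a) , c} {(.x , b) , .c} refl refl = cong (λ a → (x , a) , c) (Meets-irr a b)

    lift : ∀ t (z : Point) → T.at t (slot z) ≡ val z → Σ (Piece t) λ z′ → emb t z′ ≡ z × proj₁ (proj₁ z′) ≡ slot z
    lift t (inj₁ (x , a , c)) refl = ((suc x , tt) , c) , refl , refl
    lift t (inj₂ (a , c)) e = ((zero , lt) , c) , cong (λ b → inj₂ (b , c)) b≡a , refl
      where
      e′ : toℕ (T.at t zero) ≡ toℕ a
      e′ = trans (cong toℕ e) (Fₚ.toℕ-inject≤ a s≤n)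
      lt : toℕ (T.at t zero) < s
      lt = subst (_< s) (sym e′) (Fₚ.toℕ<n a)
      b≡a : fromℕ< lt ≡ a
      b≡a = Fₚ.toℕ-injective (trans (Fₚ.toℕ-fromℕ< lt) e′)

    differ⇒ : ∀ (x y : Point) → slot x ≢ slot y → MultipartiteWith x y
    differ⇒ (inj₁ _) (inj₁ _) n = λ e → n (cong suc e)
    differ⇒ (inj₁ _) (inj₂ _) n = tt
    differ⇒ (inj₂ _) (inj₁ _) n = tt
    differ⇒ (inj₂ _) (inj₂ _) n = n refl
    ⇒differ : ∀ (x y : Point) → MultipartiteWith x y → slot x ≢ slot y
    ⇒differ (inj₁ _) (inj₁ _) n e = n (Fₚ.suc-injective e)
    ⇒differ (inj₁ _) (inj₂ _) n ()
    ⇒differ (inj₂ _) (inj₁ _) n ()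

    decompPiece : ∀ t → Decomp k (Piece t) (Differ t)
    decompPiece t with toℕ (T.at t zero) <? s
    ... | yes lt = decomp-iso (mk↔ₛ′ to proj to-proj proj-to)
                     (λ {x} {y} n e → n (trans (sym (first x)) (trans e (first y))))
                     (λ {x} {y} n e → n (trans (first x) (trans e (sym (first y))))) Du₁
      where
      to : Fin (suc u) × Fin h → Piece t
      to (zero , c)  = (zero , lt) , c
      to (suc x , c) = (suc x , tt) , c
      first : ∀ z → proj₁ (proj₁ (to z)) ≡ proj₁ z
      first (zero , c)  = refl
      first (suc x , c) = refl
      proj : Piece t → Fin (suc u) × Fin h
      proj ((x , _) , c) = x , c
      to-proj : ∀ z → to (proj z) ≡ z
      to-proj ((zero , _) , c)  = piece-≡ refl refl
      to-proj ((suc _ , _) , c) = refl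
      proj-to : ∀ z → proj (to z) ≡ z
      proj-to (zero , c)  = refl
      proj-to (suc x , c) = refl
    ... | no ¬lt = decomp-iso (mk↔ₛ′ to proj to-proj (λ _ → refl))
                     (λ n e → n (Fₚ.suc-injective e)) (λ n e → n (cong suc e)) Du
      where
      to : Fin u × Fin h → Piece t
      to (x , c) = (suc x , tt) , c
      proj : Piece t → Fin u × Fin h
      proj ((zero , lt) , c) = ⊥-elim (¬lt lt)
      proj ((suc x , _) , c) = x , c
      to-proj : ∀ z → to (proj z) ≡ z
      to-proj ((zero , lt) , c) = ⊥-elim (¬lt lt)
      to-proj ((suc _ , _) , c) = refl

  truncate : Decomp k ((Fin u × (Fin n × Fin h)) ⊎ (Fin s × Fin h)) MultipartiteWith
  truncate = compose partition decompPiece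
    where
    find′ : ∀ {x y} → MultipartiteWith x y → Σ T.Line λ t → Σ (Piece t) λ x′ → Σ (Piece t) λ y′ → Differ t x′ y′ × emb t x′ ≡ x × emb t y′ ≡ y
    find′ {x} {y} e with T.through (⇒differ x y e) (val x) (val y)
    ... | t , e₁ , e₂ with lift t x e₁ | lift t y e₂
    ... | x′ , refl , s₁ | y′ , refl , s₂ =
      t , x′ , y′ , (λ e′ → ⇒differ x y e (trans (sym s₁) (trans e′ s₂))) , refl , refl
    uniq′ : ∀ {s t} {x y : Piece s} {x′ y′ : Piece t} → Differ s x y → Differ t x′ y′ →
            emb s x ≡ emb t x′ → emb s y ≡ emb t y′ →
            _≡_ {A = Σ T.Line λ i → Piece i × Piece i} (s , x , y) (t , x′ , y′)
    uniq′ {s} {t} {(x , _) , _} {(y , _) , _} {x′} {y′} n n′ e₁ e₂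
      with same x′ e₁ | same y′ e₂
      where
      same : ∀ {z} z′ → emb s z ≡ emb t z′ →
             T.at s (proj₁ (proj₁ z)) ≡ T.at t (proj₁ (proj₁ z′)) × proj₁ (proj₁ z) ≡ proj₁ (proj₁ z′) × proj₂ z ≡ proj₂ z′
      same {z} z′ e = trans (sym (val-emb s z)) (trans (cong val e) (val-emb t z′))
                    , trans (sym (slot-emb s z)) (trans (cong slot e) (slot-emb t z′))
                    , trans (sym (layer-emb s z)) (trans (cong layer e) (layer-emb t z′))
    ... | a₁ , refl , refl | a₂ , refl , refl with T.unique n a₁ a₂
    ... | refl = cong₂ (λ a b → _ , a , b) (piece-≡ refl refl) (piece-≡ refl refl)
    irr : ∀ {x} → ¬ MultipartiteWith x x
    irr {x} e = ⇒differ x x e refl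
    partition : EdgePartition MultipartiteWith Piece Differ
    partition = record
      { emb = emb
      ; irrefl = λ {x} → irr {x}
      ; edge = λ t {x} {y} n → differ⇒ (emb t x) (emb t y)
                 (λ e → n (trans (sym (slot-emb t x)) (trans e (slot-emb t y))))
      ; find = λ {x} {y} → find′ {x} {y}
      ; uniq = λ {s} {t} → uniq′ {s} {t} }

-- The points of `W` are adjoined to every class, so a pair inside `W` would be covered once per
-- class; leaving `W` uncovered makes the copies compatible. The class `S` is left unfilled and
-- joins the hole.
fillHole : ∀ {k} {C B S W : Set} → (∀ (c d : C) → Dec (c ≡ d)) →
           Decomp k ((C × B) ⊎ S) MultipartiteWith → Incomplete k B W → Incomplete k (C × B) (S ⊎ W)
fillHole {k} {C} {B} {S} {W} _≟_ D₀ D₁ = compose partition decompPiece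
  where
  Piece : ⊤ ⊎ C → Set
  Piece (inj₁ _) = (C × B) ⊎ S
  Piece (inj₂ _) = B ⊎ W
  Edge : ∀ i → Piece i → Piece i → Set
  Edge (inj₁ _) = MultipartiteWith
  Edge (inj₂ _) = WithHole
  decompPiece : ∀ i → Decomp k (Piece i) (Edge i)
  decompPiece (inj₁ _) = D₀
  decompPiece (inj₂ _) = D₁
  emb : ∀ i → Piece i → (C × B) ⊎ (S ⊎ W)
  emb (inj₁ _) (inj₁ z) = inj₁ z
  emb (inj₁ _) (inj₂ s) = inj₂ (inj₁ s)
  emb (inj₂ c) (inj₁ b) = inj₁ (c , b)
  emb (inj₂ c) (inj₂ w) = inj₂ (inj₂ w)
  edge : ∀ i {x y} → Edge i x y → WithHole (emb i x) (emb i y)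
  edge (inj₁ _) {inj₁ _} {inj₁ _} n = λ e → n (cong proj₁ e)
  edge (inj₁ _) {inj₁ _} {inj₂ _} n = tt
  edge (inj₁ _) {inj₂ _} {inj₁ _} n = tt
  edge (inj₂ _) {inj₁ _} {inj₁ _} n = λ e → n (cong proj₂ e)
  edge (inj₂ _) {inj₁ _} {inj₂ _} n = tt
  edge (inj₂ _) {inj₂ _} {inj₁ _} n = tt
  find′ : ∀ {x y} → WithHole x y → Σ (⊤ ⊎ C) λ i → Σ (Piece i) λ x′ → Σ (Piece i) λ y′ → Edge i x′ y′ × emb i x′ ≡ x × emb i y′ ≡ y
  find′ {inj₁ (c , a)} {inj₁ (d , b)} n with c ≟ d
  ... | yes refl = inj₂ c , inj₁ a , inj₁ b , (λ e → n (cong (c ,_) e)) , refl , refl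
  ... | no m     = inj₁ tt , inj₁ (c , a) , inj₁ (d , b) , m , refl , refl
  find′ {inj₁ z} {inj₂ (inj₁ s)} _ = inj₁ tt , inj₁ z , inj₂ s , tt , refl , refl
  find′ {inj₁ (c , b)} {inj₂ (inj₂ w)} _ = inj₂ c , inj₁ b , inj₂ w , tt , refl , refl
  find′ {inj₂ (inj₁ s)} {inj₁ z} _ = inj₁ tt , inj₂ s , inj₁ z , tt , refl , refl
  find′ {inj₂ (inj₂ w)} {inj₁ (c , b)} _ = inj₂ c , inj₂ w , inj₁ b , tt , refl , refl
  uniq′ : ∀ {i j x y x′ y′} → Edge i x y → Edge j x′ y′ → emb i x ≡ emb j x′ → emb i y ≡ emb j y′ →
          _≡_ {A = Σ (⊤ ⊎ C) λ i → Piece i × Piece i} (i , x , y) (j , x′ , y′)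
  uniq′ {inj₁ _} {inj₁ _} {inj₁ _} {inj₁ _} {inj₁ _} {inj₁ _} _ _ refl refl = refl
  uniq′ {inj₁ _} {inj₁ _} {inj₁ _} {inj₂ _} {inj₁ _} {inj₂ _} _ _ refl refl = refl
  uniq′ {inj₁ _} {inj₁ _} {inj₂ _} {inj₁ _} {inj₂ _} {inj₁ _} _ _ refl refl = refl
  uniq′ {inj₁ _} {inj₂ _} {inj₁ _} {inj₁ _} {inj₁ _} {inj₁ _} n m refl refl = ⊥-elim (n refl)
  uniq′ {inj₂ _} {inj₁ _} {inj₁ _} {inj₁ _} {inj₁ _} {inj₁ _} n m refl refl = ⊥-elim (m refl)
  uniq′ {inj₁ _} {inj₂ _} {inj₁ _} {inj₂ _} {inj₁ _} {inj₁ _} _ _ refl ()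
  uniq′ {inj₁ _} {inj₂ _} {inj₁ _} {inj₂ _} {inj₁ _} {inj₂ _} _ _ refl ()
  uniq′ {inj₁ _} {inj₂ _} {inj₂ _} {_} {inj₁ _} _ _ () _
  uniq′ {inj₁ _} {inj₂ _} {inj₂ _} {_} {inj₂ _} _ _ () _
  uniq′ {inj₂ _} {inj₁ _} {inj₁ _} {inj₁ _} {inj₁ _} {inj₂ _} _ _ refl ()
  uniq′ {inj₂ _} {inj₁ _} {inj₁ _} {inj₂ _} {inj₁ _} {inj₂ _} _ _ refl ()
  uniq′ {inj₂ _} {inj₁ _} {inj₁ _} {inj₂ _} {inj₁ _} {inj₁ _} _ _ refl ()
  uniq′ {inj₂ _} {inj₁ _} {inj₁ _} {_} {inj₂ _} _ _ () _
  uniq′ {inj₂ _} {inj₁ _} {inj₂ _} {_} {inj₁ _} _ _ () _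
  uniq′ {inj₂ _} {inj₁ _} {inj₂ _} {_} {inj₂ _} _ _ () _
  uniq′ {inj₂ _} {inj₂ _} {inj₁ _} {inj₁ _} {inj₁ _} {inj₁ _} _ _ refl refl = refl
  uniq′ {inj₂ _} {inj₂ _} {inj₁ _} {inj₂ _} {inj₁ _} {inj₂ _} _ _ refl refl = refl
  uniq′ {inj₂ _} {inj₂ _} {inj₂ _} {inj₁ _} {inj₂ _} {inj₁ _} _ _ refl refl = refl
  irr : ∀ {x} → ¬ WithHole {C × B} {S ⊎ W} x x
  irr {inj₁ _} n = n refl
  partition : EdgePartition WithHole Piece Edge
  partition = record
    { emb = emb ; irrefl = λ {x} → irr {x} ; edge = edge
    ; find = λ {x} {y} → find′ {x} {y}
    ; uniq = λ {i} {j} {x} {y} {x′} {y′} → uniq′ {i} {j} {x} {y} {x′} {y′} }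

fillAll : ∀ {k} {A W : Set} → Incomplete k A W → Decomp k W _≢_ → Decomp k (A ⊎ W) _≢_
fillAll {k} {A} {W} D₀ D₁ = compose partition decompPiece
  where
  Piece : Bool → Set
  Piece true  = A ⊎ W
  Piece false = W
  Edge : ∀ i → Piece i → Piece i → Set
  Edge true  = WithHole
  Edge false = _≢_
  decompPiece : ∀ i → Decomp k (Piece i) (Edge i)
  decompPiece true  = D₀
  decompPiece false = D₁
  emb : ∀ i → Piece i → A ⊎ W
  emb true  = id
  emb false = inj₂
  edge : ∀ i {x y} → Edge i x y → emb i x ≢ emb i y
  edge true  {inj₁ _} {inj₁ _} n e = n (inj₁-injective e)
  edge true  {inj₁ _} {inj₂ _} n ()
  edge true  {inj₂ _} {inj₁ _} n ()
  edge false n e = n (inj₂-injective e)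
  find′ : ∀ {x y} → x ≢ y → Σ Bool λ i → Σ (Piece i) λ x′ → Σ (Piece i) λ y′ → Edge i x′ y′ × emb i x′ ≡ x × emb i y′ ≡ y
  find′ {inj₁ a} {inj₁ b} n = true , inj₁ a , inj₁ b , (λ e → n (cong inj₁ e)) , refl , refl
  find′ {inj₁ a} {inj₂ b} n = true , inj₁ a , inj₂ b , tt , refl , refl
  find′ {inj₂ a} {inj₁ b} n = true , inj₂ a , inj₁ b , tt , refl , refl
  find′ {inj₂ a} {inj₂ b} n = false , a , b , (λ e → n (cong inj₂ e)) , refl , refl
  uniq′ : ∀ {i j x y x′ y′} → Edge i x y → Edge j x′ y′ → emb i x ≡ emb j x′ → emb i y ≡ emb j y′ →
          _≡_ {A = Σ Bool λ i → Piece i × Piece i} (i , x , y) (j , x′ , y′)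
  uniq′ {true}  {true}  _ _ refl refl = refl
  uniq′ {true}  {false} () _ refl refl
  uniq′ {false} {true}  _ () refl refl
  uniq′ {false} {false} _ _ refl refl = refl
  partition : EdgePartition _≢_ Piece Edge
  partition = record
    { emb = emb ; irrefl = λ n → n refl ; edge = edge ; find = find′
    ; uniq = λ {i} {j} → uniq′ {i} {j} }

-- After truncation the u classes of n h points and the class of s h points are in turn divided into
-- groups of h points by the given designs, which leaves u n + s groups of equal size. This is the
-- recursion behind `gdd-all`.
gdd-truncated : ∀ {k u h n s} → GDD k u h → GDD k (suc u) h → TD (suc u) n → s ≤ n →
                GDD k n h → GDD k s h → GDD k (u * n + s) h
gdd-truncated {k} {u} {h} {n} {s} Du Du₁ T s≤n Dn Ds =
  decomp-iso (iso ×-↔ Inv.↔-refl) (λ {x} {y} m e → m (inj (proj₁ x) (proj₁ y) e)) (λ m e → m (cong (Inverse.to iso) e))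
    (compose partition decompPiece)
  where
  iso : (Fin u × Fin n ⊎ Fin s) ↔ Fin (u * n + s)
  iso = Inv.↔-trans (Inv.↔-sym Fₚ.*↔× ⊎-↔ Inv.↔-refl) (Inv.↔-sym Fₚ.+↔⊎)
  inj : ∀ x y → Inverse.to iso x ≡ Inverse.to iso y → x ≡ y
  inj x y e = trans (sym (Inverse.strictlyInverseʳ iso x)) (trans (cong (Inverse.from iso) e) (Inverse.strictlyInverseʳ iso y))
  I : Set
  I = ⊤ ⊎ (Fin u ⊎ ⊤)
  Piece : I → Set
  Piece (inj₁ _)        = (Fin u × (Fin n × Fin h)) ⊎ (Fin s × Fin h)
  Piece (inj₂ (inj₁ _)) = Fin n × Fin h
  Piece (inj₂ (inj₂ _)) = Fin s × Fin h
  Edge : ∀ i → Piece i → Piece i → Set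
  Edge (inj₁ _)        = MultipartiteWith
  Edge (inj₂ (inj₁ _)) x y = proj₁ x ≢ proj₁ y
  Edge (inj₂ (inj₂ _)) x y = proj₁ x ≢ proj₁ y
  decompPiece : ∀ i → Decomp k (Piece i) (Edge i)
  decompPiece (inj₁ _)        = truncate Du Du₁ T s≤n
  decompPiece (inj₂ (inj₁ _)) = Dn
  decompPiece (inj₂ (inj₂ _)) = Ds
  Point = (Fin u × Fin n ⊎ Fin s) × Fin h
  emb : ∀ i → Piece i → Point
  emb (inj₁ _) (inj₁ (x , a , c)) = inj₁ (x , a) , c
  emb (inj₁ _) (inj₂ (a , c))     = inj₂ a , c
  emb (inj₂ (inj₁ x)) (a , c)     = inj₁ (x , a) , c
  emb (inj₂ (inj₂ _)) (a , c)     = inj₂ a , c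
  E : Point → Point → Set
  E x y = proj₁ x ≢ proj₁ y
  edge : ∀ i {x y} → Edge i x y → E (emb i x) (emb i y)
  edge (inj₁ _) {inj₁ _} {inj₁ _} m e = m (cong proj₁ (inj₁-injective e))
  edge (inj₁ _) {inj₁ _} {inj₂ _} m ()
  edge (inj₁ _) {inj₂ _} {inj₁ _} m ()
  edge (inj₂ (inj₁ _)) m e = m (cong proj₂ (inj₁-injective e))
  edge (inj₂ (inj₂ _)) m e = m (inj₂-injective e)
  find′ : ∀ {x y} → E x y → Σ I λ i → Σ (Piece i) λ x′ → Σ (Piece i) λ y′ → Edge i x′ y′ × emb i x′ ≡ x × emb i y′ ≡ y
  find′ {inj₁ (x , a) , c} {inj₁ (y , b) , d} m with x F.≟ y
  ... | yes refl = inj₂ (inj₁ x) , (a , c) , (b , d) , (λ e → m (cong (λ z → inj₁ (x , z)) e)) , refl , refl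
  ... | no l     = inj₁ tt , inj₁ (x , a , c) , inj₁ (y , b , d) , l , refl , refl
  find′ {inj₁ (x , a) , c} {inj₂ b , d} m = inj₁ tt , inj₁ (x , a , c) , inj₂ (b , d) , tt , refl , refl
  find′ {inj₂ a , c} {inj₁ (y , b) , d} m = inj₁ tt , inj₂ (a , c) , inj₁ (y , b , d) , tt , refl , refl
  find′ {inj₂ a , c} {inj₂ b , d} m = inj₂ (inj₂ tt) , (a , c) , (b , d) , (λ e → m (cong inj₂ e)) , refl , refl
  uniq′ : ∀ {i j x y x′ y′} → Edge i x y → Edge j x′ y′ → emb i x ≡ emb j x′ → emb i y ≡ emb j y′ →
          _≡_ {A = Σ I λ i → Piece i × Piece i} (i , x , y) (j , x′ , y′)
  uniq′ {inj₁ _} {inj₁ _} {inj₁ _} {inj₁ _} {inj₁ _} {inj₁ _} _ _ refl refl = refl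
  uniq′ {inj₁ _} {inj₁ _} {inj₁ _} {inj₂ _} {inj₁ _} {inj₂ _} _ _ refl refl = refl
  uniq′ {inj₁ _} {inj₁ _} {inj₂ _} {inj₁ _} {inj₂ _} {inj₁ _} _ _ refl refl = refl
  uniq′ {inj₁ _} {inj₂ (inj₁ _)} {inj₁ _} {inj₁ _} m _ refl refl = ⊥-elim (m refl)
  uniq′ {inj₁ _} {inj₂ (inj₁ _)} {inj₁ _} {inj₂ _} m _ refl ()
  uniq′ {inj₁ _} {inj₂ (inj₂ _)} {inj₁ _} {inj₂ _} m _ () e
  uniq′ {inj₁ _} {inj₂ (inj₂ _)} {inj₂ _} {inj₁ _} m _ refl ()
  uniq′ {inj₂ (inj₁ _)} {inj₁ _} {x′ = inj₁ _} {y′ = inj₁ _} _ m refl refl = ⊥-elim (m refl)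
  uniq′ {inj₂ (inj₁ _)} {inj₁ _} {x′ = inj₁ _} {y′ = inj₂ _} _ m refl ()
  uniq′ {inj₂ (inj₂ _)} {inj₁ _} {x′ = inj₁ _} {y′ = inj₂ _} _ m () e
  uniq′ {inj₂ (inj₂ _)} {inj₁ _} {x′ = inj₂ _} {y′ = inj₁ _} _ m refl ()
  uniq′ {inj₂ (inj₁ _)} {inj₂ (inj₁ _)} _ _ refl refl = refl
  uniq′ {inj₂ (inj₂ _)} {inj₂ (inj₂ _)} _ _ refl refl = refl
  partition : EdgePartition E Piece Edge
  partition = record
    { emb = emb ; irrefl = λ n → n refl ; edge = edge ; find = find′
    ; uniq = λ {i} {j} {x} {y} {x′} {y′} → uniq′ {i} {j} {x} {y} {x′} {y′} }

-- Arithmetic modulo n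

infix 4 _≈[_]_
-- A congruence carries its quotient, so that each closure property is a single ring identity.
record _≈[_]_ (a : ℤ) (n : ℕ) (b : ℤ) : Set where
  constructor mod
  field
    quotient : ℤ
    equation : a ≡ b +ᶻ quotient *ᶻ + n

module _ {n : ℕ} where

  ≈-reflexive : ∀ {a b} → a ≡ b → a ≈[ n ] b
  ≈-reflexive {a} refl = mod (+ 0) (lemma a (+ n))
    where lemma : ∀ a n → a ≡ a +ᶻ + 0 *ᶻ n
          lemma = ℤS.solve-∀

  ≈-refl : ∀ {a} → a ≈[ n ] a
  ≈-refl = ≈-reflexive refl

  ≈-sym : ∀ {a b} → a ≈[ n ] b → b ≈[ n ] a
  ≈-sym {_} {b} (mod q refl) = mod (-ᶻ q) (lemma b q (+ n))
    where lemma : ∀ b q n → b ≡ (b +ᶻ q *ᶻ n) +ᶻ (-ᶻ q) *ᶻ n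
          lemma = ℤS.solve-∀

  ≈-trans : ∀ {a b c} → a ≈[ n ] b → b ≈[ n ] c → a ≈[ n ] c
  ≈-trans {_} {_} {c} (mod q refl) (mod r refl) = mod (r +ᶻ q) (lemma c q r (+ n))
    where lemma : ∀ c q r n → (c +ᶻ r *ᶻ n) +ᶻ q *ᶻ n ≡ c +ᶻ (r +ᶻ q) *ᶻ n
          lemma = ℤS.solve-∀

  ≈-+ : ∀ {a b c d} → a ≈[ n ] b → c ≈[ n ] d → a +ᶻ c ≈[ n ] b +ᶻ d
  ≈-+ {_} {b} {_} {d} (mod q refl) (mod r refl) = mod (q +ᶻ r) (lemma b d q r (+ n))
    where lemma : ∀ b d q r n → (b +ᶻ q *ᶻ n) +ᶻ (d +ᶻ r *ᶻ n) ≡ (b +ᶻ d) +ᶻ (q +ᶻ r) *ᶻ n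
          lemma = ℤS.solve-∀

  ≈-* : ∀ {a b c d} → a ≈[ n ] b → c ≈[ n ] d → a *ᶻ c ≈[ n ] b *ᶻ d
  ≈-* {_} {b} {_} {d} (mod q refl) (mod r refl) =
    mod (b *ᶻ r +ᶻ q *ᶻ d +ᶻ q *ᶻ r *ᶻ + n) (lemma b d q r (+ n))
    where lemma : ∀ b d q r n → (b +ᶻ q *ᶻ n) *ᶻ (d +ᶻ r *ᶻ n) ≡ b *ᶻ d +ᶻ (b *ᶻ r +ᶻ q *ᶻ d +ᶻ q *ᶻ r *ᶻ n) *ᶻ n
          lemma = ℤS.solve-∀

  ≈-neg : ∀ {a b} → a ≈[ n ] b → -ᶻ a ≈[ n ] -ᶻ b
  ≈-neg {_} {b} (mod q refl) = mod (-ᶻ q) (lemma b q (+ n))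
    where lemma : ∀ b q n → -ᶻ (b +ᶻ q *ᶻ n) ≡ -ᶻ b +ᶻ (-ᶻ q) *ᶻ n
          lemma = ℤS.solve-∀

  ≈-- : ∀ {a b c d} → a ≈[ n ] b → c ≈[ n ] d → a -ᶻ c ≈[ n ] b -ᶻ d
  ≈-- p q = ≈-+ p (≈-neg q)

  ≈-*ˡ : ∀ c {a b} → a ≈[ n ] b → c *ᶻ a ≈[ n ] c *ᶻ b
  ≈-*ˡ c p = ≈-* (≈-refl {c}) p

  ≈-diff : ∀ {a b} → a ≈[ n ] b → a -ᶻ b ≈[ n ] + 0
  ≈-diff {_} {b} (mod q refl) = mod q (lemma b q (+ n))
    where lemma : ∀ b q n → (b +ᶻ q *ᶻ n) -ᶻ b ≡ + 0 +ᶻ q *ᶻ n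
          lemma = ℤS.solve-∀

  ≈-undiff : ∀ {a b} → a -ᶻ b ≈[ n ] + 0 → a ≈[ n ] b
  ≈-undiff {a} {b} p = ≈-trans (≈-reflexive (lemma a b)) (≈-trans (≈-+ p (≈-refl {b})) (≈-reflexive (ℤₚ.+-identityˡ b)))
    where lemma : ∀ a b → a ≡ (a -ᶻ b) +ᶻ b
          lemma = ℤS.solve-∀

  val : Fin n → ℤ
  val i = + toℕ i

  val-injective : ∀ {i j} → val i ≈[ n ] val j → i ≡ j
  val-injective {i} {j} (mod q e) = Fₚ.toℕ-injective (go q e)
    where
    big : ∀ x y m → x < n → + x ≡ + y +ᶻ + suc m *ᶻ + n → ⊥
    big x y m x<n e = ℕₚ.<-irrefl refl (ℕₚ.<-≤-trans x<n (ℕₚ.≤-trans (ℕₚ.m≤n+m n y)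
      (subst (y + n ≤_) (sym x≡) (ℕₚ.+-monoʳ-≤ y (ℕₚ.m≤m+n n (m * n))))))
      where x≡ : x ≡ y + suc m * n
            x≡ = ℤₚ.+-injective (trans e (cong (+ y +ᶻ_) (sym (ℤₚ.pos-* (suc m) n))))
    go : ∀ q → + toℕ i ≡ + toℕ j +ᶻ q *ᶻ + n → toℕ i ≡ toℕ j
    go (+ zero) e = ℤₚ.+-injective (trans e (trans (cong (+ toℕ j +ᶻ_) (ℤₚ.*-zeroˡ (+ n))) (ℤₚ.+-identityʳ _)))
    go (+ suc m) e = ⊥-elim (big _ _ m (Fₚ.toℕ<n i) e)
    go (-[1+ m ]) e = ⊥-elim (big (toℕ j) (toℕ i) m (Fₚ.toℕ<n j)
      (trans (lemma (+ toℕ j) (+ suc m) (+ n)) (cong (_+ᶻ + suc m *ᶻ + n) (sym e))))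
      where lemma : ∀ j m n → j ≡ (j +ᶻ (-ᶻ m) *ᶻ n) +ᶻ m *ᶻ n
            lemma = ℤS.solve-∀

  module _ .{{_ : NonZero n}} where

    res : ℤ → Fin n
    res a = fromℕ< (ℤDM.n%ℕd<d a n)

    val-res : ∀ a → val (res a) ≈[ n ] a
    val-res a = ≈-sym (mod (a ℤDM./ℕ n) (trans (ℤDM.a≡a%ℕn+[a/ℕn]*n a n)
      (cong (λ z → + z +ᶻ (a ℤDM./ℕ n) *ᶻ + n) (sym (Fₚ.toℕ-fromℕ< (ℤDM.n%ℕd<d a n))))))

    res-val : ∀ i → res (val i) ≡ i
    res-val i = val-injective (val-res (val i))

    res-cong : ∀ {a b} → a ≈[ n ] b → res a ≡ res b
    res-cong {a} {b} p = val-injective (≈-trans (val-res a) (≈-trans p (≈-sym (val-res b))))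

    res-injective : ∀ {a b} → res a ≡ res b → a ≈[ n ] b
    res-injective {a} {b} e = ≈-trans (≈-sym (val-res a)) (≈-trans (≈-reflexive (cong val e)) (val-res b))

    res-≡ : ∀ {a i} → a ≈[ n ] val i → res a ≡ i
    res-≡ {a} {i} p = trans (res-cong p) (res-val i)

-- Units modulo n, affine transversal designs, and the product of two designs with a hole

Unit : ℕ → ℤ → Set
Unit n a = Σ ℤ λ b → b *ᶻ a ≈[ n ] + 1

unit-cancel : ∀ {n c a b} → Unit n c → c *ᶻ a ≈[ n ] c *ᶻ b → a ≈[ n ] b
unit-cancel {n} {c} {a} {b} (d , u) p =
  ≈-trans (≈-sym (step a)) (≈-trans (≈-*ˡ d p) (step b))
  where
  lemma : ∀ c d a → d *ᶻ (c *ᶻ a) ≡ (d *ᶻ c) *ᶻ a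
  lemma = ℤS.solve-∀
  step : ∀ a → d *ᶻ (c *ᶻ a) ≈[ n ] a
  step a = ≈-trans (≈-reflexive (lemma c d a)) (≈-trans (≈-* u (≈-refl {_} {a})) (≈-reflexive (ℤₚ.*-identityˡ a)))

OneModulo : ℕ → ℕ → Set
OneModulo d n = Σ ℕ λ e → n ≡ 1 + d * e

-- If n = 1 + d e then d is invertible modulo n with inverse − e.
difference-unit : ∀ {n u} → (∀ d → 0 < d → d < u → OneModulo d n) → {x y : Fin u} → x ≢ y →
                  Unit n (+ toℕ y -ᶻ + toℕ x)
difference-unit {n} {u} one {x} {y} x≢y with ℕₚ.<-cmp (toℕ x) (toℕ y)
... | tri≈ _ e _ = ⊥-elim (x≢y (Fₚ.toℕ-injective e))
... | tri< lt _ _ with ℕₚ.m≤n⇒∃[o]m+o≡n lt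
... | o , e with one (suc o) (s≤s z≤n) (ℕₚ.≤-<-trans (subst (suc o ≤_) (trans (ℕₚ.+-suc (toℕ x) o) e) (ℕₚ.m≤n+m (suc o) (toℕ x))) (Fₚ.toℕ<n y))
... | w , refl = -ᶻ + w , mod (-ᶻ + 1) (trans (cong (λ z → (-ᶻ + w) *ᶻ (+ z -ᶻ + toℕ x)) (sym (trans (ℕₚ.+-suc (toℕ x) o) e)))
       (trans (lemma (+ w) (+ toℕ x) (+ suc o)) (cong (λ z → + 1 +ᶻ (-ᶻ + 1) *ᶻ (+ 1 +ᶻ z)) (sym (ℤₚ.pos-* (suc o) w)))))
  where lemma : ∀ w x o → (-ᶻ w) *ᶻ ((x +ᶻ o) -ᶻ x) ≡ + 1 +ᶻ (-ᶻ + 1) *ᶻ (+ 1 +ᶻ o *ᶻ w)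
        lemma = ℤS.solve-∀
difference-unit {n} {u} one {x} {y} x≢y | tri> _ _ gt with ℕₚ.m≤n⇒∃[o]m+o≡n gt
... | o , e with one (suc o) (s≤s z≤n) (ℕₚ.≤-<-trans (subst (suc o ≤_) (trans (ℕₚ.+-suc (toℕ y) o) e) (ℕₚ.m≤n+m (suc o) (toℕ y))) (Fₚ.toℕ<n x))
... | w , refl = + w , mod (-ᶻ + 1) (trans (cong (λ z → (+ w) *ᶻ (+ toℕ y -ᶻ + z)) (sym (trans (ℕₚ.+-suc (toℕ y) o) e)))
       (trans (lemma (+ w) (+ toℕ y) (+ suc o)) (cong (λ z → + 1 +ᶻ (-ᶻ + 1) *ᶻ (+ 1 +ᶻ z)) (sym (ℤₚ.pos-* (suc o) w)))))
  where lemma : ∀ w y o → w *ᶻ (y -ᶻ (y +ᶻ o)) ≡ + 1 +ᶻ (-ᶻ + 1) *ᶻ (+ 1 +ᶻ o *ᶻ w)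
        lemma = ℤS.solve-∀

-- The lines are x ↦ a + x b. Two slots determine a line as soon as the differences of slots are
-- invertible modulo `n`, which n ≡ 1 modulo every d < u guarantees, also for composite `n`.
module Desarguesian {u n : ℕ} .{{_ : NonZero n}} (one : ∀ d → 0 < d → d < u → OneModulo d n) where

  point : Fin n × Fin n → Fin u → Fin n
  point (a , b) x = res (val a +ᶻ + toℕ x *ᶻ val b)

  private
    through : ∀ {x y} → x ≢ y → ∀ a b → Σ (Fin n × Fin n) λ t → point t x ≡ a × point t y ≡ b
    through {x} {y} x≢y a b = (res c , res s) , res-≡ at-x , res-≡ at-y
      where
      D = difference-unit one x≢y
      X = + toℕ x
      Y = + toℕ y
      s c : ℤ
      s = proj₁ D *ᶻ (val b -ᶻ val a)
      c = val a -ᶻ X *ᶻ s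
      start : ∀ z → val (res {n} c) +ᶻ z *ᶻ val (res {n} s) ≈[ n ] c +ᶻ z *ᶻ s
      start z = ≈-+ (val-res c) (≈-*ˡ z (val-res s))
      at-x : val (res {n} c) +ᶻ X *ᶻ val (res {n} s) ≈[ n ] val a
      at-x = ≈-trans (start X) (≈-reflexive (lemma (val a) (X *ᶻ s)))
        where lemma : ∀ a z → (a -ᶻ z) +ᶻ z ≡ a
              lemma = ℤS.solve-∀
      at-y : val (res {n} c) +ᶻ Y *ᶻ val (res {n} s) ≈[ n ] val b
      at-y = ≈-trans (start Y) (≈-trans (≈-reflexive (lemma (val a) (val b) X Y (proj₁ D)))
               (≈-trans (≈-+ (≈-refl {_} {val a}) (≈-* (proj₂ D) (≈-refl {_} {val b -ᶻ val a}))) (≈-reflexive (lemma′ (val a) (val b)))))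
        where lemma : ∀ a b x y d → (a -ᶻ x *ᶻ (d *ᶻ (b -ᶻ a))) +ᶻ y *ᶻ (d *ᶻ (b -ᶻ a)) ≡ a +ᶻ (d *ᶻ (y -ᶻ x)) *ᶻ (b -ᶻ a)
              lemma = ℤS.solve-∀
              lemma′ : ∀ a b → a +ᶻ + 1 *ᶻ (b -ᶻ a) ≡ b
              lemma′ = ℤS.solve-∀

    unique : ∀ {x y} → x ≢ y → ∀ {s t} → point s x ≡ point t x → point s y ≡ point t y → s ≡ t
    unique {x} {y} x≢y {a , b} {c , d} e₁ e₂ = cong₂ _,_ (val-injective a≈c) (val-injective b≈d)
      where
      X = + toℕ x
      Y = + toℕ y
      p : val a +ᶻ X *ᶻ val b ≈[ n ] val c +ᶻ X *ᶻ val d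
      p = res-injective e₁
      q : val a +ᶻ Y *ᶻ val b ≈[ n ] val c +ᶻ Y *ᶻ val d
      q = res-injective e₂
      lemma : ∀ a b x y → (y -ᶻ x) *ᶻ b ≡ (a +ᶻ y *ᶻ b) -ᶻ (a +ᶻ x *ᶻ b)
      lemma = ℤS.solve-∀
      lemma′ : ∀ a b x → (a +ᶻ x *ᶻ b) -ᶻ x *ᶻ b ≡ a
      lemma′ = ℤS.solve-∀
      b≈d : val b ≈[ n ] val d
      b≈d = unit-cancel (difference-unit one x≢y) (≈-trans (≈-reflexive (lemma (val a) (val b) X Y))
              (≈-trans (≈-- q p) (≈-reflexive (sym (lemma (val c) (val d) X Y)))))
      a≈c : val a ≈[ n ] val c
      a≈c = ≈-trans (≈-reflexive (sym (lemma′ (val a) (val b) X)))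
              (≈-trans (≈-- p (≈-*ˡ X b≈d)) (≈-reflexive (lemma′ (val c) (val d) X)))

  td : TD u n
  td = record { Line = Fin n × Fin n ; at = point ; through = through ; unique = unique }

single : ∀ {k} → 2 ≤ k → Decomp k (Fin k) _≢_
single le = record
  { Index = ⊤ ; block = λ _ p → p ; irrefl = λ n → n refl ; isEdge = λ _ n → n
  ; find = λ {x} {y} n → tt , x , y , n , refl , refl ; uniq = λ _ _ _ _ → refl }

-- The direct product of a design on w points with a transversal design: blocks of the design are
-- lifted along lines, and each fibre of z + 1 points carries a copy of `Dz`. The points of
-- coordinate zero form the hole. Two of them can be joined by lifts along `t₀` only, so exactly
-- these lifts are omitted.
module _ {k w z : ℕ} (2≤k : 2 ≤ k) (Dw : Decomp k (Fin w) _≢_) (Dz : Decomp k (Fin (suc z)) _≢_)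
         (T : TD k (suc z)) (t₀ : TD.Line T) (t₀-zero : ∀ x → TD.at T t₀ x ≡ zero) where
  private
    module T = TD T
    module Dw = Decomp Dw
    Point = (Fin w × Fin z) ⊎ Fin w
    x₀ x₁ : Fin k
    x₀ = fromℕ< (ℕₚ.≤-trans (s≤s z≤n) 2≤k)
    x₁ = fromℕ< 2≤k
    x₀≢x₁ : x₀ ≢ x₁
    x₀≢x₁ e with trans (sym (Fₚ.toℕ-fromℕ< (ℕₚ.≤-trans (s≤s z≤n) 2≤k))) (trans (cong toℕ e) (Fₚ.toℕ-fromℕ< 2≤k))
    ... | ()
    -- Two slots suffice as a test: a line that is zero at two slots is `t₀`.
    isZero : T.Line → Bool
    isZero t = ⌊ (T.at t x₀ F.≟ zero) ×-dec (T.at t x₁ F.≟ zero) ⌋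
    zero⇒t₀ : ∀ {t} → isZero t ≡ true → t ≡ t₀
    zero⇒t₀ {t} e with T.at t x₀ F.≟ zero | T.at t x₁ F.≟ zero
    zero⇒t₀ {t} e  | yes a | yes b = T.unique x₀≢x₁ (trans a (sym (t₀-zero x₀))) (trans b (sym (t₀-zero x₁)))
    zero⇒t₀ {t} () | yes a | no b
    zero⇒t₀ {t} () | no a | _
    two-zeros : ∀ {t p q} → p ≢ q → T.at t p ≡ zero → T.at t q ≡ zero → isZero t ≡ true
    two-zeros {t} p≢q a b with T.unique p≢q {t} {t₀} (trans a (sym (t₀-zero _))) (trans b (sym (t₀-zero _)))
    ... | refl with T.at t x₀ F.≟ zero | T.at t x₁ F.≟ zero
    ... | yes _ | yes _ = refl
    ... | yes _ | no n = ⊥-elim (n (t₀-zero x₁))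
    ... | no n  | _ = ⊥-elim (n (t₀-zero x₀))

    pt : Fin w → Fin (suc z) → Point
    pt x zero    = inj₂ x
    pt x (suc a) = inj₁ (x , a)
    base : Point → Fin w
    base (inj₁ (x , _)) = x
    base (inj₂ x)       = x
    coord : Point → Fin (suc z)
    coord (inj₁ (_ , a)) = suc a
    coord (inj₂ _)       = zero
    base-pt : ∀ x a → base (pt x a) ≡ x
    base-pt x zero    = refl
    base-pt x (suc a) = refl
    coord-pt : ∀ x a → coord (pt x a) ≡ a
    coord-pt x zero    = refl
    coord-pt x (suc a) = refl
    pt-η : ∀ p → pt (base p) (coord p) ≡ p
    pt-η (inj₁ _) = refl
    pt-η (inj₂ _) = refl
    hole⇒ : ∀ {x y} → WithHole x y → x ≢ y × (coord x ≡ zero → coord y ≡ zero → ⊥)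
    hole⇒ {inj₁ _} {inj₁ _} n = (λ e → n (inj₁-injective e)) , λ ()
    hole⇒ {inj₁ _} {inj₂ _} n = (λ ()) , λ ()
    hole⇒ {inj₂ _} {inj₁ _} n = (λ ()) , λ _ ()
    ⇒hole : ∀ x y → x ≢ y → (coord x ≡ zero → coord y ≡ zero → ⊥) → WithHole x y
    ⇒hole (inj₁ _) (inj₁ _) n m e = n (cong inj₁ e)
    ⇒hole (inj₁ _) (inj₂ _) n m = tt
    ⇒hole (inj₂ _) (inj₁ _) n m = tt
    ⇒hole (inj₂ _) (inj₂ _) n m = m refl refl

    I : Set
    I = (Dw.Index × Σ T.Line λ t → isZero t ≡ false) ⊎ Fin w
    Piece : I → Set
    Piece (inj₁ _) = Fin k
    Piece (inj₂ _) = Fin (suc z)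
    Edge : ∀ i → Piece i → Piece i → Set
    Edge (inj₁ _) = _≢_
    Edge (inj₂ _) = _≢_
    decompPiece : ∀ i → Decomp k (Piece i) (Edge i)
    decompPiece (inj₁ _) = single 2≤k
    decompPiece (inj₂ _) = Dz
    emb : ∀ i → Piece i → Point
    emb (inj₁ (i , t , _)) p = pt (Dw.block i p) (T.at t p)
    emb (inj₂ x) a           = pt x a
    ≡-parts : ∀ {x y a b} → pt x a ≡ pt y b → x ≡ y × a ≡ b
    ≡-parts {x} {y} {a} {b} e = trans (sym (base-pt x a)) (trans (cong base e) (base-pt y b))
                              , trans (sym (coord-pt x a)) (trans (cong coord e) (coord-pt y b))
    edge : ∀ i {x y} → Edge i x y → WithHole (emb i x) (emb i y)
    edge (inj₁ (i , t , nz)) {p} {q} p≢q = ⇒hole _ _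
      (λ e → p≢q (Dw.block-injective (proj₁ (≡-parts {a = T.at t p} e))))
      (λ a b → absurd (trans (sym (two-zeros {t} p≢q (trans (sym (coord-pt _ _)) a) (trans (sym (coord-pt _ _)) b))) nz))
      where absurd : true ≡ false → ⊥
            absurd ()
    edge (inj₂ x) {a} {b} a≢b = ⇒hole _ _ (λ e → a≢b (proj₂ (≡-parts {x} e)))
      (λ c d → a≢b (trans (trans (sym (coord-pt x a)) c) (sym (trans (sym (coord-pt x b)) d))))
    find′ : ∀ {x y} → WithHole x y → Σ I λ i → Σ (Piece i) λ x′ → Σ (Piece i) λ y′ → Edge i x′ y′ × emb i x′ ≡ x × emb i y′ ≡ y
    find′ {x} {y} e with hole⇒ {x} {y} e | base x F.≟ base y
    ... | n , m | yes b = inj₂ (base x) , coord x , coord y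
          , (λ c → n (trans (sym (pt-η x)) (trans (cong₂ pt b c) (pt-η y))))
          , pt-η x , trans (cong (λ v → pt v (coord y)) b) (pt-η y)
    ... | n , m | no b with Dw.find b | isZero (proj₁ (T.through (proj₁ (proj₂ (proj₂ (proj₂ (Dw.find b))))) (coord x) (coord y))) in eq
    ... | i , p , q , p≢q , e₁ , e₂ | true = ⊥-elim (m (trans (sym at₁) (all-zero p)) (trans (sym at₂) (all-zero q)))
      where
      T′ = T.through p≢q (coord x) (coord y)
      at₁ = proj₁ (proj₂ T′)
      at₂ = proj₂ (proj₂ T′)
      all-zero : ∀ x → T.at (proj₁ T′) x ≡ zero
      all-zero x = trans (cong (λ t → T.at t x) (zero⇒t₀ eq)) (t₀-zero x)
    ... | i , p , q , p≢q , e₁ , e₂ | false =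
      inj₁ (i , proj₁ T′ , eq) , p , q , p≢q
        , trans (cong₂ pt e₁ (proj₁ (proj₂ T′))) (pt-η x) , trans (cong₂ pt e₂ (proj₂ (proj₂ T′))) (pt-η y)
      where T′ = T.through p≢q (coord x) (coord y)
    uniq′ : ∀ {i j x y x′ y′} → Edge i x y → Edge j x′ y′ → emb i x ≡ emb j x′ → emb i y ≡ emb j y′ →
            _≡_ {A = Σ I λ i → Piece i × Piece i} (i , x , y) (j , x′ , y′)
    uniq′ {inj₁ (i , t , nz)} {inj₁ (j , t′ , nz′)} n n′ e₁ e₂ with ≡-parts {a = T.at t _} {T.at t′ _} e₁ | ≡-parts {a = T.at t _} {T.at t′ _} e₂
    ... | a , b | c , d with Dw.uniq n n′ a c
    ... | refl with Dw.block-injective a | Dw.block-injective c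
    ... | refl | refl with T.unique n b d
    ... | refl = cong (λ nz → inj₁ (i , t , nz) , _ , _) (UIP.Decidable⇒UIP.≡-irrelevant Boolₚ._≟_ nz nz′)
    uniq′ {inj₁ (i , t , _)} {inj₂ z} n n′ e₁ e₂ =
      ⊥-elim (n (Dw.block-injective (trans (proj₁ (≡-parts {a = T.at t _} e₁)) (sym (proj₁ (≡-parts {a = T.at t _} e₂))))))
    uniq′ {inj₂ z} {inj₁ (i , t , _)} n n′ e₁ e₂ =
      ⊥-elim (n′ (Dw.block-injective (trans (sym (proj₁ (≡-parts {b = T.at t _} e₁))) (proj₁ (≡-parts {b = T.at t _} e₂)))))
    uniq′ {inj₂ z} {inj₂ z′} n n′ e₁ e₂ with ≡-parts {z} {z′} e₁ | ≡-parts {z} {z′} e₂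
    ... | refl , refl | _ , refl = refl

  productWithHole : Incomplete k (Fin w × Fin z) (Fin w)
  productWithHole = compose partition decompPiece
    where
    irr : ∀ {x : Point} → ¬ WithHole x x
    irr {inj₁ _} n = n refl
    partition : EdgePartition WithHole Piece Edge
    partition = record
      { emb = emb ; irrefl = λ {x} → irr {x} ; edge = edge ; find = λ {x} {y} → find′ {x} {y}
      ; uniq = λ {i} {j} {x} {y} {x′} {y′} → uniq′ {i} {j} {x} {y} {x′} {y′} }

-- Labelled transversal designs from cyclic shifts

sumTo : ℕ → (ℕ → ℤ) → ℤ
sumTo zero    f = + 0
sumTo (suc n) f = sumTo n f +ᶻ f n

-- The data of a transversal design of lines whose labels in ℤ/Λ are additive in the points, together with
-- points τ c that influence the label of a line through slot 0 only if it is computed from slot 1.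
record LabelledTD (u Λ : ℕ) : Set₁ where
  field
    order : ℕ
    td    : TD u order
  open TD td public
  field
    0#    : Fin order
    _⊕_ _⊖_ : Fin order → Fin order → Fin order
    ⊖⊕ : ∀ a s → (a ⊖ s) ⊕ s ≡ a
    ⊕⊖ : ∀ a s → (a ⊕ s) ⊖ s ≡ a
    label : Line → ℤ
    lab   : Fin u → Fin u → Fin order → Fin order → ℤ
    lab-line : ∀ {x y} → x ≢ y → ∀ t → lab x y (at t x) (at t y) ≈[ Λ ] label t
    lab-⊖ : ∀ {x y} → x ≢ y → ∀ a b s s′ → lab x y (a ⊖ s) (b ⊖ s′) ≈[ Λ ] lab x y a b -ᶻ lab x y s s′
    lab-sym : ∀ {x y} → x ≢ y → ∀ a b → lab x y a b ≈[ Λ ] lab y x b a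
    lab-0 : ∀ {x y} → x ≢ y → lab x y 0# 0# ≈[ Λ ] + 0
    τ     : ℤ → Fin order
    lab-τ₁ : ∀ {x y} c → toℕ x ≡ 0 → toℕ y ≡ 1 → lab x y (τ c) 0# ≈[ Λ ] c
    lab-τ₀ : ∀ {x y} c → toℕ x ≡ 0 → 1 < toℕ y → lab x y (τ c) 0# ≈[ Λ ] + 0

funToFin-cong : ∀ {m n} {f g : Fin m → Fin n} → (∀ i → f i ≡ g i) → F.funToFin f ≡ F.funToFin g
funToFin-cong {zero}  e = refl
funToFin-cong {suc m} e = cong₂ combine (e zero) (funToFin-cong (λ i → e (suc i)))

-- Points are functions ℤ/r → ℤ/Λ up to constants. With σ the cyclic shift, lines are x ↦ a + B_x w,
-- where B_0 = 0 and B_x = σ^x for x > 0. Two slots determine a line because B_x - B_y is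
-- invertible: up to sign it is a shift, or a shift of 1 - σ^d with 0 < d < u. That r ≡ 1 modulo d
-- makes σ^d generate all shifts, and r ≡ 1 modulo Λ controls the constants. The label of a line is
-- w(0) - w(-1), which is additive and insensitive to constants.
module Cyclic (Λ r′ u : ℕ) .{{_ : NonZero Λ}} (r≡1 : OneModulo Λ (suc r′))
              (one : ∀ d → 0 < d → d < u → OneModulo d (suc r′)) (u≤r : u ≤ suc r′) where
  private
    r = suc r′

    infix 4 _≈_
    _≈_ : ℤ → ℤ → Set
    a ≈ b = a ≈[ Λ ] b

    ≡⇒≈ : ∀ {a b} → a ≡ b → a ≈ b
    ≡⇒≈ = ≈-reflexive

    constant-from-step : (f : ℤ → ℤ) → (∀ i → f (i -ᶻ + 1) ≈ f i) → ∀ i → f i ≈ f (+ 0)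
    constant-from-step f step (+ zero) = ≈-refl
    constant-from-step f step (+ suc n) =
      ≈-trans (≈-sym (step (+ suc n))) (constant-from-step f step (+ n))
    constant-from-step f step (-[1+ zero ]) = step (+ 0)
    constant-from-step f step (-[1+ suc n ]) =
      ≈-trans (≈-trans (≡⇒≈ (cong f (cong -[1+_] (cong suc (sym (ℕₚ.+-identityʳ n)))))) (step (-[1+ n ])))
              (constant-from-step f step (-[1+ n ]))

    multiple : (f : ℤ → ℤ) (d : ℤ) → (∀ i → f (i +ᶻ d) ≈ f i) → ∀ m i → f (i +ᶻ d *ᶻ + m) ≈ f i
    multiple f d p zero i = ≡⇒≈ (cong f (lemma i d))
      where lemma : ∀ i d → i +ᶻ d *ᶻ + 0 ≡ i
            lemma = ℤS.solve-∀
    multiple f d p (suc m) i =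
      ≈-trans (≡⇒≈ (cong f (lemma i d (+ m)))) (≈-trans (p (i +ᶻ d *ᶻ + m)) (multiple f d p m i))
      where lemma : ∀ i d m → i +ᶻ d *ᶻ (+ 1 +ᶻ m) ≡ (i +ᶻ d *ᶻ m) +ᶻ d
            lemma = ℤS.solve-∀

    -- Since r ≡ 1 (mod d), invariance under d and under r gives invariance under 1.
    invariant : (f : ℤ → ℤ) (d : ℕ) → OneModulo d r → (∀ i → f (i +ᶻ + r) ≈ f i) →
                (∀ i → f (i -ᶻ + d) ≈ f i) → ∀ i → f i ≈ f (+ 0)
    invariant f d (e , r≡) per-r per-d = constant-from-step f λ i →
      ≈-trans (≈-sym (per-r (i -ᶻ + 1))) (≈-trans (≡⇒≈ (cong f (step i)))
        (≈-trans (≈-sym (per-d′ ((i +ᶻ + d *ᶻ + e)))) (back i)))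
      where
      step : ∀ i → (i -ᶻ + 1) +ᶻ + r ≡ i +ᶻ + d *ᶻ + e
      step i = trans (cong (λ z → (i -ᶻ + 1) +ᶻ z) (trans (cong +_ r≡) (cong (+ 1 +ᶻ_) (ℤₚ.pos-* d e)))) (lemma i (+ d *ᶻ + e))
        where lemma : ∀ i z → (i -ᶻ + 1) +ᶻ (+ 1 +ᶻ z) ≡ i +ᶻ z
              lemma = ℤS.solve-∀
      per-d′ : ∀ i → f (i +ᶻ + 0) ≈ f i
      per-d′ i = ≡⇒≈ (cong f (ℤₚ.+-identityʳ i))
      up : ∀ i → f (i +ᶻ + d) ≈ f i
      up i = ≈-trans (≈-sym (per-d (i +ᶻ + d))) (≡⇒≈ (cong f (lemma i (+ d))))
        where lemma : ∀ i d → (i +ᶻ d) -ᶻ d ≡ i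
              lemma = ℤS.solve-∀
      back : ∀ i → f ((i +ᶻ + d *ᶻ + e) +ᶻ + 0) ≈ f i
      back i = ≈-trans (per-d′ _) (multiple f (+ d) up e i)

  -- Functions on ℤ of period r with values modulo Λ; they are considered up to additive constants.
  record Cyc : Set where
    constructor cyc
    field
      fn  : ℤ → ℤ
      per : ∀ i → fn (i +ᶻ + r) ≈ fn i
  open Cyc

  infix 4 _∼_
  record _∼_ (a b : Cyc) : Set where
    constructor shift-by
    field
      const : ℤ
      close : ∀ i → fn a i ≈ fn b i +ᶻ const

  private
    ∼-refl : ∀ {a} → a ∼ a
    ∼-refl {a} = shift-by (+ 0) λ i → ≡⇒≈ (sym (ℤₚ.+-identityʳ (fn a i)))

    ∼-sym : ∀ {a b} → a ∼ b → b ∼ a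
    ∼-sym {a} {b} (shift-by c e) = shift-by (-ᶻ c) λ i →
      ≈-trans (≡⇒≈ (lemma (fn b i) c)) (≈-+ (≈-sym (e i)) (≈-refl { _ } { -ᶻ c }))
      where lemma : ∀ b c → b ≡ (b +ᶻ c) +ᶻ -ᶻ c
            lemma = ℤS.solve-∀

    ∼-trans : ∀ {a b c} → a ∼ b → b ∼ c → a ∼ c
    ∼-trans {a} {b} {c} (shift-by k e) (shift-by l f) = shift-by (l +ᶻ k) λ i →
      ≈-trans (e i) (≈-trans (≈-+ (f i) (≈-refl {_} {k})) (≡⇒≈ (ℤₚ.+-assoc (fn c i) l k)))

    pointwise : ∀ {a b} → (∀ i → fn a i ≈ fn b i) → a ∼ b
    pointwise {a} {b} e = shift-by (+ 0) λ i → ≈-trans (e i) (≡⇒≈ (sym (ℤₚ.+-identityʳ (fn b i))))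

    infixl 6 _⊞_ _⊟_
    _⊞_ _⊟_ : Cyc → Cyc → Cyc
    a ⊞ b = cyc (λ i → fn a i +ᶻ fn b i) λ i → ≈-+ (per a i) (per b i)
    a ⊟ b = cyc (λ i → fn a i -ᶻ fn b i) λ i → ≈-- (per a i) (per b i)
    𝟘 : Cyc
    𝟘 = cyc (λ _ → + 0) λ _ → ≈-refl

    ⊞-cong : ∀ {a b c d} → a ∼ b → c ∼ d → a ⊞ c ∼ b ⊞ d
    ⊞-cong {a} {b} {c} {d} (shift-by k e) (shift-by l f) = shift-by (k +ᶻ l) λ i →
      ≈-trans (≈-+ (e i) (f i)) (≡⇒≈ (lemma (fn b i) (fn d i) k l))
      where lemma : ∀ b d k l → (b +ᶻ k) +ᶻ (d +ᶻ l) ≡ (b +ᶻ d) +ᶻ (k +ᶻ l)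
            lemma = ℤS.solve-∀
    ⊟-cong : ∀ {a b c d} → a ∼ b → c ∼ d → a ⊟ c ∼ b ⊟ d
    ⊟-cong {a} {b} {c} {d} (shift-by k e) (shift-by l f) = shift-by (k -ᶻ l) λ i →
      ≈-trans (≈-- (e i) (f i)) (≡⇒≈ (lemma (fn b i) (fn d i) k l))
      where lemma : ∀ b d k l → (b +ᶻ k) -ᶻ (d +ᶻ l) ≡ (b -ᶻ d) +ᶻ (k -ᶻ l)
            lemma = ℤS.solve-∀

    σ : ℤ → Cyc → Cyc
    σ z a = cyc (λ i → fn a (i -ᶻ z)) λ i →
      ≈-trans (≡⇒≈ (cong (fn a) (lemma i z (+ r)))) (per a (i -ᶻ z))
      where lemma : ∀ i z r → (i +ᶻ r) -ᶻ z ≡ (i -ᶻ z) +ᶻ r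
            lemma = ℤS.solve-∀

    σ-cong : ∀ z {a b} → a ∼ b → σ z a ∼ σ z b
    σ-cong z (shift-by c e) = shift-by c λ i → e (i -ᶻ z)

    σ-σ : ∀ z a i → fn (σ z (σ (-ᶻ z) a)) i ≡ fn a i
    σ-σ z a i = cong (fn a) (lemma i z)
      where lemma : ∀ i z → (i -ᶻ z) -ᶻ (-ᶻ z) ≡ i
            lemma = ℤS.solve-∀

    -- Slot 0 belongs to the zero operator, not to the identity. A line through `τV c` at slot 0 and
    -- `𝟘` at slot y then has direction - σ^(-y) (τV c), which is concentrated in one residue class;
    -- with the identity one would have to invert 1 - σ^y.
    B : ℕ → Cyc → Cyc
    B zero    a = 𝟘
    B (suc z) a = σ (+ suc z) a

    B-cong : ∀ z {a b} → a ∼ b → B z a ∼ B z b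
    B-cong zero    p = ∼-refl
    B-cong (suc z) p = σ-cong (+ suc z) p

    B-⊟ : ∀ z a b i → fn (B z (a ⊟ b)) i ≡ fn (B z a) i -ᶻ fn (B z b) i
    B-⊟ zero    a b i = refl
    B-⊟ (suc z) a b i = refl

    sumTo-cong : ∀ n {f g} → (∀ m → f m ≈ g m) → sumTo n f ≈ sumTo n g
    sumTo-cong zero    e = ≈-refl
    sumTo-cong (suc n) e = ≈-+ (sumTo-cong n e) (e n)

    -- Modulo constants the inverse of 1 - X, for X = σ^d, is - Σ m X^m over m < r: the product
    -- telescopes to r X^r - (X + ... + X^r). Here X^r is the identity, r ≡ 1 modulo Λ, and the
    -- remaining sum is invariant under all shifts, hence a constant.
    module Inverse-of-1-σ (d : ℕ) (od : OneModulo d r) (v : Cyc) where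
      y : ℤ → ℕ → ℤ
      y i m = fn v (i -ᶻ + d *ᶻ + m)

      inv : Cyc
      inv = cyc (λ i → -ᶻ sumTo r (λ m → + m *ᶻ y i m)) λ i →
        ≈-neg (sumTo-cong r λ m → ≈-*ˡ (+ m) (≈-trans (≡⇒≈ (cong (fn v) (lemma i (+ r) (+ d *ᶻ + m)))) (per v _)))
        where lemma : ∀ i r z → (i +ᶻ r) -ᶻ z ≡ (i -ᶻ z) +ᶻ r
              lemma = ℤS.solve-∀

      telescope : ∀ (y : ℕ → ℤ) n → -ᶻ sumTo n (λ m → + m *ᶻ y m) -ᶻ (-ᶻ sumTo n (λ m → + m *ᶻ y (suc m)))
                  ≡ + n *ᶻ y n -ᶻ sumTo n (λ m → y (suc m))
      telescope y zero = sym (lemma (y 0))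
        where lemma : ∀ z → + 0 *ᶻ z -ᶻ + 0 ≡ + 0
              lemma = ℤS.solve-∀
      telescope y (suc n) = trans (lemma (sumTo n λ m → + m *ᶻ y m) (sumTo n λ m → + m *ᶻ y (suc m)) (+ n) (y n) (y (suc n)))
        (trans (cong (λ z → z +ᶻ + n *ᶻ (y (suc n) -ᶻ y n)) (telescope y n)) (lemma′ (+ n) (y n) (y (suc n)) (sumTo n λ m → y (suc m))))
        where
        lemma : ∀ a b n x z → -ᶻ (a +ᶻ n *ᶻ x) -ᶻ (-ᶻ (b +ᶻ n *ᶻ z)) ≡ (-ᶻ a -ᶻ (-ᶻ b)) +ᶻ n *ᶻ (z -ᶻ x)
        lemma = ℤS.solve-∀
        lemma′ : ∀ n x z s → (n *ᶻ x -ᶻ s) +ᶻ n *ᶻ (z -ᶻ x) ≡ (+ 1 +ᶻ n) *ᶻ z -ᶻ (s +ᶻ z)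
        lemma′ = ℤS.solve-∀

      S : ℤ → ℤ
      S i = sumTo r λ m → y i (suc m)

      y-shift : ∀ i m → y (i -ᶻ + d) m ≡ y i (suc m)
      y-shift i m = cong (fn v) (lemma i (+ d) (+ m))
        where lemma : ∀ i d m → (i -ᶻ d) -ᶻ d *ᶻ m ≡ i -ᶻ d *ᶻ (+ 1 +ᶻ m)
              lemma = ℤS.solve-∀

      y-per : ∀ i m → y i (m + r) ≈ y i m
      y-per i m = ≈-trans (≈-sym (multiple (fn v) (+ r) (per v) d (i -ᶻ + d *ᶻ + (m + r))))
                    (≡⇒≈ (cong (fn v) (lemma i (+ d) (+ m) (+ r))))
        where lemma : ∀ i d m r → (i -ᶻ d *ᶻ (m +ᶻ r)) +ᶻ r *ᶻ d ≡ i -ᶻ d *ᶻ m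
              lemma = ℤS.solve-∀

      sum-shift : ∀ (f : ℕ → ℤ) n → sumTo n (λ m → f (suc m)) +ᶻ f 0 ≡ sumTo n f +ᶻ f n
      sum-shift f zero = refl
      sum-shift f (suc n) = trans (lemma (sumTo n λ m → f (suc m)) (f (suc n)) (f 0)) (cong (_+ᶻ f (suc n)) (sum-shift f n))
        where lemma : ∀ a b c → (a +ᶻ b) +ᶻ c ≡ (a +ᶻ c) +ᶻ b
              lemma = ℤS.solve-∀

      S-const : ∀ i → S i ≈ S (+ 0)
      S-const = invariant S d od
        (λ i → sumTo-cong r λ m → ≈-trans (≡⇒≈ (cong (fn v) (lemma i (+ r) (+ d *ᶻ + suc m)))) (per v _))
        (λ i → ≈-trans (sumTo-cong r λ m → ≡⇒≈ (y-shift i (suc m))) (cyclic i))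
        where
        lemma : ∀ i r z → (i +ᶻ r) -ᶻ z ≡ (i -ᶻ z) +ᶻ r
        lemma = ℤS.solve-∀
        cancel : ∀ a b c → a +ᶻ c ≈ b +ᶻ c → a ≈ b
        cancel a b c p = ≈-trans (≡⇒≈ (l a c)) (≈-trans (≈-- p (≈-refl {_} {c})) (≡⇒≈ (sym (l b c))))
          where l : ∀ a c → a ≡ (a +ᶻ c) -ᶻ c
                l = ℤS.solve-∀
        cyclic : ∀ i → sumTo r (λ m → y i (suc (suc m))) ≈ S i
        cyclic i = cancel _ _ (y i 1) (≈-trans (≡⇒≈ (sum-shift (λ m → y i (suc m)) r))
          (≈-+ (≈-refl {_} {S i}) (y-per i 1)))

      inv-correct : inv ⊟ σ (+ d) inv ∼ v
      inv-correct = shift-by (-ᶻ S (+ 0)) λ i →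
        ≈-trans (≈-- (≈-refl {_} { fn inv i }) (≈-neg (sumTo-cong r λ m → ≈-*ˡ (+ m) (≡⇒≈ (y-shift i m)))))
        (≈-trans (≡⇒≈ (telescope (y i) r))
        (≈-+ (≈-trans (≈-* r≈1 (≈-trans (y-per i 0) (≡⇒≈ (cong (fn v) (lemma i (+ d)))))) (≡⇒≈ (ℤₚ.*-identityˡ (fn v i))))
             (≈-neg (S-const i))))
        where
        lemma : ∀ i d → i -ᶻ d *ᶻ + 0 ≡ i
        lemma = ℤS.solve-∀
        r≈1 : + r ≈ + 1
        r≈1 = mod (+ proj₁ r≡1) (trans (cong +_ (proj₂ r≡1)) (cong (+ 1 +ᶻ_) (trans (ℤₚ.pos-* Λ (proj₁ r≡1)) (ℤₚ.*-comm (+ Λ) _))))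

    -- A constant difference `c` along steps of length d adds up to r c after r steps, when the
    -- argument is back at its start modulo r. As r ≡ 1 modulo Λ this forces c ≡ 0, and then
    -- `invariant` applies.
    1-σ-injective : ∀ d → OneModulo d r → ∀ w c → (∀ i → fn w i -ᶻ fn w (i -ᶻ + d) ≈ c) → ∀ i → fn w i ≈ fn w (+ 0)
    1-σ-injective d od w c h = invariant (fn w) d od (per w) λ i →
      ≈-trans (≡⇒≈ (lemma (fn w i) (fn w (i -ᶻ + d)))) (≈-trans (≈-- (≈-refl {_} {fn w i}) (≈-trans (h i) c≈0)) (≡⇒≈ (ℤₚ.+-identityʳ _)))
      where
      lemma : ∀ a b → b ≡ a -ᶻ (a -ᶻ b)
      lemma = ℤS.solve-∀
      steps : ∀ m → fn w (+ 0) -ᶻ fn w (+ 0 -ᶻ + d *ᶻ + m) ≈ + m *ᶻ c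
      steps zero = ≡⇒≈ (trans (cong (λ z → fn w (+ 0) -ᶻ fn w z) (l (+ d))) (l′ (fn w (+ 0)) c))
        where l : ∀ d → + 0 -ᶻ d *ᶻ + 0 ≡ + 0
              l = ℤS.solve-∀
              l′ : ∀ a c → a -ᶻ a ≡ + 0 *ᶻ c
              l′ = ℤS.solve-∀
      steps (suc m) = ≈-trans (≡⇒≈ (l (fn w (+ 0)) (fn w (+ 0 -ᶻ + d *ᶻ + m)) (fn w (+ 0 -ᶻ + d *ᶻ + suc m))))
        (≈-trans (≈-+ (steps m) (≈-trans (≡⇒≈ (cong (λ z → fn w (+ 0 -ᶻ + d *ᶻ + m) -ᶻ fn w z) (l₂ (+ d) (+ m)))) (h (+ 0 -ᶻ + d *ᶻ + m))))
          (≡⇒≈ (l₃ (+ m) c)))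
        where l : ∀ a b c → a -ᶻ c ≡ (a -ᶻ b) +ᶻ (b -ᶻ c)
              l = ℤS.solve-∀
              l₂ : ∀ d m → + 0 -ᶻ d *ᶻ (+ 1 +ᶻ m) ≡ (+ 0 -ᶻ d *ᶻ m) -ᶻ d
              l₂ = ℤS.solve-∀
              l₃ : ∀ m c → m *ᶻ c +ᶻ c ≡ (+ 1 +ᶻ m) *ᶻ c
              l₃ = ℤS.solve-∀
      rc≈0 : + r *ᶻ c ≈ + 0
      rc≈0 = ≈-trans (≈-sym (steps r)) (≈-diff (≈-sym (≈-trans (≈-sym (multiple (fn w) (+ r) (per w) d (+ 0 -ᶻ + d *ᶻ + r)))
               (≡⇒≈ (cong (fn w) (l (+ d) (+ r)))))))
        where l : ∀ d r → (+ 0 -ᶻ d *ᶻ r) +ᶻ r *ᶻ d ≡ + 0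
              l = ℤS.solve-∀
      c≈0 : c ≈ + 0
      c≈0 = ≈-trans (≈-sym (mod (+ proj₁ r≡1 *ᶻ c) (trans (cong (_*ᶻ c) (trans (cong +_ (proj₂ r≡1)) (cong (+ 1 +ᶻ_) (ℤₚ.pos-* Λ (proj₁ r≡1)))))
               (l c (+ Λ) (+ proj₁ r≡1))))) rc≈0
        where l : ∀ c Λ e → (+ 1 +ᶻ Λ *ᶻ e) *ᶻ c ≡ c +ᶻ (e *ᶻ c) *ᶻ Λ
              l = ℤS.solve-∀

    ℕ-difference : ∀ {x y} → x < y → y < u → Σ ℕ λ d → y ≡ x + d × OneModulo d r
    ℕ-difference {x} {y} x<y y<u with ℕₚ.m≤n⇒∃[o]m+o≡n x<y
    ... | o , refl = suc o , sym (ℕₚ.+-suc x o)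
                   , one (suc o) (s≤s z≤n) (ℕₚ.≤-<-trans (s≤s (ℕₚ.m≤n+m o x)) y<u)

    solve< : ∀ {x y} → x < y → y < u → ∀ v → Σ Cyc λ w → B x w ⊟ B y w ∼ v
    solve< {zero} {suc y} lt lt′ v = 𝟘 ⊟ σ (-ᶻ + suc y) v , pointwise λ i →
      ≡⇒≈ (trans (lemma (fn (σ (+ suc y) (σ (-ᶻ + suc y) v)) i)) (σ-σ (+ suc y) v i))
      where lemma : ∀ a → + 0 -ᶻ (+ 0 -ᶻ a) ≡ a
            lemma = ℤS.solve-∀
    solve< {suc x} {suc y} lt lt′ v with ℕ-difference lt lt′
    ... | d , e , od = w , ∼-trans (pointwise same) inv-correct
      where
      v′ = v
      open Inverse-of-1-σ d od v′ using (inv; inv-correct)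
      w : Cyc
      w = σ (-ᶻ + suc x) inv
      same : ∀ i → fn (B (suc x) w ⊟ B (suc y) w) i ≈ fn (inv ⊟ σ (+ d) inv) i
      same i = ≈-- (≡⇒≈ (σ-σ (+ suc x) inv i))
        (≡⇒≈ (trans (cong (λ z → fn w (i -ᶻ + z)) e) (cong (fn inv) (lemma i (+ suc x) (+ d)))))
        where lemma : ∀ i x d → (i -ᶻ (x +ᶻ d)) -ᶻ (-ᶻ x) ≡ i -ᶻ d
              lemma = ℤS.solve-∀

    injective< : ∀ {x y} → x < y → y < u → ∀ w → B x w ⊟ B y w ∼ 𝟘 → w ∼ 𝟘
    injective< {zero} {suc y} lt lt′ w (shift-by c e) = shift-by (-ᶻ c) λ i →
      ≈-trans (≡⇒≈ (trans (cong (fn w) (lemma i (+ suc y))) (lemma′ (fn w ((i +ᶻ + suc y) -ᶻ + suc y)))))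
        (≈-trans (≈-neg (≈-trans (e (i +ᶻ + suc y)) (≡⇒≈ (ℤₚ.+-identityˡ c)))) (≡⇒≈ (sym (ℤₚ.+-identityˡ (-ᶻ c)))))
      where lemma : ∀ i z → i ≡ (i +ᶻ z) -ᶻ z
            lemma = ℤS.solve-∀
            lemma′ : ∀ a → a ≡ -ᶻ (+ 0 -ᶻ a)
            lemma′ = ℤS.solve-∀
    injective< {suc x} {suc y} lt lt′ w (shift-by c e) with ℕ-difference lt lt′
    ... | d , ey , od = shift-by (fn w (+ 0)) λ i →
      ≈-trans (1-σ-injective d od w c hyp i) (≡⇒≈ (sym (ℤₚ.+-identityˡ (fn w (+ 0)))))
      where
      hyp : ∀ i → fn w i -ᶻ fn w (i -ᶻ + d) ≈ c
      hyp i = ≈-trans (≈-- (≡⇒≈ (cong (fn w) (lemma i (+ suc x))))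
                           (≡⇒≈ (trans (cong (fn w) (lemma′ i (+ suc x) (+ d))) (cong (λ z → fn w ((i +ᶻ + suc x) -ᶻ + z)) (sym ey)))))
                (≈-trans (e (i +ᶻ + suc x)) (≡⇒≈ (ℤₚ.+-identityˡ c)))
        where lemma : ∀ i z → i ≡ (i +ᶻ z) -ᶻ z
              lemma = ℤS.solve-∀
              lemma′ : ∀ i z d → i -ᶻ d ≡ (i +ᶻ z) -ᶻ (z +ᶻ d)
              lemma′ = ℤS.solve-∀

    ⊟-swap : ∀ {a b c} → a ⊟ b ∼ c → b ⊟ a ∼ 𝟘 ⊟ c
    ⊟-swap {a} {b} {c} p = ∼-trans (pointwise λ i → ≡⇒≈ (lemma (fn a i) (fn b i))) (⊟-cong (∼-refl {𝟘}) p)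
      where lemma : ∀ a b → b -ᶻ a ≡ + 0 -ᶻ (a -ᶻ b)
            lemma = ℤS.solve-∀

    solveV : ∀ {x y : Fin u} → x ≢ y → ∀ v → Σ Cyc λ w → B (toℕ x) w ⊟ B (toℕ y) w ∼ v
    solveV {x} {y} n v with ℕₚ.<-cmp (toℕ x) (toℕ y)
    ... | tri< lt _ _ = solve< lt (Fₚ.toℕ<n y) v
    ... | tri≈ _ e _  = ⊥-elim (n (Fₚ.toℕ-injective e))
    ... | tri> _ _ gt with solve< gt (Fₚ.toℕ<n x) (𝟘 ⊟ v)
    ... | w , p = w , ∼-trans (⊟-swap {B (toℕ y) w} {B (toℕ x) w} p) (pointwise λ i → ≡⇒≈ (lemma (fn v i)))
      where lemma : ∀ a → + 0 -ᶻ (+ 0 -ᶻ a) ≡ a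
            lemma = ℤS.solve-∀

    injectiveV : ∀ {x y : Fin u} → x ≢ y → ∀ w → B (toℕ x) w ⊟ B (toℕ y) w ∼ 𝟘 → w ∼ 𝟘
    injectiveV {x} {y} n w p with ℕₚ.<-cmp (toℕ x) (toℕ y)
    ... | tri< lt _ _ = injective< lt (Fₚ.toℕ<n y) w p
    ... | tri≈ _ e _  = ⊥-elim (n (Fₚ.toℕ-injective e))
    ... | tri> _ _ gt = injective< gt (Fₚ.toℕ<n x) w
      (∼-trans (⊟-swap {B (toℕ x) w} {B (toℕ y) w} p) (pointwise λ _ → ≈-refl))

    LineV : Set
    LineV = Cyc × Cyc
    atV : LineV → Fin u → Cyc
    atV (a , w) x = a ⊞ B (toℕ x) w

    abstract
      throughV : ∀ {x y : Fin u} → x ≢ y → ∀ a b → Σ LineV λ t → atV t x ∼ a × atV t y ∼ b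
      throughV {x} {y} n a b with solveV n (a ⊟ b)
      ... | w , p = (a ⊟ B (toℕ x) w , w) , pointwise (λ i → ≡⇒≈ (lemma (fn a i) (fn (B (toℕ x) w) i)))
          , ∼-trans (pointwise λ i → ≡⇒≈ (lemma′ (fn a i) (fn (B (toℕ x) w) i) (fn (B (toℕ y) w) i)))
              (∼-trans (⊟-cong (∼-refl {a}) p) (pointwise λ i → ≡⇒≈ (lemma″ (fn a i) (fn b i))))
        where lemma : ∀ a z → (a -ᶻ z) +ᶻ z ≡ a
              lemma = ℤS.solve-∀
              lemma′ : ∀ a p q → (a -ᶻ p) +ᶻ q ≡ a -ᶻ (p -ᶻ q)
              lemma′ = ℤS.solve-∀
              lemma″ : ∀ a b → a -ᶻ (a -ᶻ b) ≡ b
              lemma″ = ℤS.solve-∀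

      uniqueV : ∀ {x y : Fin u} → x ≢ y → ∀ {s t} → atV s x ∼ atV t x → atV s y ∼ atV t y → proj₁ s ∼ proj₁ t × proj₂ s ∼ proj₂ t
      uniqueV {x} {y} n {a , w} {b , v} p q = a∼b , w∼v
        where
        Bx By : Cyc → Cyc
        Bx = B (toℕ x)
        By = B (toℕ y)
        diff : w ⊟ v ∼ 𝟘
        diff = injectiveV n (w ⊟ v) (∼-trans
          (pointwise λ i → ≡⇒≈ (trans (cong₂ _-ᶻ_ (B-⊟ (toℕ x) w v i) (B-⊟ (toℕ y) w v i))
            (lemma (fn a i) (fn b i) (fn (Bx w) i) (fn (Bx v) i) (fn (By w) i) (fn (By v) i))))
          (∼-trans (⊟-cong (⊟-cong p (∼-refl {atV (b , v) x})) (⊟-cong q (∼-refl {atV (b , v) y})))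
            (pointwise λ i → ≡⇒≈ (lemma₀ (fn (atV (b , v) x) i) (fn (atV (b , v) y) i)))))
          where lemma : ∀ a b xw xv yw yv → (xw -ᶻ xv) -ᶻ (yw -ᶻ yv) ≡ ((a +ᶻ xw) -ᶻ (b +ᶻ xv)) -ᶻ ((a +ᶻ yw) -ᶻ (b +ᶻ yv))
                lemma = ℤS.solve-∀
                lemma₀ : ∀ a b → (a -ᶻ a) -ᶻ (b -ᶻ b) ≡ + 0
                lemma₀ = ℤS.solve-∀
        w∼v : w ∼ v
        w∼v = ∼-trans (pointwise λ i → ≡⇒≈ (lemma (fn w i) (fn v i)))
          (∼-trans (⊞-cong diff (∼-refl {v})) (pointwise λ i → ≡⇒≈ (ℤₚ.+-identityˡ (fn v i))))
          where lemma : ∀ a b → a ≡ (a -ᶻ b) +ᶻ b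
                lemma = ℤS.solve-∀
        a∼b : a ∼ b
        a∼b = ∼-trans (pointwise λ i → ≡⇒≈ (lemma (fn a i) (fn (Bx w) i)))
          (∼-trans (⊟-cong p (B-cong (toℕ x) w∼v)) (pointwise λ i → ≡⇒≈ (sym (lemma (fn b i) (fn (Bx v) i)))))
          where lemma : ∀ a b → a ≡ (a +ᶻ b) -ᶻ b
                lemma = ℤS.solve-∀

    labelV : Cyc → ℤ
    labelV v = fn v (+ 0) -ᶻ fn v (-[1+ 0 ])

    labelV-cong : ∀ {a b} → a ∼ b → labelV a ≈ labelV b
    labelV-cong {a} {b} (shift-by c e) = ≈-trans (≈-- (e (+ 0)) (e (-[1+ 0 ])))
      (≡⇒≈ (lemma (fn b (+ 0)) (fn b (-[1+ 0 ])) c))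
      where lemma : ∀ a b c → (a +ᶻ c) -ᶻ (b +ᶻ c) ≡ a -ᶻ b
            lemma = ℤS.solve-∀

    labV : ∀ {x y : Fin u} → x ≢ y → Cyc → Cyc → ℤ
    labV n a b = labelV (proj₂ (proj₁ (throughV n a b)))

    labV-line : ∀ {x y : Fin u} (n : x ≢ y) t {a b} → atV t x ∼ a → atV t y ∼ b → labV n a b ≈ labelV (proj₂ t)
    labV-line n t {a} {b} p q = labelV-cong (proj₂ (uniqueV n {proj₁ T} {t}
        (∼-trans (proj₁ (proj₂ T)) (∼-sym p)) (∼-trans (proj₂ (proj₂ T)) (∼-sym q))))
      where T = throughV n a b

    labV-⊟ : ∀ {x y : Fin u} (n : x ≢ y) a b s s′ → labV n (a ⊟ s) (b ⊟ s′) ≈ labV n a b -ᶻ labV n s s′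
    labV-⊟ {x} {y} n a b s s′ =
      ≈-trans (labV-line n (proj₁ T ⊟ proj₁ S , proj₂ T ⊟ proj₂ S)
                 (∼-trans (at-⊟ x) (⊟-cong (proj₁ (proj₂ (throughV n a b))) (proj₁ (proj₂ (throughV n s s′)))))
                 (∼-trans (at-⊟ y) (⊟-cong (proj₂ (proj₂ (throughV n a b))) (proj₂ (proj₂ (throughV n s s′))))))
              (≡⇒≈ (lemma (fn (proj₂ T) (+ 0)) (fn (proj₂ T) (-[1+ 0 ])) (fn (proj₂ S) (+ 0)) (fn (proj₂ S) (-[1+ 0 ]))))
      where
      T = proj₁ (throughV n a b)
      S = proj₁ (throughV n s s′)
      at-⊟ : ∀ x → atV (proj₁ T ⊟ proj₁ S , proj₂ T ⊟ proj₂ S) x ∼ atV T x ⊟ atV S x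
      at-⊟ x = pointwise λ i → ≡⇒≈ (trans (cong (λ z → (fn (proj₁ T) i -ᶻ fn (proj₁ S) i) +ᶻ z) (B-⊟ (toℕ x) (proj₂ T) (proj₂ S) i))
        (l (fn (proj₁ T) i) (fn (proj₁ S) i) (fn (B (toℕ x) (proj₂ T)) i) (fn (B (toℕ x) (proj₂ S)) i)))
        where l : ∀ a b c d → (a -ᶻ b) +ᶻ (c -ᶻ d) ≡ (a +ᶻ c) -ᶻ (b +ᶻ d)
              l = ℤS.solve-∀
      lemma : ∀ a b c d → (a -ᶻ c) -ᶻ (b -ᶻ d) ≡ (a -ᶻ b) -ᶻ (c -ᶻ d)
      lemma = ℤS.solve-∀

    order′ : ℕ
    order′ = Λ ^ r′

    -- Constants are divided out by subtracting the value at 0, so a point is the list of its other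
    -- r - 1 values; hence the order Λ^(r - 1).
    enc : Cyc → Fin order′
    enc a = F.funToFin {r′} {Λ} λ j → res (fn a (+ suc (toℕ j)) -ᶻ fn a (+ 0))

    unfold : Fin order′ → Fin r → ℤ
    unfold i zero    = + 0
    unfold i (suc j) = val (F.finToFun {Λ} {r′} i j)

    dec : Fin order′ → Cyc
    dec i = cyc (λ k → unfold i (res k)) λ k → ≡⇒≈ (cong (unfold i) (res-cong {b = k} (mod (+ 1) (cong (k +ᶻ_) (sym (ℤₚ.*-identityˡ (+ r)))))))

    enc-cong : ∀ {a b} → a ∼ b → enc a ≡ enc b
    enc-cong {a} {b} (shift-by c e) = funToFin-cong {r′} λ j → res-cong
      (≈-trans (≈-- (e (+ suc (toℕ j))) (e (+ 0))) (≡⇒≈ (lemma (fn b (+ suc (toℕ j))) (fn b (+ 0)) c)))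
      where
      lemma : ∀ a b c → (a +ᶻ c) -ᶻ (b +ᶻ c) ≡ a -ᶻ b
      lemma = ℤS.solve-∀

    per-multiple : ∀ (a : Cyc) {i j} → i ≈[ r ] j → fn a i ≈ fn a j
    per-multiple a {i} {j} (mod (+ q) e) = ≈-trans (≡⇒≈ (cong (fn a) (trans e (cong (j +ᶻ_) (ℤₚ.*-comm (+ q) (+ r))))))
      (multiple (fn a) (+ r) (per a) q j)
    per-multiple a {i} {j} (mod -[1+ q ] e) = ≈-sym (≈-trans (≡⇒≈ (cong (fn a)
        (trans (lemma j (+ suc q) (+ r)) (cong (_+ᶻ + r *ᶻ + suc q) (sym e)))))
      (multiple (fn a) (+ r) (per a) (suc q) i))
      where lemma : ∀ j q r → j ≡ (j +ᶻ (-ᶻ q) *ᶻ r) +ᶻ r *ᶻ q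
            lemma = ℤS.solve-∀

    dec-enc : ∀ a → dec (enc a) ∼ a
    dec-enc a = shift-by (-ᶻ fn a (+ 0)) λ k → ≈-trans (go (res k)) (≈-+ (per-multiple a (val-res k)) ≈-refl)
      where
      go : ∀ m → unfold (enc a) m ≈ fn a (val m) -ᶻ fn a (+ 0)
      go zero    = ≡⇒≈ (sym (ℤₚ.+-inverseʳ (fn a (+ 0))))
      go (suc j) = ≈-trans (≡⇒≈ (cong val (Fₚ.finToFun-funToFin {r′} {Λ} _ j))) (val-res (fn a (+ suc (toℕ j)) -ᶻ fn a (+ 0)))

    enc-dec : ∀ i → enc (dec i) ≡ i
    enc-dec i = trans (funToFin-cong {r′} go) (Fₚ.funToFin-finToFin {r′} {Λ} i)
      where
      go : ∀ j → res {Λ} (unfold i (res (+ suc (toℕ j))) -ᶻ unfold i (res (+ 0))) ≡ F.finToFun {Λ} {r′} i j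
      go j = trans (cong₂ (λ a b → res {Λ} (unfold i a -ᶻ unfold i b)) (res-val (suc j)) (res-val {r} zero))
        (res-≡ (≡⇒≈ (ℤₚ.+-identityʳ (val (F.finToFun {Λ} {r′} i j)))))

    dec-injective : ∀ {i j} → dec i ∼ dec j → i ≡ j
    dec-injective {i} {j} p = trans (sym (enc-dec i)) (trans (enc-cong p) (enc-dec j))

    delta : Fin r → ℤ → ℤ
    delta zero    c = c
    delta (suc _) c = + 0

    τV : ℤ → Cyc
    τV c = cyc (λ k → delta (res k) c) λ k → ≡⇒≈ (cong (λ m → delta m c) (res-cong {r} {b = k} (mod (+ 1) (cong (k +ᶻ_) (sym (ℤₚ.*-identityˡ (+ r)))))))

    τV-zero : ∀ c k m → k ≡ + suc m → suc m < r → fn (τV c) k ≡ + 0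
    τV-zero c k m refl lt with res-val {r} (suc (fromℕ< (ℕₚ.≤-pred lt)))
    ... | e = cong (λ z → delta z c) (trans (cong (λ z → res {r} (+ suc z)) (sym (Fₚ.toℕ-fromℕ< (ℕₚ.≤-pred lt)))) e)

    lineτ : ∀ {x y : Fin u} c y′ → toℕ x ≡ 0 → toℕ y ≡ suc y′ →
            let t = (τV c , 𝟘 ⊟ σ (-ᶻ + suc y′) (τV c)) in atV t x ∼ τV c × atV t y ∼ 𝟘
    lineτ {x} {y} c y′ ex ey =
        subst (λ m → (τV c ⊞ B m w) ∼ τV c) (sym ex) (pointwise (λ i → ≡⇒≈ (ℤₚ.+-identityʳ (fn (τV c) i))))
      , subst (λ m → (τV c ⊞ B m w) ∼ 𝟘) (sym ey)
          (pointwise (λ i → ≡⇒≈ (trans (cong (λ z → fn (τV c) i +ᶻ (+ 0 -ᶻ z)) (σ-σ (+ suc y′) (τV c) i)) (lemma (fn (τV c) i)))))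
      where
      w : Cyc
      w = 𝟘 ⊟ σ (-ᶻ + suc y′) (τV c)
      lemma : ∀ a → a +ᶻ (+ 0 -ᶻ a) ≡ + 0
      lemma = ℤS.solve-∀

    -- The direction of the line is - `τV c` moved by y places, so its label compares the values of
    -- `τV c` at y and at y - 1, and the first vanishes because 0 < y < r. Thus the label is `c` for
    -- y = 1 and 0 for all later slots.
    labV-τ : ∀ {x y : Fin u} (n : x ≢ y) c y′ → toℕ x ≡ 0 → toℕ y ≡ suc y′ → labV n (τV c) 𝟘 ≈ fn (τV c) (+ y′) 
    labV-τ {x} {y} n c y′ ex ey = ≈-trans (labV-line n (τV c , 𝟘 ⊟ σ (-ᶻ + suc y′) (τV c)) (proj₁ L) (proj₂ L))
      (≡⇒≈ (trans (cong₂ (λ p q → (+ 0 -ᶻ p) -ᶻ (+ 0 -ᶻ q)) zero₀ (cong (fn (τV c)) (lemma (+ y′)))) (lemma′ (fn (τV c) (+ y′)))))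
      where
      L = lineτ {x} {y} c y′ ex ey
      lemma : ∀ z → -[1+ 0 ] -ᶻ (-ᶻ (+ 1 +ᶻ z)) ≡ z
      lemma = ℤS.solve-∀
      lemma′ : ∀ z → (+ 0 -ᶻ + 0) -ᶻ (+ 0 -ᶻ z) ≡ z
      lemma′ = ℤS.solve-∀
      zero₀ : fn (τV c) (+ 0 -ᶻ (-ᶻ + suc y′)) ≡ + 0
      zero₀ = τV-zero c _ y′ refl (ℕₚ.<-≤-trans (subst (_< u) ey (Fₚ.toℕ<n y)) u≤r)

  cyclicTD : LabelledTD u Λ
  cyclicTD = record
    { order = order′
    ; td = record
      { Line = Fin order′ × Fin order′ ; at = at′
      ; through = λ {x} {y} n a b → let (t , p , q) = throughV n (dec a) (dec b) in
          (enc (proj₁ t) , enc (proj₂ t)) , at-enc t {x} a p , at-enc t {y} b q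
      ; unique = λ n {s} {t} p q → let (e , f) = uniqueV n {dec (proj₁ s) , dec (proj₂ s)} {dec (proj₁ t) , dec (proj₂ t)} (enc-inj p) (enc-inj q)
                                   in cong₂ _,_ (dec-injective e) (dec-injective f) }
    ; 0# = enc 𝟘
    ; _⊕_ = λ a b → enc (dec a ⊞ dec b)
    ; _⊖_ = _⊖′_
    ; ⊖⊕ = λ a s → trans (enc-cong {dec (a ⊖′ s) ⊞ dec s} {dec a} (∼-trans (⊞-cong (dec-enc (dec a ⊟ dec s)) (∼-refl {dec s}))
              (pointwise λ i → ≡⇒≈ (lemma₁ (fn (dec a) i) (fn (dec s) i))))) (enc-dec a)
    ; ⊕⊖ = λ a s → trans (enc-cong {dec (enc (dec a ⊞ dec s)) ⊟ dec s} {dec a} (∼-trans (⊟-cong (dec-enc (dec a ⊞ dec s)) (∼-refl {dec s}))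
              (pointwise λ i → ≡⇒≈ (lemma₂ (fn (dec a) i) (fn (dec s) i))))) (enc-dec a)
    ; label = λ t → labelV (dec (proj₂ t))
    ; lab = lab′
    ; lab-line = λ {x} {y} n t → ≈-trans (lab′-≈ n _ _) (labV-line n (dec (proj₁ t) , dec (proj₂ t))
                   (∼-sym (dec-enc (atV (dec (proj₁ t) , dec (proj₂ t)) x))) (∼-sym (dec-enc (atV (dec (proj₁ t) , dec (proj₂ t)) y))))
    ; lab-⊖ = λ n a b s s′ → ≈-trans (lab′-≈ n _ _) (≈-trans (labV-cong n (dec-enc (dec a ⊟ dec s)) (dec-enc (dec b ⊟ dec s′)))
                (≈-trans (labV-⊟ n (dec a) (dec b) (dec s) (dec s′)) (≈-sym (≈-- (lab′-≈ n a b) (lab′-≈ n s s′)))))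
    ; lab-sym = λ {x} {y} n a b → let n′ = λ e → n (sym e) in
        ≈-trans (lab′-≈ n a b) (≈-trans (≈-sym (labV-line n′ (proj₁ (throughV n (dec a) (dec b)))
          (proj₂ (proj₂ (throughV n (dec a) (dec b)))) (proj₁ (proj₂ (throughV n (dec a) (dec b)))))) (≈-sym (lab′-≈ n′ b a)))
    ; lab-0 = λ {x} {y} n → ≈-trans (lab′-≈ n _ _) (≈-trans (labV-cong n (dec-enc 𝟘) (dec-enc 𝟘))
                (labV-line n (𝟘 , 𝟘) {𝟘} {𝟘} (pointwise λ i → ≡⇒≈ (at-𝟘 (toℕ x) i)) (pointwise λ i → ≡⇒≈ (at-𝟘 (toℕ y) i))))
    ; τ = λ c → enc (τV c)
    ; lab-τ₁ = λ {x} {y} c ex ey → let n = distinct ex (trans ey refl) in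
        ≈-trans (lab-τ n c) (labV-τ n c 0 ex ey)
    ; lab-τ₀ = λ {x} {y} c ex lt → small {x} {y} c ex (toℕ y) refl lt
    }
    where
    at′ : Fin order′ × Fin order′ → Fin u → Fin order′
    at′ (a , b) x = enc (atV (dec a , dec b) x)
    at-enc : ∀ t {x} c → atV t x ∼ dec c → at′ (enc (proj₁ t) , enc (proj₂ t)) x ≡ c
    at-enc t {x} c p = trans (enc-cong (∼-trans (⊞-cong (dec-enc (proj₁ t)) (B-cong (toℕ x) (dec-enc (proj₂ t)))) p)) (enc-dec c)
    enc-inj : ∀ {a b} → enc a ≡ enc b → a ∼ b
    enc-inj {a} {b} e = ∼-trans (∼-sym (dec-enc a)) (subst (λ z → dec (enc a) ∼ dec z) e ∼-refl ⟨∼⟩ dec-enc b)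
      where infixr 5 _⟨∼⟩_
            _⟨∼⟩_ : ∀ {a b c} → a ∼ b → b ∼ c → a ∼ c
            _⟨∼⟩_ = ∼-trans
    at-𝟘 : ∀ x i → fn (𝟘 ⊞ B x 𝟘) i ≡ + 0
    at-𝟘 zero    i = refl
    at-𝟘 (suc x) i = refl
    _⊖′_ : Fin order′ → Fin order′ → Fin order′
    a ⊖′ b = enc (dec a ⊟ dec b)
    lemma₁ : ∀ a s → (a -ᶻ s) +ᶻ s ≡ a
    lemma₁ = ℤS.solve-∀
    lemma₂ : ∀ a s → (a +ᶻ s) -ᶻ s ≡ a
    lemma₂ = ℤS.solve-∀
    lab′ : Fin u → Fin u → Fin order′ → Fin order′ → ℤ
    lab′ x y a b with x F.≟ y
    ... | yes _ = + 0
    ... | no n  = labV n (dec a) (dec b)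
    labV-cong : ∀ {x y : Fin u} (n : x ≢ y) {a b c d} → a ∼ b → c ∼ d → labV n a c ≈ labV n b d
    labV-cong n {a} {b} {c} {d} p q = labV-line n (proj₁ T) (∼-trans (proj₁ (proj₂ T)) (∼-sym p)) (∼-trans (proj₂ (proj₂ T)) (∼-sym q))
      where T = throughV n b d
    lab′-≈ : ∀ {x y : Fin u} (n : x ≢ y) a b → lab′ x y a b ≈ labV n (dec a) (dec b)
    lab′-≈ {x} {y} n a b with x F.≟ y
    ... | yes e = ⊥-elim (n e)
    ... | no n′ = labV-line n′ (proj₁ (throughV n (dec a) (dec b))) (proj₁ (proj₂ (throughV n (dec a) (dec b)))) (proj₂ (proj₂ (throughV n (dec a) (dec b))))
    distinct : ∀ {x y : Fin u} {m} → toℕ x ≡ 0 → toℕ y ≡ suc m → x ≢ y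
    distinct ex ey refl with trans (sym ex) ey
    ... | ()
    lab-τ : ∀ {x y : Fin u} (n : x ≢ y) c → lab′ x y (enc (τV c)) (enc 𝟘) ≈ labV n (τV c) 𝟘
    lab-τ n c = ≈-trans (lab′-≈ n _ _) (labV-cong n (dec-enc (τV c)) (dec-enc 𝟘))
    small : ∀ {x y : Fin u} c → toℕ x ≡ 0 → ∀ m → toℕ y ≡ m → 1 < m → lab′ x y (enc (τV c)) (enc 𝟘) ≈ + 0
    small {x} {y} c ex (suc (suc m)) ey lt = let n = distinct {x} {y} ex ey in
      ≈-trans (lab-τ n c) (≈-trans (labV-τ n c (suc m) ex ey)
        (≡⇒≈ (τV-zero c (+ suc m) m refl (ℕₚ.<-≤-trans (ℕₚ.<-trans (ℕₚ.n<1+n (suc m)) (subst (_< u) ey (Fₚ.toℕ<n y))) u≤r))))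
    small c ex (suc zero) ey (s≤s ())

labelledTD : ∀ u Λ → 0 < u → 0 < Λ → Σ (LabelledTD u Λ) λ T → Σ ℕ λ e → LabelledTD.order T ≡ Λ ^ suc e
-- The period is r = 1 + Λ u!, which is 1 modulo Λ and modulo every d < u and is at least u.
labelledTD u Λ 0<u 0<Λ = go (Λ * (u !)) refl (ℕₚ.*-mono-≤ 0<Λ (ℕₚ.1≤n! u))
  where
  instance nz : NonZero Λ
           nz = >-nonZero 0<Λ
  ∣fact : ∀ {d n} → 0 < d → d ≤ n → d ∣ n !
  ∣fact {suc d} {n} _ le = Div.∣-trans (Div.m∣m*n (d !)) (Div.m≤n⇒m!∣n! le)
  go : ∀ r → r ≡ Λ * (u !) → 1 ≤ r → Σ (LabelledTD u Λ) λ T → Σ ℕ λ e → LabelledTD.order T ≡ Λ ^ suc e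
  go (suc e) eq _ = Cyclic.cyclicTD Λ (suc e) u (u ! , cong suc eq) one u≤r , e , refl
    where
    one : ∀ d → 0 < d → d < u → OneModulo d (suc (suc e))
    one d p q with Div.∣-trans (∣fact p (ℕₚ.<⇒≤ q)) (Div.n∣m*n Λ)
    ... | divides c h = c , cong suc (trans eq (trans h (ℕₚ.*-comm c d)))
    u≤r : u ≤ suc (suc e)
    u≤r = ℕₚ.≤-trans (Div.∣⇒≤ {{>-nonZero (ℕₚ.<-≤-trans (s≤s z≤n) (ℕₚ.≤-refl {suc e}))}} (subst (u ∣_) (sym eq) (Div.∣-trans (∣fact 0<u ℕₚ.≤-refl) (Div.n∣m*n Λ)))) (ℕₚ.n≤1+n _)

-- From labelled covers to group divisible designs with a group of automorphisms

record FinGroup (n : ℕ) : Set where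
  infixl 7 _∙_
  field
    _∙_   : Fin n → Fin n → Fin n
    ε     : Fin n
    _⁻¹   : Fin n → Fin n
    assoc : ∀ a b c → (a ∙ b) ∙ c ≡ a ∙ (b ∙ c)
    idˡ   : ∀ a → ε ∙ a ≡ a
    idʳ   : ∀ a → a ∙ ε ≡ a
    invˡ  : ∀ a → (a ⁻¹) ∙ a ≡ ε
    invʳ  : ∀ a → a ∙ (a ⁻¹) ≡ ε

  cancelˡ : ∀ {a b c} → a ∙ b ≡ a ∙ c → b ≡ c
  cancelˡ {a} {b} {c} e = trans (sym (undo b)) (trans (cong ((a ⁻¹) ∙_) e) (undo c))
    where undo : ∀ b → (a ⁻¹) ∙ (a ∙ b) ≡ b
          undo b = trans (sym (assoc _ _ _)) (trans (cong (_∙ b) (invˡ a)) (idˡ b))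

  cancelʳ : ∀ {a b c} → b ∙ a ≡ c ∙ a → b ≡ c
  cancelʳ {a} {b} {c} e = trans (sym (undo b)) (trans (cong (_∙ (a ⁻¹)) e) (undo c))
    where undo : ∀ b → (b ∙ a) ∙ (a ⁻¹) ≡ b
          undo b = trans (assoc _ _ _) (trans (cong (b ∙_) (invʳ a)) (idʳ b))

  inv-unique : ∀ {a b} → a ∙ b ≡ ε → b ≡ a ⁻¹
  inv-unique {a} e = cancelˡ (trans e (sym (invʳ a)))

  inv-inv : ∀ a → (a ⁻¹) ⁻¹ ≡ a
  inv-inv a = sym (inv-unique (invˡ a))

  inv-∙ : ∀ a b → (a ∙ b) ⁻¹ ≡ (b ⁻¹) ∙ (a ⁻¹)
  inv-∙ a b = sym (inv-unique (trans (assoc a b _) (trans (cong (a ∙_) (trans (sym (assoc b _ _))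
    (trans (cong (_∙ (a ⁻¹)) (invʳ b)) (idˡ _)))) (invʳ a))))

NoInvolution : ∀ {n} → FinGroup n → Set
NoInvolution G = ∀ d → d ≡ d ⁻¹ → d ≡ ε
  where open FinGroup G

-- A block has one label for each of its pairs. Over a fixed pair the labels number the blocks
-- through it bijectively by `Fin l`, which tells the l covers of that pair apart.
record LabelledCover (k l : ℕ) (X : Set) : Set₁ where
  field
    Index : Set
    block : Index → Fin k → X
    block-injective : ∀ i {p q} → block i p ≡ block i q → p ≡ q
    label : Index → X → X → Fin l
    label-sym : ∀ i x y → label i x y ≡ label i y x
    find  : ∀ {x y} → x ≢ y → ∀ c → Σ Index λ i → Σ (Fin k) λ p → Σ (Fin k) λ q →
            block i p ≡ x × block i q ≡ y × label i x y ≡ c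
    uniq  : ∀ {x y} → x ≢ y → ∀ {i j p q p′ q′} → block i p ≡ x → block i q ≡ y → block j p′ ≡ x → block j q′ ≡ y →
            label i x y ≡ label j x y → i ≡ j

-- A group divisible design whose groups form c regular orbits of a group on Fin n.
record SymmetricGDD (k : ℕ) {n} (G : FinGroup n) (c N : ℕ) : Set₁ where
  open FinGroup G
  field
    act     : Fin n → Fin N → Fin N
    act-ε   : ∀ a → act ε a ≡ a
    act-∙   : ∀ g h a → act (g ∙ h) a ≡ act g (act h a)
    decomp  : Decomp k ((Fin n × Fin c) × Fin N) (λ x y → proj₁ x ≢ proj₁ y)
  open Decomp decomp
  field
    move    : ∀ g i → Σ Index λ j → ∀ p → block j p ≡ ((g ∙ proj₁ (proj₁ (block i p)) , proj₂ (proj₁ (block i p))) , act g (proj₂ (block i p)))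

sumℤ-≈ : ∀ {Λ n} {f g : Fin n → ℤ} → (∀ i → f i ≈[ Λ ] g i) → Σℤ.sum f ≈[ Λ ] Σℤ.sum g
sumℤ-≈ {n = zero}  e = ≈-refl
sumℤ-≈ {n = suc n} e = ≈-+ (e zero) (sumℤ-≈ (λ i → e (suc i)))

sumℤ-- : ∀ {n} (f g : Fin n → ℤ) → Σℤ.sum (λ i → f i -ᶻ g i) ≡ Σℤ.sum f -ᶻ Σℤ.sum g
sumℤ-- {zero}  f g = refl
sumℤ-- {suc n} f g = trans (cong ((f zero -ᶻ g zero) +ᶻ_) (sumℤ-- (λ i → f (suc i)) (λ i → g (suc i))))
                           (lemma (f zero) (g zero) _ _)
  where lemma : ∀ a b c d → (a -ᶻ b) +ᶻ (c -ᶻ d) ≡ (a +ᶻ c) -ᶻ (b +ᶻ d)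
        lemma = ℤS.solve-∀

sumℤ-single : ∀ {Λ n v} (f : Fin n → ℤ) j → (∀ i → i ≢ j → f i ≈[ Λ ] + 0) → f j ≈[ Λ ] v → Σℤ.sum f ≈[ Λ ] v
sumℤ-single {Λ} {suc n} {v} f zero z e = ≈-trans (≈-+ e (zeros (λ i → f (suc i)) (λ i → z (suc i) λ ()))) (≈-reflexive (ℤₚ.+-identityʳ v))
  where zeros : ∀ {m} (g : Fin m → ℤ) → (∀ i → g i ≈[ Λ ] + 0) → Σℤ.sum g ≈[ Λ ] + 0
        zeros {zero}  g e = ≈-refl
        zeros {suc m} g e = ≈-trans (≈-+ (e zero) (zeros (λ i → g (suc i)) (λ i → e (suc i)))) (≈-reflexive refl)
sumℤ-single {Λ} {suc n} {v} f (suc j) z e = ≈-trans (≈-+ (z zero λ ()) (sumℤ-single (λ i → f (suc i)) j (λ i m → z (suc i) λ e → m (Fₚ.suc-injective e)) e))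
  (≈-reflexive (ℤₚ.+-identityˡ v))

swap : ∀ {n} → Fin n → Fin n → Fin n → Fin n
swap i j k with k F.≟ i
... | yes _ = j
... | no _ with k F.≟ j
... | yes _ = i
... | no _  = k

swap-left : ∀ {n} (i j : Fin n) → swap i j i ≡ j
swap-left i j with i F.≟ i
... | yes _ = refl
... | no n  = ⊥-elim (n refl)

swap-other : ∀ {n} {i j k : Fin n} → k ≢ i → k ≢ j → swap i j k ≡ k
swap-other {_} {i} {j} {k} a b with k F.≟ i
... | yes e = ⊥-elim (a e)
... | no _ with k F.≟ j
... | yes e = ⊥-elim (b e)
... | no _  = refl

swap-involutive : ∀ {n} (i j k : Fin n) → swap i j (swap i j k) ≡ k
swap-involutive i j k with k F.≟ i
swap-involutive i j k | yes e with j F.≟ i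
... | yes e′ = trans e′ (sym e)
... | no _ with j F.≟ j
... | yes _ = sym e
... | no n  = ⊥-elim (n refl)
swap-involutive i j k | no n with k F.≟ j
... | yes e = trans (swap-left i j) (sym e)
... | no m  = swap-other n m

swap-injective : ∀ {n} (i j : Fin n) {k l} → swap i j k ≡ swap i j l → k ≡ l
swap-injective i j {k} {l} e = trans (sym (swap-involutive i j k)) (trans (cong (swap i j) e) (swap-involutive i j l))

pick : {A : Set} → ℕ → ℕ → A → A → A
pick a b x y = if ⌊ b <? a ⌋ then y else x

pick-map : {A B : Set} (f : A → B) (a b : ℕ) (x y : A) → f (pick a b x y) ≡ pick a b (f x) (f y)
pick-map f a b x y with ⌊ b <? a ⌋
... | true  = refl
... | false = refl

pick-sym : {A : Set} {a b : ℕ} (x y : A) → a ≢ b → pick a b x y ≡ pick b a y x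
pick-sym {_} {a} {b} x y n with b <? a | a <? b
... | yes p | yes q = ⊥-elim (ℕₚ.<-asym p q)
... | yes p | no _  = refl
... | no _  | yes q = refl
... | no p  | no q  = ⊥-elim (n (ℕₚ.≤-antisym (ℕₚ.≮⇒≥ p) (ℕₚ.≮⇒≥ q)))

-- A point of the lift over x has one coordinate for each triple (g, x₁, x₂); in that coordinate the
-- translates of x₁ and x₂ by g occupy slots 0 and 1 of `L`. `G` permutes the triples, so the sum
-- `Ψ` of the labels of two points over all coordinates is invariant. Base blocks are shifted so
-- that `Ψ` equals `want`, which encodes an element of `G` and a label of the cover. For two points
-- over different x and y, `Ψ` thus reveals first the translating element, then the block of the
-- cover; the lines are then determined coordinate by coordinate.
module _ {n c k l : ℕ} (G : FinGroup n) (noInvolution : NoInvolution G)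
         (2≤u : 2 ≤ n * c) (C : LabelledCover k l (Fin n × Fin c)) (0<l : 0 < l) (L : LabelledTD (n * c) (n * l)) where
  open FinGroup G
  private
    X = Fin n × Fin c
    u = n * c
    Λ = n * l
    module C = LabelledCover C
    module L = LabelledTD L

    infixr 6 _·_
    _·_ : Fin n → X → X
    g · (h , y) = g ∙ h , y
    ·-∙ : ∀ g h x → (g ∙ h) · x ≡ g · h · x
    ·-∙ g h (a , y) = cong (_, y) (assoc g h a)
    ·-ε : ∀ x → ε · x ≡ x
    ·-ε (a , y) = cong (_, y) (idˡ a)
    ε⁻¹-· : ∀ x → (ε ⁻¹) · x ≡ x
    ε⁻¹-· x = trans (cong (_· x) (sym (inv-unique (idˡ ε)))) (·-ε x)
    ·-inv : ∀ g x → g · (g ⁻¹) · x ≡ x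
    ·-inv g x = trans (sym (·-∙ g (g ⁻¹) x)) (trans (cong (_· x) (invʳ g)) (·-ε x))
    ·-inv′ : ∀ g x → (g ⁻¹) · g · x ≡ x
    ·-inv′ g x = trans (sym (·-∙ (g ⁻¹) g x)) (trans (cong (_· x) (invˡ g)) (·-ε x))
    ·-injective : ∀ g {x y} → g · x ≡ g · y → x ≡ y
    ·-injective g {x} {y} e = trans (sym (·-inv′ g x)) (trans (cong ((g ⁻¹) ·_) e) (·-inv′ g y))

    -- An equivariant choice of one group element from each unordered pair of points.
    κ₀ : Fin n → Fin n → Fin n
    κ₀ g h = pick (toℕ ((g ⁻¹) ∙ h)) (toℕ ((h ⁻¹) ∙ g)) g h
    κ : X → X → Fin n
    κ (g , y) (h , y′) with y F.≟ y′
    ... | yes _ = κ₀ g h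
    ... | no _  = pick (toℕ y) (toℕ y′) g h

    quotient-shift : ∀ a g h → ((a ∙ g) ⁻¹) ∙ (a ∙ h) ≡ (g ⁻¹) ∙ h
    quotient-shift a g h = trans (cong (_∙ (a ∙ h)) (inv-∙ a g)) (trans (assoc _ _ _)
      (cong ((g ⁻¹) ∙_) (trans (sym (assoc _ _ _)) (trans (cong (_∙ h) (invˡ a)) (idˡ h)))))

    κ₀-equivariant : ∀ a g h → κ₀ (a ∙ g) (a ∙ h) ≡ a ∙ κ₀ g h
    κ₀-equivariant a g h = trans (cong₂ (λ d d′ → pick (toℕ d) (toℕ d′) (a ∙ g) (a ∙ h)) (quotient-shift a g h) (quotient-shift a h g))
      (sym (pick-map (a ∙_) (toℕ ((g ⁻¹) ∙ h)) (toℕ ((h ⁻¹) ∙ g)) g h))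
    κ-equivariant : ∀ a x y → κ (a · x) (a · y) ≡ a ∙ κ x y
    κ-equivariant a (g , y) (h , y′) with y F.≟ y′
    ... | yes _ = κ₀-equivariant a g h
    ... | no _  = sym (pick-map (a ∙_) (toℕ y) (toℕ y′) g h)

    quotient-inv : ∀ g h → (h ⁻¹) ∙ g ≡ ((g ⁻¹) ∙ h) ⁻¹
    quotient-inv g h = sym (trans (inv-∙ (g ⁻¹) h) (cong ((h ⁻¹) ∙_) (inv-inv g)))

    -- If the two keys compared in `κ₀` coincide, then g⁻¹ h is its own inverse. The absence of
    -- involutions gives g = h, so the choice between `g` and `h` does not depend on their order.
    equal-quotient : ∀ g h → (g ⁻¹) ∙ h ≡ (h ⁻¹) ∙ g → g ≡ h
    equal-quotient g h e = sym (cancelˡ {g ⁻¹} (trans (noInvolution _ (trans e (quotient-inv g h))) (sym (invˡ g))))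

    κ₀-sym : ∀ g h → κ₀ g h ≡ κ₀ h g
    κ₀-sym g h with g F.≟ h
    ... | yes refl = refl
    ... | no n = pick-sym g h λ e → n (equal-quotient g h (Fₚ.toℕ-injective e))
    κ-sym : ∀ x y → κ x y ≡ κ y x
    κ-sym (g , y) (h , y′) with y F.≟ y′ | y′ F.≟ y
    ... | yes _ | yes _ = κ₀-sym g h
    ... | yes e | no n  = ⊥-elim (n (sym e))
    ... | no n  | yes e = ⊥-elim (n (sym e))
    ... | no n  | no _  = pick-sym g h λ e → n (Fₚ.toℕ-injective e)

    code : X → Fin u
    code (g , y) = combine g y
    code-injective : ∀ {x y} → code x ≡ code y → x ≡ y
    code-injective {g , y} {h , z} e = let (a , b) = Fₚ.combine-injective g y h z e in cong₂ _,_ a b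

    o₀ o₁ : Fin u
    o₀ = fromℕ< (ℕₚ.≤-trans (s≤s z≤n) 2≤u)
    o₁ = fromℕ< 2≤u
    o₀≡0 : toℕ o₀ ≡ 0
    o₀≡0 = Fₚ.toℕ-fromℕ< _
    o₁≡1 : toℕ o₁ ≡ 1
    o₁≡1 = Fₚ.toℕ-fromℕ< 2≤u
    o₀≢o₁ : o₀ ≢ o₁
    o₀≢o₁ e with trans (sym o₀≡0) (trans (cong toℕ e) o₁≡1)
    ... | ()

    -- The inner transposition brings `x₁` to slot 0; the outer one brings `x₂` to slot 1 and, for
    -- `x₁` different from `x₂`, leaves slot 0 alone.
    π : X → X → X → Fin u
    π x₁ x₂ x = swap (swap (code x₁) o₀ (code x₂)) o₁ (swap (code x₁) o₀ (code x))
    π-injective : ∀ x₁ x₂ {x y} → π x₁ x₂ x ≡ π x₁ x₂ y → x ≡ y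
    π-injective x₁ x₂ e = code-injective (swap-injective _ _ (swap-injective _ _ e))
    π-second : ∀ x₁ x₂ → π x₁ x₂ x₂ ≡ o₁
    π-second x₁ x₂ = swap-left (swap (code x₁) o₀ (code x₂)) o₁
    π-first : ∀ {x₁ x₂} → x₁ ≢ x₂ → π x₁ x₂ x₁ ≡ o₀
    π-first {x₁} {x₂} n = trans (cong (swap _ o₁) (swap-left (code x₁) o₀))
      (swap-other (λ e → n (code-injective (swap-injective (code x₁) o₀ (trans (swap-left (code x₁) o₀) e)))) o₀≢o₁)

    jn = n * (u * u)
    Coord = Fin n × (X × X)
    unpair : Fin u × Fin u → X × X
    unpair (a , b) = remQuot c a , remQuot c b
    unpack : Fin n × Fin (u * u) → Coord
    unpack (g , q) = g , unpair (remQuot {u} u q)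
    abstract
      dj : Fin jn → Coord
      dj j = unpack (remQuot {n} (u * u) j)
      cj : Coord → Fin jn
      cj (g , x , y) = combine g (combine (code x) (code y))
      dj-cj : ∀ z → dj (cj z) ≡ z
      dj-cj (g , x , y) = trans (cong unpack (Fₚ.remQuot-combine {n} {u * u} g (combine (code x) (code y))))
        (cong (g ,_) (trans (cong unpair (Fₚ.remQuot-combine {u} {u} (code x) (code y)))
          (cong₂ _,_ (Fₚ.remQuot-combine {n} {c} (proj₁ x) (proj₂ x)) (Fₚ.remQuot-combine {n} {c} (proj₁ y) (proj₂ y)))))
      cj-dj : ∀ j → cj (dj j) ≡ j
      cj-dj j = trans (cong (combine (proj₁ (remQuot {n} (u * u) j))) (trans (cong₂ combine (Fₚ.combine-remQuot {n} c (proj₁ q)) (Fₚ.combine-remQuot {n} c (proj₂ q))) (Fₚ.combine-remQuot {u} u q′)))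
                (Fₚ.combine-remQuot {n} (u * u) j)
        where
              q′ : Fin (u * u)
              q′ = proj₂ (remQuot {n} (u * u) j)
              q : Fin u × Fin u
              q = remQuot {u} u q′

    slotOf : Coord → X → Fin u
    slotOf (g , x₁ , x₂) x = π x₁ x₂ ((g ⁻¹) · x)
    slot : Fin jn → X → Fin u
    slot j x = slotOf (dj j) x
    slot-injective : ∀ j {x y} → slot j x ≡ slot j y → x ≡ y
    slot-injective j e = ·-injective _ (π-injective _ _ e)
    slot-≢ : ∀ j {x y} → x ≢ y → slot j x ≢ slot j y
    slot-≢ j n e = n (slot-injective j e)

    N = L.order ^ jn
    co : Fin N → Fin jn → Fin L.order
    co = F.finToFun {L.order} {jn}
    en : (Fin jn → Fin L.order) → Fin N
    en = F.funToFin {jn} {L.order}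
    co-en : ∀ f j → co (en f) j ≡ f j
    co-en f j = Fₚ.finToFun-funToFin {jn} {L.order} f j
    co-ext : ∀ {a b} → (∀ j → co a j ≡ co b j) → a ≡ b
    co-ext {a} {b} e = trans (sym (Fₚ.funToFin-finToFin {jn} {L.order} a)) (trans (funToFin-cong {jn} e) (Fₚ.funToFin-finToFin {jn} {L.order} b))

    mvCoord : Fin n → Coord → Coord
    mvCoord h (g , q) = (h ⁻¹) ∙ g , q
    mv : Fin n → Fin jn → Fin jn
    mv h j = cj (mvCoord h (dj j))
    mv-∙ : ∀ g h j → mv (g ∙ h) j ≡ mv h (mv g j)
    mv-∙ g h j = cong cj (trans (cong (_, proj₂ (dj j)) (trans (cong (_∙ proj₁ (dj j)) (inv-∙ g h)) (assoc _ _ _)))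
      (cong (mvCoord h) (sym (dj-cj (mvCoord g (dj j))))))
    mv-ε : ∀ j → mv ε j ≡ j
    mv-ε j = trans (cong (λ z → cj (z , proj₂ (dj j))) (trans (cong (_∙ proj₁ (dj j)) (sym (inv-unique (idˡ ε)))) (idˡ _))) (cj-dj j)
    mv-inv : ∀ h j → mv (h ⁻¹) (mv h j) ≡ j
    mv-inv h j = trans (sym (mv-∙ h (h ⁻¹) j)) (trans (cong (λ z → mv z j) (invʳ h)) (mv-ε j))
    mv-inv′ : ∀ h j → mv h (mv (h ⁻¹) j) ≡ j
    mv-inv′ h j = trans (sym (mv-∙ (h ⁻¹) h j)) (trans (cong (λ z → mv z j) (invˡ h)) (mv-ε j))
    slot-mv : ∀ h j x → slot j (h · x) ≡ slot (mv h j) x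
    slot-mv h j x = trans (cong (π _ _) (trans (sym (·-∙ _ h x)) (cong (_· x) (sym (trans (inv-∙ (h ⁻¹) g) (cong ((g ⁻¹) ∙_) (inv-inv h)))))))
      (cong (λ z → slotOf z x) (sym (dj-cj (mvCoord h (dj j)))))
      where g = proj₁ (dj j)

    act : Fin n → Fin N → Fin N
    act h a = en (λ j → co a (mv h j))
    co-act : ∀ h a j → co (act h a) j ≡ co a (mv h j)
    co-act h a j = co-en (λ j → co a (mv h j)) j
    act-ε : ∀ a → act ε a ≡ a
    act-ε a = co-ext λ j → trans (co-act ε a j) (cong (co a) (mv-ε j))
    act-∙ : ∀ g h a → act (g ∙ h) a ≡ act g (act h a)
    act-∙ g h a = co-ext λ j → trans (co-act (g ∙ h) a j) (trans (cong (co a) (mv-∙ g h j))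
      (sym (trans (co-act g (act h a) j) (co-act h a (mv g j)))))

    Ψ : X → X → (Fin jn → Fin L.order) → (Fin jn → Fin L.order) → ℤ
    Ψ x y a b = Σℤ.sum λ j → L.lab (slot j x) (slot j y) (a j) (b j)

    Ψ-cong : ∀ x y {a a′ b b′} → (∀ j → a j ≡ a′ j) → (∀ j → b j ≡ b′ j) → Ψ x y a b ≡ Ψ x y a′ b′
    Ψ-cong x y e f = Σℤ.sum-cong-≗ λ j → cong₂ (L.lab (slot j x) (slot j y)) (e j) (f j)

    -- Translating both points by `h` replaces coordinate j by `mv h j` in the slots and in the
    -- values alike, so the sum is merely reindexed.
    Ψ-invariant : ∀ h x y a b → Ψ (h · x) (h · y) (co (act h a)) (co (act h b)) ≡ Ψ x y (co a) (co b)
    Ψ-invariant h x y a b = trans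
      (Σℤ.sum-cong-≗ λ j → trans (cong₂ (λ s t → L.lab s t _ _) (slot-mv h j x) (slot-mv h j y))
        (cong₂ (L.lab _ _) (co-act h a j) (co-act h b j)))
      (sym (Σℤ.sum-permute (λ j → L.lab (slot j x) (slot j y) (co a j) (co b j))
        (permutation (mv h) (mv (h ⁻¹)) (mv-inv′ h) (mv-inv h))))

    instance
      Λ-nonZero : NonZero Λ
      Λ-nonZero = >-nonZero (ℕₚ.*-mono-≤ 0<n 0<l)
        where 0<n : 0 < n
              0<n = ℕₚ.≤-trans (s≤s z≤n) (Fₚ.toℕ<n ε)

    want : C.Index → X → X → Fin Λ
    want i x y = combine (κ x y) (C.label i x y)
    want-sym : ∀ i x y → want i x y ≡ want i y x
    want-sym i x y = cong₂ combine (κ-sym x y) (C.label-sym i x y)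

    _≟ₓ_ : (x y : X) → Dec (x ≡ y)
    (g , y) ≟ₓ (h , z) with g F.≟ h | y F.≟ z
    ... | yes refl | yes refl = yes refl
    ... | no n     | _        = no λ e → n (cong proj₁ e)
    ... | _        | no n     = no λ e → n (cong proj₂ e)

    -- Shifts occur only in coordinates with g = ε and x₁ before x₂, and there only for the point
    -- over x₁: each unordered pair is adjusted in exactly one coordinate.
    Active : X → Fin n × (X × X) → Set
    Active x (g , x₁ , x₂) = (g ≡ ε × x ≡ x₁) × toℕ (code x₁) < toℕ (code x₂)
    active? : ∀ x z → Dec (Active x z)
    active? x (g , x₁ , x₂) = ((g F.≟ ε) ×-dec (x ≟ₓ x₁)) ×-dec (toℕ (code x₁) <? toℕ (code x₂))
    sh′ : C.Index → X → Fin n × (X × X) → Fin L.order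
    sh′ i x z with active? x z
    ... | yes _ = L.τ (val (want i (proj₁ (proj₂ z)) (proj₂ (proj₂ z))))
    ... | no _  = L.0#
    sh : C.Index → X → Fin jn → Fin L.order
    sh i x j = sh′ i x (dj j)
    sh′-active : ∀ i x z → Active x z → sh′ i x z ≡ L.τ (val (want i (proj₁ (proj₂ z)) (proj₂ (proj₂ z))))
    sh′-active i x z a with active? x z
    ... | yes _ = refl
    ... | no n  = ⊥-elim (n a)
    sh′-inactive : ∀ i x z → ¬ Active x z → sh′ i x z ≡ L.0#
    sh′-inactive i x z a with active? x z
    ... | yes e = ⊥-elim (a e)
    ... | no _  = refl
    sh-active : ∀ i x j → Active x (dj j) → sh i x j ≡ L.τ (val (want i (proj₁ (proj₂ (dj j))) (proj₂ (proj₂ (dj j)))))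
    sh-active i x j = sh′-active i x (dj j)
    sh-inactive : ∀ i x j → ¬ Active x (dj j) → sh i x j ≡ L.0#
    sh-inactive i x j = sh′-inactive i x (dj j)

    slot-first : ∀ {x} j → Active x (dj j) → toℕ (slot j x) ≡ 0
    slot-first {x} j ((g≡ε , x≡x₁) , lt) = trans (cong toℕ (trans (cong (π _ _) back) (π-first x₁≢x₂))) o₀≡0
      where
      x₁≢x₂ : proj₁ (proj₂ (dj j)) ≢ proj₂ (proj₂ (dj j))
      x₁≢x₂ e = ℕₚ.<-irrefl (cong (λ z → toℕ (code z)) e) lt
      back : (proj₁ (dj j) ⁻¹) · x ≡ proj₁ (proj₂ (dj j))
      back = trans (cong₂ (λ g x → (g ⁻¹) · x) g≡ε x≡x₁) (ε⁻¹-· (proj₁ (proj₂ (dj j))))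
    slot-second : ∀ j → proj₁ (dj j) ≡ ε → toℕ (slot j (proj₂ (proj₂ (dj j)))) ≡ 1
    slot-second j g≡ε = trans (cong toℕ (trans (cong (π _ _)
      (trans (cong (λ g → (g ⁻¹) · proj₂ (proj₂ (dj j))) g≡ε) (ε⁻¹-· (proj₂ (proj₂ (dj j)))))) (π-second _ _))) o₁≡1

    other-slot : ∀ {x y} j → Active x (dj j) → x ≢ y → y ≢ proj₂ (proj₂ (dj j)) → 1 < toℕ (slot j y)
    other-slot {x} {y} j a n m with toℕ (slot j y) in eq
    ... | zero = ⊥-elim (n (slot-injective j (Fₚ.toℕ-injective (trans (slot-first j a) (sym eq)))))
    ... | suc zero = ⊥-elim (m (slot-injective j (Fₚ.toℕ-injective (trans eq (sym (slot-second j (proj₁ (proj₁ a))))))))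
    ... | suc (suc _) = s≤s (s≤s z≤n)

    term : C.Index → X → X → Fin jn → ℤ
    term i x y j = L.lab (slot j x) (slot j y) (sh i x j) (sh i y j)

    not-both : ∀ {x y z} → x ≢ y → Active x z → ¬ Active y z
    not-both n ((_ , e) , _) ((_ , f) , _) = n (trans e (sym f))

    term-sym : ∀ i {x y} → x ≢ y → ∀ j → term i x y j ≈[ Λ ] term i y x j
    term-sym i n j = L.lab-sym (slot-≢ j n) _ _

    term-zero : ∀ i {x y} → x ≢ y → ∀ j → (dj j ≡ (ε , x , y) → toℕ (code x) < toℕ (code y) → ⊥) →
                (dj j ≡ (ε , y , x) → toℕ (code y) < toℕ (code x) → ⊥) → term i x y j ≈[ Λ ] + 0
    term-zero i {x} {y} n j h h′ = go (active? x (dj j)) (active? y (dj j))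
      where
      go : Dec (Active x (dj j)) → Dec (Active y (dj j)) → term i x y j ≈[ Λ ] + 0
      go (yes a) _ = ≈-trans (≈-reflexive (cong₂ (L.lab (slot j x) (slot j y)) (sh-active i x j a) (sh-inactive i y j (not-both n a))))
          (L.lab-τ₀ _ (slot-first j a) (other-slot j a n λ e → h (cong₂ _,_ (proj₁ (proj₁ a)) (cong₂ _,_ (sym (proj₂ (proj₁ a))) (sym e)))
            (subst (λ z → toℕ (code z) < toℕ (code y)) (sym (proj₂ (proj₁ a))) (subst (λ z → _ < toℕ (code z)) (sym e) (proj₂ a)))))
      go (no na) (yes b) = ≈-trans (term-sym i n j)
          (≈-trans (≈-reflexive (cong₂ (L.lab (slot j y) (slot j x)) (sh-active i y j b) (sh-inactive i x j na)))
          (L.lab-τ₀ _ (slot-first j b) (other-slot j b (λ e → n (sym e)) λ e → h′ (cong₂ _,_ (proj₁ (proj₁ b)) (cong₂ _,_ (sym (proj₂ (proj₁ b))) (sym e)))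
            (subst (λ z → toℕ (code z) < toℕ (code x)) (sym (proj₂ (proj₁ b))) (subst (λ z → _ < toℕ (code z)) (sym e) (proj₂ b))))))
      go (no na) (no nb) = ≈-trans (≈-reflexive (cong₂ (L.lab (slot j x) (slot j y)) (sh-inactive i x j na) (sh-inactive i y j nb)))
          (L.lab-0 (slot-≢ j n))

    term-main : ∀ i {x y} → x ≢ y → toℕ (code x) < toℕ (code y) → term i x y (cj (ε , x , y)) ≈[ Λ ] val (want i x y)
    term-main i {x} {y} n lt = ≈-trans (≈-reflexive (cong₂ (L.lab (slot j x) (slot j y))
        (trans (sh-active i x j a) (cong (λ z → L.τ (val (want i (proj₁ (proj₂ z)) (proj₂ (proj₂ z))))) e)) (sh-inactive i y j (not-both n a))))
      (L.lab-τ₁ _ (slot-first j a) (subst (λ z → toℕ (slot j z) ≡ 1) (cong (λ z → proj₂ (proj₂ z)) e) (slot-second j (cong proj₁ e))))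
      where
      j = cj (ε , x , y)
      e : dj j ≡ (ε , x , y)
      e = dj-cj (ε , x , y)
      a : Active x (dj j)
      a = subst (Active x) (sym e) ((refl , refl) , lt)

    -- By `lab-τ₁` and `lab-τ₀` a shift at slot 0 influences only the pair formed with slot 1. So
    -- among all coordinates only (ε, x, y) contributes, or (ε, y, x) if y comes first.
    Ψ-shift : ∀ i {x y} → x ≢ y → Ψ x y (sh i x) (sh i y) ≈[ Λ ] val (want i x y)
    Ψ-shift i {x} {y} n with ℕₚ.<-cmp (toℕ (code x)) (toℕ (code y))
    ... | tri< lt _ ngt = sumℤ-single (term i x y) (cj (ε , x , y))
            (λ j m → term-zero i n j (λ e _ → m (trans (sym (cj-dj j)) (cong cj e))) (λ _ gt → ngt gt)) (term-main i n lt)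
    ... | tri≈ _ e _ = ⊥-elim (n (code-injective (Fₚ.toℕ-injective e)))
    ... | tri> nlt _ gt = ≈-trans (sumℤ-≈ (term-sym i n)) (≈-trans
            (sumℤ-single (term i y x) (cj (ε , y , x))
              (λ j m → term-zero i (λ e → n (sym e)) j (λ e _ → m (trans (sym (cj-dj j)) (cong cj e))) (λ _ lt → nlt lt)) (term-main i (λ e → n (sym e)) gt))
            (≈-reflexive (cong val (want-sym i y x))))

    Lines = Vec L.Line jn
    total : Lines → ℤ
    total t = Σℤ.sum λ j → L.label (lookup t j)
    -- The lines in the several coordinates are free except that their labels sum to 0; this makes
    -- `Ψ` of two points of a base block equal to `want`.
    Base = Σ (C.Index × Lines) λ { (i , t) → res {Λ} (total t) ≡ res (+ 0) }

    raw : C.Index → Lines → X → Fin jn → Fin L.order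
    raw i t x j = L.at (lookup t j) (slot j x) L.⊕ sh i x j

    Ψ-base : ∀ i t {x y} → x ≢ y → Ψ x y (raw i t x) (raw i t y) ≈[ Λ ] total t +ᶻ val (want i x y)
    Ψ-base i t {x} {y} n = ≈-undiff′ (≈-trans (≈-reflexive (sym (sumℤ-- (λ j → L.lab (slot j x) (slot j y) (raw i t x j) (raw i t y j)) (term i x y))))
      (sumℤ-≈ λ j → ≈-trans (≈-sym (L.lab-⊖ (slot-≢ j n) (raw i t x j) (raw i t y j) (sh i x j) (sh i y j)))
        (≈-trans (≈-reflexive (cong₂ (L.lab (slot j x) (slot j y)) (L.⊕⊖ _ _) (L.⊕⊖ _ _))) (L.lab-line (slot-≢ j n) (lookup t j)))))
      where
      ≈-undiff′ : Ψ x y (raw i t x) (raw i t y) -ᶻ Ψ x y (sh i x) (sh i y) ≈[ Λ ] total t →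
                  Ψ x y (raw i t x) (raw i t y) ≈[ Λ ] total t +ᶻ val (want i x y)
      ≈-undiff′ p = ≈-trans (≈-reflexive (lemma (Ψ x y (raw i t x) (raw i t y)) (Ψ x y (sh i x) (sh i y)))) (≈-+ p (Ψ-shift i n))
        where lemma : ∀ a b → a ≡ (a -ᶻ b) +ᶻ b
              lemma = ℤS.solve-∀

    Point = X × Fin N
    _•_ : Fin n → Point → Point
    g • (x , a) = g · x , act g a
    basePoint : Base → Fin k → Point
    basePoint ((i , t) , _) p = C.block i p , en (raw i t (C.block i p))
    block : Fin n × Base → Fin k → Point
    block (g , β) p = g • basePoint β p

    Ψ-block : ∀ g i t z p q → p ≢ q → let β = ((i , t) , z) in
      Ψ (proj₁ (block (g , β) p)) (proj₁ (block (g , β) q)) (co (proj₂ (block (g , β) p))) (co (proj₂ (block (g , β) q)))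
        ≈[ Λ ] val (want i (C.block i p) (C.block i q))
    Ψ-block g i t z p q n = ≈-trans (≈-reflexive (trans (Ψ-invariant g _ _ _ _) (Ψ-cong _ _ (co-en _) (co-en _))))
      (≈-trans (Ψ-base i t λ e → n (C.block-injective i e)) (≈-trans (≈-+ (res-injective {a = total t} {+ 0} z) (≈-refl {_} {w})) (≈-reflexive (ℤₚ.+-identityˡ w))))

      where w = val (want i (C.block i p) (C.block i q))

    find′ : ∀ {x y : Point} → proj₁ x ≢ proj₁ y → Joins block x y
    find′ {x , a} {y , b} ne = (g , (i , t) , zero-total) , p , q , p≢q
        , cong₂ _,_ (trans (cong (g ·_) bp) (·-inv g x)) (trans (cong (act g) (pt bp a₀ left)) (act-inv a))
        , cong₂ _,_ (trans (cong (g ·_) bq) (·-inv g y)) (trans (cong (act g) (pt bq b₀ right)) (act-inv b))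
      where
      l′ : Fin Λ
      l′ = res (Ψ x y (co a) (co b))
      γ = proj₁ (remQuot {n} l l′)
      ρ = proj₂ (remQuot {n} l l′)
      -- Equivariance turns κ (g⁻¹ x) (g⁻¹ y) into g⁻¹ (κ x y), and this `g` makes the latter equal
      -- to γ.
      g = κ x y ∙ (γ ⁻¹)
      x₀ = (g ⁻¹) · x
      y₀ = (g ⁻¹) · y
      a₀ = act (g ⁻¹) a
      b₀ = act (g ⁻¹) b
      n₀ : x₀ ≢ y₀
      n₀ e = ne (·-injective (g ⁻¹) e)
      found = C.find n₀ ρ
      i = proj₁ found
      p = proj₁ (proj₂ found)
      q = proj₁ (proj₂ (proj₂ found))
      bp = proj₁ (proj₂ (proj₂ (proj₂ found)))
      bq = proj₁ (proj₂ (proj₂ (proj₂ (proj₂ found))))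
      lb = proj₂ (proj₂ (proj₂ (proj₂ (proj₂ found))))
      p≢q : p ≢ q
      p≢q e = n₀ (trans (sym bp) (trans (cong (C.block i) e) bq))
      κ₀≡γ : κ x₀ y₀ ≡ γ
      κ₀≡γ = trans (κ-equivariant (g ⁻¹) x y) (trans (cong (_∙ κ x y) (trans (inv-∙ (κ x y) (γ ⁻¹)) (cong (_∙ (κ x y ⁻¹)) (inv-inv γ))))
               (trans (assoc γ _ _) (trans (cong (γ ∙_) (invˡ (κ x y))) (idʳ γ))))
      want≡ : want i x₀ y₀ ≡ l′
      want≡ = trans (cong₂ combine κ₀≡γ lb) (Fₚ.combine-remQuot {n} l l′)
      lines : ∀ j → Σ L.Line λ t → L.at t (slot j x₀) ≡ co a₀ j L.⊖ sh i x₀ j × L.at t (slot j y₀) ≡ co b₀ j L.⊖ sh i y₀ j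
      lines j = L.through (slot-≢ j n₀) _ _
      t : Lines
      t = tabulate λ j → proj₁ (lines j)
      lookup-t : ∀ j → lookup t j ≡ proj₁ (lines j)
      lookup-t j = Vₚ.lookup∘tabulate _ j
      left : ∀ j → raw i t x₀ j ≡ co a₀ j
      left j = trans (cong (λ z → L.at z (slot j x₀) L.⊕ sh i x₀ j) (lookup-t j))
                 (trans (cong (L._⊕ sh i x₀ j) (proj₁ (proj₂ (lines j)))) (L.⊖⊕ _ _))
      right : ∀ j → raw i t y₀ j ≡ co b₀ j
      right j = trans (cong (λ z → L.at z (slot j y₀) L.⊕ sh i y₀ j) (lookup-t j))
                 (trans (cong (L._⊕ sh i y₀ j) (proj₂ (proj₂ (lines j)))) (L.⊖⊕ _ _))
      pt : ∀ {p z} → C.block i p ≡ z → ∀ c → (∀ j → raw i t z j ≡ co c j) → en (raw i t (C.block i p)) ≡ c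
      pt refl c h = co-ext λ j → trans (co-en _ j) (h j)
      act-inv : ∀ c → act g (act (g ⁻¹) c) ≡ c
      act-inv c = trans (sym (act-∙ g (g ⁻¹) c)) (trans (cong (λ z → act z c) (invʳ g)) (act-ε c))
      Ψ₀ : Ψ x₀ y₀ (co a₀) (co b₀) ≈[ Λ ] val (want i x₀ y₀)
      Ψ₀ = ≈-trans (≈-reflexive (Ψ-invariant (g ⁻¹) x y a b)) (≈-trans (≈-sym (val-res {Λ} _)) (≈-reflexive (cong val (sym want≡))))
      zero-total : res {Λ} (total t) ≡ res (+ 0)
      zero-total = res-cong (≈-trans (≈-reflexive (lemma (total t) (val (want i x₀ y₀))))
        (≈-trans (≈-- (≈-sym (Ψ-base i t n₀)) (≈-refl {_} {val (want i x₀ y₀)}))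
          (≈-trans (≈-- (≈-trans (≈-reflexive (Ψ-cong x₀ y₀ left right)) Ψ₀) (≈-refl {_} {val (want i x₀ y₀)}))
            (≈-reflexive (ℤₚ.+-inverseʳ (val (want i x₀ y₀)))))))
        where lemma : ∀ a b → a ≡ (a +ᶻ b) -ᶻ b
              lemma = ℤS.solve-∀

    vec-ext : ∀ {A : Set} {m} {s t : Vec A m} → (∀ j → lookup s j ≡ lookup t j) → s ≡ t
    vec-ext {s = s} {t} e = trans (sym (Vₚ.tabulate∘lookup s)) (trans (Vₚ.tabulate-cong e) (Vₚ.tabulate∘lookup t))

    ⊕-cancel : ∀ {a b s} → a L.⊕ s ≡ b L.⊕ s → a ≡ b
    ⊕-cancel {a} {b} {s} e = trans (sym (L.⊕⊖ a s)) (trans (cong (L._⊖ s) e) (L.⊕⊖ b s))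

    same : ∀ {g i t z i′ t′ z′ p q p′ q′} → p ≢ q → i ≡ i′ →
           block (g , (i , t) , z) p ≡ block (g , (i′ , t′) , z′) p′ → block (g , (i , t) , z) q ≡ block (g , (i′ , t′) , z′) q′ →
           (g , (i , t) , z) ≡ (g , (i′ , t′) , z′)
    same {g} {i} {t} {z} {.i} {t′} {z′} {p} {q} {p′} {q′} n refl e f
      with C.block-injective i (·-injective g (,-injectiveˡ e)) | C.block-injective i (·-injective g (,-injectiveˡ f))
    ... | refl | refl with vec-ext {s = t} {t′} (λ j → L.unique (slot-≢ j λ e → n (C.block-injective i e))
                             (⊕-cancel (at-eq (,-injectiveʳ e) j)) (⊕-cancel (at-eq (,-injectiveʳ f) j)))
      where
      at-eq : ∀ {x} → act g (en (raw i t x)) ≡ act g (en (raw i t′ x)) → ∀ j → raw i t x j ≡ raw i t′ x j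
      at-eq {x} e j = trans (sym (co-en _ j)) (trans (cong (λ a → co a j) (act-injective e)) (co-en _ j))
        where
        act-injective : ∀ {a b} → act g a ≡ act g b → a ≡ b
        act-injective {a} {b} e = trans (sym (undo a)) (trans (cong (act (g ⁻¹)) e) (undo b))
          where undo : ∀ a → act (g ⁻¹) (act g a) ≡ a
                undo a = trans (sym (act-∙ (g ⁻¹) g a)) (trans (cong (λ z → act z a) (invˡ g)) (act-ε a))
    ... | refl = cong (λ z → g , (i , t) , z) (UIP.Decidable⇒UIP.≡-irrelevant F._≟_ z z′)

    uniq′ : ∀ {i j p q p′ q′} → p ≢ q → p′ ≢ q′ → block i p ≡ block j p′ → block i q ≡ block j q′ → i ≡ j
    uniq′ {g , (i , t) , z} {g′ , (i′ , t′) , z′} {p} {q} {p′} {q′} n n′ e f = finish g≡g′ e f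
      where
      x = proj₁ (block (g , (i , t) , z) p)
      y = proj₁ (block (g , (i , t) , z) q)
      want≡ : want i (C.block i p) (C.block i q) ≡ want i′ (C.block i′ p′) (C.block i′ q′)
      want≡ = val-injective (≈-trans (≈-sym (Ψ-block g i t z p q n))
        (≈-trans (≈-reflexive (cong₂ (λ u v → Ψ (proj₁ u) (proj₁ v) (co (proj₂ u)) (co (proj₂ v))) e f)) (Ψ-block g′ i′ t′ z′ p′ q′ n′)))
      parts = Fₚ.combine-injective _ _ _ _ want≡
      unmove : ∀ g x y → κ x y ≡ (g ⁻¹) ∙ κ (g · x) (g · y)
      unmove g x y = sym (trans (cong ((g ⁻¹) ∙_) (κ-equivariant g x y))
        (trans (sym (assoc (g ⁻¹) g (κ x y))) (trans (cong (_∙ κ x y) (invˡ g)) (idˡ (κ x y)))))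
      -- Both blocks contain the same points over x and y. The first component of `want` is g⁻¹ (κ x
      -- y) for the one block and g′⁻¹ (κ x y) for the other.
      g≡g′ : g ≡ g′
      g≡g′ = trans (sym (inv-inv g)) (trans (cong _⁻¹ (cancelʳ {κ x y} (trans (sym (unmove g (C.block i p) (C.block i q))) (trans (proj₁ parts)
        (trans (unmove g′ (C.block i′ p′) (C.block i′ q′)) (cong ((g′ ⁻¹) ∙_) (sym (cong₂ κ (cong proj₁ e) (cong proj₁ f))))))))) (inv-inv g′))
      finish : g ≡ g′ → block (g , (i , t) , z) p ≡ block (g′ , (i′ , t′) , z′) p′ → block (g , (i , t) , z) q ≡ block (g′ , (i′ , t′) , z′) q′ →
               (g , (i , t) , z) ≡ (g′ , (i′ , t′) , z′)
      finish refl e f = same n i≡i′ e f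
        where
        ep = ·-injective g (,-injectiveˡ e)
        eq = ·-injective g (,-injectiveˡ f)
        i≡i′ : i ≡ i′
        i≡i′ = C.uniq (λ e → n (C.block-injective i e)) refl refl (sym ep) (sym eq)
                 (trans (proj₂ parts) (cong₂ (C.label i′) (sym ep) (sym eq)))

  symmetricGDD : SymmetricGDD k G c (L.order ^ (n * ((n * c) * (n * c))))
  symmetricGDD = record
    { act = act ; act-ε = act-ε ; act-∙ = act-∙
    ; decomp = record
      { Index = Fin n × Base ; block = block ; irrefl = λ n → n refl
      ; isEdge = λ { (g , (i , t) , z) p≢q e → p≢q (C.block-injective i (·-injective g e)) }
      ; find = find′ ; uniq = λ {i} {j} → uniq′ {i} {j} }
    ; move = λ { h (g , β) → (h ∙ g , β) , λ p → cong₂ _,_ (·-∙ h g (proj₁ (basePoint β p))) (act-∙ h g (proj₂ (basePoint β p))) } }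

-- Lists of blocks covering every pair equally often

bit : Bool → ℕ
bit true  = 1
bit false = 0

total : {A : Set} → (A → ℕ) → List A → ℕ
total f []       = 0
total f (a ∷ as) = f a + total f as

total-++ : {A : Set} (f : A → ℕ) (as bs : List A) → total f (as ++ bs) ≡ total f as + total f bs
total-++ f []       bs = refl
total-++ f (a ∷ as) bs = trans (cong (λ z → f a + z) (total-++ f as bs)) (sym (ℕₚ.+-assoc (f a) _ _))

total-cong : {A : Set} {f g : A → ℕ} → (∀ a → f a ≡ g a) → ∀ as → total f as ≡ total g as
total-cong e []       = refl
total-cong e (a ∷ as) = cong₂ _+_ (e a) (total-cong e as)

total-map : {A B : Set} (f : B → ℕ) (g : A → B) (as : List A) → total f (List.map g as) ≡ total (f ∘ g) as
total-map f g []       = refl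
total-map f g (a ∷ as) = cong (λ z → f (g a) + z) (total-map f g as)

rank : {A : Set} (f : A → Bool) (as : List A) → Fin (length as) → ℕ
rank f (a ∷ as) zero    = 0
rank f (a ∷ as) (suc i) = bit (f a) + rank f as i

rank-cong : {A : Set} {f g : A → Bool} → (∀ a → f a ≡ g a) → ∀ as i → rank f as i ≡ rank g as i
rank-cong e (a ∷ as) zero    = refl
rank-cong e (a ∷ as) (suc i) = cong₂ _+_ (cong bit (e a)) (rank-cong e as i)

module _ {A : Set} (f : A → Bool) where

  rank<total : ∀ as i → f (List.lookup as i) ≡ true → rank f as i < total (bit ∘ f) as
  rank<total (a ∷ as) zero    e rewrite e = s≤s z≤n
  rank<total (a ∷ as) (suc i) e = ℕₚ.+-monoʳ-< (bit (f a)) (rank<total as i e)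

  rank-find : ∀ as c → c < total (bit ∘ f) as → Σ (Fin (length as)) λ i → f (List.lookup as i) ≡ true × rank f as i ≡ c
  rank-find (a ∷ as) c lt with f a in eq
  rank-find (a ∷ as) zero    lt | true = zero , eq , refl
  rank-find (a ∷ as) (suc c) (s≤s lt) | true with rank-find as c lt
  ... | i , e , r = suc i , e , trans (cong (λ b → bit b + rank f as i) eq) (cong suc r)
  rank-find (a ∷ as) c lt | false with rank-find as c lt
  ... | i , e , r = suc i , e , trans (cong (λ b → bit b + rank f as i) eq) r

  rank-injective : ∀ as i j → f (List.lookup as i) ≡ true → f (List.lookup as j) ≡ true → rank f as i ≡ rank f as j → i ≡ j
  rank-injective (a ∷ as) zero    zero    e₁ e₂ e = refl
  rank-injective (a ∷ as) zero    (suc j) e₁ e₂ e rewrite e₁ with e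
  ... | ()
  rank-injective (a ∷ as) (suc i) zero    e₁ e₂ e rewrite e₂ with e
  ... | ()
  rank-injective (a ∷ as) (suc i) (suc j) e₁ e₂ e = cong suc (rank-injective as i j e₁ e₂ (ℕₚ.+-cancelˡ-≡ (bit (f a)) _ _ e))

module _ {u k : ℕ} where

  Injective : Vec (Fin u) k → Set
  Injective v = ∀ p q → lookup v p ≡ lookup v q → p ≡ q

  injective? : ∀ v → Dec (Injective v)
  injective? v = Fₚ.all? λ p → Fₚ.all? λ q → (lookup v p F.≟ lookup v q) →-dec (p F.≟ q)
    where open import Relation.Nullary.Decidable using (_→-dec_)

  occurs? : (v : Vec (Fin u) k) (x : Fin u) → Dec (∃ λ p → lookup v p ≡ x)
  occurs? v x = Fₚ.any? λ p → lookup v p F.≟ x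

  covers : Vec (Fin u) k → Fin u → Fin u → Bool
  covers v x y = ⌊ occurs? v x ⌋ ∧ ⌊ occurs? v y ⌋

  covers⇒ : ∀ v x y → covers v x y ≡ true → (∃ λ p → lookup v p ≡ x) × (∃ λ p → lookup v p ≡ y)
  covers⇒ v x y e with occurs? v x | occurs? v y
  ... | yes a | yes b = a , b
  covers⇒ v x y () | yes a | no _
  covers⇒ v x y () | no _ | _

  ⇒covers : ∀ v {x y} → (∃ λ p → lookup v p ≡ x) → (∃ λ p → lookup v p ≡ y) → covers v x y ≡ true
  ⇒covers v {x} {y} a b with occurs? v x | occurs? v y
  ... | yes _ | yes _ = refl
  ... | yes _ | no n  = ⊥-elim (n b)
  ... | no n  | _     = ⊥-elim (n a)

Block : ℕ → ℕ → Set
Block u k = Σ (Vec (Fin u) k) Injective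

hits : ∀ {u k} → Fin u → Fin u → Block u k → ℕ
hits x y b = bit (covers (proj₁ b) x y)

multiplicity : ∀ {u k} → List (Block u k) → Fin u → Fin u → ℕ
multiplicity bs x y = total (hits x y) bs

-- A block is labelled by its rank in the list among the blocks through the pair. For a block that
-- covers the pair this rank is below `l`; reduction modulo `l` gives the other blocks some value.
listCover : ∀ {u k l} (bs : List (Block u k)) → 0 < l → (∀ {x y} → x ≢ y → multiplicity bs x y ≡ l) → LabelledCover k l (Fin u)
listCover {u} {k} {l} bs 0<l const = record
  { Index = Fin (length bs)
  ; block = λ i → lookup (vec i)
  ; block-injective = λ i → proj₂ (List.lookup bs i) _ _
  ; label = λ i x y → fromℕ< (DM.m%n<n (rk i x y) l)
  ; label-sym = λ i x y → cong (λ r → fromℕ< (DM.m%n<n r l)) (rank-cong (λ b → Boolₚ.∧-comm ⌊ occurs? (proj₁ b) x ⌋ ⌊ occurs? (proj₁ b) y ⌋) bs i)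
  ; find = find′
  ; uniq = λ { {x} {y} n {i} {j} {p} {q} {p′} {q′} e₁ e₂ e₃ e₄ e → rank-injective (cov x y) bs i j
      (⇒covers (vec i) (p , e₁) (q , e₂)) (⇒covers (vec j) (p′ , e₃) (q′ , e₄))
      (label-rank n i j (⇒covers (vec i) (p , e₁) (q , e₂)) (⇒covers (vec j) (p′ , e₃) (q′ , e₄)) e) } }
  where
  instance nz : NonZero l
           nz = >-nonZero 0<l
  vec : Fin (length bs) → Vec (Fin u) k
  vec i = proj₁ (List.lookup bs i)
  cov : Fin u → Fin u → Block u k → Bool
  cov x y b = covers (proj₁ b) x y
  rk : Fin (length bs) → Fin u → Fin u → ℕ
  rk i x y = rank (cov x y) bs i
  rk< : ∀ {x y} → x ≢ y → ∀ i → covers (vec i) x y ≡ true → rk i x y < l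
  rk< {x} {y} n i e = subst (rk i x y <_) (const n) (rank<total (cov x y) bs i e)
  label-rank : ∀ {x y} → x ≢ y → ∀ i j → covers (vec i) x y ≡ true → covers (vec j) x y ≡ true →
               fromℕ< (DM.m%n<n (rk i x y) l) ≡ fromℕ< (DM.m%n<n (rk j x y) l) → rk i x y ≡ rk j x y
  label-rank {x} {y} n i j a b e = trans (sym (DM.m<n⇒m%n≡m (rk< n i a))) (trans
    (trans (sym (Fₚ.toℕ-fromℕ< (DM.m%n<n (rk i x y) l))) (trans (cong toℕ e) (Fₚ.toℕ-fromℕ< (DM.m%n<n (rk j x y) l)))) (DM.m<n⇒m%n≡m (rk< n j b)))
  find′ : ∀ {x y} → x ≢ y → ∀ c → Σ (Fin (length bs)) λ i → Σ (Fin k) λ p → Σ (Fin k) λ q →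
          lookup (vec i) p ≡ x × lookup (vec i) q ≡ y × fromℕ< (DM.m%n<n (rk i x y) l) ≡ c
  find′ {x} {y} n c with rank-find (cov x y) bs (toℕ c) (subst (toℕ c <_) (sym (const n)) (Fₚ.toℕ<n c))
  ... | i , e , r with covers⇒ (vec i) x y e
  ... | (p , e₁) , (q , e₂) = i , p , q , e₁ , e₂ ,
    Fₚ.toℕ-injective (trans (Fₚ.toℕ-fromℕ< (DM.m%n<n (rk i x y) l)) (trans (DM.m<n⇒m%n≡m (rk< n i e)) r))

cover-iso : ∀ {k l} {A B : Set} → A ↔ B → LabelledCover k l A → LabelledCover k l B
cover-iso {k} {l} {A} {B} f C = record
  { Index = C.Index
  ; block = λ i p → to (C.block i p)
  ; block-injective = λ i e → C.block-injective i (inj e)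
  ; label = λ i x y → C.label i (from x) (from y)
  ; label-sym = λ i x y → C.label-sym i (from x) (from y)
  ; find = λ {x} {y} n c → let (i , p , q , e₁ , e₂ , e) = C.find {from x} {from y} (λ e → n (from-inj e)) c in
      i , p , q , trans (cong to e₁) (strictlyInverseˡ x) , trans (cong to e₂) (strictlyInverseˡ y) , e
  ; uniq = λ {x} {y} n e₁ e₂ e₃ e₄ e → C.uniq (λ e → n (from-inj e)) (back e₁) (back e₂) (back e₃) (back e₄) e }
  where
  module C = LabelledCover C
  open Inverse f
  inj : ∀ {x y} → to x ≡ to y → x ≡ y
  inj {x} {y} e = trans (sym (strictlyInverseʳ x)) (trans (cong from e) (strictlyInverseʳ y))
  from-inj : ∀ {x y} → from x ≡ from y → x ≡ y
  from-inj {x} {y} e = trans (sym (strictlyInverseˡ x)) (trans (cong to e) (strictlyInverseˡ y))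
  back : ∀ {a x} → to a ≡ x → a ≡ from x
  back {a} e = trans (sym (strictlyInverseʳ a)) (cong from e)

concatFin : {A : Set} (n : ℕ) → (Fin n → List A) → List A
concatFin zero    f = []
concatFin (suc n) f = f zero ++ concatFin n (f ∘ suc)

allVec : ∀ u k → List (Vec (Fin u) k)
allVec u zero    = [] ∷ []
allVec u (suc k) = concatFin u λ x → List.map (x ∷_) (allVec u k)

total-concatFin : {A : Set} (f : A → ℕ) (n : ℕ) (g : Fin n → List A) → total f (concatFin n g) ≡ Σℕ.sum λ i → total f (g i)
total-concatFin f zero    g = refl
total-concatFin f (suc n) g = trans (total-++ f (g zero) _) (cong (λ z → total f (g zero) + z) (total-concatFin f n (g ∘ suc)))

total-allVec : ∀ u k (f : Vec (Fin u) (suc k) → ℕ) → total f (allVec u (suc k)) ≡ Σℕ.sum λ x → total (λ v → f (x ∷ v)) (allVec u k)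
total-allVec u k f = trans (total-concatFin f u _) (Σℕ.sum-cong-≗ λ x → total-map f (x ∷_) (allVec u k))

allVec-permute : ∀ {u} (σ : Permutation′ u) k (f : Vec (Fin u) k → ℕ) →
                 total f (allVec u k) ≡ total (λ v → f (V.map (σ ⟨$⟩ʳ_) v)) (allVec u k)
allVec-permute σ zero    f = refl
allVec-permute {u} σ (suc k) f = trans (total-allVec u k f) (trans (Σℕ.sum-cong-≗ λ x → allVec-permute σ k (λ v → f (x ∷ v)))
  (trans (Σℕ.sum-permute (λ x → total (λ v → f (x ∷ V.map (σ ⟨$⟩ʳ_) v)) (allVec u k)) σ) (sym (total-allVec u k _))))

∈-concatFin : {A : Set} {a : A} (n : ℕ) (g : Fin n → List A) (i : Fin n) → ∀ xs ys → g i ≡ xs ++ a ∷ ys →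
              Σ (List A) λ xs′ → Σ (List A) λ ys′ → concatFin n g ≡ xs′ ++ a ∷ ys′
∈-concatFin {a = a} (suc n) g zero xs ys e = xs , ys ++ concatFin n (g ∘ suc) ,
  trans (cong (_++ concatFin n (g ∘ suc)) e) (Lₚ.++-assoc xs (a ∷ ys) _)
∈-concatFin {a = a} (suc n) g (suc i) xs ys e with ∈-concatFin n (g ∘ suc) i xs ys e
... | xs′ , ys′ , e′ = g zero ++ xs′ , ys′ , trans (cong (g zero ++_) e′) (sym (Lₚ.++-assoc (g zero) xs′ (a ∷ ys′)))

∈-allVec : ∀ u k (v : Vec (Fin u) k) → Σ (List (Vec (Fin u) k)) λ xs → Σ (List (Vec (Fin u) k)) λ ys → allVec u k ≡ xs ++ v ∷ ys
∈-allVec u zero [] = [] , [] , refl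
∈-allVec u (suc k) (x ∷ v) with ∈-allVec u k v
... | xs , ys , e = ∈-concatFin u _ x (List.map (x ∷_) xs) (List.map (x ∷_) ys)
  (trans (cong (List.map (x ∷_)) e) (Lₚ.map-++ (x ∷_) xs (v ∷ ys)))

module _ {u k : ℕ} where

  blocksOf : List (Vec (Fin u) k) → List (Block u k)
  blocksOf [] = []
  blocksOf (v ∷ vs) with injective? v
  ... | yes i = (v , i) ∷ blocksOf vs
  ... | no _  = blocksOf vs

  weight : Fin u → Fin u → Vec (Fin u) k → ℕ
  weight x y v = bit (⌊ injective? v ⌋ ∧ covers v x y)

  multiplicity-blocksOf : ∀ vs x y → multiplicity (blocksOf vs) x y ≡ total (weight x y) vs
  multiplicity-blocksOf [] x y = refl
  multiplicity-blocksOf (v ∷ vs) x y with injective? v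
  ... | yes i = cong (λ z → bit (covers v x y) + z) (multiplicity-blocksOf vs x y)
  ... | no _  = multiplicity-blocksOf vs x y

  ⌊⌋-⇔ : {P Q : Set} (p : Dec P) (q : Dec Q) → (P → Q) → (Q → P) → ⌊ p ⌋ ≡ ⌊ q ⌋
  ⌊⌋-⇔ (yes _) (yes _) f g = refl
  ⌊⌋-⇔ (yes p) (no n)  f g = ⊥-elim (n (f p))
  ⌊⌋-⇔ (no n)  (yes q) f g = ⊥-elim (n (g q))
  ⌊⌋-⇔ (no _)  (no _)  f g = refl

  weight-map : (σ : Permutation′ u) → ∀ x y v → weight (σ ⟨$⟩ʳ x) (σ ⟨$⟩ʳ y) (V.map (σ ⟨$⟩ʳ_) v) ≡ weight x y v
  weight-map σ x y v = cong bit (cong₂ _∧_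
    (⌊⌋-⇔ (injective? m) (injective? v)
      (λ i p q e → i p q (trans (lk p) (trans (cong (σ ⟨$⟩ʳ_) e) (sym (lk q)))))
      (λ i p q e → i p q (σ-inj (trans (sym (lk p)) (trans e (lk q))))))
    (cong₂ _∧_ (occ x) (occ y)))
    where
    m : Vec (Fin u) k
    m = V.map (σ ⟨$⟩ʳ_) v
    lk : ∀ p → lookup m p ≡ σ ⟨$⟩ʳ lookup v p
    lk p = Vₚ.lookup-map p (σ ⟨$⟩ʳ_) v
    σ-inj : ∀ {a b} → σ ⟨$⟩ʳ a ≡ σ ⟨$⟩ʳ b → a ≡ b
    σ-inj e = trans (sym (Perm.inverseˡ σ)) (trans (cong (σ ⟨$⟩ˡ_) e) (Perm.inverseˡ σ))
    occ : ∀ x → ⌊ occurs? m (σ ⟨$⟩ʳ x) ⌋ ≡ ⌊ occurs? v x ⌋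
    occ x = ⌊⌋-⇔ (occurs? m (σ ⟨$⟩ʳ x)) (occurs? v x)
      (λ { (p , e) → p , σ-inj (trans (sym (lk p)) e) })
      (λ { (p , e) → p , trans (lk p) (cong (σ ⟨$⟩ʳ_) e) })

  -- All injective tuples are listed, so every k-subset occurs k! times, once for each ordering.
  allBlocks : List (Block u k)
  allBlocks = blocksOf (allVec u k)

  allBlocks-permute : (σ : Permutation′ u) → ∀ x y → multiplicity allBlocks (σ ⟨$⟩ʳ x) (σ ⟨$⟩ʳ y) ≡ multiplicity allBlocks x y
  allBlocks-permute σ x y = trans (multiplicity-blocksOf (allVec u k) _ _) (trans (allVec-permute σ k _)
    (trans (total-cong (weight-map σ x y) (allVec u k)) (sym (multiplicity-blocksOf (allVec u k) x y))))

  -- The list is invariant under permutations of the points, and two transpositions carry any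
  -- ordered pair of distinct points to any other.
  allBlocks-constant : ∀ {x y a b} → x ≢ y → a ≢ b → multiplicity allBlocks x y ≡ multiplicity allBlocks a b
  allBlocks-constant {x} {y} {a} {b} x≢y a≢b =
    trans (sym (allBlocks-permute (invol x a) x y)) (trans (cong (λ z → multiplicity allBlocks z y′) (swap-left x a))
      (trans (sym (allBlocks-permute (invol y′ b) a y′)) (cong₂ (multiplicity allBlocks) (swap-other a≢y′ a≢b) (swap-left y′ b))))
    where
    invol : ∀ i j → Permutation′ u
    invol i j = permutation (swap i j) (swap i j) (swap-involutive i j) (swap-involutive i j)
    y′ = swap x a y
    a≢y′ : a ≢ y′
    a≢y′ e = x≢y (swap-injective x a (trans (swap-left x a) e))

  removeBlock : ∀ (b : Block u k) → Σ (List (Block u k)) λ bs → ∀ x y → hits x y b + multiplicity bs x y ≡ multiplicity allBlocks x y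
  removeBlock (v , i) with ∈-allVec u k v
  ... | xs , ys , e = blocksOf (xs ++ ys) , λ x y → sym (begin
      multiplicity allBlocks x y                       ≡⟨ multiplicity-blocksOf (allVec u k) x y ⟩
      total (weight x y) (allVec u k)                  ≡⟨ cong (total (weight x y)) e ⟩
      total (weight x y) (xs ++ v ∷ ys)                ≡⟨ total-++ (weight x y) xs (v ∷ ys) ⟩
      total (weight x y) xs + (weight x y v + total (weight x y) ys)   ≡⟨ rearrange (total (weight x y) xs) (weight x y v) _ ⟩
      weight x y v + (total (weight x y) xs + total (weight x y) ys)   ≡⟨ cong₂ _+_ (weight-injective x y) (trans (sym (total-++ (weight x y) xs ys)) (sym (multiplicity-blocksOf (xs ++ ys) x y))) ⟩
      hits x y (v , i) + multiplicity (blocksOf (xs ++ ys)) x y ∎)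
    where
    open ≡-Reasoning
    rearrange : ∀ a b c → a + (b + c) ≡ b + (a + c)
    rearrange = ℕS.solve-∀
    weight-injective : ∀ x y → weight x y v ≡ hits x y (v , i)
    weight-injective x y with injective? v
    ... | yes _ = refl
    ... | no n  = ⊥-elim (n i)

  hits≤allBlocks : ∀ (b : Block u k) x y → hits x y b ≤ multiplicity allBlocks x y
  hits≤allBlocks b x y with removeBlock b
  ... | bs , e = subst (hits x y b ≤_) (e x y) (ℕₚ.m≤m+n _ _)

-- Integral solutions: covers whose multiplicity is 1 modulo a given number

module SignedCovers (k₂ r₂ : ℕ) (room : 4 + k₂ ≤ 3 + r₂) where
  k = 2 + k₂
  r₁ = 2 + r₂
  r = 3 + r₂

  V₀ V₁ V₂ : Fin r
  V₀ = zero
  V₁ = suc zero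
  V₂ = suc (suc zero)

  Weight : Set
  Weight = Fin r → Fin r → ℤ

  U : Fin r → Fin r → ℕ
  U = multiplicity (allBlocks {r} {k})

  -- w is an integral combination of blocks, up to a multiple of the family of all blocks.
  record Realizable (w : Weight) : Set where
    constructor realized
    field
      blocks : List (Block r k)
      copies : ℕ
      equal  : ∀ x y → toℕ y < toℕ x → + multiplicity blocks x y ≡ w x y +ᶻ + (copies * U x y)

  R-ext : ∀ {w w′} → (∀ x y → toℕ y < toℕ x → w x y ≡ w′ x y) → Realizable w → Realizable w′
  R-ext e (realized bs n h) = realized bs n λ x y lt → trans (h x y lt) (cong (_+ᶻ + (n * U x y)) (e x y lt))

  R-+ : ∀ {w w′} → Realizable w → Realizable w′ → Realizable (λ x y → w x y +ᶻ w′ x y)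
  R-+ {w} {w′} (realized bs n h) (realized cs m g) = realized (bs ++ cs) (n + m) λ x y lt →
    trans (cong +_ (total-++ (hits x y) bs cs)) (trans (cong₂ _+ᶻ_ (h x y lt) (g x y lt))
      (trans (lemma (w x y) (w′ x y) (+ (n * U x y)) (+ (m * U x y))) (cong (λ z → (w x y +ᶻ w′ x y) +ᶻ + z) (sym (ℕₚ.*-distribʳ-+ (U x y) n m)))))
    where lemma : ∀ a b c d → (a +ᶻ c) +ᶻ (b +ᶻ d) ≡ (a +ᶻ b) +ᶻ (c +ᶻ d)
          lemma = ℤS.solve-∀

  R-0 : Realizable (λ _ _ → + 0)
  R-0 = realized [] 0 λ _ _ _ → refl

  R-block : ∀ b → Realizable (λ x y → + hits x y b)
  R-block b = realized (b ∷ []) 0 λ x y _ → refl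

  negatives : ∀ (bs : List (Block r k)) → Σ (List (Block r k)) λ cs → ∀ x y → multiplicity bs x y + multiplicity cs x y ≡ length bs * U x y
  negatives [] = [] , λ _ _ → refl
  negatives (b ∷ bs) = add (removeBlock b) (negatives bs)
    where
    rearrange : ∀ a b c d → (a + b) + (c + d) ≡ (a + c) + (b + d)
    rearrange = ℕS.solve-∀
    add : (Σ (List (Block r k)) λ ds → ∀ x y → hits x y b + multiplicity ds x y ≡ U x y) →
          (Σ (List (Block r k)) λ cs → ∀ x y → multiplicity bs x y + multiplicity cs x y ≡ length bs * U x y) →
          Σ (List (Block r k)) λ cs → ∀ x y → multiplicity (b ∷ bs) x y + multiplicity cs x y ≡ U x y + length bs * U x y
    add (ds , g) (cs , h) = ds ++ cs , λ x y → trans (cong (λ z → (hits x y b + multiplicity bs x y) + z) (total-++ (hits x y) ds cs))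
      (trans (rearrange (hits x y b) (multiplicity bs x y) (multiplicity ds x y) (multiplicity cs x y)) (cong₂ _+_ (g x y) (h x y)))

  extend : ∀ n (bs : List (Block r k)) → Σ (List (Block r k)) λ cs → ∀ x y → multiplicity cs x y ≡ multiplicity bs x y + n * U x y
  extend zero    bs = bs , λ x y → sym (ℕₚ.+-identityʳ _)
  extend (suc n) bs with extend n bs
  ... | cs , h = allBlocks ++ cs , λ x y → trans (total-++ (hits x y) allBlocks cs) (trans (cong (λ z → U x y + z) (h x y)) (lemma (U x y) (multiplicity bs x y) (n * U x y)))
    where lemma : ∀ a b c → a + (b + c) ≡ b + (a + c)
          lemma = ℕS.solve-∀

  R-neg : ∀ {w} → Realizable w → Realizable (λ x y → -ᶻ w x y)
  R-neg {w} (realized bs n h) with negatives bs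
  ... | cs , g with extend n cs
  ... | ds , f = realized ds (length bs) λ x y lt → trans (cong +_ (f x y)) (solve x y lt)
    where
    lemma : ∀ w c n → (c +ᶻ n) ≡ -ᶻ w +ᶻ ((w +ᶻ n) +ᶻ c)
    lemma = ℤS.solve-∀
    solve : ∀ x y → toℕ y < toℕ x → + (multiplicity cs x y + n * U x y) ≡ -ᶻ w x y +ᶻ + (length bs * U x y)
    solve x y lt = trans (lemma (w x y) (+ multiplicity cs x y) (+ (n * U x y)))
      (cong (-ᶻ w x y +ᶻ_) (trans (cong (_+ᶻ + multiplicity cs x y) (sym (h x y lt))) (cong +_ (g x y))))

  R-- : ∀ {w w′} → Realizable w → Realizable w′ → Realizable (λ x y → w x y -ᶻ w′ x y)
  R-- p q = R-+ p (R-neg q)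

  R-scaleℕ : ∀ n {w} → Realizable w → Realizable (λ x y → + n *ᶻ w x y)
  R-scaleℕ zero    {w} p = R-ext (λ x y _ → sym (ℤₚ.*-zeroˡ (w x y))) R-0
  R-scaleℕ (suc n) {w} p = R-ext (λ x y _ → lemma (+ n) (w x y)) (R-+ p (R-scaleℕ n p))
    where lemma : ∀ n w → w +ᶻ n *ᶻ w ≡ (+ 1 +ᶻ n) *ᶻ w
          lemma = ℤS.solve-∀

  R-scale : ∀ c {w} → Realizable w → Realizable (λ x y → c *ᶻ w x y)
  R-scale (+ n) p = R-scaleℕ n p
  R-scale -[1+ n ] {w} p = R-ext (λ x y _ → ℤₚ.neg-distribˡ-* (+ suc n) (w x y)) (R-neg (R-scaleℕ (suc n) p))

  R-sum : ∀ {n} {w : Fin n → Weight} → (∀ i → Realizable (w i)) → Realizable (λ x y → Σℤ.sum λ i → w i x y)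
  R-sum {zero}  p = R-0
  R-sum {suc n} p = R-+ (p zero) (R-sum (λ i → p (suc i)))

  δ : ∀ {n} → Fin n → Fin n → ℤ
  δ a x = if does (a F.≟ x) then + 1 else + 0

  δ-refl : ∀ {n} (a : Fin n) → δ a a ≡ + 1
  δ-refl a with a F.≟ a
  ... | yes _ = refl
  ... | no n  = ⊥-elim (n refl)

  δ-≢ : ∀ {n} {a x : Fin n} → a ≢ x → δ a x ≡ + 0
  δ-≢ {_} {a} {x} n with a F.≟ x
  ... | yes e = ⊥-elim (n e)
  ... | no _  = refl

  edge : ∀ {n} → Fin n → Fin n → Fin n → Fin n → ℤ
  edge a b x y = δ a x *ᶻ δ b y +ᶻ δ b x *ᶻ δ a y

  member : ∀ {n m} → Vec (Fin n) m → Fin n → ℤ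
  member []      x = + 0
  member (a ∷ v) x = δ a x +ᶻ member v x

  tail-injective : ∀ {n m} {a : Fin n} {v : Vec (Fin n) m} → Injective (a ∷ v) → Injective v
  tail-injective i p q e = Fₚ.suc-injective (i (suc p) (suc q) e)

  member-zero : ∀ {n m} (v : Vec (Fin n) m) x → (∀ p → lookup v p ≢ x) → member v x ≡ + 0
  member-zero []      x n = refl
  member-zero (a ∷ v) x n = cong₂ _+ᶻ_ (δ-≢ (n zero)) (member-zero v x (λ p → n (suc p)))

  member-occurs : ∀ {n m} (v : Vec (Fin n) m) → Injective v → ∀ x → member v x ≡ + bit ⌊ occurs? v x ⌋
  member-occurs v i x with occurs? v x
  ... | no n = member-zero v x λ p e → n (p , e)
  ... | yes (p , refl) = one v i p
    where
    one : ∀ {n m} (v : Vec (Fin n) m) → Injective v → ∀ p → member v (lookup v p) ≡ + 1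
    one (a ∷ v) i zero    = cong₂ _+ᶻ_ (δ-refl a) (member-zero v a λ p e → absurd (i (suc p) zero e))
      where absurd : ∀ {p} → F.suc p ≡ zero → ⊥
            absurd ()
    one (a ∷ v) i (suc p) = cong₂ _+ᶻ_ (δ-≢ λ e → absurd (i zero (suc p) e)) (one v (tail-injective i) p)
      where absurd : zero ≡ F.suc p → ⊥
            absurd ()

  -- The pairs of a block form the product of its indicator vector with itself, so identities
  -- between combinations of blocks become polynomial identities in indicators.
  hits-member : ∀ (b : Block r k) x y → + hits x y b ≡ member (proj₁ b) x *ᶻ member (proj₁ b) y
  hits-member (v , i) x y = trans (and ⌊ occurs? v x ⌋ ⌊ occurs? v y ⌋) (sym (cong₂ _*ᶻ_ (member-occurs v i x) (member-occurs v i y)))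
    where and : ∀ a b → + bit (a ∧ b) ≡ + bit a *ᶻ + bit b
          and true  true  = refl
          and true  false = refl
          and false true  = refl
          and false false = refl

  member² : ∀ (v : Vec (Fin r) k) → Injective v → ∀ x → member v x *ᶻ member v x ≡ member v x
  member² v i x rewrite member-occurs v i x with ⌊ occurs? v x ⌋
  ... | true  = refl
  ... | false = refl

  R-tuple : ∀ (v : Vec (Fin r) k) → Injective v → Realizable (λ x y → member v x *ᶻ member v y)
  R-tuple v i = R-ext (λ x y _ → hits-member (v , i) x y) (R-block (v , i))

  fresh : (xs : List (Fin r)) → length xs < r → Σ (Fin r) λ x → ∀ i → List.lookup xs i ≢ x
  fresh xs lt with Fₚ.any? (λ x → Fₚ.all? λ i → ¬? (List.lookup xs i F.≟ x))
  ... | yes p = p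
  ... | no n = ⊥-elim (ℕₚ.<⇒≱ lt (Fₚ.injective⇒≤ {f = λ x → proj₁ (pos x)} λ {x} {y} e →
                 trans (sym (proj₂ (pos x))) (trans (cong (List.lookup xs) e) (proj₂ (pos y)))))
    where
    pos : ∀ x → ∃ λ i → List.lookup xs i ≡ x
    pos x with Fₚ.any? (λ i → List.lookup xs i F.≟ x)
    ... | yes p = p
    ... | no m  = ⊥-elim (n (x , λ i e → m (i , e)))

  freshVec : ∀ m (xs : List (Fin r)) → length xs + m ≤ r →
             Σ (Vec (Fin r) m) λ v → Injective v × (∀ p i → lookup v p ≢ List.lookup xs i)
  freshVec zero    xs le = [] , (λ ()) , λ ()
  freshVec (suc m) xs le with fresh xs (ℕₚ.≤-trans (ℕₚ.≤-trans (s≤s (ℕₚ.m≤m+n (length xs) m)) (ℕₚ.≤-reflexive (sym (ℕₚ.+-suc (length xs) m)))) le)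
  ... | x , n with freshVec m (x ∷ xs) (ℕₚ.≤-trans (ℕₚ.≤-reflexive (sym (ℕₚ.+-suc (length xs) m))) le)
  ... | v , i , a = x ∷ v , inj , avoid
    where
    inj : Injective (x ∷ v)
    inj zero zero e = refl
    inj zero (suc q) e = ⊥-elim (a q zero (sym e))
    inj (suc p) zero e = ⊥-elim (a p zero e)
    inj (suc p) (suc q) e = cong suc (i p q e)
    avoid : ∀ p j → lookup (x ∷ v) p ≢ List.lookup xs j
    avoid zero j e = n j (sym e)
    avoid (suc p) j e = a p (suc j) e

  cons-injective : ∀ {m} {v : Vec (Fin r) m} {a} → (∀ p → lookup v p ≢ a) → Injective v → Injective (a ∷ v)
  cons-injective n i zero zero e = refl
  cons-injective n i zero (suc q) e = ⊥-elim (n q (sym e))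
  cons-injective n i (suc p) zero e = ⊥-elim (n p e)
  cons-injective n i (suc p) (suc q) e = cong suc (i p q e)

  pair-injective : ∀ {v : Vec (Fin r) k₂} {a b} → Injective v → (∀ p → lookup v p ≢ a) → (∀ p → lookup v p ≢ b) → a ≢ b → Injective (a ∷ b ∷ v)
  pair-injective {v} {a} {b} i na nb n = cons-injective (λ { zero e → n (sym e) ; (suc p) → na p }) (cons-injective nb i)

  -- The blocks on S ∪ {a,b}, S ∪ {b,c}, S ∪ {c,d}, S ∪ {d,a} combine to an alternating 4-cycle.
  R-cycle : ∀ {a b c d} → a ≢ b → b ≢ c → c ≢ d → d ≢ a →
            Realizable (λ x y → ((edge a b x y -ᶻ edge b c x y) +ᶻ edge c d x y) -ᶻ edge d a x y)
  R-cycle {a} {b} {c} {d} ab bc cd da with freshVec k₂ (a ∷ b ∷ c ∷ d ∷ []) room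
  ... | S , i , n = R-ext
    (λ x y _ → lemma (δ a x) (δ b x) (δ c x) (δ d x) (member S x) (δ a y) (δ b y) (δ c y) (δ d y) (member S y))
    (R-- (R-+ (R-- (R-tuple (a ∷ b ∷ S) (pair-injective i na nb ab)) (R-tuple (b ∷ c ∷ S) (pair-injective i nb nc bc)))
      (R-tuple (c ∷ d ∷ S) (pair-injective i nc nd cd))) (R-tuple (d ∷ a ∷ S) (pair-injective i nd na da)))
    where
    na = λ p → n p zero
    nb = λ p → n p (suc zero)
    nc = λ p → n p (suc (suc zero))
    nd = λ p → n p (suc (suc (suc zero)))
    lemma : ∀ a b c d s a′ b′ c′ d′ s′ →
      (((a +ᶻ (b +ᶻ s)) *ᶻ (a′ +ᶻ (b′ +ᶻ s′)) -ᶻ (b +ᶻ (c +ᶻ s)) *ᶻ (b′ +ᶻ (c′ +ᶻ s′))) +ᶻ (c +ᶻ (d +ᶻ s)) *ᶻ (c′ +ᶻ (d′ +ᶻ s′))) -ᶻ (d +ᶻ (a +ᶻ s)) *ᶻ (d′ +ᶻ (a′ +ᶻ s′))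
      ≡ (((a *ᶻ b′ +ᶻ b *ᶻ a′) -ᶻ (b *ᶻ c′ +ᶻ c *ᶻ b′)) +ᶻ (c *ᶻ d′ +ᶻ d *ᶻ c′)) -ᶻ (d *ᶻ a′ +ᶻ a *ᶻ d′)
    lemma = ℤS.solve-∀

  star : ∀ {m} → Fin r → Fin r → Vec (Fin r) m → Weight
  star v w S x y = (δ v x *ᶻ member S y +ᶻ member S x *ᶻ δ v y) -ᶻ (δ w x *ᶻ member S y +ᶻ member S x *ᶻ δ w y)

  -- Trading a point s of `S` for `z` in the difference of the edges to `v` and those to `w` costs
  -- the alternating cycle v s w z. Modulo such cycles only the number of points of `S` counts.
  R-star : ∀ {v w z m} (S : Vec (Fin r) m) → v ≢ w → v ≢ z → w ≢ z → (∀ p → lookup S p ≢ v) → (∀ p → lookup S p ≢ w) → (∀ p → lookup S p ≢ z) →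
           Realizable (λ x y → star v w S x y -ᶻ + m *ᶻ (edge v z x y -ᶻ edge w z x y))
  R-star {v} {w} {z} [] _ _ _ _ _ _ = R-ext (λ x y _ → lemma (δ v x) (δ v y) (δ w x) (δ w y) (edge v z x y -ᶻ edge w z x y)) R-0
    where lemma : ∀ a b c d e → + 0 ≡ ((a *ᶻ + 0 +ᶻ + 0 *ᶻ b) -ᶻ (c *ᶻ + 0 +ᶻ + 0 *ᶻ d)) -ᶻ + 0 *ᶻ e
          lemma = ℤS.solve-∀
  R-star {v} {w} {z} {suc m} (s ∷ S) vw vz wz nv nw nz =
    R-ext (λ x y _ → lemma (δ v x) (δ v y) (δ w x) (δ w y) (δ z x) (δ z y) (δ s x) (δ s y) (member S x) (member S y) (+ m))
      (R-+ (R-cycle {v} {s} {w} {z} (λ e → nv zero (sym e)) (nw zero) wz (λ e → vz (sym e)))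
           (R-star S vw vz wz (λ p → nv (suc p)) (λ p → nw (suc p)) (λ p → nz (suc p))))
    where
    lemma : ∀ v v′ w w′ z z′ s s′ t t′ m →
      ((((v *ᶻ s′ +ᶻ s *ᶻ v′) -ᶻ (s *ᶻ w′ +ᶻ w *ᶻ s′)) +ᶻ (w *ᶻ z′ +ᶻ z *ᶻ w′)) -ᶻ (z *ᶻ v′ +ᶻ v *ᶻ z′))
        +ᶻ (((v *ᶻ t′ +ᶻ t *ᶻ v′) -ᶻ (w *ᶻ t′ +ᶻ t *ᶻ w′)) -ᶻ m *ᶻ ((v *ᶻ z′ +ᶻ z *ᶻ v′) -ᶻ (w *ᶻ z′ +ᶻ z *ᶻ w′)))
      ≡ ((v *ᶻ (s′ +ᶻ t′) +ᶻ (s +ᶻ t) *ᶻ v′) -ᶻ (w *ᶻ (s′ +ᶻ t′) +ᶻ (s +ᶻ t) *ᶻ w′)) -ᶻ (+ 1 +ᶻ m) *ᶻ ((v *ᶻ z′ +ᶻ z *ᶻ v′) -ᶻ (w *ᶻ z′ +ᶻ z *ᶻ w′))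
    lemma = ℤS.solve-∀

  -- Loops are invisible below the diagonal. Realizability is compared only there, since products of
  -- indicators also have diagonal entries.
  δδ : ∀ (v : Fin r) {x y} → toℕ y < toℕ x → δ v x *ᶻ δ v y ≡ + 0
  δδ v {x} {y} lt with v F.≟ x
  ... | no _ = ℤₚ.*-zeroˡ (δ v y)
  ... | yes refl = trans (ℤₚ.*-identityˡ (δ v y)) (δ-≢ λ e → ℕₚ.<-irrefl (cong toℕ (sym e)) lt)

  -- Replacing `v` by `w` in a block with `z` and k - 2 further points moves k - 1 edges from v to
  -- w, and by `R-star` all of them may be taken to end in `z`. Degrees can thus be shifted in
  -- multiples of k - 1.
  R-move : ∀ {v w z} → v ≢ w → v ≢ z → w ≢ z → Realizable (λ x y → + suc k₂ *ᶻ (edge v z x y -ᶻ edge w z x y))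
  R-move {v} {w} {z} vw vz wz with freshVec k₂ (v ∷ w ∷ z ∷ []) (ℕₚ.≤-trans (ℕₚ.n≤1+n _) room)
  ... | S , i , n = R-ext identity
    (R-- (R-- (R-tuple (v ∷ z ∷ S) (pair-injective i nv nz vz)) (R-tuple (w ∷ z ∷ S) (pair-injective i nw nz wz)))
      (R-star S vw vz wz nv nw nz))
    where
    nv = λ p → n p zero
    nw = λ p → n p (suc zero)
    nz = λ p → n p (suc (suc zero))
    lemma : ∀ v v′ w w′ z z′ t t′ m →
      ((v +ᶻ (z +ᶻ t)) *ᶻ (v′ +ᶻ (z′ +ᶻ t′)) -ᶻ (w +ᶻ (z +ᶻ t)) *ᶻ (w′ +ᶻ (z′ +ᶻ t′)))
        -ᶻ (((v *ᶻ t′ +ᶻ t *ᶻ v′) -ᶻ (w *ᶻ t′ +ᶻ t *ᶻ w′)) -ᶻ m *ᶻ ((v *ᶻ z′ +ᶻ z *ᶻ v′) -ᶻ (w *ᶻ z′ +ᶻ z *ᶻ w′)))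
      ≡ ((v *ᶻ v′) -ᶻ (w *ᶻ w′)) +ᶻ (+ 1 +ᶻ m) *ᶻ ((v *ᶻ z′ +ᶻ z *ᶻ v′) -ᶻ (w *ᶻ z′ +ᶻ z *ᶻ w′))
    lemma = ℤS.solve-∀
    identity : ∀ x y → toℕ y < toℕ x → _ ≡ + suc k₂ *ᶻ (edge v z x y -ᶻ edge w z x y)
    identity x y lt = trans (lemma (δ v x) (δ v y) (δ w x) (δ w y) (δ z x) (δ z y) (member S x) (member S y) (+ k₂))
      (trans (cong (_+ᶻ (+ suc k₂ *ᶻ (edge v z x y -ᶻ edge w z x y))) (cong₂ _-ᶻ_ (δδ v lt) (δδ w lt))) (ℤₚ.+-identityˡ _))

  spoke : Fin r → Weight
  spoke a = edge a V₀
  T : Weight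
  T x y = (edge V₁ V₂ x y -ᶻ edge V₂ V₀ x y) -ᶻ edge V₁ V₀ x y

  -- Modulo alternating 4-cycles an edge off `V₀` is the sum of the spokes of its two ends and a
  -- class `T` common to all edges. A combination of such edges is then known from its degrees and
  -- its total weight.
  reduced : Fin r → Fin r → Weight
  reduced a b x y = ((edge a b x y -ᶻ spoke a x y) -ᶻ spoke b x y) -ᶻ T x y

  R-reduced₁ : ∀ {b} → b ≢ V₀ → b ≢ V₁ → Realizable (reduced b V₁)
  R-reduced₁ {b} b0 b1 with b F.≟ V₂
  ... | yes refl = R-ext (λ x y _ → lemma (δ V₀ x) (δ V₁ x) (δ V₂ x) (δ V₀ y) (δ V₁ y) (δ V₂ y)) R-0
    where lemma : ∀ o a b o′ a′ b′ → + 0 ≡ (((b *ᶻ a′ +ᶻ a *ᶻ b′) -ᶻ (b *ᶻ o′ +ᶻ o *ᶻ b′)) -ᶻ (a *ᶻ o′ +ᶻ o *ᶻ a′))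
                     -ᶻ (((a *ᶻ b′ +ᶻ b *ᶻ a′) -ᶻ (b *ᶻ o′ +ᶻ o *ᶻ b′)) -ᶻ (a *ᶻ o′ +ᶻ o *ᶻ a′))
          lemma = ℤS.solve-∀
  ... | no b2 = R-ext (λ x y _ → lemma (δ b x) (δ V₀ x) (δ V₁ x) (δ V₂ x) (δ b y) (δ V₀ y) (δ V₁ y) (δ V₂ y))
                  (R-cycle {b} {V₁} {V₂} {V₀} b1 (λ ()) (λ ()) (λ e → b0 (sym e)))
    where lemma : ∀ v o a b v′ o′ a′ b′ →
                    (((v *ᶻ a′ +ᶻ a *ᶻ v′) -ᶻ (a *ᶻ b′ +ᶻ b *ᶻ a′)) +ᶻ (b *ᶻ o′ +ᶻ o *ᶻ b′)) -ᶻ (o *ᶻ v′ +ᶻ v *ᶻ o′)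
                    ≡ (((v *ᶻ a′ +ᶻ a *ᶻ v′) -ᶻ (v *ᶻ o′ +ᶻ o *ᶻ v′)) -ᶻ (a *ᶻ o′ +ᶻ o *ᶻ a′))
                     -ᶻ (((a *ᶻ b′ +ᶻ b *ᶻ a′) -ᶻ (b *ᶻ o′ +ᶻ o *ᶻ b′)) -ᶻ (a *ᶻ o′ +ᶻ o *ᶻ a′))
          lemma = ℤS.solve-∀

  reduced-sym : ∀ a b x y → reduced a b x y ≡ reduced b a x y
  reduced-sym a b x y = cong (_-ᶻ T x y) (lemma (δ a x) (δ b x) (δ a y) (δ b y) (spoke a x y) (spoke b x y))
    where lemma : ∀ a b a′ b′ s t → ((a *ᶻ b′ +ᶻ b *ᶻ a′) -ᶻ s) -ᶻ t ≡ ((b *ᶻ a′ +ᶻ a *ᶻ b′) -ᶻ t) -ᶻ s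
          lemma = ℤS.solve-∀

  R-reduced : ∀ {a b} → a ≢ V₀ → b ≢ V₀ → a ≢ b → Realizable (reduced a b)
  R-reduced {a} {b} a0 b0 ab with a F.≟ V₁ | b F.≟ V₁
  ... | yes refl | yes refl = ⊥-elim (ab refl)
  ... | no a1    | yes refl = R-reduced₁ a0 a1
  ... | yes refl | no b1    = R-ext (λ x y _ → reduced-sym b V₁ x y) (R-reduced₁ b0 b1)
  ... | no a1    | no b1    = R-ext (λ x y _ → lemma (δ a x) (δ b x) (δ V₀ x) (δ V₁ x) (δ a y) (δ b y) (δ V₀ y) (δ V₁ y) (T x y))
                  (R-+ (R-cycle {a} {b} {V₁} {V₀} ab b1 (λ ()) (λ e → a0 (sym e))) (R-reduced₁ b0 b1))
    where lemma : ∀ a b o u a′ b′ o′ u′ t →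
                    ((((a *ᶻ b′ +ᶻ b *ᶻ a′) -ᶻ (b *ᶻ u′ +ᶻ u *ᶻ b′)) +ᶻ (u *ᶻ o′ +ᶻ o *ᶻ u′)) -ᶻ (o *ᶻ a′ +ᶻ a *ᶻ o′))
                     +ᶻ ((((b *ᶻ u′ +ᶻ u *ᶻ b′) -ᶻ (b *ᶻ o′ +ᶻ o *ᶻ b′)) -ᶻ (u *ᶻ o′ +ᶻ o *ᶻ u′)) -ᶻ t)
                    ≡ (((a *ᶻ b′ +ᶻ b *ᶻ a′) -ᶻ (a *ᶻ o′ +ᶻ o *ᶻ a′)) -ᶻ (b *ᶻ o′ +ᶻ o *ᶻ b′)) -ᶻ t
          lemma = ℤS.solve-∀

-- The constant weight 1 as an integral combination of blocks

module Elimination-of-edges (k₂ r₂ : ℕ) (room : 4 + k₂ ≤ 3 + r₂) where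
  open SignedCovers k₂ r₂ room

  sum-δ : ∀ {n} (f : Fin n → ℤ) x → Σℤ.sum (λ a → f a *ᶻ δ a x) ≡ f x
  sum-δ {suc n} f zero = trans (cong₂ _+ᶻ_ (ℤₚ.*-identityʳ (f zero)) (zeros (λ a → f (suc a)))) (ℤₚ.+-identityʳ _)
    where zeros : ∀ {m} (g : Fin m → ℤ) → Σℤ.sum (λ a → g a *ᶻ + 0) ≡ + 0
          zeros {zero}  g = refl
          zeros {suc m} g = cong₂ _+ᶻ_ (ℤₚ.*-zeroʳ (g zero)) (zeros (λ a → g (suc a)))
  sum-δ {suc n} f (suc x) = trans (cong₂ _+ᶻ_ (ℤₚ.*-zeroʳ (f zero)) (sum-δ (λ a → f (suc a)) x)) (ℤₚ.+-identityˡ _)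

  sum-one : ∀ n → Σℤ.sum {n} (λ _ → + 1) ≡ + n
  sum-one zero    = refl
  sum-one (suc n) = cong (+ 1 +ᶻ_) (sum-one n)

  sum-scale : ∀ {n} c (f : Fin n → ℤ) → Σℤ.sum (λ a → c *ᶻ f a) ≡ c *ᶻ Σℤ.sum f
  sum-scale c f = sym (Σℤ.*-distribˡ-sum c f)

  sum-scaleʳ : ∀ {n} c (f : Fin n → ℤ) → Σℤ.sum (λ a → f a *ᶻ c) ≡ Σℤ.sum f *ᶻ c
  sum-scaleʳ c f = sym (Σℤ.*-distribʳ-sum c f)

  sum-cong : ∀ {n} {f g : Fin n → ℤ} → (∀ a → f a ≡ g a) → Σℤ.sum f ≡ Σℤ.sum g
  sum-cong = Σℤ.sum-cong-≗

  δ-sym : ∀ {n} (a b : Fin n) → δ a b ≡ δ b a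
  δ-sym a b with a F.≟ b | b F.≟ a
  ... | yes _ | yes _ = refl
  ... | yes e | no n  = ⊥-elim (n (sym e))
  ... | no n  | yes e = ⊥-elim (n (sym e))
  ... | no _  | no _  = refl

  sum-member : ∀ {n m} (v : Vec (Fin n) m) → Σℤ.sum (member v) ≡ + m
  sum-member {n} [] = zeros n
    where zeros : ∀ n → Σℤ.sum {n} (λ _ → + 0) ≡ + 0
          zeros zero    = refl
          zeros (suc n) = trans (ℤₚ.+-identityˡ _) (zeros n)
  sum-member (a ∷ v) = trans (Σℤ.∑-distrib-+ (δ a) (member v)) (cong₂ _+ᶻ_
    (trans (sum-cong λ x → trans (δ-sym a x) (sym (ℤₚ.*-identityˡ _))) (sum-δ (λ _ → + 1) a)) (sum-member v))

  -- The integers are parameters here so that they do not compute.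
  module Elimination (ρ N κ R : ℤ) (κ≡ : + suc k₂ ≡ κ) (R≡ : + r₁ ≡ R)
                     (r₁ᶻ : R ≡ ρ *ᶻ κ) (rr₁ᶻ : (+ 1 +ᶻ R) *ᶻ R ≡ N *ᶻ ((+ 1 +ᶻ κ) *ᶻ κ)) where

    abstract
      B₀ : Σ (Vec (Fin r) k) λ v → Injective v × (∀ p i → lookup v p ≢ List.lookup (V₀ ∷ []) i)
      -- A block avoiding `V₀` leaves the weight 1 on every spoke in `w`.
      B₀ = freshVec k (V₀ ∷ []) (ℕₚ.≤-trans (ℕₚ.n≤1+n _) room)
    m : Fin r → ℤ
    m = member (proj₁ B₀)
    m₀ : m V₀ ≡ + 0
    m₀ = member-zero (proj₁ B₀) V₀ λ p → proj₂ (proj₂ B₀) p zero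
    m² : ∀ x → m x *ᶻ m x ≡ m x
    m² = member² (proj₁ B₀) (proj₁ (proj₂ B₀))
    sum-m : Σℤ.sum (λ a → m (suc a)) ≡ + 1 +ᶻ κ
    sum-m = trans (sym (ℤₚ.+-identityˡ _)) (trans (cong (_+ᶻ Σℤ.sum (λ a → m (suc a))) (sym m₀)) (trans (sum-member (proj₁ B₀)) (cong (+ 1 +ᶻ_) κ≡)))

    sum-R : Σℤ.sum {r₁} (λ _ → + 1) ≡ R
    sum-R = trans (sum-one r₁) R≡

    -- All pairs once, minus `N` copies of one block, where `N` is the number of blocks a design on
    -- r points would have. The total weight is 0 and all degrees are multiples of k - 1, which
    -- turns out to be enough for `w` to be realizable; adding the `N` copies back gives the
    -- constant 1.
    w : Weight
    w x y = + 1 -ᶻ N *ᶻ (m x *ᶻ m y)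

    onlyIf : ∀ {P : Set} → Dec P → ℤ → ℤ
    onlyIf (yes _) z = z
    onlyIf (no _)  _ = + 0
    p : Fin r₁ → Fin r₁ → ℤ
    p a b = onlyIf (toℕ a <? toℕ b) (w (suc a) (suc b))

    p-sum : ∀ a b → p a b +ᶻ p b a ≡ w (suc a) (suc b) -ᶻ w (suc a) (suc b) *ᶻ δ b a
    p-sum a b with toℕ a <? toℕ b | toℕ b <? toℕ a
    ... | yes l | yes g = ⊥-elim (ℕₚ.<-asym l g)
    ... | yes l | no _ rewrite δ-≢ {_} {b} {a} (λ e → ℕₚ.<-irrefl (cong toℕ (sym e)) l) = lemma (w (suc a) (suc b))
      where lemma : ∀ w → w +ᶻ + 0 ≡ w -ᶻ w *ᶻ + 0
            lemma = ℤS.solve-∀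
    ... | no _ | yes g rewrite δ-≢ {_} {b} {a} (λ e → ℕₚ.<-irrefl (cong toℕ e) g) = lemma (N) (m (suc a)) (m (suc b))
      where lemma : ∀ N a b → + 0 +ᶻ (+ 1 -ᶻ N *ᶻ (b *ᶻ a)) ≡ (+ 1 -ᶻ N *ᶻ (a *ᶻ b)) -ᶻ (+ 1 -ᶻ N *ᶻ (a *ᶻ b)) *ᶻ + 0
            lemma = ℤS.solve-∀
    ... | no l | no g with Fₚ.toℕ-injective (ℕₚ.≤-antisym (ℕₚ.≮⇒≥ g) (ℕₚ.≮⇒≥ l))
    ... | refl rewrite δ-refl a = lemma (w (suc a) (suc a))
      where lemma : ∀ w → + 0 +ᶻ + 0 ≡ w -ᶻ w *ᶻ + 1
            lemma = ℤS.solve-∀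

    D : Fin r₁ → ℤ
    D a = Σℤ.sum λ b → p a b +ᶻ p b a
    c : Fin r₁ → ℤ
    c a = ρ -ᶻ N *ᶻ m (suc a)

    -- `D a` is the degree of a in `w` without the spoke to `V₀`; the summand 1 is the weight of
    -- that spoke.
    D-value : ∀ a → D a +ᶻ + 1 ≡ κ *ᶻ c a
    D-value a = begin
      D a +ᶻ + 1
        ≡⟨ cong (_+ᶻ + 1) (sum-cong (p-sum a)) ⟩
      Σℤ.sum (λ b → w (suc a) (suc b) -ᶻ w (suc a) (suc b) *ᶻ δ b a) +ᶻ + 1
        ≡⟨ cong (_+ᶻ + 1) (sumℤ-- (λ b → w (suc a) (suc b)) (λ b → w (suc a) (suc b) *ᶻ δ b a)) ⟩
      (Σℤ.sum (λ b → w (suc a) (suc b)) -ᶻ Σℤ.sum (λ b → w (suc a) (suc b) *ᶻ δ b a)) +ᶻ + 1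
        ≡⟨ cong₂ (λ s t → (s -ᶻ t) +ᶻ + 1) row (sum-δ (λ b → w (suc a) (suc b)) a) ⟩
      ((R -ᶻ (N *ᶻ mₐ) *ᶻ (+ 1 +ᶻ κ)) -ᶻ (+ 1 -ᶻ N *ᶻ (mₐ *ᶻ mₐ))) +ᶻ + 1
        ≡⟨ cong₂ (λ s t → ((s -ᶻ (N *ᶻ mₐ) *ᶻ (+ 1 +ᶻ κ)) -ᶻ (+ 1 -ᶻ N *ᶻ t)) +ᶻ + 1) r₁ᶻ (m² (suc a)) ⟩
      ((ρ *ᶻ κ -ᶻ (N *ᶻ mₐ) *ᶻ (+ 1 +ᶻ κ)) -ᶻ (+ 1 -ᶻ N *ᶻ mₐ)) +ᶻ + 1
        ≡⟨ lemma (ρ) (κ) (N) mₐ ⟩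
      κ *ᶻ c a ∎
      where
      open ≡-Reasoning
      mₐ = m (suc a)
      lemma : ∀ ρ k N m → ((ρ *ᶻ k -ᶻ (N *ᶻ m) *ᶻ (+ 1 +ᶻ k)) -ᶻ (+ 1 -ᶻ N *ᶻ m)) +ᶻ + 1 ≡ k *ᶻ (ρ -ᶻ N *ᶻ m)
      lemma = ℤS.solve-∀
      row : Σℤ.sum (λ b → w (suc a) (suc b)) ≡ R -ᶻ (N *ᶻ mₐ) *ᶻ (+ 1 +ᶻ κ)
      row = trans (sumℤ-- (λ _ → + 1) (λ b → N *ᶻ (mₐ *ᶻ m (suc b)))) (cong₂ _-ᶻ_ sum-R
        (trans (sum-cong λ b → sym (ℤₚ.*-assoc (N) mₐ (m (suc b)))) (trans (sum-scale (N *ᶻ mₐ) (λ b → m (suc b))) (cong ((N *ᶻ mₐ) *ᶻ_) sum-m))))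

    -- The degrees of `w` over all vertices sum to 0, and that of `V₀` is R.
    sum-c : κ *ᶻ Σℤ.sum c ≡ -ᶻ R
    sum-c = begin
      κ *ᶻ Σℤ.sum c
        ≡⟨ cong (κ *ᶻ_) (trans (sumℤ-- (λ _ → ρ) (λ a → N *ᶻ m (suc a))) (cong₂ _-ᶻ_
             (trans (sum-cong {r₁} λ _ → sym (ℤₚ.*-identityʳ (ρ))) (trans (sum-scale {r₁} (ρ) (λ _ → + 1)) (cong (ρ *ᶻ_) sum-R)))
             (trans (sum-scale (N) (λ a → m (suc a))) (cong (N *ᶻ_) sum-m)))) ⟩
      κ *ᶻ (ρ *ᶻ R -ᶻ N *ᶻ (+ 1 +ᶻ κ))
        ≡⟨ lemma (κ) (ρ) (R) (N) (+ 1 +ᶻ κ) ⟩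
      (ρ *ᶻ κ) *ᶻ R -ᶻ N *ᶻ ((+ 1 +ᶻ κ) *ᶻ κ)
        ≡⟨ cong₂ (λ s t → s *ᶻ R -ᶻ t) (sym r₁ᶻ) (sym rr₁ᶻ) ⟩
      R *ᶻ R -ᶻ (+ 1 +ᶻ R) *ᶻ R
        ≡⟨ lemma′ (R) ⟩
      -ᶻ R ∎
      where
      open ≡-Reasoning
      lemma : ∀ s ρ r N k → s *ᶻ (ρ *ᶻ r -ᶻ N *ᶻ k) ≡ (ρ *ᶻ s) *ᶻ r -ᶻ N *ᶻ (k *ᶻ s)
      lemma = ℤS.solve-∀
      lemma′ : ∀ r → r *ᶻ r -ᶻ (+ 1 +ᶻ r) *ᶻ r ≡ -ᶻ r
      lemma′ = ℤS.solve-∀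

    W : ℤ
    W = Σℤ.sum λ a → Σℤ.sum λ b → p a b

    row-col : (f : Fin r₁ → ℤ) → Σℤ.sum (λ a → Σℤ.sum λ b → p a b *ᶻ (f a +ᶻ f b)) ≡ Σℤ.sum λ a → D a *ᶻ f a
    row-col f = begin
      Σℤ.sum (λ a → Σℤ.sum λ b → p a b *ᶻ (f a +ᶻ f b))
        ≡⟨ sum-cong (λ a → trans (sum-cong λ b → ℤₚ.*-distribˡ-+ (p a b) (f a) (f b)) (Σℤ.∑-distrib-+ (λ b → p a b *ᶻ f a) (λ b → p a b *ᶻ f b))) ⟩
      Σℤ.sum (λ a → Σℤ.sum (λ b → p a b *ᶻ f a) +ᶻ Σℤ.sum (λ b → p a b *ᶻ f b))
        ≡⟨ Σℤ.∑-distrib-+ (λ a → Σℤ.sum (λ b → p a b *ᶻ f a)) (λ a → Σℤ.sum (λ b → p a b *ᶻ f b)) ⟩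
      Σℤ.sum (λ a → Σℤ.sum (λ b → p a b *ᶻ f a)) +ᶻ Σℤ.sum (λ a → Σℤ.sum (λ b → p a b *ᶻ f b))
        ≡⟨ cong (Σℤ.sum (λ a → Σℤ.sum (λ b → p a b *ᶻ f a)) +ᶻ_) (Σℤ.∑-comm (λ a b → p a b *ᶻ f b)) ⟩
      Σℤ.sum (λ a → Σℤ.sum (λ b → p a b *ᶻ f a)) +ᶻ Σℤ.sum (λ a → Σℤ.sum (λ b → p b a *ᶻ f a))
        ≡⟨ sym (Σℤ.∑-distrib-+ (λ a → Σℤ.sum (λ b → p a b *ᶻ f a)) (λ a → Σℤ.sum (λ b → p b a *ᶻ f a))) ⟩
      Σℤ.sum (λ a → Σℤ.sum (λ b → p a b *ᶻ f a) +ᶻ Σℤ.sum (λ b → p b a *ᶻ f a))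
        ≡⟨ sum-cong (λ a → trans (cong₂ _+ᶻ_ (sum-scaleʳ (f a) (p a)) (sum-scaleʳ (f a) (λ b → p b a)))
             (trans (sym (ℤₚ.*-distribʳ-+ (f a) (Σℤ.sum (p a)) (Σℤ.sum λ b → p b a))) (cong (_*ᶻ f a) (sym (Σℤ.∑-distrib-+ (p a) (λ b → p b a)))))) ⟩
      Σℤ.sum (λ a → D a *ᶻ f a) ∎
      where open ≡-Reasoning

    -- Handshaking: twice the total is the sum of the degrees κ c a - 1, which is - R - R.
    W-value : W ≡ -ᶻ R
    W-value = ℤₚ.*-cancelˡ-≡ (+ 2) W (-ᶻ R) (begin
      + 2 *ᶻ W
        ≡⟨ trans (ℤₚ.*-comm (+ 2) W) (sym (trans (sum-cong (λ a → sum-scaleʳ (+ 2) (p a))) (sum-scaleʳ (+ 2) (λ a → Σℤ.sum (p a))))) ⟩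
      Σℤ.sum (λ a → Σℤ.sum λ b → p a b *ᶻ (+ 1 +ᶻ + 1))
        ≡⟨ row-col (λ _ → + 1) ⟩
      Σℤ.sum (λ a → D a *ᶻ + 1)
        ≡⟨ sum-cong (λ a → trans (lemma (D a)) (cong (_-ᶻ + 1) (D-value a))) ⟩
      Σℤ.sum (λ a → κ *ᶻ c a -ᶻ + 1)
        ≡⟨ sumℤ-- (λ a → κ *ᶻ c a) (λ _ → + 1) ⟩
      Σℤ.sum (λ a → κ *ᶻ c a) -ᶻ Σℤ.sum {r₁} (λ _ → + 1)
        ≡⟨ cong₂ _-ᶻ_ (trans (sum-scale (κ) c) sum-c) sum-R ⟩
      -ᶻ R -ᶻ R
        ≡⟨ lemma′ (R) ⟩
      + 2 *ᶻ (-ᶻ R) ∎)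
      where
      open ≡-Reasoning
      lemma : ∀ d → d *ᶻ + 1 ≡ (d +ᶻ + 1) -ᶻ + 1
      lemma = ℤS.solve-∀
      lemma′ : ∀ r → -ᶻ r -ᶻ r ≡ + 2 *ᶻ (-ᶻ r)
      lemma′ = ℤS.solve-∀

    -- `part₁` expresses the edges off `V₀` through spokes and copies of `T`; `part₂` moves spokes
    -- onto that of `V₁` in multiples of κ. What remains besides `w` is R times the difference of
    -- the edges V₁V₂ and V₀V₂, and since R = ρ κ it can be removed by moves of the same kind, which
    -- is `part₃`.
    part₁ : Weight
    part₁ x y = Σℤ.sum λ a → Σℤ.sum λ b → p a b *ᶻ reduced (suc a) (suc b) x y
    part₂ : Weight
    part₂ x y = Σℤ.sum λ a → c a *ᶻ (κ *ᶻ (spoke (suc a) x y -ᶻ spoke V₁ x y))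
    part₃ : Weight
    part₃ x y = -ᶻ ρ *ᶻ (κ *ᶻ (edge V₁ V₂ x y -ᶻ edge V₀ V₂ x y))

    R-moveκ : ∀ {v w z} → v ≢ w → v ≢ z → w ≢ z → Realizable (λ x y → κ *ᶻ (edge v z x y -ᶻ edge w z x y))
    R-moveκ {v} {w} {z} vw vz wz = R-ext (λ x y _ → cong (_*ᶻ (edge v z x y -ᶻ edge w z x y)) κ≡) (R-move vw vz wz)

    R₁ : Realizable part₁
    R₁ = R-sum λ a → R-sum λ b → term a b
      where
      term : ∀ a b → Realizable (λ x y → p a b *ᶻ reduced (suc a) (suc b) x y)
      term a b with toℕ a <? toℕ b
      ... | yes lt = R-scale (w (suc a) (suc b)) (R-reduced {suc a} {suc b} (λ ()) (λ ()) λ e → ℕₚ.<-irrefl (cong toℕ (Fₚ.suc-injective e)) lt)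
      ... | no _   = R-ext (λ x y _ → sym (ℤₚ.*-zeroˡ (reduced (suc a) (suc b) x y))) R-0
    R₂ : Realizable part₂
    R₂ = R-sum λ a → R-scale (c a) (term a)
      where
      term : ∀ a → Realizable (λ x y → κ *ᶻ (spoke (suc a) x y -ᶻ spoke V₁ x y))
      term zero    = R-ext (λ x y _ → lemma (κ) (spoke V₁ x y)) R-0
        where lemma : ∀ k s → + 0 ≡ k *ᶻ (s -ᶻ s)
              lemma = ℤS.solve-∀
      term (suc a) = R-moveκ {suc (suc a)} {V₁} {V₀} (λ ()) (λ ()) (λ ())
    R₃ : Realizable part₃
    R₃ = R-scale (-ᶻ ρ) (R-moveκ {V₁} {V₀} {V₂} (λ ()) (λ ()) (λ ()))

    E₁ : Weight
    E₁ x y = Σℤ.sum λ a → Σℤ.sum λ b → p a b *ᶻ edge (suc a) (suc b) x y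
    S₁ : Weight
    S₁ x y = Σℤ.sum λ a → spoke (suc a) x y

    part₁-value : ∀ x y → part₁ x y ≡ (E₁ x y -ᶻ Σℤ.sum (λ a → D a *ᶻ spoke (suc a) x y)) -ᶻ W *ᶻ T x y
    part₁-value x y = begin
      part₁ x y
        ≡⟨ sum-cong (λ a → trans (sum-cong λ b → lemma (p a b) (edge (suc a) (suc b) x y) (spoke (suc a) x y) (spoke (suc b) x y) (T x y))
             (trans (sumℤ-- (λ b → p a b *ᶻ edge (suc a) (suc b) x y -ᶻ p a b *ᶻ (f a +ᶻ f b)) (λ b → p a b *ᶻ T x y))
               (cong (_-ᶻ Σℤ.sum (λ b → p a b *ᶻ T x y)) (sumℤ-- (λ b → p a b *ᶻ edge (suc a) (suc b) x y) (λ b → p a b *ᶻ (f a +ᶻ f b)))))) ⟩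
      Σℤ.sum (λ a → (e a -ᶻ s a) -ᶻ t a)
        ≡⟨ trans (sumℤ-- (λ a → e a -ᶻ s a) t) (cong (_-ᶻ Σℤ.sum t) (sumℤ-- e s)) ⟩
      (E₁ x y -ᶻ Σℤ.sum s) -ᶻ Σℤ.sum t
        ≡⟨ cong₂ (λ u v → (E₁ x y -ᶻ u) -ᶻ v) (row-col f)
             (trans (sum-cong λ a → sum-scaleʳ (T x y) (p a)) (sum-scaleʳ (T x y) (λ a → Σℤ.sum (p a)))) ⟩
      (E₁ x y -ᶻ Σℤ.sum (λ a → D a *ᶻ f a)) -ᶻ W *ᶻ T x y ∎
      where
      open ≡-Reasoning
      f e s t : Fin r₁ → ℤ
      f a = spoke (suc a) x y
      e a = Σℤ.sum λ b → p a b *ᶻ edge (suc a) (suc b) x y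
      s a = Σℤ.sum λ b → p a b *ᶻ (f a +ᶻ f b)
      t a = Σℤ.sum λ b → p a b *ᶻ T x y
      lemma : ∀ p e f g t → p *ᶻ (((e -ᶻ f) -ᶻ g) -ᶻ t) ≡ (p *ᶻ e -ᶻ p *ᶻ (f +ᶻ g)) -ᶻ p *ᶻ t
      lemma = ℤS.solve-∀

    part₂-value : ∀ x y → part₂ x y ≡ (Σℤ.sum (λ a → D a *ᶻ spoke (suc a) x y) +ᶻ S₁ x y) +ᶻ R *ᶻ spoke V₁ x y
    part₂-value x y = begin
      part₂ x y
        ≡⟨ sum-cong (λ a → trans (lemma (c a) (κ) (f a) (spoke V₁ x y))
             (cong₂ _-ᶻ_ (trans (cong (_*ᶻ f a) (sym (D-value a))) (lemma′ (D a) (f a))) refl)) ⟩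
      Σℤ.sum (λ a → (D a *ᶻ f a +ᶻ f a) -ᶻ (κ *ᶻ c a) *ᶻ spoke V₁ x y)
        ≡⟨ sumℤ-- (λ a → D a *ᶻ f a +ᶻ f a) (λ a → (κ *ᶻ c a) *ᶻ spoke V₁ x y) ⟩
      Σℤ.sum (λ a → D a *ᶻ f a +ᶻ f a) -ᶻ Σℤ.sum (λ a → (κ *ᶻ c a) *ᶻ spoke V₁ x y)
        ≡⟨ cong₂ _-ᶻ_ (Σℤ.∑-distrib-+ (λ a → D a *ᶻ f a) f)
             (trans (sum-scaleʳ (spoke V₁ x y) (λ a → κ *ᶻ c a)) (cong (_*ᶻ spoke V₁ x y) (trans (sum-scale (κ) c) sum-c))) ⟩
      (Σℤ.sum (λ a → D a *ᶻ f a) +ᶻ S₁ x y) -ᶻ (-ᶻ R) *ᶻ spoke V₁ x y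
        ≡⟨ lemma″ (Σℤ.sum (λ a → D a *ᶻ f a) +ᶻ S₁ x y) (R) (spoke V₁ x y) ⟩
      (Σℤ.sum (λ a → D a *ᶻ f a) +ᶻ S₁ x y) +ᶻ R *ᶻ spoke V₁ x y ∎
      where
      open ≡-Reasoning
      f : Fin r₁ → ℤ
      f a = spoke (suc a) x y
      lemma : ∀ c k f s → c *ᶻ (k *ᶻ (f -ᶻ s)) ≡ (k *ᶻ c) *ᶻ f -ᶻ (k *ᶻ c) *ᶻ s
      lemma = ℤS.solve-∀
      lemma′ : ∀ d f → (d +ᶻ + 1) *ᶻ f ≡ d *ᶻ f +ᶻ f
      lemma′ = ℤS.solve-∀
      lemma″ : ∀ a r s → a -ᶻ (-ᶻ r) *ᶻ s ≡ a +ᶻ r *ᶻ s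
      lemma″ = ℤS.solve-∀

    T-value : ∀ x y → T x y ≡ (edge V₁ V₂ x y -ᶻ edge V₀ V₂ x y) -ᶻ spoke V₁ x y
    T-value x y = cong (λ z → (edge V₁ V₂ x y -ᶻ z) -ᶻ spoke V₁ x y) (ℤₚ.+-comm (δ V₂ x *ᶻ δ V₀ y) (δ V₀ x *ᶻ δ V₂ y))

    collect : ∀ {p₁ p₂ p₃ E Δ S t s d W} → p₁ ≡ (E -ᶻ Δ) -ᶻ W *ᶻ t → p₂ ≡ (Δ +ᶻ S) +ᶻ R *ᶻ s → p₃ ≡ -ᶻ ρ *ᶻ (κ *ᶻ d) →
              W ≡ -ᶻ R → t ≡ d -ᶻ s → (p₁ +ᶻ p₂) +ᶻ p₃ ≡ E +ᶻ S
    collect {E = E} {Δ} {S} {s = s} {d} refl refl refl refl refl =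
      trans (cong (λ r → (((E -ᶻ Δ) -ᶻ (-ᶻ r) *ᶻ (d -ᶻ s)) +ᶻ ((Δ +ᶻ S) +ᶻ r *ᶻ s)) +ᶻ (-ᶻ ρ *ᶻ (κ *ᶻ d))) r₁ᶻ) (lemma E Δ S ρ κ s d)
      where lemma : ∀ E Δ S ρ κ s d → (((E -ᶻ Δ) -ᶻ (-ᶻ (ρ *ᶻ κ)) *ᶻ (d -ᶻ s)) +ᶻ ((Δ +ᶻ S) +ᶻ (ρ *ᶻ κ) *ᶻ s)) +ᶻ (-ᶻ ρ *ᶻ (κ *ᶻ d)) ≡ E +ᶻ S
            lemma = ℤS.solve-∀

    combined : ∀ x y → (part₁ x y +ᶻ part₂ x y) +ᶻ part₃ x y ≡ E₁ x y +ᶻ S₁ x y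
    combined x y = collect {p₁ = part₁ x y} {part₂ x y} {part₃ x y} {E₁ x y} {Σℤ.sum λ a → D a *ᶻ spoke (suc a) x y} {S₁ x y}
      {T x y} {spoke V₁ x y} {edge V₁ V₂ x y -ᶻ edge V₀ V₂ x y} {W} (part₁-value x y) (part₂-value x y) refl W-value (T-value x y)

    E₁+S₁ : ∀ x y → toℕ y < toℕ x → E₁ x y +ᶻ S₁ x y ≡ w x y
    E₁+S₁ zero y ()
    E₁+S₁ (suc x) zero _ = trans (cong₂ _+ᶻ_ zeros ones) (sym (trans (cong (λ z → + 1 -ᶻ N *ᶻ (m (suc x) *ᶻ z)) m₀) (lemma (N) (m (suc x)))))
      where
      lemma : ∀ N m → + 1 -ᶻ N *ᶻ (m *ᶻ + 0) ≡ + 0 +ᶻ + 1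
      lemma = ℤS.solve-∀
      lemma₀ : ∀ p a b → p *ᶻ (a *ᶻ + 0 +ᶻ b *ᶻ + 0) ≡ + 0 *ᶻ p
      lemma₀ = ℤS.solve-∀
      zeros : E₁ (suc x) zero ≡ + 0
      zeros = trans (sum-cong λ a → trans (sum-cong λ b → lemma₀ (p a b) (δ a x) (δ b x)) (trans (sum-scale (+ 0) (p a)) (ℤₚ.*-zeroˡ (Σℤ.sum (p a)))))
        (trans (sum-cong {r₁} λ a → sym (ℤₚ.*-zeroˡ (+ 1))) (trans (sum-scale {r₁} (+ 0) (λ _ → + 1)) (ℤₚ.*-zeroˡ (Σℤ.sum {r₁} (λ _ → + 1)))))
      lemma₁ : ∀ d → d *ᶻ + 1 +ᶻ + 0 *ᶻ + 0 ≡ + 1 *ᶻ d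
      lemma₁ = ℤS.solve-∀
      ones : S₁ (suc x) zero ≡ + 1
      ones = trans (sum-cong λ a → lemma₁ (δ a x)) (sum-δ (λ _ → + 1) x)
    E₁+S₁ (suc x) (suc y) lt = trans (cong₂ _+ᶻ_ main zeros) (trans (ℤₚ.+-identityʳ _) (trans (p-sum x y)
        (trans (cong (λ z → w (suc x) (suc y) -ᶻ w (suc x) (suc y) *ᶻ z) (δ-≢ λ e → ℕₚ.<-irrefl (cong toℕ e) (ℕₚ.≤-pred lt))) (lemma (w (suc x) (suc y))))))
      where
      lemma : ∀ w → w -ᶻ w *ᶻ + 0 ≡ w
      lemma = ℤS.solve-∀
      lemma₀ : ∀ d d′ → d *ᶻ + 0 +ᶻ + 0 *ᶻ d′ ≡ + 0 *ᶻ d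
      lemma₀ = ℤS.solve-∀
      zeros : S₁ (suc x) (suc y) ≡ + 0
      zeros = trans (sum-cong λ a → lemma₀ (δ a x) (δ a y)) (trans (sum-scale (+ 0) (λ a → δ a x)) (ℤₚ.*-zeroˡ (Σℤ.sum λ a → δ a x)))
      lemma₁ : ∀ p a b a′ b′ → p *ᶻ (a *ᶻ b′ +ᶻ b *ᶻ a′) ≡ (p *ᶻ b′) *ᶻ a +ᶻ (p *ᶻ b) *ᶻ a′
      lemma₁ = ℤS.solve-∀
      main : E₁ (suc x) (suc y) ≡ p x y +ᶻ p y x
      main = trans (sum-cong λ a → trans (sum-cong λ b → lemma₁ (p a b) (δ a x) (δ b x) (δ a y) (δ b y))
          (trans (Σℤ.∑-distrib-+ (λ b → (p a b *ᶻ δ b y) *ᶻ δ a x) (λ b → (p a b *ᶻ δ b x) *ᶻ δ a y))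
            (cong₂ _+ᶻ_ (trans (sum-scaleʳ (δ a x) (λ b → p a b *ᶻ δ b y)) (cong (_*ᶻ δ a x) (sum-δ (p a) y)))
                        (trans (sum-scaleʳ (δ a y) (λ b → p a b *ᶻ δ b x)) (cong (_*ᶻ δ a y) (sum-δ (p a) x))))))
        (trans (Σℤ.∑-distrib-+ (λ a → p a y *ᶻ δ a x) (λ a → p a x *ᶻ δ a y)) (cong₂ _+ᶻ_ (sum-δ (λ a → p a y) x) (sum-δ (λ a → p a x) y)))

    R-one : Realizable (λ _ _ → + 1)
    R-one = R-ext {λ x y → w x y +ᶻ N *ᶻ (m x *ᶻ m y)} (λ x y lt → lemma (N *ᶻ (m x *ᶻ m y)))
      (R-+ {w} R-w (R-scale N {λ x y → m x *ᶻ m y} (R-tuple (proj₁ B₀) (proj₁ (proj₂ B₀)))))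
      where
      lemma : ∀ z → (+ 1 -ᶻ z) +ᶻ z ≡ + 1
      lemma = ℤS.solve-∀
      R-w : Realizable w
      R-w = R-ext {λ x y → (part₁ x y +ᶻ part₂ x y) +ᶻ part₃ x y} (λ x y lt → trans (combined x y) (E₁+S₁ x y lt))
        (R-+ {λ x y → part₁ x y +ᶻ part₂ x y} {part₃} (R-+ {part₁} {part₂} R₁ R₂) R₃)

  coverOf : Realizable (λ _ _ → + 1) → ∀ Q → 1 ≤ Q →
            Σ (List (Block r k)) λ bs → Σ ℕ λ n → 1 ≤ n × (∀ {x y} → x ≢ y → multiplicity bs x y ≡ 1 + Q * n * multiplicity (allBlocks {r} {k}) x y)
  -- The surplus of n copies of the family of all blocks is topped up to Q (n + 1) copies, a
  -- multiple of `Q`; taking n + 1 keeps the factor positive.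
  coverOf (realized bs n e) Q 1≤Q with ℕₚ.m≤n⇒∃[o]m+o≡n {n} {Q * suc n} (ℕₚ.≤-trans (ℕₚ.n≤1+n n) (ℕₚ.≤-trans (ℕₚ.≤-reflexive (sym (ℕₚ.*-identityˡ (suc n)))) (ℕₚ.*-monoˡ-≤ (suc n) 1≤Q)))
  ... | o , eq with extend o bs
  ... | cs , g = cs , suc n , s≤s z≤n , λ {x} {y} → constant x y
    where
    below : ∀ x y → toℕ y < toℕ x → multiplicity cs x y ≡ 1 + Q * suc n * U x y
    below x y lt = trans (g x y) (trans (cong (λ z → z + o * U x y) (ℤₚ.+-injective (e x y lt)))
      (cong suc (trans (sym (ℕₚ.*-distribʳ-+ (U x y) n o)) (cong (λ z → z * U x y) eq))))
    sym-hits : ∀ (ds : List (Block r k)) x y → multiplicity ds x y ≡ multiplicity ds y x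
    sym-hits ds x y = total-cong (λ b → cong bit (Boolₚ.∧-comm ⌊ occurs? (proj₁ b) x ⌋ ⌊ occurs? (proj₁ b) y ⌋)) ds
    constant : ∀ x y → x ≢ y → multiplicity cs x y ≡ 1 + Q * suc n * U x y
    constant x y n′ with ℕₚ.<-cmp (toℕ x) (toℕ y)
    ... | tri> _ _ gt = below x y gt
    ... | tri≈ _ q _  = ⊥-elim (n′ (Fₚ.toℕ-injective q))
    ... | tri< lt _ _ = trans (sym-hits cs x y) (trans (below y x lt) (cong (λ z → 1 + Q * suc n * z) (sym-hits allBlocks y x)))

  signedCover : (ρ N : ℕ) → 2 + r₂ ≡ ρ * suc k₂ → (3 + r₂) * (2 + r₂) ≡ N * ((2 + k₂) * suc k₂) → ∀ Q → 1 ≤ Q →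
                Σ (List (Block r k)) λ bs → Σ ℕ λ n → 1 ≤ n × (∀ {x y} → x ≢ y → multiplicity bs x y ≡ 1 + Q * n * multiplicity (allBlocks {r} {k}) x y)
  signedCover ρ N r₁≡ rr₁≡ = coverOf (go (+ ρ) (+ N) (+ suc k₂) (+ r₁) refl refl
      (trans (cong +_ r₁≡) (ℤₚ.pos-* ρ (suc k₂)))
      (trans (sym (ℤₚ.pos-* r r₁)) (trans (cong +_ rr₁≡) (trans (ℤₚ.pos-* N _) (cong (+ N *ᶻ_) (ℤₚ.pos-* k (suc k₂)))))))
    where
    go : (ρ N κ R : ℤ) → + suc k₂ ≡ κ → + r₁ ≡ R → R ≡ ρ *ᶻ κ → (+ 1 +ᶻ R) *ᶻ R ≡ N *ᶻ ((+ 1 +ᶻ κ) *ᶻ κ) → Realizable (λ _ _ → + 1)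
    go = Elimination.R-one

-- Group divisible designs from uniform covers

abstract
  allBlocks-uniform : ∀ {k u} → 2 ≤ k → k ≤ u → Σ ℕ λ l → 0 < l × (∀ {x y} → x ≢ y → multiplicity (allBlocks {u} {k}) x y ≡ l)
  allBlocks-uniform {k} {u} 2≤k k≤u = multiplicity (allBlocks {u} {k}) x₀ x₁ , positive , λ n → allBlocks-constant {u} {k} n x₀≢x₁
    where
    p₀ p₁ : Fin k
    p₀ = fromℕ< (ℕₚ.≤-trans (s≤s z≤n) 2≤k)
    p₁ = fromℕ< 2≤k
    x₀ x₁ : Fin u
    x₀ = F.inject≤ p₀ k≤u
    x₁ = F.inject≤ p₁ k≤u
    x₀≢x₁ : x₀ ≢ x₁
    x₀≢x₁ e with trans (sym (Fₚ.toℕ-fromℕ< (ℕₚ.≤-trans (s≤s z≤n) 2≤k))) (trans (cong toℕ (Fₚ.inject≤-injective k≤u k≤u p₀ p₁ e)) (Fₚ.toℕ-fromℕ< 2≤k))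
    ... | ()
    v : Vec (Fin u) k
    v = tabulate λ p → F.inject≤ p k≤u
    lk : ∀ p → lookup v p ≡ F.inject≤ p k≤u
    lk = Vₚ.lookup∘tabulate _
    b : Block u k
    b = v , λ p q e → Fₚ.inject≤-injective k≤u k≤u p q (trans (sym (lk p)) (trans e (lk q)))
    positive : 0 < multiplicity (allBlocks {u} {k}) x₀ x₁
    positive = ℕₚ.≤-trans (ℕₚ.≤-reflexive (sym (cong bit (⇒covers v (p₀ , lk p₀) (p₁ , lk p₁))))) (hits≤allBlocks b x₀ x₁)

record InflatedGDD (k : ℕ) {n} (G : FinGroup n) (c l : ℕ) : Set₁ where
  field
    exponent : ℕ
  size = (n * l) ^ suc exponent
  field
    gdd : SymmetricGDD k G c size
    td  : TD (n * c) size

inflatedGDD : ∀ {n k c l} (G : FinGroup n) → NoInvolution G → 2 ≤ n * c →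
              (bs : List (Block (n * c) k)) → 0 < l → (∀ {x y} → x ≢ y → multiplicity bs x y ≡ l) → InflatedGDD k G c l
inflatedGDD {n} {k} {c} {l} G noInv 2≤u bs 0<l const with labelledTD (n * c) (n * l) (ℕₚ.≤-trans (s≤s z≤n) 2≤u) (ℕₚ.*-mono-≤ 0<n 0<l)
  where 0<n : 0 < n
        0<n = ℕₚ.≤-trans (s≤s z≤n) (Fₚ.toℕ<n (FinGroup.ε G))
... | L , e , eq = record
  { exponent = ℕ.pred (suc e * J)
  ; gdd = subst (SymmetricGDD k G c) size≡ (symmetricGDD G noInv 2≤u (cover-iso Fₚ.*↔× (listCover bs 0<l const)) 0<l L)
  ; td = subst (TD (n * c)) size≡ (td-power (LabelledTD.td L) J) }
  where
  J = n * ((n * c) * (n * c))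
  0<J : 0 < suc e * J
  0<J = ℕₚ.*-mono-≤ {1} {suc e} (s≤s z≤n) (ℕₚ.*-mono-≤ 0<n (ℕₚ.*-mono-≤ 0<u 0<u))
    where 0<u : 0 < n * c
          0<u = ℕₚ.≤-trans (s≤s z≤n) 2≤u
          0<n : 0 < n
          0<n = ℕₚ.≤-trans (s≤s z≤n) (Fₚ.toℕ<n (FinGroup.ε G))
  size≡ : LabelledTD.order L ^ J ≡ (n * l) ^ suc (ℕ.pred (suc e * J))
  size≡ = trans (cong (_^ J) eq) (trans (ℕₚ.^-*-assoc (n * l) (suc e) J) (cong ((n * l) ^_) (sym (ℕₚ.suc-pred (suc e * J) {{>-nonZero 0<J}}))))

trivialGroup : FinGroup 1
trivialGroup = record
  { _∙_ = λ _ _ → zero ; ε = zero ; _⁻¹ = λ _ → zero ; assoc = λ _ _ _ → refl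
  ; idˡ = λ { zero → refl } ; idʳ = λ { zero → refl } ; invˡ = λ { zero → refl } ; invʳ = λ { zero → refl } }

trivial-odd : NoInvolution trivialGroup
trivial-odd zero _ = refl

-- The lift for the trivial group. Its groups have size a power of the multiplicity `l`, so a cover
-- with l ≡ 1 modulo some Q yields groups of size ≡ 1 modulo Q.
coverGDD : ∀ {k u l} → 2 ≤ u → (bs : List (Block u k)) → 0 < l → (∀ {x y} → x ≢ y → multiplicity bs x y ≡ l) →
           Σ ℕ λ e → GDD k u (l ^ suc e) × TD u (l ^ suc e)
coverGDD {k} {u} {l} 2≤u bs 0<l const = I.exponent , subst (GDD k u) size≡ gdd , subst (TD u) size≡ (subst (λ u → TD u I.size) (ℕₚ.*-identityˡ u) I.td)
  where
  bs′ : List (Block (1 * u) k)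
  bs′ = subst (λ u → List (Block u k)) (sym (ℕₚ.*-identityˡ u)) bs
  const′ : ∀ {x y} → x ≢ y → multiplicity bs′ x y ≡ l
  const′ = go (sym (ℕₚ.*-identityˡ u))
    where go : ∀ {u′} (e : u ≡ u′) {x y} → x ≢ y → multiplicity (subst (λ u → List (Block u k)) e bs) x y ≡ l
          go refl = const
  module I = InflatedGDD (inflatedGDD {1} {k} {u} {l} trivialGroup trivial-odd (subst (2 ≤_) (sym (ℕₚ.*-identityˡ u)) 2≤u) bs′ 0<l const′)
  size≡ : I.size ≡ l ^ suc I.exponent
  size≡ = cong (_^ suc I.exponent) (ℕₚ.*-identityˡ l)
  gdd : GDD k u I.size
  gdd = decomp-iso (mk↔ₛ′ (λ { ((_ , x) , a) → x , a }) (λ { (x , a) → (zero , x) , a }) (λ _ → refl) (λ { ((zero , _) , _) → refl }))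
          (λ n e → n (point-≡ e)) (λ n e → n (cong proj₂ e)) (SymmetricGDD.decomp I.gdd)
    where point-≡ : ∀ {x y : Fin 1 × Fin u} → proj₂ x ≡ proj₂ y → x ≡ y
          point-≡ {zero , _} {zero , _} refl = refl

abstract
  completeGDD : ∀ {k u} → 2 ≤ k → k ≤ u → Σ ℕ λ N → 0 < N × GDD k u N × TD u N
  completeGDD {k} {u} 2≤k k≤u with allBlocks-uniform 2≤k k≤u
  ... | l , 0<l , const with coverGDD (ℕₚ.≤-trans 2≤k k≤u) (allBlocks {u} {k}) 0<l const
  ... | e , D , T = l ^ suc e , ℕₚ.m^n>0 l {{>-nonZero 0<l}} (suc e) , D , T

abstract
  -- Inflation needs more than a common multiple of the group sizes: each quotient has to carry a
  -- transversal design as well. The product of the sizes has both properties.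
  gdd-product : ∀ {k} (N : ℕ → ℕ) → (∀ i → 0 < N i) → (∀ i → TD k (N i)) → ∀ m →
                Σ ℕ λ M → 0 < M × (∀ i → i < m → Σ ℕ λ q → TD k q × N i * q ≡ M) × TD k M
  gdd-product {k} N pos T zero = 1 , s≤s z≤n , (λ _ ()) , td-one
  gdd-product {k} N pos T (suc m) with gdd-product {k} N pos T m
  ... | M , 0<M , f , TM = M * N m , ℕₚ.*-mono-≤ 0<M (pos m) , g , td-product TM (T m)
    where
    g : ∀ i → i < suc m → Σ ℕ λ q → TD k q × N i * q ≡ M * N m
    g i lt with i ℕ.≟ m
    ... | yes refl = M , TM , ℕₚ.*-comm (N i) M
    ... | no n with f i (ℕₚ.≤∧≢⇒< (ℕₚ.≤-pred lt) n)
    ... | q , Tq , e = q * N m , td-product Tq (T m) , trans (sym (ℕₚ.*-assoc (N i) q (N m))) (cong (λ z → z * N m) e)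

factorial-one : ∀ {d n} x → 0 < d → d ≤ n → OneModulo d (1 + n ! * x)
factorial-one {d} {n} x 0<d d≤n with Div.∣-trans (d∣d! 0<d) (Div.m≤n⇒m!∣n! d≤n)
  where d∣d! : ∀ {d} → 0 < d → d ∣ d !
        d∣d! {suc d} _ = Div.m∣m*n (d !)
... | divides q e = q * x , cong suc (trans (cong (λ z → z * x) e) (lemma q d x))
  where lemma : ∀ q d x → (q * d) * x ≡ d * (q * x)
        lemma = ℕS.solve-∀

factorialTD : ∀ u x → TD (suc u) (1 + u ! * x)
factorialTD u x = Desarguesian.td λ d 0<d d≤u → factorial-one x 0<d (ℕₚ.≤-pred d≤u)

-- By induction from an initial segment, writing m = k p + s with p ≡ 1 (mod k!).
gdd-all : ∀ k → 2 ≤ k → Σ ℕ λ H → 0 < H × (∀ m → k ≤ m → GDD k m H)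
gdd-all k 2≤k = H , proj₁ (proj₂ P) , (λ m k≤m → build m k≤m (<-wellFounded m))
  where
  0<k : 0 < k
  0<k = ℕₚ.≤-trans (s≤s z≤n) 2≤k
  f = k !
  kf = k * f
  instance nz : NonZero kf
           nz = >-nonZero (ℕₚ.*-mono-≤ 0<k (ℕₚ.1≤n! k))
  bound : ℕ
  -- Beyond k + bound the quotient x is at least k + kf, whence s = k + y < k + kf ≤ p, as
  -- truncation requires.
  bound = k + kf * (k + kf)
  C : ∀ i → Σ ℕ λ N → 0 < N × GDD k (k + i) N × TD (k + i) N
  C i = completeGDD 2≤k (ℕₚ.m≤m+n k i)
  P = gdd-product (λ i → proj₁ (C i)) (λ i → proj₁ (proj₂ (C i))) (λ i → td-restrict (ℕₚ.m≤m+n k i) (proj₂ (proj₂ (proj₂ (C i))))) (suc bound)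
  H = proj₁ P
  small : ∀ m → k ≤ m → m ≤ k + bound → GDD k m H
  small m k≤m le with ℕₚ.m≤n⇒∃[o]m+o≡n k≤m
  ... | o , refl with proj₁ (proj₂ (proj₂ P)) o (s≤s (ℕₚ.+-cancelˡ-≤ k o bound le))
  ... | q , T , e = subst (GDD k (k + o)) e (gdd-inflate (proj₁ (proj₂ (proj₂ (C o)))) T)
  build : ∀ m → k ≤ m → Acc _<_ m → GDD k m H
  build m k≤m (acc rec) with m ≤? k + bound
  ... | yes le = small m k≤m le
  ... | no nle with ℕₚ.m≤n⇒∃[o]m+o≡n (ℕₚ.≤-trans (ℕₚ.+-monoʳ-≤ k (ℕₚ.m≤m+n k (kf * (k + kf)))) (ℕₚ.<⇒≤ (ℕₚ.≰⇒> nle)))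
  ... | o , m≡ = subst (λ z → GDD k z H) m≡′
      (gdd-truncated (small k ℕₚ.≤-refl (ℕₚ.m≤m+n k bound)) (small (suc k) (ℕₚ.n≤1+n k) k+1≤) (factorialTD k x) s≤p
        (build p (ℕₚ.≤-trans (ℕₚ.m≤m+n k y) s≤p) (rec p<m)) (build (k + y) (ℕₚ.m≤m+n k y) (rec s<m)))
    where
    x = o / kf
    y = o % kf
    p = 1 + f * x
    k+1≤ : suc k ≤ k + bound
    k+1≤ = ℕₚ.≤-trans (ℕₚ.≤-reflexive (ℕₚ.+-comm 1 k)) (ℕₚ.+-monoʳ-≤ k (ℕₚ.≤-trans 0<k (ℕₚ.m≤m+n k _)))
    m≡′ : k * p + (k + y) ≡ m
    m≡′ = trans (lemma k f x y) (trans (cong (λ z → k + k + z) (sym (DM.m≡m%n+[m/n]*n o kf))) m≡)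
      where lemma : ∀ k f x y → k * (1 + f * x) + (k + y) ≡ k + k + (y + x * (k * f))
            lemma = ℕS.solve-∀
    o-large : kf * (k + kf) ≤ o
    o-large = ℕₚ.+-cancelˡ-≤ (k + k) _ _ (ℕₚ.≤-trans (ℕₚ.≤-reflexive (ℕₚ.+-assoc k k _)) (ℕₚ.≤-trans (ℕₚ.<⇒≤ (ℕₚ.≰⇒> nle)) (ℕₚ.≤-reflexive (sym m≡))))
    x-large : k + kf ≤ x
    x-large = ℕₚ.≤-trans (ℕₚ.≤-reflexive (sym (trans (cong (_/ kf) (ℕₚ.*-comm kf (k + kf))) (DM.m*n/n≡m (k + kf) kf)))) (DM./-monoˡ-≤ kf o-large)
    s≤p : k + y ≤ p
    s≤p = ℕₚ.≤-trans (ℕₚ.+-monoʳ-≤ k (ℕₚ.<⇒≤ (DM.m%n<n o kf))) (ℕₚ.≤-trans x-large (ℕₚ.≤-trans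
      (ℕₚ.≤-trans (ℕₚ.≤-reflexive (sym (ℕₚ.*-identityˡ x))) (ℕₚ.*-monoˡ-≤ x (ℕₚ.1≤n! k))) (ℕₚ.n≤1+n _)))
    p≤kp : p ≤ k * p
    p≤kp = ℕₚ.≤-trans (ℕₚ.≤-reflexive (sym (ℕₚ.*-identityˡ p))) (ℕₚ.*-monoˡ-≤ p 0<k)
    p<m : p < m
    p<m = ℕₚ.≤-trans (ℕₚ.≤-trans (ℕₚ.≤-reflexive (ℕₚ.+-comm 1 p)) (ℕₚ.+-mono-≤ p≤kp (ℕₚ.≤-trans 0<k (ℕₚ.m≤m+n k y)))) (ℕₚ.≤-reflexive m≡′)
    s<m : k + y < m
    s<m = ℕₚ.≤-trans (ℕₚ.+-monoˡ-≤ (k + y) (ℕₚ.≤-trans (s≤s z≤n) p≤kp)) (ℕₚ.≤-reflexive m≡′)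

-- Primes congruent to 1 modulo a given number

infixr 8 _^ᶻ_
_^ᶻ_ : ℤ → ℕ → ℤ
_^ᶻ_ = ℤ._^_

≈-^ : ∀ {n a b} m → a ≈[ n ] b → a ^ᶻ m ≈[ n ] b ^ᶻ m
≈-^ zero    p = ≈-refl
≈-^ (suc m) p = ≈-* p (≈-^ m p)

one-^ : ∀ m → (+ 1) ^ᶻ m ≡ + 1
one-^ = ℤₚ.^-zeroˡ

^ᶻ-* : ∀ a m n → a ^ᶻ (m * n) ≡ (a ^ᶻ m) ^ᶻ n
^ᶻ-* a m zero    = cong (a ^ᶻ_) (ℕₚ.*-zeroʳ m)
^ᶻ-* a m (suc n) = trans (cong (a ^ᶻ_) (ℕₚ.*-suc m n)) (trans (ℤₚ.^-distribˡ-+-* a m (m * n)) (cong (a ^ᶻ m *ᶻ_) (^ᶻ-* a m n)))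

pos-^ : ∀ a m → + (a ^ m) ≡ (+ a) ^ᶻ m
pos-^ a zero    = refl
pos-^ a (suc m) = trans (ℤₚ.pos-* a (a ^ m)) (cong (+ a *ᶻ_) (pos-^ a m))

*-^ᶻ : ∀ a b m → (a *ᶻ b) ^ᶻ m ≡ a ^ᶻ m *ᶻ b ^ᶻ m
*-^ᶻ a b zero    = refl
*-^ᶻ a b (suc m) = trans (cong ((a *ᶻ b) *ᶻ_) (*-^ᶻ a b m)) (lemma a b (a ^ᶻ m) (b ^ᶻ m))
  where lemma : ∀ a b c d → (a *ᶻ b) *ᶻ (c *ᶻ d) ≡ (a *ᶻ c) *ᶻ (b *ᶻ d)
        lemma = ℤS.solve-∀

≈0⇒∣ : ∀ {p n} → + n ≈[ p ] + 0 → p ∣ n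
≈0⇒∣ {p} {n} (mod (+ q) e) = divides q (ℤₚ.+-injective (trans e (trans (ℤₚ.+-identityˡ _) (sym (ℤₚ.pos-* q p)))))
≈0⇒∣ {p} {n} (mod -[1+ q ] e) = divides (suc q) (trans (cong ℤ.∣_∣ (trans e (ℤₚ.+-identityˡ (-[1+ q ] *ᶻ + p)))) (ℤₚ.abs-* -[1+ q ] (+ p)))

∣⇒≈0 : ∀ {p n} → p ∣ n → + n ≈[ p ] + 0
∣⇒≈0 {p} (divides q refl) = mod (+ q) (trans (ℤₚ.pos-* q p) (sym (ℤₚ.+-identityˡ _)))

module PrimeField (p′ : ℕ) (isPrime : Prime (suc p′)) where
  private
    p = suc p′

  unit : ∀ {a} → ¬ a ≈[ p ] + 0 → Unit p a
  unit {a} n with res {p} a in eq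
  ... | zero  = ⊥-elim (n (≈-trans (≈-sym (val-res {p} a)) (≈-reflexive (cong val eq))))
  ... | suc x with Cop.coprime-Bézout (Cop.prime⇒coprime {n = suc (toℕ x)} isPrime (s≤s (Fₚ.toℕ<n x)))
  ... | GCD.Bézout.+- u v e = -ᶻ + v , ≈-trans (≈-*ˡ (-ᶻ + v) a≈) (mod (-ᶻ + u) (lemma (+ v) (+ suc (toℕ x)) (+ u) (+ p)
          (trans (cong (+ 1 +ᶻ_) (sym (ℤₚ.pos-* v _))) (trans (cong +_ e) (ℤₚ.pos-* u p)))))
    where
    a≈ : a ≈[ p ] + suc (toℕ x)
    a≈ = ≈-trans (≈-sym (val-res {p} a)) (≈-reflexive (cong val eq))
    lemma : ∀ v x u p → + 1 +ᶻ v *ᶻ x ≡ u *ᶻ p → (-ᶻ v) *ᶻ x ≡ + 1 +ᶻ (-ᶻ u) *ᶻ p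
    lemma v x u p h = trans (l v x) (trans (cong (λ z → + 1 -ᶻ z) h) (l′ u p))
      where l : ∀ v x → (-ᶻ v) *ᶻ x ≡ + 1 -ᶻ (+ 1 +ᶻ v *ᶻ x)
            l = ℤS.solve-∀
            l′ : ∀ u p → + 1 -ᶻ u *ᶻ p ≡ + 1 +ᶻ (-ᶻ u) *ᶻ p
            l′ = ℤS.solve-∀
  ... | GCD.Bézout.-+ u v e = + v , ≈-trans (≈-*ˡ (+ v) a≈) (mod (+ u)
          (trans (sym (ℤₚ.pos-* v _)) (trans (cong +_ (sym e)) (cong (+ 1 +ᶻ_) (ℤₚ.pos-* u p)))))
    where
    a≈ : a ≈[ p ] + suc (toℕ x)
    a≈ = ≈-trans (≈-sym (val-res {p} a)) (≈-reflexive (cong val eq))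

  private
    1≉0 : ¬ + 1 ≈[ p ] + 0
    1≉0 e = Pr.¬prime[1] (subst Prime (Div.∣1⇒≡1 (≈0⇒∣ e)) isPrime)

  unit⇒≉0 : ∀ {a} → Unit p a → ¬ a ≈[ p ] + 0
  unit⇒≉0 {a} (b , u) z = 1≉0 (≈-trans (≈-sym u) (≈-trans (≈-*ˡ b z) (≈-reflexive (ℤₚ.*-zeroʳ b))))

  no-zero-divisors : ∀ {a b} → ¬ a ≈[ p ] + 0 → a *ᶻ b ≈[ p ] + 0 → b ≈[ p ] + 0
  no-zero-divisors {a} {b} n e = unit-cancel (unit n) (≈-trans e (≈-reflexive (sym (ℤₚ.*-zeroʳ a))))

  val-suc≉0 : ∀ (i : Fin p′) → ¬ val {p} (suc i) ≈[ p ] + 0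
  val-suc≉0 i e with val-injective {p} {suc i} {zero} e
  ... | ()

  -- Multiplication by a permutes the nonzero residues.
  fermat : ∀ a → ¬ a ≈[ p ] + 0 → a ^ᶻ p′ ≈[ p ] + 1
  fermat a a≉0 = ≈-trans (≈-reflexive (sym (ℤₚ.*-identityʳ _))) (≈-trans (≈-reflexive (ℤₚ.*-comm (a ^ᶻ p′) (+ 1)))
      (≈-trans (≈-reflexive (ℤₚ.*-identityˡ _)) (unit-cancel unit-P
        (≈-trans (≈-reflexive (ℤₚ.*-comm P (a ^ᶻ p′))) (≈-trans (≈-sym moved) (≈-reflexive (sym (ℤₚ.*-identityʳ P))))))))
    where
    u = unit a≉0
    b = proj₁ u
    b≉0 : ¬ b ≈[ p ] + 0
    b≉0 z = 1≉0 (≈-trans (≈-sym (proj₂ u)) (≈-trans (≈-* z (≈-refl {_} {a})) (≈-reflexive (ℤₚ.*-zeroˡ a))))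
    P : ℤ
    P = Πℤ.sum λ (i : Fin p′) → val {p} (suc i)
    step : ∀ c → ¬ c ≈[ p ] + 0 → (i : Fin p′) → Σ (Fin p′) λ j → val {p} (suc j) ≈[ p ] c *ᶻ val {p} (suc i)
    step c c≉0 i with res {p} (c *ᶻ val {p} (suc i)) in eq
    ... | zero  = ⊥-elim (val-suc≉0 i (no-zero-divisors c≉0 (≈-trans (≈-sym (val-res {p} _)) (≈-reflexive (cong val eq)))))
    ... | suc j = j , ≈-trans (≈-reflexive (cong val (sym eq))) (val-res {p} _)
    π : ∀ c → ¬ c ≈[ p ] + 0 → Fin p′ → Fin p′
    π c n i = proj₁ (step c n i)
    inverse : ∀ c d (nc : ¬ c ≈[ p ] + 0) (nd : ¬ d ≈[ p ] + 0) → c *ᶻ d ≈[ p ] + 1 → ∀ i → π c nc (π d nd i) ≡ i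
    inverse c d nc nd cd i = Fₚ.suc-injective (val-injective {p} (≈-trans (proj₂ (step c nc (π d nd i)))
      (≈-trans (≈-*ˡ c (proj₂ (step d nd i))) (≈-trans (≈-reflexive (sym (ℤₚ.*-assoc c d _)))
        (≈-trans (≈-* cd (≈-refl {_} {val {p} (suc i)})) (≈-reflexive (ℤₚ.*-identityˡ _)))))))
    scaled : ∀ {n} (f g : Fin n → ℤ) → (∀ i → f i ≈[ p ] a *ᶻ g i) → Πℤ.sum f ≈[ p ] a ^ᶻ n *ᶻ Πℤ.sum g
    scaled {zero}  f g h = ≈-refl
    scaled {suc n} f g h = ≈-trans (≈-* (h zero) (scaled (λ i → f (suc i)) (λ i → g (suc i)) (λ i → h (suc i))))
      (≈-reflexive (lemma a (g zero) (a ^ᶻ n) _))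
      where lemma : ∀ a g c r → (a *ᶻ g) *ᶻ (c *ᶻ r) ≡ (a *ᶻ c) *ᶻ (g *ᶻ r)
            lemma = ℤS.solve-∀
    moved : P ≈[ p ] a ^ᶻ p′ *ᶻ P
    moved = ≈-trans (≈-reflexive (Πℤ.sum-permute (λ i → val {p} (suc i)) (permutation (π a a≉0) (π b b≉0)
        (inverse a b a≉0 b≉0 (≈-trans (≈-reflexive (ℤₚ.*-comm a b)) (proj₂ u))) (inverse b a b≉0 a≉0 (proj₂ u)))))
      (scaled (λ i → val {p} (suc (π a a≉0 i))) (λ i → val {p} (suc i)) (λ i → proj₂ (step a a≉0 i)))
    unit-P : Unit p P
    unit-P = go (λ i → val {p} (suc i)) λ i → unit (val-suc≉0 i)
      where
      go : ∀ {n} (f : Fin n → ℤ) → (∀ i → Unit p (f i)) → Unit p (Πℤ.sum f)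
      go {zero}  f h = + 1 , ≈-refl
      go {suc n} f h with h zero | go (λ i → f (suc i)) (λ i → h (suc i))
      ... | c , ec | d , ed = c *ᶻ d , ≈-trans (≈-reflexive (lemma c d (f zero) _)) (≈-* ec ed)
        where lemma : ∀ c d x y → (c *ᶻ d) *ᶻ (x *ᶻ y) ≡ (c *ᶻ x) *ᶻ (d *ᶻ y)
              lemma = ℤS.solve-∀

prime-divisor : ∀ n → 1 < n → Σ ℕ λ p → Prime p × p ∣ n
prime-divisor n 1<n with factorise n {{>-nonZero (ℕₚ.<⇒≤ 1<n)}}
... | record { factors = [] ; isFactorisation = e } = ⊥-elim (ℕₚ.<-irrefl (sym e) 1<n)
... | record { factors = q ∷ qs ; isFactorisation = e ; factorsPrime = pq ∷ _ } = q , pq , subst (q ∣_) (sym e) (Div.m∣m*n _)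

prime-∣-^ : ∀ {p} → Prime p → ∀ a m → p ∣ a ^ m → p ∣ a
prime-∣-^ pp a zero    d = ⊥-elim (Pr.¬prime[1] (subst Prime (Div.∣1⇒≡1 d) pp))
prime-∣-^ pp a (suc m) d with Pr.euclidsLemma a (a ^ m) pp d
... | inj₁ e = e
... | inj₂ e = prime-∣-^ pp a m e


-- A prime r is cancelled from both numbers at a time. The hypothesis survives: for r itself one
-- power is lost on both sides, and powers of other primes are coprime to r.
prime-power-test : ∀ m n → 0 < m → (∀ r c → Prime r → r ^ c ∣ m → r ^ c ∣ n) → m ∣ n
prime-power-test m n 0<m h = go m n 0<m h (<-wellFounded m)
  where
  go : ∀ m n → 0 < m → (∀ r c → Prime r → r ^ c ∣ m → r ^ c ∣ n) → Acc _<_ m → m ∣ n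
  go m n 0<m h (acc rec) with 1 <? m
  ... | no n1 = subst (_∣ n) (ℕₚ.≤-antisym 0<m (ℕₚ.≮⇒≥ n1)) (Div.1∣ n)
  ... | yes 1<m with prime-divisor m 1<m
  ... | r , pr , divides m₁ refl with h r 1 pr (subst (_∣ m₁ * r) (sym (ℕₚ.*-identityʳ r)) (Div.n∣m*n m₁))
  ... | divides n₁ refl = subst (m₁ * r ∣_) (cong (λ z → n₁ * z) (sym (ℕₚ.*-identityʳ r))) (Div.*-monoˡ-∣ r (go m₁ n₁ 0<m₁ test (rec m₁<m)))
    where
    instance r≢0 : NonZero r
             r≢0 = Pr.prime⇒nonZero pr
    0<m₁ : 0 < m₁
    0<m₁ = ℕₚ.n≢0⇒n>0 λ e → ℕₚ.<-irrefl (sym (cong (λ z → z * r) e)) 0<m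
    m₁<m : m₁ < m₁ * r
    m₁<m = ℕₚ.m<m*n m₁ r {{>-nonZero 0<m₁}} (ℕ.nonTrivial⇒n>1 r {{Pr.prime⇒nonTrivial pr}})
    comm : n₁ * (r * 1) ≡ r * n₁
    comm = trans (cong (λ z → n₁ * z) (ℕₚ.*-identityʳ r)) (ℕₚ.*-comm n₁ r)
    test : ∀ s c → Prime s → s ^ c ∣ m₁ → s ^ c ∣ n₁
    test s c ps d with s ℕ.≟ r
    ... | yes refl = Div.*-cancelˡ-∣ r (subst (r * r ^ c ∣_) comm (h r (suc c) pr (subst (r * r ^ c ∣_) (ℕₚ.*-comm r m₁) (Div.*-monoʳ-∣ r d))))
    ... | no s≢r = Cop.coprime-divisor coprime (subst (s ^ c ∣_) comm (h s c ps (Div.∣-trans d (Div.m∣m*n r))))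
      where
      coprime : Cop.Coprime (s ^ c) r
      coprime {d} (a , b) with Pr.prime⇒irreducible pr b
      ... | inj₁ e = e
      ... | inj₂ refl with Pr.prime⇒irreducible ps (prime-∣-^ pr s c a)
      ... | inj₁ e = e
      ... | inj₂ e = ⊥-elim (s≢r (sym e))

^-∣ : ∀ r {m n} → m ≤ n → r ^ m ∣ r ^ n
^-∣ r {m} le with ℕₚ.m≤n⇒∃[o]m+o≡n le
... | o , refl = divides (r ^ o) (trans (ℕₚ.^-distribˡ-+-* r m o) (ℕₚ.*-comm (r ^ m) (r ^ o)))

geometric : ℕ → ℕ → ℕ
geometric t zero    = 0
geometric t (suc m) = 1 + (1 + t) * geometric t m

geometric-sum : ∀ t m → (1 + t) ^ m ≡ 1 + t * geometric t m
geometric-sum t zero    = cong suc (sym (ℕₚ.*-zeroʳ t))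
geometric-sum t (suc m) = trans (cong (λ z → (1 + t) * z) (geometric-sum t m)) (lemma t (geometric t m))
  where lemma : ∀ t g → (1 + t) * (1 + t * g) ≡ 1 + t * (1 + (1 + t) * g)
        lemma = ℕS.solve-∀

geometric-mod : ∀ t m → Σ ℕ λ h → geometric t m ≡ m + t * h
geometric-mod t zero = 0 , sym (ℕₚ.*-zeroʳ t)
geometric-mod t (suc m) with geometric-mod t m
... | h , e = h + m + t * h , trans (cong (λ z → 1 + (1 + t) * z) e) (lemma t m h)
  where lemma : ∀ t m h → 1 + (1 + t) * (m + t * h) ≡ 1 + m + t * (h + m + t * h)
        lemma = ℕS.solve-∀

n<2^n : ∀ n → n < 2 ^ n
n<2^n zero    = s≤s z≤n
n<2^n (suc n) = ℕₚ.≤-trans (ℕₚ.+-mono-≤ (ℕₚ.m^n>0 2 n) (n<2^n n)) (ℕₚ.≤-reflexive (cong (λ z → 2 ^ n + z) (sym (ℕₚ.+-identityʳ (2 ^ n)))))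

-- Removing from a^E − 1 its common factors with a^(E/r^x) − 1 for the primes r dividing e leaves a number
-- greater than 1; modulo its prime divisors, a has order divisible by e.
module _ (e₀ B : ℕ) (0<e₀ : 0 < e₀) where
  private
    instance
      e₀≢0 : NonZero e₀
      e₀≢0 = >-nonZero 0<e₀
    -- With this x the exponents E / r^x for the primes r dividing e₀ add up to at most (e₀ + 1) E /
    -- 2^x < E, so removing the common factors cannot exhaust a^E - 1.
    x = suc e₀
    E = e₀ ^ x * e₀
    0<E : 0 < E
    0<E = ℕₚ.*-mono-≤ (ℕₚ.m^n>0 e₀ x) 0<e₀
    -- No prime factor of a^E - 1 divides a. The factor `E` therefore keeps the prime from dividing
    -- e₀, the factor B! makes it larger than `B`, and a ≥ 3 gives room for a^S < a^E - 1.
    a = 3 * (E * (B !))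
    3≤a : 3 ≤ a
    3≤a = ℕₚ.*-monoʳ-≤ 3 (ℕₚ.*-mono-≤ 0<E (ℕₚ.1≤n! B))
    instance
      a≢0 : NonZero a
      a≢0 = >-nonZero (ℕₚ.≤-trans (s≤s z≤n) 3≤a)
    abstract
      minus-one : ∀ m → Σ ℕ λ t → a ^ m ≡ 1 + t
      minus-one m with ℕₚ.m≤n⇒∃[o]m+o≡n (ℕₚ.m^n>0 a m)
      ... | o , eq = o , sym eq
    T = proj₁ (minus-one E)
    T≡ : a ^ E ≡ 1 + T
    T≡ = proj₂ (minus-one E)

    E-split : ∀ {r e} → e₀ ≡ e * r → E ≡ (e ^ x * e₀) * r ^ x
    E-split {r} {e} eq = trans (cong (λ z → z ^ x * e₀) eq) (trans (cong (λ z → z * e₀) (^-distribʳ-* x e r)) (lemma (e ^ x) (r ^ x) e₀))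
      where
      lemma : ∀ a b c → (a * b) * c ≡ (a * c) * b
      lemma = ℕS.solve-∀
      ^-distribʳ-* : ∀ m a b → (a * b) ^ m ≡ a ^ m * b ^ m
      ^-distribʳ-* zero    a b = refl
      ^-distribʳ-* (suc m) a b = trans (cong (λ z → a * b * z) (^-distribʳ-* m a b)) (l a b (a ^ m) (b ^ m))
        where l : ∀ a b c d → a * b * (c * d) ≡ (a * c) * (b * d)
              l = ℕS.solve-∀

    T-split : ∀ {r e t} → e₀ ≡ e * r → a ^ (e ^ x * e₀) ≡ 1 + t → T ≡ t * geometric t (r ^ x)
    T-split {r} {e} {t} eq h = ℕₚ.suc-injective (trans (sym T≡) (trans (cong (a ^_) (E-split {r} {e} eq))
      (trans (sym (ℕₚ.^-*-assoc a (e ^ x * e₀) (r ^ x))) (trans (cong (_^ (r ^ x)) h) (geometric-sum t (r ^ x))))))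

    -- `G` is asked to divide the quotient of a^E - 1 by a^(E/r^x) - 1 instead of being coprime to
    -- the latter; a single division by the gcd then suffices for each r.
    Good : ℕ → ℕ → Set
    Good n G = ∀ r → r < n → Prime r → ∀ e t → e₀ ≡ e * r → a ^ (e ^ x * e₀) ≡ 1 + t → G ∣ geometric t (r ^ x)

    strip : ∀ n → Σ ℕ λ G → Σ ℕ λ S → 0 < G × G ∣ T × T ≤ G * a ^ S × S * 2 ^ x ≤ n * E × Good n G
    strip zero = T , 0 , 0<T , Div.∣-refl , ℕₚ.≤-reflexive (sym (ℕₚ.*-identityʳ T)) , z≤n , λ _ ()
      where
      0<T : 0 < T
      0<T = ℕₚ.≤-pred (subst (1 <_) T≡ (ℕₚ.≤-trans (ℕₚ.≤-trans (s≤s (s≤s z≤n)) 3≤a) (ℕₚ.≤-trans (ℕₚ.≤-reflexive (sym (ℕₚ.^-identityʳ a))) (ℕₚ.^-monoʳ-≤ a 0<E))))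
    strip (suc n) with strip n | Pr.prime? n | n ∣? e₀
    ... | G , S , 0<G , G∣T , le , le′ , good | no np | _ = G , S , 0<G , G∣T , le , ℕₚ.≤-trans le′ (ℕₚ.m≤n+m _ E) , good′
      where
      good′ : Good (suc n) G
      good′ r r<n pr with r ℕ.≟ n
      ... | yes refl = ⊥-elim (np pr)
      ... | no r≢n = good r (ℕₚ.≤∧≢⇒< (ℕₚ.≤-pred r<n) r≢n) pr
    ... | G , S , 0<G , G∣T , le , le′ , good | yes _ | no nd = G , S , 0<G , G∣T , le , ℕₚ.≤-trans le′ (ℕₚ.m≤n+m _ E) , good′
      where
      good′ : Good (suc n) G
      good′ r r<n pr e t eq with r ℕ.≟ n
      ... | yes refl = ⊥-elim (nd (divides e eq))
      ... | no r≢n = good r (ℕₚ.≤∧≢⇒< (ℕₚ.≤-pred r<n) r≢n) pr e t eq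
    ... | G , S , 0<G , G∣T , le , le′ , good | yes pn | yes (divides e eq) = G′ , S + Eₙ , 0<G′ , Div.∣-trans G′∣G G∣T , le₂ , le₃ , good′
      where
      Eₙ = e ^ x * e₀
      t = proj₁ (minus-one Eₙ)
      t≡ : a ^ Eₙ ≡ 1 + t
      t≡ = proj₂ (minus-one Eₙ)
      g = GCD.gcd G t
      instance
        g≢0 : NonZero g
        g≢0 = ℕ.≢-nonZero (GCD.gcd[m,n]≢0 G t (inj₁ λ z → ℕₚ.<-irrefl (sym z) 0<G))
      G′ t′ : ℕ
      G′ = G / g
      t′ = t / g
      G≡ : G ≡ G′ * g
      G≡ = sym (DM.m/n*n≡m (GCD.gcd[m,n]∣m G t))
      t′≡ : t ≡ t′ * g
      t′≡ = sym (DM.m/n*n≡m (GCD.gcd[m,n]∣n G t))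
      G′∣G : G′ ∣ G
      G′∣G = divides g (trans G≡ (ℕₚ.*-comm G′ g))
      0<G′ : 0 < G′
      0<G′ = ℕₚ.n≢0⇒n>0 λ z → ℕₚ.<-irrefl (sym (trans G≡ (cong (λ w → w * g) z))) 0<G
      -- G = G′ g and t = t′ g with G′ and t′ coprime. As G divides T, which is t times the
      -- geometric sum, G′ divides t′ times that sum and hence the sum.
      G′∣N : G′ ∣ geometric t (n ^ x)
      G′∣N = Cop.coprime-divisor (Cop.coprime-/gcd G t) (Div.*-cancelʳ-∣ g (subst₂ _∣_ G≡ T≡′ G∣T))
        where
        T≡′ : T ≡ (t′ * geometric t (n ^ x)) * g
        T≡′ = trans (T-split {n} {e} {t} eq t≡) (trans (cong (λ z → z * geometric t (n ^ x)) t′≡) (lemma t′ g (geometric t (n ^ x))))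
          where lemma : ∀ a b c → (a * b) * c ≡ (a * c) * b
                lemma = ℕS.solve-∀
      0<Eₙ : 0 < Eₙ
      0<Eₙ = ℕₚ.*-mono-≤ (ℕₚ.m^n>0 e {{ℕ.≢-nonZero λ z → ℕₚ.<-irrefl (sym (trans eq (cong (λ w → w * n) z))) 0<e₀}} x) 0<e₀
      1<aᴱ : 1 < a ^ Eₙ
      1<aᴱ = ℕₚ.≤-trans (ℕₚ.≤-trans (s≤s (s≤s z≤n)) 3≤a) (ℕₚ.≤-trans (ℕₚ.≤-reflexive (sym (ℕₚ.^-identityʳ a))) (ℕₚ.^-monoʳ-≤ a 0<Eₙ))
      g≤ : g ≤ a ^ Eₙ
      g≤ = ℕₚ.≤-trans (GCD.gcd[m,n]≤n G t {{>-nonZero (ℕₚ.≤-pred (subst (1 <_) t≡ 1<aᴱ))}}) (ℕₚ.≤-trans (ℕₚ.n≤1+n t) (ℕₚ.≤-reflexive (sym t≡)))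
      le₂ : T ≤ G′ * a ^ (S + Eₙ)
      le₂ = ℕₚ.≤-trans le (ℕₚ.≤-trans (ℕₚ.≤-reflexive (trans (cong (λ z → z * a ^ S) G≡) (lemma G′ g (a ^ S))))
        (ℕₚ.*-monoʳ-≤ G′ (ℕₚ.≤-trans (ℕₚ.*-monoʳ-≤ (a ^ S) g≤) (ℕₚ.≤-reflexive (sym (ℕₚ.^-distribˡ-+-* a S Eₙ))))))
        where lemma : ∀ a b c → (a * b) * c ≡ a * (c * b)
              lemma = ℕS.solve-∀
      le₃ : (S + Eₙ) * 2 ^ x ≤ suc n * E
      le₃ = ℕₚ.≤-trans (ℕₚ.≤-reflexive (trans (ℕₚ.*-distribʳ-+ (2 ^ x) S Eₙ) (ℕₚ.+-comm (S * 2 ^ x) _))) (ℕₚ.+-mono-≤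
        (ℕₚ.≤-trans (ℕₚ.*-monoʳ-≤ Eₙ (ℕₚ.^-monoˡ-≤ x (ℕ.nonTrivial⇒n>1 n {{Pr.prime⇒nonTrivial pn}}))) (ℕₚ.≤-reflexive (sym (E-split {n} {e} eq)))) le′)
      good′ : Good (suc n) G′
      good′ r r<n pr e′ t″ eq′ h with r ℕ.≟ n
      ... | no r≢n = Div.∣-trans G′∣G (good r (ℕₚ.≤∧≢⇒< (ℕₚ.≤-pred r<n) r≢n) pr e′ t″ eq′ h)
      ... | yes refl with ℕₚ.*-cancelʳ-≡ e′ e r {{Pr.prime⇒nonZero pr}} (trans (sym eq′) eq)
      ... | refl with ℕₚ.suc-injective (trans (sym h) t≡)
      ... | refl = G′∣N

    stripped = strip (suc e₀)
    G S : ℕ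
    G = proj₁ stripped
    S = proj₁ (proj₂ stripped)

    1<G : 1 < G
    1<G = ℕₚ.≰⇒> λ G≤1 → ℕₚ.<-irrefl refl (ℕₚ.<-≤-trans T-large (ℕₚ.≤-trans T≤
            (ℕₚ.≤-trans (ℕₚ.*-monoˡ-≤ (a ^ S) G≤1) (ℕₚ.≤-reflexive (ℕₚ.*-identityˡ _)))))
      where
      T≤ = proj₁ (proj₂ (proj₂ (proj₂ (proj₂ stripped))))
      S≤ = proj₁ (proj₂ (proj₂ (proj₂ (proj₂ (proj₂ stripped)))))
      S<E : S < E
      S<E = ℕₚ.*-cancelʳ-< (2 ^ x) S E (ℕₚ.≤-<-trans S≤ (ℕₚ.<-≤-trans (ℕₚ.*-monoˡ-< E {{>-nonZero 0<E}} (n<2^n (suc e₀))) (ℕₚ.≤-reflexive (ℕₚ.*-comm (2 ^ x) E))))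
      T-large : a ^ S < T
      T-large = ℕₚ.≤-pred (subst (suc (suc (a ^ S)) ≤_) T≡ (ℕₚ.≤-trans (ℕₚ.≤-trans
        (ℕₚ.≤-trans (ℕₚ.+-mono-≤ (s≤s (ℕₚ.m^n>0 a S)) (ℕₚ.≤-refl {a ^ S})) (ℕₚ.+-monoˡ-≤ (a ^ S) (ℕₚ.+-monoˡ-≤ (a ^ S) (ℕₚ.m^n>0 a S))))
        (ℕₚ.≤-trans (ℕₚ.≤-reflexive (lemma (a ^ S))) (ℕₚ.*-monoˡ-≤ (a ^ S) 3≤a))) (ℕₚ.^-monoʳ-≤ a S<E)))
        where lemma : ∀ z → z + z + z ≡ 3 * z
              lemma = ℕS.solve-∀

  prime-one-mod : Σ ℕ λ p′ → Prime (suc p′) × B < suc p′ × e₀ ∣ p′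
  prime-one-mod with prime-divisor G 1<G
  ... | zero , pp , _ = ⊥-elim (Pr.¬prime[0] pp)
  ... | suc p′ , pp , p∣G = p′ , pp , ℕₚ.≰⇒> (λ p≤B → p∤a (Div.∣-trans (p∣B! p≤B) (Div.∣-trans (Div.n∣m*n E) (Div.n∣m*n 3)))) , e₀∣p′
    where
    p = suc p′
    open PrimeField p′ pp
    p∣T : p ∣ T
    p∣T = Div.∣-trans p∣G (proj₁ (proj₂ (proj₂ (proj₂ stripped))))
    p∤a : ¬ p ∣ a
    p∤a d = Pr.¬prime[1] (subst Prime (Div.∣1⇒≡1 (Div.∣m+n∣m⇒∣n (subst (p ∣_) (trans T≡ (ℕₚ.+-comm 1 T)) p∣aE) p∣T)) pp)
      where p∣aE : p ∣ a ^ E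
            p∣aE = Div.∣-trans d (subst (_∣ a ^ E) (ℕₚ.^-identityʳ a) (^-∣ a 0<E))
    p∤e₀ : ¬ p ∣ e₀
    p∤e₀ d = p∤a (Div.∣-trans d (Div.∣-trans (Div.n∣m*n (e₀ ^ x)) (Div.∣-trans (Div.m∣m*n (B !)) (Div.n∣m*n 3))))
    p∣B! : p ≤ B → p ∣ B !
    p∣B! le = Div.∣-trans (Div.m∣m*n (p′ !)) (Div.m≤n⇒m!∣n! le)
    -- Modulo a divisor of t the geometric sum is r^x. As p divides the sum, it would divide r and
    -- hence e₀, which is a factor of `a`.
    ∤t : ∀ r → Prime r → ∀ e t → e₀ ≡ e * r → a ^ (e ^ x * e₀) ≡ 1 + t → ¬ p ∣ t
    ∤t r pr e t eq h p∣t = p∤e₀ (Div.∣-trans (prime-∣-^ pp r x (Div.∣m+n∣m⇒∣n (subst (p ∣_) (trans (proj₂ gm) (ℕₚ.+-comm (r ^ x) _)) p∣N) (Div.∣-trans p∣t (Div.m∣m*n (proj₁ gm))))) (divides e eq))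
      where
      gm = geometric-mod t (r ^ x)
      p∣N : p ∣ geometric t (r ^ x)
      p∣N = Div.∣-trans p∣G (proj₂ (proj₂ (proj₂ (proj₂ (proj₂ (proj₂ stripped))))) r (s≤s (Div.∣⇒≤ (divides e eq))) pr e t eq h)
    a≉0 : ¬ + a ≈[ p ] + 0
    a≉0 z = p∤a (≈0⇒∣ z)
    aE≈1 : (+ a) ^ᶻ E ≈[ p ] + 1
    aE≈1 = ≈-trans (≈-reflexive (trans (sym (pos-^ a E)) (cong +_ T≡))) (≈-trans (≈-+ (≈-refl {_} {+ 1}) (∣⇒≈0 p∣T)) (≈-reflexive refl))
    power-one : ∀ {m} c → (+ a) ^ᶻ m ≈[ p ] + 1 → (+ a) ^ᶻ (c * m) ≈[ p ] + 1
    power-one {m} c h = ≈-trans (≈-reflexive (trans (cong ((+ a) ^ᶻ_) (ℕₚ.*-comm c m)) (^ᶻ-* (+ a) m c))) (≈-trans (≈-^ c h) (≈-reflexive (one-^ c)))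
    cancel-one : ∀ {m n} → (+ a) ^ᶻ n ≈[ p ] + 1 → (+ a) ^ᶻ (m + n) ≈[ p ] + 1 → (+ a) ^ᶻ m ≈[ p ] + 1
    cancel-one {m} {n} h k = ≈-trans (≈-reflexive (sym (ℤₚ.*-identityʳ _))) (≈-trans (≈-*ˡ ((+ a) ^ᶻ m) (≈-sym h))
      (≈-trans (≈-reflexive (sym (ℤₚ.^-distribˡ-+-* (+ a) m n))) k))
    g = GCD.gcd E p′
    ag≈1 : (+ a) ^ᶻ g ≈[ p ] + 1
    ag≈1 with GCD.Bézout.identity (GCD.gcd-GCD E p′)
    ... | GCD.Bézout.+- u v e = cancel-one {g} {v * p′} (power-one {p′} v (fermat (+ a) a≉0)) (subst (λ z → (+ a) ^ᶻ z ≈[ p ] + 1) (sym e) (power-one {E} u aE≈1))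
    ... | GCD.Bézout.-+ u v e = cancel-one {g} {u * E} (power-one {E} u aE≈1) (subst (λ z → (+ a) ^ᶻ z ≈[ p ] + 1) (sym e) (power-one {p′} v (fermat (+ a) a≉0)))
    -- Let E = y g with g the gcd of E and p - 1, so that a^g ≡ 1. If r^x divided y, then g would
    -- divide E / r^x, contrary to `∤t`. Hence y divides e₀^x, and E = e₀^(x+1) leaves a factor e₀
    -- in g.
    e₀∣p′ : e₀ ∣ p′
    e₀∣p′ with GCD.gcd[m,n]∣m E p′
    ... | divides y E≡ = Div.∣-trans e₀∣g (GCD.gcd[m,n]∣n E p′)
      where
      0<y : 0 < y
      0<y = ℕₚ.n≢0⇒n>0 λ z → ℕₚ.<-irrefl (sym (trans E≡ (cong (λ w → w * g) z))) 0<E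
      power-free : ∀ r → Prime r → ∀ e → e₀ ≡ e * r → ¬ r ^ x ∣ y
      power-free r pr e eq (divides y′ y≡) = ∤t r pr e t eq t≡ (≈0⇒∣ (≈-trans (≈-reflexive (lemma (+ t)))
          (≈-diff (≈-trans (≈-reflexive (trans (cong +_ (sym t≡)) (pos-^ a Eᵣ))) (subst (λ z → (+ a) ^ᶻ z ≈[ p ] + 1) (sym Eᵣ≡) (power-one {g} y′ ag≈1))))))
        where
        Eᵣ = e ^ x * e₀
        t = proj₁ (minus-one Eᵣ)
        t≡ = proj₂ (minus-one Eᵣ)
        lemma : ∀ t → t ≡ (+ 1 +ᶻ t) -ᶻ + 1
        lemma = ℤS.solve-∀
        Eᵣ≡ : Eᵣ ≡ y′ * g
        Eᵣ≡ = ℕₚ.*-cancelʳ-≡ Eᵣ (y′ * g) (r ^ x) {{ℕₚ.m^n≢0 r x {{Pr.prime⇒nonZero pr}}}}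
          (trans (sym (E-split {r} {e} eq)) (trans E≡ (trans (cong (λ z → z * g) y≡) (lemma′ y′ (r ^ x) g))))
          where lemma′ : ∀ a b c → (a * b) * c ≡ (a * c) * b
                lemma′ = ℕS.solve-∀
      ^x-∣ : ∀ {r} m → r ∣ e₀ → r ^ m ∣ e₀ ^ m
      ^x-∣ zero    d = Div.∣-refl
      ^x-∣ (suc m) d = Div.*-pres-∣ d (^x-∣ m d)
      r∣e₀ : ∀ {r} → Prime r → r ∣ E → r ∣ e₀
      r∣e₀ pr d with Pr.euclidsLemma (e₀ ^ x) e₀ pr d
      ... | inj₁ d′ = prime-∣-^ pr e₀ x d′
      ... | inj₂ d′ = d′
      y∣ : y ∣ e₀ ^ x
      y∣ = prime-power-test y (e₀ ^ x) 0<y test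
        where
        test : ∀ r c → Prime r → r ^ c ∣ y → r ^ c ∣ e₀ ^ x
        test r zero    pr d = Div.1∣ _
        test r (suc c) pr d with r∣e₀ pr (Div.∣-trans (Div.∣-trans (Div.m∣m*n (r ^ c)) d) (divides g (trans E≡ (ℕₚ.*-comm y g)))) | suc c <? x
        ... | r∣e | yes lt = Div.∣-trans (^-∣ r (ℕₚ.<⇒≤ lt)) (^x-∣ x r∣e)
        ... | divides e eq | no nlt = ⊥-elim (power-free r pr e eq (Div.∣-trans (^-∣ r (ℕₚ.≮⇒≥ nlt)) d))
      e₀∣g : e₀ ∣ g
      e₀∣g with y∣
      ... | divides z z≡ = divides z (ℕₚ.*-cancelʳ-≡ g (z * e₀) y {{>-nonZero 0<y}} (trans (ℕₚ.*-comm g y) (trans (sym E≡) (trans (cong (λ w → w * e₀) z≡) (lemma z y e₀)))))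
        where lemma : ∀ a b c → (a * b) * c ≡ (a * c) * b
              lemma = ℕS.solve-∀

-- Counting, and polynomials over a prime field

count : ∀ {n} → (Fin n → Bool) → ℕ
count P = Σℕ.sum (bit ∘ P)

Enumeration : ∀ {n} → (Fin n → Bool) → Set
Enumeration {n} P = Σ (Fin (count P) → Fin n) λ g →
  (∀ i → P (g i) ≡ true) × (∀ x → P x ≡ true → ∃ λ i → g i ≡ x) × (∀ {i j} → g i ≡ g j → i ≡ j)

enumerate : ∀ {n} (P : Fin n → Bool) → Enumeration P
enumerate {zero} P = (λ ()) , (λ ()) , (λ ()) , λ {}
enumerate {suc n} P with P zero in eq | enumerate (P ∘ suc)
... | true  | g , t , s , inj = g′ , t′ , s′ , inj′
  where
  g′ : Fin (suc (count (P ∘ suc))) → Fin (suc n)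
  g′ zero    = zero
  g′ (suc i) = suc (g i)
  t′ : ∀ i → P (g′ i) ≡ true
  t′ zero    = eq
  t′ (suc i) = t i
  s′ : ∀ x → P x ≡ true → ∃ λ i → g′ i ≡ x
  s′ zero e = zero , refl
  s′ (suc x) e with s x e
  ... | i , refl = suc i , refl
  inj′ : ∀ {i j} → g′ i ≡ g′ j → i ≡ j
  inj′ {zero}  {zero}  e = refl
  inj′ {suc i} {suc j} e = cong suc (inj (Fₚ.suc-injective e))
... | false | g , t , s , inj = (λ i → suc (g i)) , t , s′ , λ e → inj (Fₚ.suc-injective e)
  where
  s′ : ∀ x → P x ≡ true → ∃ λ i → suc (g i) ≡ x
  s′ zero e with trans (sym eq) e
  ... | ()
  s′ (suc x) e with s x e
  ... | i , refl = i , refl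

count-upper : ∀ {n m} (P : Fin n → Bool) → (∀ {l} (g : Fin l → Fin n) → (∀ {i j} → g i ≡ g j → i ≡ j) → (∀ i → P (g i) ≡ true) → l ≤ m) → count P ≤ m
count-upper P h = let (g , t , s , inj) = enumerate P in h g inj t

count-lower : ∀ {n l} (P : Fin n → Bool) (g : Fin l → Fin n) → (∀ {i j} → g i ≡ g j → i ≡ j) → (∀ i → P (g i) ≡ true) → l ≤ count P
count-lower P g g-inj t with enumerate P
... | h , _ , s , _ = Fₚ.injective⇒≤ {f = λ i → proj₁ (s (g i) (t i))} λ {i} {j} e →
  g-inj (trans (sym (proj₂ (s (g i) (t i)))) (trans (cong h e) (proj₂ (s (g j) (t j)))))

sumℕ-≤ : ∀ {n} {f g : Fin n → ℕ} → (∀ i → f i ≤ g i) → Σℕ.sum f ≤ Σℕ.sum g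
sumℕ-≤ {zero}  h = z≤n
sumℕ-≤ {suc n} h = ℕₚ.+-mono-≤ (h zero) (sumℕ-≤ (λ i → h (suc i)))

sumℕ-const : ∀ n c → Σℕ.sum {n} (λ _ → c) ≡ n * c
sumℕ-const zero    c = refl
sumℕ-const (suc n) c = cong (λ z → c + z) (sumℕ-const n c)

count≤n : ∀ {n} (P : Fin n → Bool) → count P ≤ n
count≤n {n} P = ℕₚ.≤-trans (sumℕ-≤ {n} {bit ∘ P} {λ _ → 1} λ i → bit≤1 (P i)) (ℕₚ.≤-reflexive (trans (sumℕ-const n 1) (ℕₚ.*-identityʳ n)))
  where bit≤1 : ∀ b → bit b ≤ 1
        bit≤1 true  = s≤s z≤n
        bit≤1 false = z≤n

is : ∀ {n} → Fin n → Fin n → Bool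
is a x = does (a F.≟ x)

is-true : ∀ {n} {a x : Fin n} → is a x ≡ true → a ≡ x
is-true {_} {a} {x} e with a F.≟ x
... | yes r = r

is-refl : ∀ {n} (a : Fin n) → is a a ≡ true
is-refl a with a F.≟ a
... | yes _ = refl
... | no n  = ⊥-elim (n refl)

sum-is : ∀ {n} (f : Fin n → ℕ) x → Σℕ.sum (λ a → bit (is x a) * f a) ≡ f x
sum-is {suc n} f zero = trans (cong₂ _+_ (ℕₚ.+-identityʳ (f zero)) (trans (sumℕ-const n 0) (ℕₚ.*-zeroʳ n))) (ℕₚ.+-identityʳ _)
sum-is {suc n} f (suc x) = sum-is (λ a → f (suc a)) x

count-is : ∀ {n} (x : Fin n) → count (is x) ≡ 1
count-is x = trans (Σℕ.sum-cong-≗ λ a → sym (ℕₚ.*-identityʳ (bit (is x a)))) (sum-is (λ _ → 1) x)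

-- Monic polynomials, given by their lower coefficients.
monic : ∀ {n} → Vec ℤ n → ℤ → ℤ
monic []       x = + 1
monic (c ∷ cs) x = c +ᶻ x *ᶻ monic cs x

addScaled : ∀ {n} → ℤ → Vec ℤ (suc n) → Vec ℤ n → Vec ℤ (suc n)
addScaled r (p ∷ [])     []       = (p +ᶻ r) ∷ []
addScaled r (p ∷ q ∷ ps) (s ∷ ss) = (p +ᶻ r *ᶻ s) ∷ addScaled r (q ∷ ps) ss

monic-addScaled : ∀ {n} r (p : Vec ℤ (suc n)) q x → monic (addScaled r p q) x ≡ monic p x +ᶻ r *ᶻ monic q x
monic-addScaled r (p ∷ []) [] x = lemma p r x
  where lemma : ∀ p r x → (p +ᶻ r) +ᶻ x *ᶻ + 1 ≡ (p +ᶻ x *ᶻ + 1) +ᶻ r *ᶻ + 1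
        lemma = ℤS.solve-∀
monic-addScaled r (p ∷ q ∷ ps) (s ∷ ss) x = trans (cong (λ z → (p +ᶻ r *ᶻ s) +ᶻ x *ᶻ z) (monic-addScaled r (q ∷ ps) ss x))
    (lemma p r s x (monic (q ∷ ps) x) (monic ss x))
  where lemma : ∀ p r s x a b → (p +ᶻ r *ᶻ s) +ᶻ x *ᶻ (a +ᶻ r *ᶻ b) ≡ (p +ᶻ x *ᶻ a) +ᶻ r *ᶻ (s +ᶻ x *ᶻ b)
        lemma = ℤS.solve-∀

divideRoot : ∀ {n} → ℤ → Vec ℤ (suc n) → Vec ℤ n
divideRoot r (c ∷ [])      = []
divideRoot r (c ∷ c′ ∷ cs) = addScaled r (c′ ∷ cs) (divideRoot r (c′ ∷ cs))

divideRoot-correct : ∀ {n} r (p : Vec ℤ (suc n)) x → monic p x -ᶻ monic p r ≡ (x -ᶻ r) *ᶻ monic (divideRoot r p) x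
divideRoot-correct r (c ∷ []) x = lemma c r x
  where lemma : ∀ c r x → (c +ᶻ x *ᶻ + 1) -ᶻ (c +ᶻ r *ᶻ + 1) ≡ (x -ᶻ r) *ᶻ + 1
        lemma = ℤS.solve-∀
divideRoot-correct r (c ∷ c′ ∷ cs) x = trans (lemma c r x P R) (trans (cong (λ z → (x -ᶻ r) *ᶻ P +ᶻ r *ᶻ z) (divideRoot-correct r (c′ ∷ cs) x))
    (trans (lemma′ (x -ᶻ r) P r (monic (divideRoot r (c′ ∷ cs)) x)) (cong ((x -ᶻ r) *ᶻ_) (sym (monic-addScaled r (c′ ∷ cs) (divideRoot r (c′ ∷ cs)) x)))))
  where
  P R : ℤ
  P = monic (c′ ∷ cs) x
  R = monic (c′ ∷ cs) r
  lemma : ∀ c r x P R → (c +ᶻ x *ᶻ P) -ᶻ (c +ᶻ r *ᶻ R) ≡ (x -ᶻ r) *ᶻ P +ᶻ r *ᶻ (P -ᶻ R)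
  lemma = ℤS.solve-∀
  lemma′ : ∀ d P r Q → d *ᶻ P +ᶻ r *ᶻ (d *ᶻ Q) ≡ d *ᶻ (P +ᶻ r *ᶻ Q)
  lemma′ = ℤS.solve-∀

power-coefficients : ∀ n → Vec ℤ n
power-coefficients zero    = []
power-coefficients (suc n) = + 0 ∷ power-coefficients n

monic-power : ∀ n x → monic (power-coefficients n) x ≡ x ^ᶻ n
monic-power zero    x = refl
monic-power (suc n) x = trans (ℤₚ.+-identityˡ _) (cong (x *ᶻ_) (monic-power n x))

module Roots (p′ : ℕ) (isPrime : Prime (suc p′)) where
  open PrimeField p′ isPrime public
  p = suc p′

  infix 4 _≈_
  _≈_ : ℤ → ℤ → Set
  a ≈ b = a ≈[ p ] b

  v : Fin p → ℤ
  v = val {p}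
  ρ : ℤ → Fin p
  ρ = res {p}

  roots≤ : ∀ {n m} (cs : Vec ℤ n) (g : Fin m → Fin p) → (∀ {i j} → g i ≡ g j → i ≡ j) → (∀ i → monic cs (v (g i)) ≈ + 0) → m ≤ n
  roots≤ {zero} {zero} [] g inj z = z≤n
  roots≤ {zero} {suc m} [] g inj z = ⊥-elim (unit⇒≉0 {+ 1} (+ 1 , ≈-refl) (z zero))
  roots≤ {suc n} {zero} cs g inj z = z≤n
  roots≤ {suc n} {suc m} cs g inj z = s≤s (roots≤ (divideRoot r cs) (g ∘ suc) (λ e → Fₚ.suc-injective (inj e)) λ i →
      no-zero-divisors {v (g (suc i)) -ᶻ r} {monic (divideRoot r cs) (v (g (suc i)))} (λ e → absurd (inj (val-injective {p} (≈-undiff {p} {v (g (suc i))} {r} e))))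
        (≈-trans (≈-reflexive (sym (divideRoot-correct r cs (v (g (suc i)))))) (≈-trans (≈-- (z (suc i)) (z zero)) (≈-reflexive refl))))
    where
    r = v (g zero)
    absurd : ∀ {i} → F.suc i ≡ zero → ⊥
    absurd ()

  power-roots≤ : ∀ n {m} → 0 < n → (g : Fin m → Fin p) → (∀ {i j} → g i ≡ g j → i ≡ j) → (∀ i → v (g i) ^ᶻ n ≈ + 1) → m ≤ n
  power-roots≤ (suc n) _ g inj z = roots≤ (-ᶻ + 1 ∷ power-coefficients n) g inj λ i →
    ≈-trans (≈-+ (≈-refl {_} { -ᶻ + 1 }) (≈-trans (≈-reflexive (cong (v (g i) *ᶻ_) (monic-power n (v (g i))))) (z i))) (≈-reflexive refl)

-- e colour classes: the cosets of the group of f-th roots of unity, where e f = p − 1.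
module Colouring (p′ : ℕ) (isPrime : Prime (suc p′)) (e f : ℕ) (0<e : 0 < e) (0<f : 0 < f) (ef : f * e ≡ p′) where
  open Roots p′ isPrime public

  isRoot : Fin p → Bool
  isRoot y = is (ρ (v y ^ᶻ e)) (ρ (+ 1))

  abstract
    rootIndex : Σ (Fin p → Fin e) λ ι → ∀ {y z} → isRoot y ≡ true → isRoot z ≡ true → ι y ≡ ι z → y ≡ z
    rootIndex = ι , inj
      where
      E : Enumeration isRoot
      E = enumerate isRoot
      le : count isRoot ≤ e
      le = count-upper isRoot λ g g-inj t → power-roots≤ e 0<e g g-inj λ i → res-injective {p} {v (g i) ^ᶻ e} {+ 1} (is-true (t i))
      pos : ∀ y b → isRoot y ≡ b → Fin e
      pos y true  h = F.inject≤ (proj₁ (proj₁ (proj₂ (proj₂ E)) y h)) le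
      -- An arbitrary colour for residues that are not e-th roots of unity, such as 0.
      pos y false h = fromℕ< 0<e
      ι : Fin p → Fin e
      ι y = pos y (isRoot y) refl
      pos≡ : ∀ y b (h : isRoot y ≡ b) → pos y (isRoot y) refl ≡ pos y b h
      pos≡ y b refl = refl
      inj : ∀ {y z} → isRoot y ≡ true → isRoot z ≡ true → ι y ≡ ι z → y ≡ z
      inj {y} {z} a b h = trans (sym (proj₂ (proj₁ (proj₂ (proj₂ E)) y a))) (trans (cong (proj₁ E)
        (Fₚ.inject≤-injective le le _ _ (trans (sym (pos≡ y true a)) (trans h (pos≡ z true b))))) (proj₂ (proj₁ (proj₂ (proj₂ E)) z b)))

  χ : ℤ → Fin e
  χ a = proj₁ rootIndex (ρ (a ^ᶻ f))

  χ-cong : ∀ {a b} → a ^ᶻ f ≈ b ^ᶻ f → χ a ≡ χ b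
  χ-cong h = cong (proj₁ rootIndex) (res-cong h)

  power-isRoot : ∀ {a} → ¬ a ≈ + 0 → isRoot (ρ (a ^ᶻ f)) ≡ true
  power-isRoot {a} n = trans (cong (λ z → is z (ρ (+ 1))) (res-cong {p} (≈-trans (≈-^ e (val-res {p} (a ^ᶻ f)))
    (≈-trans (≈-reflexive (trans (sym (^ᶻ-* a f e)) (cong (a ^ᶻ_) ef))) (fermat a n))))) (is-refl (ρ (+ 1)))

  χ-≡ : ∀ {a b} → ¬ a ≈ + 0 → ¬ b ≈ + 0 → χ a ≡ χ b → a ^ᶻ f ≈ b ^ᶻ f
  χ-≡ {a} {b} na nb h = res-injective {p} {a ^ᶻ f} {b ^ᶻ f} (proj₂ rootIndex (power-isRoot na) (power-isRoot nb) h)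

  same : Fin p → Fin p → Fin p → Bool
  same s s′ z = is (χ (v z -ᶻ v s)) (χ (v z -ᶻ v s′))

  v-≉ : ∀ {s z} → s ≢ z → ¬ v z -ᶻ v s ≈ + 0
  v-≉ {s} {z} n h = n (sym (val-injective {p} (≈-undiff {p} {v z} {v s} h)))

  -- (z − s)/(z − s′) is an f-th root of unity if z − s and z − s′ have the same colour.
  collisions : ∀ {s s′} → s ≢ s′ → count (same s s′) ≤ f + 2
  collisions {s} {s′} s≢s′ = ℕₚ.≤-trans (sumℕ-≤ pointwise) (ℕₚ.≤-trans (ℕₚ.≤-reflexive
      (trans (Σℕ.∑-distrib-+ (bit ∘ P) (λ z → bit (is s z) + bit (is s′ z)))
        (cong (λ w → count P + w) (trans (Σℕ.∑-distrib-+ (bit ∘ is s) (bit ∘ is s′)) (cong₂ _+_ (count-is s) (count-is s′))))))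
      (ℕₚ.+-monoˡ-≤ 2 (count-upper P bound)))
    where
    -- The places z = s and z = s′, where a difference vanishes, are split off; they account for the
    -- summand 2 in the bound.
    P : Fin p → Bool
    P z = same s s′ z ∧ (Data.Bool.not (is s z) ∧ Data.Bool.not (is s′ z))
      where import Data.Bool
    pointwise : ∀ z → bit (same s s′ z) ≤ bit (P z) + (bit (is s z) + bit (is s′ z))
    pointwise z with same s s′ z | is s z | is s′ z
    ... | true  | true  | _     = s≤s z≤n
    ... | true  | false | true  = s≤s z≤n
    ... | true  | false | false = s≤s z≤n
    ... | false | _     | _     = z≤n
    P-parts : ∀ z → P z ≡ true → χ (v z -ᶻ v s) ≡ χ (v z -ᶻ v s′) × s ≢ z × s′ ≢ z
    P-parts z h with same s s′ z in e₁ | is s z in e₂ | is s′ z in e₃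
    ... | true | false | false = is-true e₁ , (λ e → absurd (trans (sym (trans (cong (λ t → is t z) e) (is-refl z))) e₂))
                                            , (λ e → absurd (trans (sym (trans (cong (λ t → is t z) e) (is-refl z))) e₃))
      where absurd : true ≡ false → ⊥
            absurd ()
    bound : ∀ {l} (g : Fin l → Fin p) → (∀ {i j} → g i ≡ g j → i ≡ j) → (∀ i → P (g i) ≡ true) → l ≤ f
    bound g g-inj t = power-roots≤ f 0<f (λ i → ρ (w i)) w-inj w-root
      where
      a b : ∀ i → ℤ
      a i = v (g i) -ᶻ v s
      b i = v (g i) -ᶻ v s′
      a≉0 : ∀ i → ¬ a i ≈ + 0
      a≉0 i = v-≉ (proj₁ (proj₂ (P-parts (g i) (t i))))
      b≉0 : ∀ i → ¬ b i ≈ + 0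
      b≉0 i = v-≉ (proj₂ (proj₂ (P-parts (g i) (t i))))
      u : ∀ i → Unit p (b i)
      u i = unit (b≉0 i)
      w : ∀ i → ℤ
      w i = proj₁ (u i) *ᶻ a i
      w-b : ∀ i → b i *ᶻ w i ≈ a i
      w-b i = ≈-trans (≈-reflexive (lemma (b i) (proj₁ (u i)) (a i))) (≈-trans (≈-* (proj₂ (u i)) (≈-refl {_} {a i})) (≈-reflexive (ℤₚ.*-identityˡ (a i))))
        where lemma : ∀ b c a → b *ᶻ (c *ᶻ a) ≡ (c *ᶻ b) *ᶻ a
              lemma = ℤS.solve-∀
      w-root : ∀ i → v (ρ (w i)) ^ᶻ f ≈ + 1
      w-root i = ≈-trans (≈-^ f (val-res {p} (w i))) (≈-trans (≈-reflexive (*-^ᶻ (proj₁ (u i)) (a i) f))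
        (≈-trans (≈-*ˡ (proj₁ (u i) ^ᶻ f) (χ-≡ (a≉0 i) (b≉0 i) (proj₁ (P-parts (g i) (t i)))))
          (≈-trans (≈-reflexive (sym (*-^ᶻ (proj₁ (u i)) (b i) f))) (≈-trans (≈-^ f (proj₂ (u i))) (≈-reflexive (one-^ f))))))
      w-inj : ∀ {i j} → ρ (w i) ≡ ρ (w j) → i ≡ j
      w-inj {i} {j} h = g-inj (val-injective {p} (unit-cancel {p} {v s -ᶻ v s′} (unit (λ z → s≢s′ (val-injective {p} (≈-undiff {p} {v s} {v s′} z)))) final))
        where
        w≈ : w i ≈ w j
        w≈ = res-injective {p} {w i} {w j} h
        cross : b j *ᶻ a i ≈ b i *ᶻ a j
        cross = ≈-trans (≈-*ˡ (b j) (≈-sym (w-b i))) (≈-trans (≈-reflexive (l (b j) (b i) (w i)))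
          (≈-trans (≈-*ˡ (b i) (≈-trans (≈-*ˡ (b j) w≈) (w-b j))) ≈-refl))
          where l : ∀ x y z → x *ᶻ (y *ᶻ z) ≡ y *ᶻ (x *ᶻ z)
                l = ℤS.solve-∀
        final : (v s -ᶻ v s′) *ᶻ v (g i) ≈ (v s -ᶻ v s′) *ᶻ v (g j)
        final = ≈-trans (≈-reflexive (l₁ (v s) (v s′) (v (g i)) (v (g j)))) (≈-trans (≈-+ (≈-refl {_} {c}) cross) (≈-reflexive (l₂ (v s) (v s′) (v (g i)) (v (g j)))))
          where
          c : ℤ
          c = (v s *ᶻ v (g i) +ᶻ v s *ᶻ v (g j)) -ᶻ (v (g i) *ᶻ v (g j) +ᶻ v s *ᶻ v s′)
          l₁ : ∀ s s′ x y → (s -ᶻ s′) *ᶻ x ≡ ((s *ᶻ x +ᶻ s *ᶻ y) -ᶻ (x *ᶻ y +ᶻ s *ᶻ s′)) +ᶻ (y -ᶻ s′) *ᶻ (x -ᶻ s)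
          l₁ = ℤS.solve-∀
          l₂ : ∀ s s′ x y → ((s *ᶻ x +ᶻ s *ᶻ y) -ᶻ (x *ᶻ y +ᶻ s *ᶻ s′)) +ᶻ (x -ᶻ s′) *ᶻ (y -ᶻ s) ≡ (s -ᶻ s′) *ᶻ y
          l₂ = ℤS.solve-∀

-- The second moment method

-- While m + 1 points remain to be chosen, each candidate set has at least p / K elements. Each of
-- the m later sets rules out at most 12 e² K points for the next choice, and all of these together
-- must be fewer than p / K; the choice then shrinks the later sets by a factor of at most 2 e.
threshold : ℕ → ℕ → ℕ → ℕ
threshold e zero    K = 0
threshold e (suc m) K = suc (K * (m * (12 * (e * e) * K))) + threshold e m (K * (2 * e))

module SecondMoment {p e : ℕ} (f : ℕ) (c : Fin p → Fin p → Fin e)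
                    (collide : ∀ {s s′} → s ≢ s′ → count (λ z → is (c z s) (c z s′)) ≤ f + 2) (fe≤p : f * e ≤ p) where
  private
    Σ′ : ∀ {n} → (Fin n → ℕ) → ℕ
    Σ′ = Σℕ.sum

    scaleˡ : ∀ {n} k (g : Fin n → ℕ) → Σ′ (λ i → k * g i) ≡ k * Σ′ g
    scaleˡ k g = sym (Σℕ.*-distribˡ-sum k g)
    scaleʳ : ∀ {n} k (g : Fin n → ℕ) → Σ′ (λ i → g i * k) ≡ Σ′ g * k
    scaleʳ k g = sym (Σℕ.*-distribʳ-sum k g)
    cong-Σ : ∀ {n} {g h : Fin n → ℕ} → (∀ i → g i ≡ h i) → Σ′ g ≡ Σ′ h
    cong-Σ = Σℕ.sum-cong-≗

    square-sum : ∀ {n} (g : Fin n → ℕ) → Σ′ g * Σ′ g ≡ Σ′ λ s → Σ′ λ s′ → g s * g s′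
    square-sum g = trans (sym (scaleʳ (Σ′ g) g)) (cong-Σ λ s → sym (scaleˡ (g s) g))

    diff-square : ∀ a b → ℕ.∣ a - b ∣ * ℕ.∣ a - b ∣ + 2 * (a * b) ≡ a * a + b * b
    diff-square a b with ℕₚ.≤-total a b
    ... | inj₁ le with ℕₚ.m≤n⇒∃[o]m+o≡n le
    ... | o , refl rewrite ℕₚ.∣m-m+n∣≡n a o = lemma a o
      where lemma : ∀ a o → o * o + 2 * (a * (a + o)) ≡ a * a + (a + o) * (a + o)
            lemma = ℕS.solve-∀
    diff-square a b | inj₂ le with ℕₚ.m≤n⇒∃[o]m+o≡n le
    ... | o , refl rewrite ℕₚ.∣-∣-comm (b + o) b | ℕₚ.∣m-m+n∣≡n b o = lemma b o
      where lemma : ∀ b o → o * o + 2 * ((b + o) * b) ≡ (b + o) * (b + o) + b * b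
            lemma = ℕS.solve-∀

  module _ (S : Fin p → Bool) where
    σ = count S
    private
      w : Fin p → ℕ
      w s = bit (S s)
      w² : ∀ s → w s * w s ≡ w s
      w² s with S s
      ... | true  = refl
      ... | false = refl

    number : Fin e → Fin p → ℕ
    number i z = Σ′ λ s → w s * bit (is (c z s) i)

    private
      number-total : ∀ z → Σ′ (λ i → number i z) ≡ σ
      number-total z = trans (Σℕ.∑-comm (λ i s → w s * bit (is (c z s) i)))
        (cong-Σ λ s → trans (scaleˡ (w s) (λ i → bit (is (c z s) i))) (trans (cong (λ t → w s * t) (count-is (c z s))) (ℕₚ.*-identityʳ (w s))))

      pairs : Fin p → ℕ
      pairs z = Σ′ λ s → Σ′ λ s′ → (w s * w s′) * bit (is (c z s′) (c z s))

      number-square : ∀ z → Σ′ (λ i → number i z * number i z) ≡ pairs z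
      number-square z = trans (cong-Σ λ i → square-sum (λ s → w s * bit (is (c z s) i)))
        (trans (Σℕ.∑-comm (λ i s → Σ′ λ s′ → (w s * bit (is (c z s) i)) * (w s′ * bit (is (c z s′) i))))
          (cong-Σ λ s → trans (Σℕ.∑-comm (λ i s′ → (w s * bit (is (c z s) i)) * (w s′ * bit (is (c z s′) i))))
            (cong-Σ λ s′ → trans (cong-Σ λ i → lemma (w s) (w s′) (bit (is (c z s) i)) (bit (is (c z s′) i)))
              (trans (scaleˡ (w s * w s′) (λ i → bit (is (c z s) i) * bit (is (c z s′) i)))
                (cong (λ t → (w s * w s′) * t) (sum-is (λ i → bit (is (c z s′) i)) (c z s)))))))
        where lemma : ∀ a b x y → (a * x) * (b * y) ≡ (a * b) * (x * y)
              lemma = ℕS.solve-∀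

      collide′ : ∀ s s′ → Σ′ (λ z → bit (is (c z s′) (c z s))) ≤ (f + 2) + bit (is s s′) * p
      collide′ s s′ with s F.≟ s′
      ... | yes refl = ℕₚ.≤-trans (count≤n (λ z → is (c z s) (c z s))) (ℕₚ.≤-trans (ℕₚ.≤-reflexive (sym (ℕₚ.+-identityʳ p))) (ℕₚ.m≤n+m (p + 0) (f + 2)))
      ... | no n = ℕₚ.≤-trans (collide (λ e → n (sym e))) (ℕₚ.m≤m+n (f + 2) 0)

      moment : ℕ
      moment = Σ′ λ z → Σ′ λ i → number i z * number i z

      -- The second moment counts triples (z, s, s′) for which s and s′ have the same colour seen
      -- from z: at most f + 2 values of z if s and s′ differ, at most p if they coincide.
      moment≤ : moment ≤ (σ * σ) * (f + 2) + σ * p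
      moment≤ = begin
        moment
          ≡⟨ cong-Σ number-square ⟩
        Σ′ (λ z → Σ′ λ s → Σ′ λ s′ → (w s * w s′) * bit (is (c z s′) (c z s)))
          ≡⟨ Σℕ.∑-comm (λ z s → Σ′ λ s′ → (w s * w s′) * bit (is (c z s′) (c z s))) ⟩
        Σ′ (λ s → Σ′ λ z → Σ′ λ s′ → (w s * w s′) * bit (is (c z s′) (c z s)))
          ≡⟨ cong-Σ (λ s → trans (Σℕ.∑-comm (λ z s′ → (w s * w s′) * bit (is (c z s′) (c z s))))
               (cong-Σ λ s′ → scaleˡ (w s * w s′) (λ z → bit (is (c z s′) (c z s))))) ⟩
        Σ′ (λ s → Σ′ λ s′ → (w s * w s′) * Σ′ (λ z → bit (is (c z s′) (c z s))))
          ≤⟨ sumℕ-≤ (λ s → sumℕ-≤ λ s′ → ℕₚ.*-monoʳ-≤ (w s * w s′) (collide′ s s′)) ⟩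
        Σ′ (λ s → Σ′ λ s′ → (w s * w s′) * ((f + 2) + bit (is s s′) * p))
          ≡⟨ cong-Σ (λ s → trans (cong-Σ λ s′ → lemma (w s) (w s′) (f + 2) (bit (is s s′)) p)
               (Σℕ.∑-distrib-+ (λ s′ → (w s * w s′) * (f + 2)) (λ s′ → (bit (is s s′) * w s′) * (w s * p)))) ⟩
        Σ′ (λ s → Σ′ (λ s′ → (w s * w s′) * (f + 2)) + Σ′ (λ s′ → (bit (is s s′) * w s′) * (w s * p)))
          ≡⟨ cong-Σ (λ s → cong₂ _+_ (scaleʳ (f + 2) (λ s′ → w s * w s′))
               (trans (scaleʳ (w s * p) (λ s′ → bit (is s s′) * w s′)) (trans (cong (λ t → t * (w s * p)) (sum-is w s))
                 (trans (sym (ℕₚ.*-assoc (w s) (w s) p)) (cong (λ t → t * p) (w² s)))))) ⟩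
        Σ′ (λ s → Σ′ (λ s′ → w s * w s′) * (f + 2) + w s * p)
          ≡⟨ Σℕ.∑-distrib-+ (λ s → Σ′ (λ s′ → w s * w s′) * (f + 2)) (λ s → w s * p) ⟩
        Σ′ (λ s → Σ′ (λ s′ → w s * w s′) * (f + 2)) + Σ′ (λ s → w s * p)
          ≡⟨ cong₂ _+_ (trans (scaleʳ (f + 2) (λ s → Σ′ (λ s′ → w s * w s′))) (cong (λ t → t * (f + 2)) (sym (square-sum w)))) (scaleʳ p w) ⟩
        (σ * σ) * (f + 2) + σ * p ∎
        where
        open ℕₚ.≤-Reasoning
        lemma : ∀ a b f d p → (a * b) * (f + d * p) ≡ (a * b) * f + (d * b) * (a * p)
        lemma = ℕS.solve-∀

      dev : Fin p → Fin e → ℕ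
      dev z i = ℕ.∣ e * number i z - σ ∣ * ℕ.∣ e * number i z - σ ∣

      dev-total : ∀ z → Σ′ (dev z) + e * (σ * σ) ≡ (e * e) * Σ′ (λ i → number i z * number i z)
      dev-total z = ℕₚ.+-cancelʳ-≡ (e * (σ * σ)) _ _ (begin
        (Σ′ (dev z) + e * (σ * σ)) + e * (σ * σ)
          ≡⟨ lemma (Σ′ (dev z)) e σ ⟩
        Σ′ (dev z) + (2 * e * σ) * σ
          ≡⟨ cong (λ t → Σ′ (dev z) + (2 * e * σ) * t) (sym (number-total z)) ⟩
        Σ′ (dev z) + (2 * e * σ) * Σ′ (λ i → number i z)
          ≡⟨ cong (λ t → Σ′ (dev z) + t) (sym (scaleˡ (2 * e * σ) (λ i → number i z))) ⟩
        Σ′ (dev z) + Σ′ (λ i → (2 * e * σ) * number i z)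
          ≡⟨ sym (Σℕ.∑-distrib-+ (dev z) (λ i → (2 * e * σ) * number i z)) ⟩
        Σ′ (λ i → dev z i + (2 * e * σ) * number i z)
          ≡⟨ cong-Σ (λ i → trans (cong (λ t → dev z i + t) (lemma₁ e σ (number i z))) (trans (diff-square (e * number i z) σ) (cong (λ t → t + σ * σ) (lemma₂ e (number i z))))) ⟩
        Σ′ (λ i → (e * e) * (number i z * number i z) + σ * σ)
          ≡⟨ Σℕ.∑-distrib-+ (λ i → (e * e) * (number i z * number i z)) (λ _ → σ * σ) ⟩
        Σ′ (λ i → (e * e) * (number i z * number i z)) + Σ′ {e} (λ _ → σ * σ)
          ≡⟨ cong₂ _+_ (scaleˡ (e * e) (λ i → number i z * number i z)) (sumℕ-const e (σ * σ)) ⟩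
        (e * e) * Σ′ (λ i → number i z * number i z) + e * (σ * σ) ∎)
        where
        open ≡-Reasoning
        lemma : ∀ d e s → (d + e * (s * s)) + e * (s * s) ≡ d + (2 * e * s) * s
        lemma = ℕS.solve-∀
        lemma₁ : ∀ e s n → (2 * e * s) * n ≡ 2 * ((e * n) * s)
        lemma₁ = ℕS.solve-∀
        lemma₂ : ∀ e n → (e * n) * (e * n) ≡ (e * e) * (n * n)
        lemma₂ = ℕS.solve-∀

      -- Expanding the squares, the main term e² σ² f is cancelled against p e σ² because f e ≤ p.
      -- The rest is 2 e² σ² + e² σ p, at most 3 e² σ p because σ ≤ p.
      all-dev≤ : Σ′ (λ z → Σ′ (dev z)) ≤ 3 * (e * e) * (σ * p)
      all-dev≤ = ℕₚ.+-cancelʳ-≤ (p * (e * (σ * σ))) _ _ (begin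
        Σ′ (λ z → Σ′ (dev z)) + p * (e * (σ * σ))
          ≡⟨ cong (λ t → Σ′ (λ z → Σ′ (dev z)) + t) (sym (sumℕ-const p (e * (σ * σ)))) ⟩
        Σ′ (λ z → Σ′ (dev z)) + Σ′ {p} (λ _ → e * (σ * σ))
          ≡⟨ sym (Σℕ.∑-distrib-+ (λ z → Σ′ (dev z)) (λ _ → e * (σ * σ))) ⟩
        Σ′ (λ z → Σ′ (dev z) + e * (σ * σ))
          ≡⟨ trans (cong-Σ dev-total) (scaleˡ (e * e) (λ z → Σ′ λ i → number i z * number i z)) ⟩
        (e * e) * moment
          ≤⟨ ℕₚ.*-monoʳ-≤ (e * e) moment≤ ⟩
        (e * e) * ((σ * σ) * (f + 2) + σ * p)
          ≡⟨ lemma e σ f p ⟩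
        (f * e) * (e * (σ * σ)) + (2 * (e * e) * (σ * σ) + (e * e) * (σ * p))
          ≤⟨ ℕₚ.+-mono-≤ (ℕₚ.*-monoˡ-≤ (e * (σ * σ)) fe≤p) (ℕₚ.+-monoˡ-≤ ((e * e) * (σ * p)) (ℕₚ.*-monoʳ-≤ (2 * (e * e)) (ℕₚ.*-monoʳ-≤ σ (count≤n S)))) ⟩
        p * (e * (σ * σ)) + (2 * (e * e) * (σ * p) + (e * e) * (σ * p))
          ≡⟨ lemma′ (p * (e * (σ * σ))) (e * e) (σ * p) ⟩
        3 * (e * e) * (σ * p) + p * (e * (σ * σ)) ∎)
        where
        open ℕₚ.≤-Reasoning
        lemma : ∀ e s f p → (e * e) * ((s * s) * (f + 2) + s * p) ≡ (f * e) * (e * (s * s)) + (2 * (e * e) * (s * s) + (e * e) * (s * p))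
        lemma = ℕS.solve-∀
        lemma′ : ∀ a b c → a + (2 * b * c + b * c) ≡ 3 * b * c + a
        lemma′ = ℕS.solve-∀

    bad : Fin e → Fin p → Bool
    bad i z = ⌊ 2 * e * number i z ≤? σ ⌋

    private
      bad-dev : ∀ i z → bit (bad i z) * (σ * σ) ≤ 4 * dev z i
      bad-dev i z with 2 * e * number i z ≤? σ
      ... | no _ = z≤n
      ... | yes le with ℕₚ.m≤n⇒∃[o]m+o≡n le
      ... | o , eq = ℕₚ.≤-trans (ℕₚ.≤-reflexive (ℕₚ.+-identityʳ (σ * σ))) (ℕₚ.≤-trans (ℕₚ.*-mono-≤ half half) (ℕₚ.≤-reflexive (lemma d)))
        where
        x = e * number i z
        d = ℕ.∣ x - σ ∣
        σ≡ : σ ≡ x + (x + o)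
        σ≡ = trans (sym eq) (l e (number i z) o)
          where l : ∀ e n o → 2 * e * n + o ≡ e * n + (e * n + o)
                l = ℕS.solve-∀
        d≡ : d ≡ x + o
        d≡ = trans (cong (λ t → ℕ.∣ x - t ∣) σ≡) (ℕₚ.∣m-m+n∣≡n x (x + o))
        half : σ ≤ 2 * d
        half = ℕₚ.≤-trans (ℕₚ.≤-reflexive σ≡) (ℕₚ.≤-trans (ℕₚ.+-monoˡ-≤ (x + o) (ℕₚ.m≤m+n x o))
          (ℕₚ.≤-reflexive (trans (cong (λ t → (x + o) + t) (sym (ℕₚ.+-identityʳ (x + o)))) (cong (2 *_) (sym d≡)))))
        lemma : ∀ d → 2 * d * (2 * d) ≡ 4 * (d * d)
        lemma = ℕS.solve-∀

      member≤sum : ∀ {n} (g : Fin n → ℕ) i → g i ≤ Σ′ g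
      member≤sum g zero    = ℕₚ.m≤m+n _ _
      member≤sum g (suc i) = ℕₚ.≤-trans (member≤sum (g ∘ suc) i) (ℕₚ.m≤n+m _ (g zero))

    abstract
      -- Chebyshev's inequality: at a bad point the deviation is at least σ / 2, so the constant is
      -- 4 times the 3 of `all-dev≤`.
      few-bad : ∀ i → count (bad i) * σ ≤ 12 * (e * e) * p
      few-bad i with σ ℕ.≟ 0
      ... | yes z = ℕₚ.≤-trans (ℕₚ.≤-reflexive (trans (cong (λ t → count (bad i) * t) z) (ℕₚ.*-zeroʳ (count (bad i))))) z≤n
      ... | no nz = ℕₚ.*-cancelʳ-≤ (count (bad i) * σ) (12 * (e * e) * p) σ {{ℕ.≢-nonZero nz}} (begin
        count (bad i) * σ * σ
          ≡⟨ trans (ℕₚ.*-assoc (count (bad i)) σ σ) (sym (scaleʳ (σ * σ) (bit ∘ bad i))) ⟩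
        Σ′ (λ z → bit (bad i z) * (σ * σ))
          ≤⟨ sumℕ-≤ (λ z → ℕₚ.≤-trans (bad-dev i z) (ℕₚ.*-monoʳ-≤ 4 (member≤sum (dev z) i))) ⟩
        Σ′ (λ z → 4 * Σ′ (dev z))
          ≡⟨ scaleˡ 4 (λ z → Σ′ (dev z)) ⟩
        4 * Σ′ (λ z → Σ′ (dev z))
          ≤⟨ ℕₚ.*-monoʳ-≤ 4 all-dev≤ ⟩
        4 * (3 * (e * e) * (σ * p))
          ≡⟨ lemma e σ p ⟩
        12 * (e * e) * p * σ ∎)
        where
        open ℕₚ.≤-Reasoning
        lemma : ∀ e s p → 4 * (3 * (e * e) * (s * p)) ≡ 12 * (e * e) * p * s
        lemma = ℕS.solve-∀

  private
    count-union : ∀ {m} (P : Fin p → Bool) (Q : Fin m → Fin p → Bool) → (∀ z → P z ≡ true → ∃ λ j → Q j z ≡ true) →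
                  count P ≤ Σ′ λ j → count (Q j)
    count-union P Q h = ℕₚ.≤-trans (sumℕ-≤ pointwise) (ℕₚ.≤-reflexive (sym (Σℕ.∑-comm (λ j z → bit (Q j z)))))
      where
      member≤sum′ : ∀ {n} (g : Fin n → ℕ) i → g i ≤ Σ′ g
      member≤sum′ g zero    = ℕₚ.m≤m+n _ _
      member≤sum′ g (suc i) = ℕₚ.≤-trans (member≤sum′ (g ∘ suc) i) (ℕₚ.m≤n+m _ (g zero))
      pointwise : ∀ z → bit (P z) ≤ Σ′ λ j → bit (Q j z)
      pointwise z with P z in eq
      ... | false = z≤n
      ... | true with h z eq
      ... | j , q = ℕₚ.≤-trans (ℕₚ.≤-reflexive (cong bit (sym q))) (member≤sum′ (λ j → bit (Q j z)) j)

  -- Points are chosen one at a time, avoiding those that are bad for one of the remaining candidate sets.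
  embed : ∀ m K → threshold e m K ≤ p → (S : Fin m → Fin p → Bool) → (∀ j → p ≤ K * count (S j)) → (κ : Fin m → Fin m → Fin e) →
          Σ (Fin m → Fin p) λ b → (∀ j → S j (b j) ≡ true) × (∀ i j → toℕ i < toℕ j → c (b i) (b j) ≡ κ i j)
  embed zero K _ S large κ = (λ ()) , (λ ()) , λ ()
  embed (suc m) K le S large κ with Fₚ.any? good?
    where
    good? : ∀ z → Dec (S zero z ≡ true × ∀ j → bad (S (suc j)) (κ zero (suc j)) z ≡ false)
    good? z = (S zero z Boolₚ.≟ true) ×-dec Fₚ.all? λ j → bad (S (suc j)) (κ zero (suc j)) z Boolₚ.≟ false
  ... | no none = ⊥-elim (ℕₚ.<-irrefl refl (ℕₚ.<-≤-trans (ℕₚ.<-≤-trans (ℕₚ.≤-refl) (ℕₚ.≤-trans (ℕₚ.m≤m+n _ (threshold e m (K * (2 * e)))) le))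
      (ℕₚ.≤-trans (large zero) (ℕₚ.*-monoʳ-≤ K all-bad))))
    where
    few : ∀ j → count (bad (S (suc j)) (κ zero (suc j))) ≤ 12 * (e * e) * K
    few j with count (S (suc j)) ℕ.≟ 0
    ... | yes z = ⊥-elim (ℕₚ.<-irrefl refl (ℕₚ.<-≤-trans (ℕₚ.≤-trans (s≤s z≤n) le) (ℕₚ.≤-trans (large (suc j)) (ℕₚ.≤-reflexive (trans (cong (λ t → K * t) z) (ℕₚ.*-zeroʳ K))))))
    ... | no nz = ℕₚ.*-cancelʳ-≤ _ _ (count (S (suc j))) {{ℕ.≢-nonZero nz}} (ℕₚ.≤-trans (few-bad (S (suc j)) (κ zero (suc j)))
        (ℕₚ.≤-trans (ℕₚ.*-monoʳ-≤ (12 * (e * e)) (large (suc j))) (ℕₚ.≤-reflexive (sym (ℕₚ.*-assoc (12 * (e * e)) K (count (S (suc j))))))))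
    all-bad : count (S zero) ≤ m * (12 * (e * e) * K)
    all-bad = ℕₚ.≤-trans (count-union (S zero) (λ j → bad (S (suc j)) (κ zero (suc j))) covered)
      (ℕₚ.≤-trans (sumℕ-≤ few) (ℕₚ.≤-reflexive (sumℕ-const m _)))
      where
      covered : ∀ z → S zero z ≡ true → ∃ λ j → bad (S (suc j)) (κ zero (suc j)) z ≡ true
      covered z t with Fₚ.any? (λ j → bad (S (suc j)) (κ zero (suc j)) z Boolₚ.≟ true)
      ... | yes r = r
      ... | no n = ⊥-elim (none (z , t , λ j → Boolₚ.¬-not λ h → n (j , h)))
  ... | yes (z , t , good) with embed m (K * (2 * e)) (ℕₚ.≤-trans (ℕₚ.m≤n+m _ (suc (K * (m * (12 * (e * e) * K))))) le) S′ large′ (λ i j → κ (suc i) (suc j))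
    where
    S′ : Fin m → Fin p → Bool
    S′ j s = S (suc j) s ∧ is (c z s) (κ zero (suc j))
    count-∧ : ∀ j → count (S′ j) ≡ number (S (suc j)) (κ zero (suc j)) z
    count-∧ j = Σℕ.sum-cong-≗ λ s → and (S (suc j) s) (is (c z s) (κ zero (suc j)))
      where and : ∀ a b → bit (a ∧ b) ≡ bit a * bit b
            and true  b = sym (ℕₚ.+-identityʳ (bit b))
            and false b = refl
    not-bad : ∀ j → count (S (suc j)) ≤ 2 * e * count (S′ j)
    not-bad j with 2 * e * number (S (suc j)) (κ zero (suc j)) z ≤? count (S (suc j)) | good j
    ... | no n | _ = ℕₚ.≤-trans (ℕₚ.<⇒≤ (ℕₚ.≰⇒> n)) (ℕₚ.≤-reflexive (cong (λ t → 2 * e * t) (sym (count-∧ j))))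
    ... | yes _ | ()
    large′ : ∀ j → p ≤ K * (2 * e) * count (S′ j)
    large′ j = ℕₚ.≤-trans (large (suc j)) (ℕₚ.≤-trans (ℕₚ.*-monoʳ-≤ K (not-bad j)) (ℕₚ.≤-reflexive (sym (ℕₚ.*-assoc K (2 * e) _))))
  ... | b , inS , col = b′ , inS′ , col′
    where
    b′ : Fin (suc m) → Fin p
    b′ zero    = z
    b′ (suc j) = b j
    split-and : ∀ x y → x ∧ y ≡ true → x ≡ true × y ≡ true
    split-and true true h = refl , refl
    inS′ : ∀ j → S j (b′ j) ≡ true
    inS′ zero    = t
    inS′ (suc j) = proj₁ (split-and (S (suc j) (b j)) _ (inS j))
    col′ : ∀ i j → toℕ i < toℕ j → c (b′ i) (b′ j) ≡ κ i j
    col′ zero    (suc j) lt = is-true (proj₂ (split-and (S (suc j) (b j)) _ (inS j)))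
    col′ (suc i) (suc j) lt = col i j (ℕₚ.≤-pred lt)

-- Difference families over prime fields

isYes-true : {P : Set} (d : Dec P) → P → ⌊ d ⌋ ≡ true
isYes-true (yes _) _ = refl
isYes-true (no n)  x = ⊥-elim (n x)

isYes-true⁻¹ : {P : Set} (d : Dec P) → ⌊ d ⌋ ≡ true → P
isYes-true⁻¹ (yes x) _ = x

isYes-false⁻¹ : {P : Set} (d : Dec P) → ⌊ d ⌋ ≡ false → ¬ P
isYes-false⁻¹ (no n) _ = n

abstract
  disjoint-parts : ∀ p k → 0 < k → k ≤ p → Σ (Fin k → Fin p → Bool) λ S →
                   (∀ j → p ≤ 2 * k * count (S j)) × (∀ {i j x} → S i x ≡ true → S j x ≡ true → i ≡ j)
  disjoint-parts p k 0<k k≤p = interval , p≤ , λ {i} {j} {x} a b → Fₚ.toℕ-injective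
      (trans (sym (isYes-true⁻¹ (toℕ x / width ℕ.≟ toℕ i) a)) (isYes-true⁻¹ (toℕ x / width ℕ.≟ toℕ j) b))
    where
    instance
      k≢0 : NonZero k
      k≢0 = >-nonZero 0<k
    width : ℕ
    width = p / k
    0<width : 0 < width
    0<width = DM.m≥n⇒m/n>0 k≤p
    instance
      width≢0 : NonZero width
      width≢0 = >-nonZero 0<width
    interval : Fin k → Fin p → Bool
    interval j x = ⌊ toℕ x / width ℕ.≟ toℕ j ⌋
    intervalPoint : ∀ (j : Fin k) (i : Fin width) → toℕ i + toℕ j * width < p
    intervalPoint j i = ℕₚ.<-≤-trans (ℕₚ.+-monoˡ-< (toℕ j * width) (Fₚ.toℕ<n i))
      (ℕₚ.≤-trans (ℕₚ.*-monoˡ-≤ width (Fₚ.toℕ<n j)) (ℕₚ.≤-trans (ℕₚ.≤-reflexive (ℕₚ.*-comm k width)) (DM.m/n*n≤m p k)))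
    interval-size : ∀ j → width ≤ count (interval j)
    interval-size j = count-lower (interval j) (λ i → fromℕ< (intervalPoint j i))
      (λ {i} {i′} h → Fₚ.toℕ-injective (ℕₚ.+-cancelʳ-≡ (toℕ j * width) (toℕ i) (toℕ i′)
        (trans (sym (Fₚ.toℕ-fromℕ< (intervalPoint j i))) (trans (cong toℕ h) (Fₚ.toℕ-fromℕ< (intervalPoint j i′))))))
      λ i → isYes-true (_ ℕ.≟ _) (trans (cong (_/ width) (Fₚ.toℕ-fromℕ< (intervalPoint j i)))
        (trans (DM.+-distrib-/-∣ʳ (toℕ i) (Div.n∣m*n (toℕ j))) (cong₂ _+_ (DM.m<n⇒m/n≡0 (Fₚ.toℕ<n i)) (DM.m*n/n≡m (toℕ j) width))))
    -- The factor 2 absorbs the rounding of p / k, which is at least 1.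
    p≤ : ∀ j → p ≤ 2 * k * count (interval j)
    p≤ j = ℕₚ.≤-trans (ℕₚ.≤-trans (ℕₚ.≤-reflexive (DM.m≡m%n+[m/n]*n p k)) (ℕₚ.+-monoˡ-≤ (width * k) (ℕₚ.≤-trans (ℕₚ.<⇒≤ (DM.m%n<n p k))
        (ℕₚ.≤-trans (ℕₚ.≤-reflexive (sym (ℕₚ.*-identityˡ k))) (ℕₚ.*-monoˡ-≤ k 0<width)))))
      (ℕₚ.≤-trans (ℕₚ.≤-reflexive (lemma width k)) (ℕₚ.*-monoʳ-≤ (2 * k) (interval-size j)))
      where lemma : ∀ w k → w * k + w * k ≡ 2 * k * w
            lemma = ℕS.solve-∀

module DifferenceFamily (k : ℕ) (2≤k : 2 ≤ k) where
  private
    0<k : 0 < k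
    0<k = ℕₚ.≤-trans (s≤s z≤n) 2≤k

  pairOf : Fin (k * k) → Fin k × Fin k
  pairOf = remQuot {k} k

  increasing : Fin (k * k) → Bool
  increasing x = ⌊ toℕ (proj₁ (pairOf x)) <? toℕ (proj₂ (pairOf x)) ⌋

  increasing-combine : ∀ {i j} → toℕ i < toℕ j → increasing (combine i j) ≡ true
  increasing-combine {i} {j} lt = isYes-true (_ <? _)
    (subst₂ (λ a b → toℕ a < toℕ b) (sym (cong proj₁ (Fₚ.remQuot-combine i j))) (sym (cong proj₂ (Fₚ.remQuot-combine i j))) lt)

  increasing⇒ : ∀ x → increasing x ≡ true → toℕ (proj₁ (pairOf x)) < toℕ (proj₂ (pairOf x))
  increasing⇒ x h = isYes-true⁻¹ (_ <? _) h

  abstract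
    e : ℕ
    e = count increasing

    pairs : Σ (Fin e → Fin (k * k)) λ g →
            (∀ i → increasing (g i) ≡ true) × (∀ x → increasing x ≡ true → ∃ λ i → g i ≡ x) × (∀ {i j} → g i ≡ g j → i ≡ j)
    pairs = enumerate increasing

    0<e : 0 < e
    0<e = count-lower {k * k} {1} increasing (λ _ → combine i₀ i₁) (λ { {zero} {zero} _ → refl }) λ _ → increasing-combine lt
      where
      i₀ i₁ : Fin k
      i₀ = fromℕ< 0<k
      i₁ = fromℕ< 2≤k
      lt : toℕ i₀ < toℕ i₁
      lt = subst₂ _<_ (sym (Fₚ.toℕ-fromℕ< 0<k)) (sym (Fₚ.toℕ-fromℕ< 2≤k)) (s≤s z≤n)

  κ : Fin k → Fin k → Fin e
  κ i j with toℕ i <? toℕ j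
  ... | yes lt = proj₁ (proj₁ (proj₂ (proj₂ pairs)) (combine i j) (increasing-combine lt))
  ... | no _   = fromℕ< 0<e

  κ-pair : ∀ {i j} → toℕ i < toℕ j → proj₁ pairs (κ i j) ≡ combine i j
  κ-pair {i} {j} lt with toℕ i <? toℕ j
  ... | yes lt′ = proj₂ (proj₁ (proj₂ (proj₂ pairs)) (combine i j) (increasing-combine lt′))
  ... | no n    = ⊥-elim (n lt)

  κ-injective : ∀ {i j i′ j′} → toℕ i < toℕ j → toℕ i′ < toℕ j′ → κ i j ≡ κ i′ j′ → i ≡ i′ × j ≡ j′
  κ-injective {i} {j} {i′} {j′} lt lt′ h = Fₚ.combine-injective i j i′ j′ (trans (sym (κ-pair lt)) (trans (cong (proj₁ pairs) h) (κ-pair lt′)))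

  κ-surjective : ∀ x → Σ (Fin k) λ i → Σ (Fin k) λ j → toℕ i < toℕ j × κ i j ≡ x
  κ-surjective x = i , j , lt , proj₂ (proj₂ (proj₂ pairs)) (trans (κ-pair lt) (Fₚ.combine-remQuot {k} k (proj₁ pairs x)))
    where
    i = proj₁ (pairOf (proj₁ pairs x))
    j = proj₂ (pairOf (proj₁ pairs x))
    lt : toℕ i < toℕ j
    lt = increasing⇒ (proj₁ pairs x) (proj₁ (proj₂ pairs) x)

  module _ (p′ : ℕ) (isPrime : Prime (suc p′)) (q : ℕ) (0<f : 0 < 2 * q) (fe : 2 * q * e ≡ p′)
           (b : Fin k → Fin (suc p′)) (b-distinct : ∀ {i j} → b i ≡ b j → i ≡ j) (2<p : 2 < suc p′) where
    private
      f = 2 * q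
    open Colouring p′ isPrime e f 0<e 0<f fe

    -- The differences b i - b j with i < j represent each of the e colours once, so every nonzero d
    -- is h (b i - b j) for exactly one such pair and one f-th root of unity h. As f is even, -1 is
    -- such a root, and h and -h give the same unordered pairs of points; one of them is kept. The
    -- translates of the tuples h b then cover every pair once.
    module _ (coloured : ∀ i j → toℕ i < toℕ j → χ (v (b i) -ᶻ v (b j)) ≡ κ i j) where
      private
        even-power : ∀ a → (-ᶻ a) ^ᶻ f ≡ a ^ᶻ f
        even-power a = trans (^ᶻ-* (-ᶻ a) 2 q) (trans (cong (_^ᶻ q) (lemma a)) (sym (^ᶻ-* a 2 q)))
          where lemma : ∀ a → (-ᶻ a) *ᶻ ((-ᶻ a) *ᶻ + 1) ≡ a *ᶻ (a *ᶻ + 1)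
                lemma = ℤS.solve-∀

        Δ : Fin k → Fin k → ℤ
        Δ i j = v (b i) -ᶻ v (b j)
        Δ≉0 : ∀ {i j} → i ≢ j → ¬ Δ i j ≈ + 0
        Δ≉0 n = v-≉ λ h → n (b-distinct (sym h))

        neg : Fin p → Fin p
        neg h = ρ (-ᶻ v h)
        v-neg : ∀ h → v (neg h) ≈ -ᶻ v h
        v-neg h = val-res {p} (-ᶻ v h)
        lower : Fin p → Bool
        lower h = ⌊ toℕ h <? toℕ (neg h) ⌋
        lower⇒ : ∀ h → lower h ≡ true → toℕ h < toℕ (neg h)
        lower⇒ h = isYes-true⁻¹ (toℕ h <? toℕ (neg h))
        ⇒lower : ∀ h → toℕ h < toℕ (neg h) → lower h ≡ true
        ⇒lower h = isYes-true (toℕ h <? toℕ (neg h))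
        neg-neg : ∀ h → neg (neg h) ≡ h
        neg-neg h = res-≡ {p} (≈-trans (≈-neg (v-neg h)) (≈-reflexive (ℤₚ.neg-involutive (v h))))

        unity : Fin p → Bool
        unity h = is (ρ (v h ^ᶻ f)) (ρ (+ 1))
        unity⇒ : ∀ h → unity h ≡ true → v h ^ᶻ f ≈ + 1
        unity⇒ h t = res-injective {p} {v h ^ᶻ f} {+ 1} (is-true t)
        ⇒unity : ∀ h → v h ^ᶻ f ≈ + 1 → unity h ≡ true
        ⇒unity h t = trans (cong (λ z → is z (ρ (+ 1))) (res-cong {p} t)) (is-refl (ρ (+ 1)))

        unity-≉0 : ∀ h → v h ^ᶻ f ≈ + 1 → ¬ v h ≈ + 0
        unity-≉0 h t z = unit⇒≉0 {v h ^ᶻ f} (+ 1 , ≈-trans (≈-reflexive (ℤₚ.*-identityˡ (v h ^ᶻ f))) t)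
          (≈-trans (≈-^ f z) (zero-power f 0<f))
          where zero-power : ∀ n → 0 < n → (+ 0) ^ᶻ n ≈ + 0
                zero-power (suc n) _ = ≈-reflexive (ℤₚ.*-zeroˡ ((+ 0) ^ᶻ n))

        -- 2 is invertible, so h ≠ − h for h ≠ 0, and exactly one of h, − h is lower.
        lower-neg : ∀ h → ¬ v h ≈ + 0 → lower h ≡ false → lower (neg h) ≡ true
        lower-neg h h≉0 n with ℕₚ.<-cmp (toℕ (neg h)) (toℕ h)
        ... | tri< lt _ _ = ⇒lower (neg h) (subst (λ z → toℕ (neg h) < toℕ z) (sym (neg-neg h)) lt)
        ... | tri> _ _ gt = ⊥-elim (isYes-false⁻¹ (toℕ h <? toℕ (neg h)) n gt)
        ... | tri≈ _ eq _ = ⊥-elim (h≉0 (no-zero-divisors {+ 2} {v h} 2≉0 (≈-trans (≈-reflexive (lemma (v h)))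
              (≈-trans (≈-+ (≈-refl {_} {v h}) (≈-trans (≈-reflexive (cong v (sym (Fₚ.toℕ-injective eq)))) (v-neg h))) (≈-reflexive (ℤₚ.+-inverseʳ (v h)))))))
          where
          lemma : ∀ h → + 2 *ᶻ h ≡ h +ᶻ h
          lemma = ℤS.solve-∀
          2≉0 : ¬ + 2 ≈ + 0
          2≉0 z = ℕₚ.<⇒≱ 2<p (Div.∣⇒≤ (≈0⇒∣ z))

        Index : Set
        Index = Σ (Fin p × Fin p) λ { (h , a) → unity h ∧ lower h ≡ true }
        pt : Fin p → Fin p → Fin k → Fin p
        pt h a i = ρ (v a +ᶻ v h *ᶻ v (b i))
        block : Index → Fin k → Fin p
        block ((h , a) , _) = pt h a

        split-and : ∀ x y → x ∧ y ≡ true → x ≡ true × y ≡ true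
        split-and true true h = refl , refl

        pt-diff : ∀ {h a h′ a′ s t s′ t′} → pt h a s ≡ pt h′ a′ s′ → pt h a t ≡ pt h′ a′ t′ → v h *ᶻ Δ s t ≈ v h′ *ᶻ Δ s′ t′
        pt-diff {h} {a} {h′} {a′} {s} {t} {s′} {t′} e₁ e₂ = ≈-trans (≈-reflexive (lemma (v a) (v h) (v (b s)) (v (b t))))
          (≈-trans (≈-- (res-injective {p} {v a +ᶻ v h *ᶻ v (b s)} {v a′ +ᶻ v h′ *ᶻ v (b s′)} e₁) (res-injective {p} {v a +ᶻ v h *ᶻ v (b t)} {v a′ +ᶻ v h′ *ᶻ v (b t′)} e₂))
            (≈-reflexive (sym (lemma (v a′) (v h′) (v (b s′)) (v (b t′))))))
          where lemma : ∀ a h s t → h *ᶻ (s -ᶻ t) ≡ (a +ᶻ h *ᶻ s) -ᶻ (a +ᶻ h *ᶻ t)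
                lemma = ℤS.solve-∀

        pt-injective : ∀ {h a s t} → v h ^ᶻ f ≈ + 1 → pt h a s ≡ pt h a t → s ≡ t
        pt-injective {h} {a} {s} {t} u e₁ with s F.≟ t
        ... | yes r = r
        ... | no n  = ⊥-elim (Δ≉0 n (no-zero-divisors (unity-≉0 h u) (≈-trans (pt-diff {h} {a} {h} {a} {s} {t} {t} {t} e₁ refl)
                        (≈-trans (≈-*ˡ (v h) (≈-reflexive (ℤₚ.+-inverseʳ (v (b t))))) (≈-reflexive (ℤₚ.*-zeroʳ (v h)))))))

        find′ : ∀ {x y} → x ≢ y → Joins block x y
        find′ {x} {y} x≢y = go (lower h) refl
          where
          d = v x -ᶻ v y
          d≉0 : ¬ d ≈ + 0
          d≉0 = v-≉ λ h → x≢y (sym h)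
          pr = κ-surjective (χ d)
          i = proj₁ pr
          j = proj₁ (proj₂ pr)
          i<j = proj₁ (proj₂ (proj₂ pr))
          i≢j : i ≢ j
          i≢j h = ℕₚ.<-irrefl (cong toℕ h) i<j
          U = unit (Δ≉0 i≢j)
          h = ρ (proj₁ U *ᶻ d)
          vh : v h ≈ proj₁ U *ᶻ d
          vh = val-res {p} (proj₁ U *ᶻ d)
          hΔ : v h *ᶻ Δ i j ≈ d
          hΔ = ≈-trans (≈-* vh (≈-refl {_} {Δ i j})) (≈-trans (≈-reflexive (lemma (proj₁ U) d (Δ i j))) (≈-trans (≈-* (proj₂ U) (≈-refl {_} {d})) (≈-reflexive (ℤₚ.*-identityˡ d))))
            where lemma : ∀ u d z → (u *ᶻ d) *ᶻ z ≡ (u *ᶻ z) *ᶻ d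
                  lemma = ℤS.solve-∀
          hf : v h ^ᶻ f ≈ + 1
          hf = ≈-trans (≈-^ f vh) (≈-trans (≈-reflexive (*-^ᶻ (proj₁ U) d f)) (≈-trans (≈-*ˡ (proj₁ U ^ᶻ f)
                 (χ-≡ d≉0 (Δ≉0 i≢j) (trans (sym (proj₂ (proj₂ (proj₂ pr)))) (sym (coloured i j i<j)))))
                 (≈-trans (≈-reflexive (sym (*-^ᶻ (proj₁ U) (Δ i j) f))) (≈-trans (≈-^ f (proj₂ U)) (≈-reflexive (one-^ f))))))
          through : ∀ g s t → v g *ᶻ Δ s t ≈ d → let a = ρ (v x -ᶻ v g *ᶻ v (b s)) in pt g a s ≡ x × pt g a t ≡ y
          through g s t gΔ = res-≡ {p} (≈-trans (≈-+ va (≈-refl {_} {v g *ᶻ v (b s)})) (≈-reflexive (l₁ (v x) (v g *ᶻ v (b s)))))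
                           , res-≡ {p} (≈-trans (≈-+ va (≈-refl {_} {v g *ᶻ v (b t)})) (≈-trans (≈-reflexive (l₂ (v x) (v g) (v (b s)) (v (b t))))
                               (≈-trans (≈-- (≈-refl {_} {v x}) gΔ) (≈-reflexive (l₃ (v x) (v y))))))
            where
            va = val-res {p} (v x -ᶻ v g *ᶻ v (b s))
            l₁ : ∀ x z → (x -ᶻ z) +ᶻ z ≡ x
            l₁ = ℤS.solve-∀
            l₂ : ∀ x g s t → (x -ᶻ g *ᶻ s) +ᶻ g *ᶻ t ≡ x -ᶻ g *ᶻ (s -ᶻ t)
            l₂ = ℤS.solve-∀
            l₃ : ∀ x y → x -ᶻ (x -ᶻ y) ≡ y
            l₃ = ℤS.solve-∀
          go : ∀ c → lower h ≡ c → Joins block x y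
          go true  lo = ((h , ρ (v x -ᶻ v h *ᶻ v (b i))) , cong₂ _∧_ (⇒unity h hf) lo) , i , j , i≢j , through h i j hΔ
          go false lo = ((neg h , ρ (v x -ᶻ v (neg h) *ᶻ v (b j))) , cong₂ _∧_ (⇒unity (neg h) nf) (lower-neg h (unity-≉0 h hf) lo))
                      , j , i , (λ r → i≢j (sym r)) , through (neg h) j i
                          (≈-trans (≈-* (v-neg h) (≈-refl {_} {Δ j i})) (≈-trans (≈-reflexive (lemma (v h) (v (b i)) (v (b j)))) hΔ))
            where
            nf : v (neg h) ^ᶻ f ≈ + 1
            nf = ≈-trans (≈-^ f (v-neg h)) (≈-trans (≈-reflexive (even-power (v h))) hf)
            lemma : ∀ h i j → (-ᶻ h) *ᶻ (j -ᶻ i) ≡ h *ᶻ (i -ᶻ j)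
            lemma = ℤS.solve-∀

        colour : ∀ {h s t} → v h ^ᶻ f ≈ + 1 → χ (v h *ᶻ Δ s t) ≡ χ (Δ s t)
        colour {h} {s} {t} u = χ-cong (≈-trans (≈-reflexive (*-^ᶻ (v h) (Δ s t) f)) (≈-trans (≈-* u (≈-refl {_} {Δ s t ^ᶻ f})) (≈-reflexive (ℤₚ.*-identityˡ _))))
        colour-sym : ∀ s t → χ (Δ s t) ≡ χ (Δ t s)
        colour-sym s t = χ-cong (≈-reflexive (trans (cong (_^ᶻ f) (lemma (v (b s)) (v (b t)))) (even-power (Δ t s))))
          where lemma : ∀ s t → s -ᶻ t ≡ -ᶻ (t -ᶻ s)
                lemma = ℤS.solve-∀

        same-pair : ∀ {s t s′ t′} → s ≢ t → s′ ≢ t′ → χ (Δ s t) ≡ χ (Δ s′ t′) → (s ≡ s′ × t ≡ t′) ⊎ (s ≡ t′ × t ≡ s′)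
        same-pair {s} {t} {s′} {t′} n n′ h with ℕₚ.<-cmp (toℕ s) (toℕ t) | ℕₚ.<-cmp (toℕ s′) (toℕ t′)
        ... | tri≈ _ r _ | _ = ⊥-elim (n (Fₚ.toℕ-injective r))
        ... | tri< _ _ _ | tri≈ _ r _ = ⊥-elim (n′ (Fₚ.toℕ-injective r))
        ... | tri> _ _ _ | tri≈ _ r _ = ⊥-elim (n′ (Fₚ.toℕ-injective r))
        ... | tri< a _ _ | tri< c _ _ = inj₁ (κ-injective a c (trans (sym (coloured s t a)) (trans h (coloured s′ t′ c))))
        ... | tri> _ _ a | tri> _ _ c = let (x , y) = κ-injective a c (trans (sym (coloured t s a)) (trans (colour-sym t s) (trans h (trans (colour-sym s′ t′) (coloured t′ s′ c))))) in inj₁ (y , x)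
        ... | tri< a _ _ | tri> _ _ c = inj₂ (κ-injective a c (trans (sym (coloured s t a)) (trans h (trans (colour-sym s′ t′) (coloured t′ s′ c)))))
        ... | tri> _ _ a | tri< c _ _ = let (x , y) = κ-injective a c (trans (sym (coloured t s a)) (trans (colour-sym t s) (trans h (coloured s′ t′ c)))) in inj₂ (y , x)

        index-≡ : ∀ {h a h′ a′ z z′} → h ≡ h′ → a ≡ a′ → _≡_ {A = Index} ((h , a) , z) ((h′ , a′) , z′)
        index-≡ {z = z} {z′} refl refl = cong (_ ,_) (UIP.Decidable⇒UIP.≡-irrelevant Boolₚ._≟_ z z′)

        uniq′ : ∀ {x y : Index} {s t s′ t′} → s ≢ t → s′ ≢ t′ → block x s ≡ block y s′ → block x t ≡ block y t′ → x ≡ y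
        uniq′ {(h , a) , z} {(h′ , a′) , z′} {s} {t} {s′} {t′} n n′ e₁ e₂ = finish
            (same-pair n n′ (trans (sym (colour {h} {s} {t} u)) (trans (χ-cong (≈-^ f hh)) (colour {h′} {s′} {t′} u′))))
          where
          zz = split-and (unity h) (lower h) z
          zz′ = split-and (unity h′) (lower h′) z′
          u = unity⇒ h (proj₁ zz)
          u′ = unity⇒ h′ (proj₁ zz′)
          hh : v h *ᶻ Δ s t ≈ v h′ *ᶻ Δ s′ t′
          hh = pt-diff {h} {a} {h′} {a′} {s} {t} {s′} {t′} e₁ e₂
          finish : (s ≡ s′ × t ≡ t′) ⊎ (s ≡ t′ × t ≡ s′) → _≡_ {A = Index} ((h , a) , z) ((h′ , a′) , z′)
          finish (inj₁ (refl , refl)) = index-≡ {z = z} {z′} h≡h′ (val-injective {p} (≈-trans (≈-reflexive (sym (lemma (v a) (v h *ᶻ v (b s)))))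
              (≈-trans (≈-- (res-injective {p} {v a +ᶻ v h *ᶻ v (b s)} {v a′ +ᶻ v h′ *ᶻ v (b s)} e₁) (≈-reflexive (cong (λ g → v g *ᶻ v (b s)) h≡h′)))
                (≈-reflexive (lemma (v a′) (v h′ *ᶻ v (b s)))))))
            where
            lemma : ∀ a z → (a +ᶻ z) -ᶻ z ≡ a
            lemma = ℤS.solve-∀
            h≡h′ : h ≡ h′
            h≡h′ = val-injective {p} (unit-cancel {p} {Δ s t} (unit (Δ≉0 n)) (≈-trans (≈-reflexive (ℤₚ.*-comm (Δ s t) (v h))) (≈-trans hh (≈-reflexive (ℤₚ.*-comm (v h′) (Δ s t))))))
          finish (inj₂ (refl , refl)) = ⊥-elim (ℕₚ.<-asym (lower⇒ h (proj₂ zz)) (subst₂ (λ g g′ → toℕ g < toℕ g′) h′≡ (trans (cong neg h′≡) (neg-neg h)) (lower⇒ h′ (proj₂ zz′))))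
            where
            h′≡ : h′ ≡ neg h
            h′≡ = val-injective {p} (unit-cancel {p} {Δ t s} (unit (Δ≉0 λ r → n (sym r)))
              (≈-trans (≈-reflexive (ℤₚ.*-comm (Δ t s) (v h′))) (≈-trans (≈-sym hh) (≈-trans (≈-reflexive (lemma (v h) (v (b s)) (v (b t))))
                (≈-*ˡ (Δ t s) (≈-sym (v-neg h)))))))
              where lemma : ∀ h s t → h *ᶻ (s -ᶻ t) ≡ (t -ᶻ s) *ᶻ (-ᶻ h)
                    lemma = ℤS.solve-∀

      difference-design : Decomp k (Fin (suc p′)) _≢_
      difference-design = record
        { Index = Index ; block = block ; irrefl = λ n → n refl
        ; isEdge = λ { ((h , a) , z) n e₁ → n (pt-injective {h} {a} (unity⇒ h (proj₁ (split-and (unity h) (lower h) z))) e₁) }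
        ; find = find′ ; uniq = λ {x} {y} → uniq′ {x} {y} }

  -- The candidate sets are disjoint intervals, so the chosen points are distinct.
  bound : ℕ
  bound = 2 + k + threshold e k (2 * k)

  prime-design : ∀ p′ → Prime (suc p′) → bound < suc p′ → 2 * e ∣ p′ → Decomp k (Fin (suc p′)) _≢_
  prime-design p′ isPrime large (divides q p′≡) =
    difference-design p′ isPrime q 0<f fe b b-distinct 2<p coloured
    where
    p = suc p′
    2<p : 2 < p
    2<p = ℕₚ.≤-<-trans (ℕₚ.≤-trans (ℕₚ.m≤m+n 2 k) (ℕₚ.m≤m+n (2 + k) _)) large
    k≤p : k ≤ p
    k≤p = ℕₚ.≤-trans (ℕₚ.≤-trans (ℕₚ.m≤n+m k 2) (ℕₚ.m≤m+n (2 + k) _)) (ℕₚ.<⇒≤ large)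
    0<q : 0 < q
    0<q = ℕₚ.n≢0⇒n>0 λ z → ℕₚ.<-irrefl refl (ℕₚ.≤-trans (ℕₚ.≤-pred 2<p) (ℕₚ.≤-trans (ℕₚ.≤-reflexive (trans p′≡ (cong (λ w → w * (2 * e)) z))) z≤n))
    fe : 2 * q * e ≡ p′
    fe = trans (lemma q e) (sym p′≡)
      where lemma : ∀ q e → 2 * q * e ≡ q * (2 * e)
            lemma = ℕS.solve-∀
    0<f : 0 < 2 * q
    0<f = ℕₚ.*-mono-≤ {1} {2} (s≤s z≤n) 0<q
    module C = Colouring p′ isPrime e (2 * q) 0<e 0<f fe
    module S = SecondMoment {p} {e} (2 * q) (λ z s → C.χ (C.v z -ᶻ C.v s)) C.collisions (ℕₚ.≤-trans (ℕₚ.≤-reflexive fe) (ℕₚ.n≤1+n p′))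
    parts = disjoint-parts p k 0<k k≤p
    chosen = S.embed k (2 * k) (ℕₚ.≤-trans (ℕₚ.m≤n+m _ (2 + k)) (ℕₚ.<⇒≤ large)) (proj₁ parts) (proj₁ (proj₂ parts)) κ
    b : Fin k → Fin p
    b = proj₁ chosen
    b-distinct : ∀ {i j} → b i ≡ b j → i ≡ j
    b-distinct {i} {j} h = proj₂ (proj₂ parts) (proj₁ (proj₂ chosen) i) (subst (λ x → proj₁ parts j x ≡ true) (sym h) (proj₁ (proj₂ chosen) j))
    coloured : ∀ i j → toℕ i < toℕ j → C.χ (C.v (b i) -ᶻ C.v (b j)) ≡ κ i j
    coloured = proj₂ (proj₂ chosen)

abstract
  design-one-mod : ∀ k → 2 ≤ k → ∀ E → 0 < E → Σ ℕ λ t → 0 < t × E ∣ t × Decomp k (Fin (suc t)) _≢_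
  design-one-mod k 2≤k E 0<E = from (prime-one-mod (E * (2 * D.e)) D.bound (ℕₚ.*-mono-≤ 0<E (ℕₚ.*-mono-≤ {1} {2} (s≤s z≤n) D.0<e)))
    where
    module D = DifferenceFamily k 2≤k
    from : (Σ ℕ λ p′ → Prime (suc p′) × D.bound < suc p′ × (E * (2 * D.e)) ∣ p′) → Σ ℕ λ t → 0 < t × E ∣ t × Decomp k (Fin (suc t)) _≢_
    from (p′ , isPrime , large , d) = p′ , ℕₚ.≤-pred (ℕₚ.≤-trans (s≤s (s≤s z≤n)) large) , Div.∣-trans (Div.m∣m*n {E} (2 * D.e)) d
      , D.prime-design p′ isPrime large (Div.∣-trans (Div.n∣m*n E) d)

-- A progression of design orders

⊥-fill : ∀ {A : Set} → A ↔ (A ⊎ ⊥)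
⊥-fill = mk↔ₛ′ inj₁ (λ { (inj₁ a) → a ; (inj₂ ()) }) (λ { (inj₁ a) → refl ; (inj₂ ()) }) (λ _ → refl)

-- The case of `fillHole` in which the additional class is empty.
gdd-fill : ∀ {k} {X B W : Set} → (∀ (x y : X) → Dec (x ≡ y)) → Decomp k (X × B) (λ x y → proj₁ x ≢ proj₁ y) →
           Incomplete k B W → Incomplete k (X × B) W
gdd-fill {k} {X} {B} {W} _≟_ D I = decomp-iso f (λ {x} {y} → E⇒F {x} {y}) (λ {x} {y} → F⇒E {x} {y})
    (fillHole _≟_ (decomp-iso ⊥-fill (λ n → n) (λ n → n) D) I)
  where
  drop : (X × B) ⊎ (⊥ ⊎ W) → (X × B) ⊎ W
  drop (inj₁ a)         = inj₁ a
  drop (inj₂ (inj₁ ()))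
  drop (inj₂ (inj₂ w))  = inj₂ w
  pad : (X × B) ⊎ W → (X × B) ⊎ (⊥ ⊎ W)
  pad (inj₁ a) = inj₁ a
  pad (inj₂ w) = inj₂ (inj₂ w)
  pad-drop : ∀ x → pad (drop x) ≡ x
  pad-drop (inj₁ a)         = refl
  pad-drop (inj₂ (inj₁ ()))
  pad-drop (inj₂ (inj₂ w))  = refl
  drop-pad : ∀ x → drop (pad x) ≡ x
  drop-pad (inj₁ a) = refl
  drop-pad (inj₂ w) = refl
  f : ((X × B) ⊎ (⊥ ⊎ W)) ↔ ((X × B) ⊎ W)
  f = mk↔ₛ′ drop pad drop-pad pad-drop
  E⇒F : ∀ {x y} → WithHole x y → WithHole (drop x) (drop y)
  E⇒F {inj₁ _} {inj₁ _} n = n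
  E⇒F {inj₁ _} {inj₂ (inj₁ ())} n
  E⇒F {inj₁ _} {inj₂ (inj₂ _)} n = tt
  E⇒F {inj₂ (inj₁ ())} {_} n
  E⇒F {inj₂ (inj₂ _)} {inj₁ _} n = tt
  E⇒F {inj₂ (inj₂ _)} {inj₂ _} ()
  F⇒E : ∀ {x y} → WithHole (drop x) (drop y) → WithHole x y
  F⇒E {inj₁ _} {inj₁ _} n = n
  F⇒E {inj₁ _} {inj₂ (inj₁ ())} n
  F⇒E {inj₁ _} {inj₂ (inj₂ _)} n = tt
  F⇒E {inj₂ (inj₁ ())} {_} n
  F⇒E {inj₂ (inj₂ _)} {inj₁ _} n = tt
  F⇒E {inj₂ (inj₂ _)} {inj₂ (inj₁ ())} n
  F⇒E {inj₂ (inj₂ _)} {inj₂ (inj₂ _)} ()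

no-hole : ∀ {k} {A B W : Set} → (∀ (w w′ : W) → w ≡ w′) → B ↔ (A ⊎ W) → Decomp k B _≢_ → Incomplete k A W
no-hole {k} {A} {B} {W} small f D = decomp-iso f (λ n → ⇒ (λ e → n (inj e))) (λ {x} {y} m e → ⇐ m (cong to e)) D
  where
  open Inverse f
  inj : ∀ {x y} → to x ≡ to y → x ≡ y
  inj {x} {y} e = trans (sym (strictlyInverseʳ x)) (trans (cong from e) (strictlyInverseʳ y))
  ⇒ : ∀ {x y : A ⊎ W} → x ≢ y → WithHole x y
  ⇒ {inj₁ _} {inj₁ _} n e = n (cong inj₁ e)
  ⇒ {inj₁ _} {inj₂ _} n = tt
  ⇒ {inj₂ _} {inj₁ _} n = tt
  ⇒ {inj₂ w} {inj₂ w′} n = n (cong inj₂ (small w w′))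
  ⇐ : ∀ {x y : A ⊎ W} → WithHole x y → x ≢ y
  ⇐ {inj₁ _} {inj₁ _} n e = n (inj₁-injective e)
  ⇐ {inj₁ _} {inj₂ _} n ()
  ⇐ {inj₂ _} {inj₁ _} n ()

one-point : ∀ {k} {W : Set} → (∀ (w w′ : W) → w ≡ w′) → Decomp k W _≢_
one-point small = record
  { Index = ⊥ ; block = λ () ; irrefl = λ n → n refl ; isEdge = λ () ; find = λ {x} {y} n → ⊥-elim (n (small x y)) ; uniq = λ {} }

fin-one : ∀ (w w′ : Fin 1) → w ≡ w′
fin-one zero zero = refl

IsOrder : ℕ → ℕ → Set₁
IsOrder k n = Decomp k (Fin n) _≢_

order-≡ : ∀ {k m n} → m ≡ n → IsOrder k m → IsOrder k n
order-≡ refl D = D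

order-fill : ∀ {k n w} → Incomplete k (Fin n) (Fin w) → IsOrder k w → IsOrder k (n + w)
order-fill {k} {n} {w} I D = complete-iso (Inv.↔-sym Fₚ.+↔⊎) (fillAll I D)

incomplete-iso : ∀ {k} {A B W V : Set} → A ↔ B → W ↔ V → Incomplete k A W → Incomplete k B V
incomplete-iso {k} {A} {B} {W} {V} f g = decomp-iso (f ⊎-↔ g) (λ {x} {y} → ⇒ {x} {y}) (λ {x} {y} → ⇐ {x} {y})
  where
  module f = Inverse f
  inj : ∀ {x y} → f.to x ≡ f.to y → x ≡ y
  inj {x} {y} e = trans (sym (f.strictlyInverseʳ x)) (trans (cong f.from e) (f.strictlyInverseʳ y))
  ⇒ : ∀ {x y} → WithHole x y → WithHole (Inverse.to (f ⊎-↔ g) x) (Inverse.to (f ⊎-↔ g) y)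
  ⇒ {inj₁ _} {inj₁ _} n e = n (inj e)
  ⇒ {inj₁ _} {inj₂ _} n = tt
  ⇒ {inj₂ _} {inj₁ _} n = tt
  ⇐ : ∀ {x y} → WithHole (Inverse.to (f ⊎-↔ g) x) (Inverse.to (f ⊎-↔ g) y) → WithHole x y
  ⇐ {inj₁ _} {inj₁ _} n e = n (cong f.to e)
  ⇐ {inj₁ _} {inj₂ _} n = tt
  ⇐ {inj₂ _} {inj₁ _} n = tt

order-product : ∀ {k m h} → GDD k m h → IsOrder k h → IsOrder k (m * h)
order-product {k} {m} {h} D P = complete-iso (Inv.↔-trans (Inv.↔-sym ⊥-fill) (Inv.↔-sym Fₚ.*↔×))
  (fillAll (gdd-fill F._≟_ D (no-hole (λ ()) ⊥-fill P)) (one-point λ ()))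

order-suc-multiple : ∀ {k m h} → GDD k m h → IsOrder k (1 + h) → IsOrder k (1 + m * h)
order-suc-multiple {k} {m} {h} D P = order-≡ (ℕₚ.+-comm (m * h) 1)
  (order-fill (incomplete-iso (Inv.↔-sym Fₚ.*↔×) Inv.↔-refl (gdd-fill F._≟_ D (no-hole fin-one Fₚ.+↔⊎ (order-≡ (ℕₚ.+-comm 1 h) P)))) (one-point fin-one))

product-with-hole : ∀ {k w x} → 2 ≤ k → IsOrder k w → IsOrder k (1 + k ! * x) → Incomplete k (Fin (w * (k ! * x))) (Fin w)
product-with-hole {k} {w} {x} 2≤k Pw Pz = incomplete-iso (Inv.↔-sym Fₚ.*↔×) Inv.↔-refl
  (productWithHole 2≤k Pw Pz (td-restrict (ℕₚ.n≤1+n k) (factorialTD k x)) (zero , zero)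
    λ y → res-≡ {1 + k ! * x} {_} {zero} (≈-reflexive (trans (ℤₚ.+-identityˡ _) (ℤₚ.*-zeroʳ (+ toℕ (F.inject≤ y (ℕₚ.n≤1+n k)))))))

order-times : ∀ {k w z} → 2 ≤ k → k ! ∣ z → IsOrder k w → IsOrder k (1 + z) → IsOrder k (w * (1 + z))
order-times {k} {w} {z} 2≤k (divides x e) Pw Pz = order-≡ (lemma w x (k !) z (trans e (ℕₚ.*-comm x (k !))))
    (order-fill (product-with-hole {x = x} 2≤k Pw (order-≡ (cong suc (trans e (ℕₚ.*-comm x (k !)))) Pz)) Pw)
  where lemma : ∀ w x f z → z ≡ f * x → w * (f * x) + w ≡ w * (1 + z)
        lemma w x f z refl = l w (f * x)
          where l : ∀ w y → w * y + w ≡ w * (1 + y)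
                l = ℕS.solve-∀

order-power : ∀ {k z} → 2 ≤ k → k ! ∣ z → IsOrder k (1 + z) → ∀ J → IsOrder k ((1 + z) ^ J)
order-power 2≤k d P zero    = one-point fin-one
order-power {k} {z} 2≤k d P (suc J) = order-≡ (ℕₚ.*-comm ((1 + z) ^ J) (1 + z)) (order-times 2≤k d (order-power 2≤k d P J) P)

-- Lifting the exponent in powers of a design order

triangular : ℕ → ℕ
triangular zero    = 0
triangular (suc m) = triangular m + m

triangular-double : ∀ m → 2 * triangular (suc m) ≡ suc m * m
triangular-double zero    = refl
triangular-double (suc m) = trans (lemma (triangular (suc m)) m) (trans (cong (λ z → z + 2 * suc m) (triangular-double m)) (lemma′ m))
  where lemma : ∀ t m → 2 * (t + suc m) ≡ 2 * t + 2 * suc m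
        lemma = ℕS.solve-∀
        lemma′ : ∀ m → suc m * m + 2 * suc m ≡ suc (suc m) * suc m
        lemma′ = ℕS.solve-∀

geometric-mod² : ∀ t m → Σ ℕ λ h → geometric t m ≡ m + t * triangular m + t * t * h
geometric-mod² t zero = 0 , lemma t
  where lemma : ∀ t → 0 ≡ 0 + t * 0 + t * t * 0
        lemma = ℕS.solve-∀
geometric-mod² t (suc m) with geometric-mod² t m
... | h , e = triangular m + h + t * h , trans (cong (λ z → 1 + (1 + t) * z) e) (lemma t m (triangular m) h)
  where lemma : ∀ t m T h → 1 + (1 + t) * (m + t * T + t * t * h) ≡ 1 + m + t * (T + m) + t * t * (T + h + t * h)
        lemma = ℕS.solve-∀

-- Lifting the exponent: if s and 2 d divide t then (1 + t)^s − 1 = s t y with y ≡ 1 (mod d).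
power-step : ∀ {d s t} → 0 < s → s ∣ t → 2 * d ∣ t → Σ ℕ λ x → (1 + t) ^ s ≡ 1 + t * s * (1 + d * x)
power-step {d} {suc s} {t} _ (divides a t≡) (divides c t≡′) with geometric-mod² t (suc s)
... | h , e = c * s + 2 * (a * (c * h)) , trans (geometric-sum t (suc s)) (cong suc (trans (cong (λ z → t * z) geo) (lemma t s d (c * s + 2 * (a * (c * h))))))
  where
  lemma : ∀ t s d x → t * (suc s * (1 + d * x)) ≡ t * suc s * (1 + d * x)
  lemma = ℕS.solve-∀
  geo : geometric t (suc s) ≡ suc s * (1 + d * (c * s + 2 * (a * (c * h))))
  geo = trans e (trans (cong₂ (λ x y → suc s + x * triangular (suc s) + y * h) t≡′ (cong₂ _*_ t≡ t≡′))
    (trans (l₁ s c d (triangular (suc s)) a h) (trans (cong (λ z → suc s + d * c * z + (suc s * d) * (2 * (a * (c * h)))) (triangular-double s)) (l₂ s c d (2 * (a * (c * h)))))))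
    where
    l₁ : ∀ s c d T a h → suc s + (c * (2 * d)) * T + (a * suc s) * (c * (2 * d)) * h ≡ suc s + d * c * (2 * T) + (suc s * d) * (2 * (a * (c * h)))
    l₁ = ℕS.solve-∀
    l₂ : ∀ s c d x → suc s + d * c * (suc s * s) + (suc s * d) * x ≡ suc s * (1 + d * (c * s + x))
    l₂ = ℕS.solve-∀

-- Some power of 1 + t exceeds 1 by t m up to a factor ≡ 1 modulo d. For d = k! that factor is the
-- order of an affine transversal design and can be absorbed by inflation.
Reachable : ℕ → ℕ → ℕ → Set
Reachable t d m = Σ ℕ λ J → Σ ℕ λ x → (1 + t) ^ J ≡ 1 + t * m * (1 + d * x)

reach-step : ∀ {t d m s} → 0 < s → s ∣ t → 2 * d ∣ t → Reachable t d m → Reachable t d (m * s)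
reach-step {t} {d} {m} {s} 0<s s∣t d∣t (J , x , e) with power-step {d} {s} {t * m * (1 + d * x)} 0<s (up {s} s∣t) (up {2 * d} d∣t)
  where up : ∀ {a} → a ∣ t → a ∣ t * m * (1 + d * x)
        up h = Div.∣-trans h (Div.∣-trans (Div.m∣m*n {t} m) (Div.m∣m*n {t * m} (1 + d * x)))
... | y , e′ = J * s , x + y + d * (x * y) , trans (sym (ℕₚ.^-*-assoc (1 + t) J s)) (trans (cong (_^ s) e) (trans e′ (lemma t m d x s y)))
  where lemma : ∀ t m d x s y → 1 + t * m * (1 + d * x) * s * (1 + d * y) ≡ 1 + t * (m * s) * (1 + d * (x + y + d * (x * y)))
        lemma = ℕS.solve-∀

reach-power : ∀ {t d m} → 0 < t → 2 * d ∣ t → Reachable t d m → ∀ e → Reachable t d (m * t ^ e)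
reach-power {t} {d} {m} 0<t d∣t R zero    = subst (Reachable t d) (sym (ℕₚ.*-identityʳ m)) R
reach-power {t} {d} {m} 0<t d∣t R (suc e) = subst (Reachable t d) (lemma m (t ^ e) t) (reach-step {t} {d} {m * t ^ e} {t} 0<t Div.∣-refl d∣t (reach-power {t} {d} {m} 0<t d∣t R e))
  where lemma : ∀ m p t → m * p * t ≡ m * (t * p)
        lemma = ℕS.solve-∀

record Progression (k : ℕ) : Set₁ where
  field
    H      : ℕ
    0<H    : 0 < H
    k!∣H   : k ! ∣ H
    gdd    : ∀ m → k ≤ m → GDD k m H
    order  : ∀ m → k ≤ m → IsOrder k (1 + m * H)

abstract
  -- `H` has to be a group size that works for every number m ≥ k of groups, and 1 + H has to be a
  -- design order. The first property survives inflating h by t^(e+1) and by 1 + k! x, the second is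
  -- inherited by powers of a design order 1 + t. Lifting the exponent lets the two meet: t (h t^e)
  -- (1 + k! x) = (1 + t)^J - 1.
  progression : ∀ k → 2 ≤ k → Progression k
  progression k 2≤k = from-gdd (gdd-all k 2≤k)
    where
    from-reachable : ∀ {h t e} → 0 < h → (∀ m → k ≤ m → GDD k m h) → 0 < t → (h * (2 * (k !))) ∣ t → IsOrder k (suc t) →
                     TD k (t ^ suc e) → Reachable t (k !) (1 * h * t ^ e) → Progression k
    from-reachable {h} {t} {e} 0<h D 0<t E∣t P T (J , x , e≡) = record
      { H = H
      ; 0<H = ℕₚ.*-mono-≤ (ℕₚ.*-mono-≤ 0<t (ℕₚ.*-mono-≤ (ℕₚ.*-mono-≤ {1} {1} ℕₚ.≤-refl 0<h) (ℕₚ.m^n>0 t {{>-nonZero 0<t}} e))) (s≤s z≤n)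
      ; k!∣H = Div.∣-trans (Div.∣-trans k!∣t (Div.m∣m*n (1 * h * t ^ e))) (Div.m∣m*n (1 + k ! * x))
      ; gdd = G
      ; order = λ m k≤m → order-suc-multiple (G m k≤m) (order-≡ e≡ (order-power 2≤k k!∣t P J)) }
      where
      k!∣t : k ! ∣ t
      k!∣t = Div.∣-trans (Div.n∣m*n 2) (Div.∣-trans (Div.n∣m*n h) E∣t)
      H : ℕ
      H = t * (1 * h * t ^ e) * (1 + k ! * x)
      G : ∀ m → k ≤ m → GDD k m H
      G m k≤m = subst (GDD k m) (lemma h t (t ^ e) (1 + k ! * x))
          (gdd-inflate (gdd-inflate (D m k≤m) T) (td-restrict (ℕₚ.n≤1+n k) (factorialTD k x)))
        where lemma : ∀ h t p n → h * (t * p) * n ≡ t * (1 * h * p) * n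
              lemma = ℕS.solve-∀
    from-labelled : ∀ {h t} → 0 < h → (∀ m → k ≤ m → GDD k m h) → 0 < t → (h * (2 * (k !))) ∣ t → IsOrder k (suc t) →
                    (Σ (LabelledTD k t) λ L → Σ ℕ λ e → LabelledTD.order L ≡ t ^ suc e) → Progression k
    from-labelled {h} {t} 0<h D 0<t E∣t P (L , e , order≡) =
      from-reachable {h} {t} {e} 0<h D 0<t E∣t P (subst (TD k) order≡ (LabelledTD.td L))
        (reach-power {t} {k !} {1 * h} 0<t 2k!∣t (reach-step {t} {k !} {1} {h} 0<h h∣t 2k!∣t (1 , 0 , lemma t (k !))) e)
      where
      h∣t : h ∣ t
      h∣t = Div.∣-trans (Div.m∣m*n (2 * (k !))) E∣t
      2k!∣t : 2 * (k !) ∣ t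
      2k!∣t = Div.∣-trans (Div.n∣m*n h) E∣t
      lemma : ∀ t f → (1 + t) * 1 ≡ 1 + t * 1 * (1 + f * 0)
      lemma = ℕS.solve-∀
    from-design : ∀ {h} → 0 < h → (∀ m → k ≤ m → GDD k m h) →
                  (Σ ℕ λ t → 0 < t × (h * (2 * (k !))) ∣ t × IsOrder k (suc t)) → Progression k
    from-design {h} 0<h D (t , 0<t , E∣t , P) = from-labelled {h} {t} 0<h D 0<t E∣t P (labelledTD k t (ℕₚ.≤-trans (s≤s z≤n) 2≤k) 0<t)
    from-gdd : (Σ ℕ λ h → 0 < h × (∀ m → k ≤ m → GDD k m h)) → Progression k
    from-gdd (h , 0<h , D) = from-design {h} 0<h D (design-one-mod k 2≤k (h * (2 * (k !))) (ℕₚ.*-mono-≤ 0<h (ℕₚ.*-mono-≤ {1} {2} (s≤s z≤n) (ℕₚ.1≤n! k))))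

-- Design orders in residue classes, and designs with holes

Admissible : ℕ → ℕ → Set
Admissible k v = (k ∸ 1) ∣ (v ∸ 1) × (k * (k ∸ 1)) ∣ (v * (v ∸ 1))

admissible? : ∀ k v → Dec (Admissible k v)
admissible? k v = ((k ∸ 1) ∣? (v ∸ 1)) ×-dec ((k * (k ∸ 1)) ∣? (v * (v ∸ 1)))

module _ {k : ℕ} where
  private
    expand : ∀ a t → (suc a + t) * (a + t) ≡ suc a * a + t * (suc a + (a + t))
    expand = ℕS.solve-∀

  admissible-up : ∀ {v t} → 0 < v → (k * (k ∸ 1)) ∣ t → Admissible k v → Admissible k (v + t)
  admissible-up {suc v} {t} _ d (a , b) = Div.∣m∣n⇒∣m+n a (Div.∣-trans (Div.n∣m*n k) d)
    , subst (k * (k ∸ 1) ∣_) (sym (expand v t)) (Div.∣m∣n⇒∣m+n b (Div.∣-trans d (Div.m∣m*n _)))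

  admissible-down : ∀ {v t} → 0 < v → (k * (k ∸ 1)) ∣ t → Admissible k (v + t) → Admissible k v
  admissible-down {suc v} {t} _ d (a , b) =
      Div.∣m+n∣m⇒∣n (subst (k ∸ 1 ∣_) (ℕₚ.+-comm v t) a) (Div.∣-trans (Div.n∣m*n k) d)
    , Div.∣m+n∣m⇒∣n (subst (k * (k ∸ 1) ∣_) (trans (expand v t) (ℕₚ.+-comm (suc v * v) _)) b) (Div.∣-trans d (Div.m∣m*n _))

  -- Admissibility is a property of residue classes modulo k (k - 1), so one large representative
  -- decides for its whole class and inadmissible classes can be discarded.
  admissible-transfer : ∀ {v w} i j M → 0 < v → 0 < w → (k * (k ∸ 1)) ∣ M → v + M * i ≡ w + M * j → Admissible k v → Admissible k w
  admissible-transfer i j M 0<v 0<w d e a = admissible-down 0<w (Div.∣-trans d (Div.m∣m*n j))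
    (subst (Admissible k) e (admissible-up 0<v (Div.∣-trans d (Div.m∣m*n i)) a))

abstract
  -- With λ = 1 + Q H k n U the groups of the lift have size a power of λ. Such a power has the form
  -- 1 + m H, where the factor k in λ - 1 ensures m ≥ k, so it is a design order and the groups can
  -- be filled. It is also ≡ 1 modulo `Q`, which keeps the total in the class of r.
  order-from-cover : ∀ {k r} → 2 ≤ k → 2 ≤ r → (P : Progression k) → ∀ {Q n U} → 0 < Q → 1 ≤ n → 0 < U → (bs : List (Block r k)) →
                     (∀ {x y} → x ≢ y → multiplicity bs x y ≡ 1 + Q * (Progression.H P * k) * n * U) → Σ ℕ λ y → IsOrder k (r * (1 + Q * y))
  order-from-cover {k} {r} 2≤k 2≤r P {Q} {n} {U} 0<Q 1≤n 0<U bs mult = build (coverGDD {k} {r} {1 + t} 2≤r bs (s≤s z≤n) mult)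
    where
    open Progression P
    t : ℕ
    t = Q * (H * k) * n * U
    build : (Σ ℕ λ e → GDD k r ((1 + t) ^ suc e) × TD r ((1 + t) ^ suc e)) → Σ ℕ λ y → IsOrder k (r * (1 + Q * y))
    build (e , D , _) = H * k * n * U * geometric t (suc e)
                      , order-≡ (cong (r *_) size≡) (order-product D (order-≡ size≡′ (order (Q * k * n * U * geometric t (suc e)) k≤m)))
      where
      size≡ : (1 + t) ^ suc e ≡ 1 + Q * (H * k * n * U * geometric t (suc e))
      size≡ = trans (geometric-sum t (suc e)) (cong suc (lemma Q H k n U (geometric t (suc e))))
        where lemma : ∀ Q H k n U g → Q * (H * k) * n * U * g ≡ Q * (H * k * n * U * g)
              lemma = ℕS.solve-∀
      size≡′ : 1 + Q * k * n * U * geometric t (suc e) * H ≡ (1 + t) ^ suc e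
      size≡′ = sym (trans (geometric-sum t (suc e)) (cong suc (lemma Q H k n U (geometric t (suc e)))))
        where lemma : ∀ Q H k n U g → Q * (H * k) * n * U * g ≡ Q * k * n * U * g * H
              lemma = ℕS.solve-∀
      k≤m : k ≤ Q * k * n * U * geometric t (suc e)
      k≤m = ℕₚ.≤-trans (ℕₚ.≤-reflexive (lemma k)) (ℕₚ.*-mono-≤ (ℕₚ.*-mono-≤ (ℕₚ.*-mono-≤ (ℕₚ.*-mono-≤ 0<Q (ℕₚ.≤-refl {k})) 1≤n) 0<U) (s≤s {0} {(1 + t) * geometric t e} z≤n))
        where lemma : ∀ k → k ≡ 1 * k * 1 * 1 * 1
              lemma = ℕS.solve-∀

abstract
  signed-cover : ∀ k r → 3 ≤ k → k + 2 ≤ r → Admissible k r → ∀ Q → 1 ≤ Q →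
    Σ (List (Block r k)) λ bs → Σ ℕ λ n → 1 ≤ n × (∀ {x y} → x ≢ y → multiplicity bs x y ≡ 1 + Q * n * multiplicity (allBlocks {r} {k}) x y)
  signed-cover (suc zero) _ (s≤s ())
  signed-cover (suc (suc k₂)) zero             _ ()
  signed-cover (suc (suc k₂)) (suc zero)       _ (s≤s ())
  signed-cover (suc (suc k₂)) (suc (suc zero)) _ (s≤s (s≤s le)) = ⊥-elim (ℕₚ.m+1+n≰m 0 (ℕₚ.≤-trans (ℕₚ.m≤n+m 2 k₂) le))
  signed-cover (suc (suc k₂)) (suc (suc (suc r₂))) _ le (divides ρ e₁ , divides N e₂) =
      Elimination-of-edges.signedCover k₂ r₂ (ℕₚ.≤-trans (ℕₚ.≤-reflexive (cong (λ z → suc (suc z)) (ℕₚ.+-comm 2 k₂))) le) ρ N e₁ e₂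

  orders-in-class : ∀ k → 3 ≤ k → Progression k → ∀ r → k + 2 ≤ r → Admissible k r → ∀ Q → 0 < Q → Σ ℕ λ y → IsOrder k (r * (1 + Q * y))
  orders-in-class k 3≤k P r le adm Q 0<Q =
      from (signed-cover k r 3≤k le adm (Q * (H * k)) (ℕₚ.*-mono-≤ 0<Q (ℕₚ.*-mono-≤ 0<H (ℕₚ.≤-trans (s≤s z≤n) 3≤k))))
           (allBlocks-uniform {k} {r} 2≤k k≤r)
    where
    open Progression P
    2≤k : 2 ≤ k
    2≤k = ℕₚ.≤-trans (s≤s (s≤s z≤n)) 3≤k
    k≤r : k ≤ r
    k≤r = ℕₚ.≤-trans (ℕₚ.m≤m+n k 2) le
    from : (Σ (List (Block r k)) λ bs → Σ ℕ λ n → 1 ≤ n × (∀ {x y} → x ≢ y → multiplicity bs x y ≡ 1 + Q * (H * k) * n * multiplicity (allBlocks {r} {k}) x y)) →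
           (Σ ℕ λ l → 0 < l × (∀ {x y} → x ≢ y → multiplicity (allBlocks {r} {k}) x y ≡ l)) →
           Σ ℕ λ y → IsOrder k (r * (1 + Q * y))
    from (bs , n , 1≤n , mult) (U , 0<U , const) =
      order-from-cover 2≤k (ℕₚ.≤-trans 2≤k k≤r) P {Q} {n} {U} 0<Q 1≤n 0<U bs (λ ne → trans (mult ne) (cong (λ z → 1 + Q * (H * k) * n * z) (const ne)))

-- A truncated transversal design whose full groups are filled with designs having a hole of size w.
design-with-hole : ∀ {k} → 2 ≤ k → (P : Progression k) → let open Progression P in
                   ∀ {w u n m s} → IsOrder k w → k ≤ u → TD (suc u) n → n ≡ w * m → k ≤ m → s ≤ n →
                   Incomplete k (Fin (u * (n * H))) (Fin (s * H + w))
design-with-hole {k} 2≤k P {w} {u} {n} {m} {s} Pw k≤u T n≡ k≤m s≤n =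
    incomplete-iso (Inv.↔-trans (Inv.↔-refl ×-↔ Inv.↔-sym Fₚ.*↔×) (Inv.↔-sym Fₚ.*↔×)) (Inv.↔-trans (Inv.↔-sym Fₚ.*↔× ⊎-↔ Inv.↔-refl) (Inv.↔-sym Fₚ.+↔⊎))
      (fillHole F._≟_ (truncate (gdd u k≤u) (gdd (suc u) (ℕₚ.m≤n⇒m≤1+n k≤u)) T s≤n) (incomplete-iso Fₚ.*↔× Inv.↔-refl hole))
  where
  open Progression P
  hole : Incomplete k (Fin (n * H)) (Fin w)
  hole with k!∣H
  ... | divides x e = subst (λ z → Incomplete k (Fin z) (Fin w)) (sym size≡) (product-with-hole {x = x * m} 2≤k Pw (order-≡ (cong suc (trans (cong (λ z → m * z) e) (lemma m x (k !)))) (order m k≤m)))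
    where
    lemma : ∀ m x f → m * (x * f) ≡ f * (x * m)
    lemma = ℕS.solve-∀
    size≡ : n * H ≡ w * (k ! * (x * m))
    size≡ = trans (cong₂ _*_ n≡ e) (lemma′ w m x (k !))
      where lemma′ : ∀ w m x f → w * m * (x * f) ≡ w * (f * (x * m))
            lemma′ = ℕS.solve-∀

eventually-mod : ∀ {ℓ} (Q : ℕ) .{{_ : NonZero Q}} (A : ℕ → Set ℓ) → (∀ ρ → ρ < Q → Σ ℕ λ v₀ → ∀ v → v₀ ≤ v → v % Q ≡ ρ → A v) →
                 Σ ℕ λ v₀ → ∀ v → v₀ ≤ v → A v
eventually-mod {ℓ} Q A h = proj₁ (go Q ℕₚ.≤-refl) , λ v le → proj₂ (go Q ℕₚ.≤-refl) v le (DM.m%n<n v Q)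
  where
  go : ∀ n → n ≤ Q → Σ ℕ λ v₀ → ∀ v → v₀ ≤ v → v % Q < n → A v
  go zero    _ = 0 , λ _ _ ()
  go (suc n) le with go n (ℕₚ.<⇒≤ le) | h n le
  ... | a , f | b , g = a + b , λ v p q → case v p q (v % Q ℕ.≟ n)
    where
    case : ∀ v → a + b ≤ v → v % Q < suc n → Dec (v % Q ≡ n) → A v
    case v p q (yes e) = g v (ℕₚ.≤-trans (ℕₚ.m≤n+m b a) p) e
    case v p q (no ne) = f v (ℕₚ.≤-trans (ℕₚ.m≤m+n a b) p) (ℕₚ.≤∧≢⇒< (ℕₚ.≤-pred q) ne)

-- Finite groups of odd order, and designs from symmetric decompositions

does⁻¹ : {P : Set} (d : Dec P) → does d ≡ true → P
does⁻¹ (yes p) _ = p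

-- `f` exchanges the points with x < f x and those with f x < x, and every point is of one of these
-- kinds.
involution-even : ∀ {n} (f : Fin n → Fin n) → (∀ x → f (f x) ≡ x) → (∀ x → f x ≢ x) → 2 ∣ n
involution-even {n} f inv free = divides S (trans (sym (ℕₚ.*-identityʳ n)) (trans (sym (sumℕ-const n 1)) (trans (Σℕ.sum-cong-≗ pointwise)
    (trans (Σℕ.∑-distrib-+ ascends (ascends ∘ f)) (trans (cong (λ z → S + z) (sym (Σℕ.sum-permute ascends π))) (double S))))))
  where
  ascends : Fin n → ℕ
  ascends x = bit (does (toℕ x <? toℕ (f x)))
  S : ℕ
  S = Σℕ.sum ascends
  double : ∀ s → s + s ≡ s * 2
  double = ℕS.solve-∀
  π : Permutation′ n
  π = permutation f f inv inv
  one : ∀ a b → a ≢ b → 1 ≡ bit (does (a <? b)) + bit (does (b <? a))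
  one a b a≢b with ℕₚ.<-cmp a b
  ... | tri< lt _ gt = sym (cong₂ (λ u v → bit u + bit v) (dec-true (a <? b) lt) (dec-false (b <? a) gt))
  ... | tri≈ _ e _   = ⊥-elim (a≢b e)
  ... | tri> gt _ lt = sym (cong₂ (λ u v → bit u + bit v) (dec-false (a <? b) gt) (dec-true (b <? a) lt))
  pointwise : ∀ x → 1 ≡ ascends x + ascends (f x)
  pointwise x = subst (λ y → 1 ≡ ascends x + bit (does (toℕ (f x) <? toℕ y))) (sym (inv x))
    (one (toℕ x) (toℕ (f x)) (λ e → free x (sym (Fₚ.toℕ-injective e))))

-- Right multiplication by an element of order 2 would pair off the elements of `G`.
odd-noInvolution : ∀ {n} (G : FinGroup n) → Odd n → NoInvolution G
odd-noInvolution {n} G odd d d≡ with d F.≟ FinGroup.ε G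
... | yes e = e
... | no d≢ε = ⊥-elim (odd (involution-even (_∙ d) square free))
  where
  open FinGroup G
  square : ∀ g → (g ∙ d) ∙ d ≡ g
  square g = trans (assoc g d d) (trans (cong (g ∙_) (trans (cong (d ∙_) d≡) (invʳ d))) (idʳ g))
  free : ∀ g → g ∙ d ≢ g
  free g e = d≢ε (cancelˡ (trans e (sym (idʳ g))))

module _ {c ℓ} (G : Group c ℓ) {n : ℕ} (finite : FiniteOfOrder G n) where
  private
    module G = Group G
    module φ = Bijection finite

  element : Fin n → G.Carrier
  element x = proj₁ (φ.surjective x)

  to-element : ∀ x → φ.to (element x) ≡ x
  to-element x = proj₂ (φ.surjective x) G.refl

  element-to : ∀ g → element (φ.to g) G.≈ g
  element-to g = φ.injective (to-element (φ.to g))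

  finGroup : FinGroup n
  finGroup = record
    { _∙_   = λ x y → φ.to (element x G.∙ element y)
    ; ε     = φ.to G.ε
    ; _⁻¹   = λ x → φ.to (element x G.⁻¹)
    ; assoc = λ x y z → φ.cong (G.trans (G.∙-congʳ (element-to _)) (G.trans (G.assoc _ _ _) (G.∙-congˡ (G.sym (element-to _)))))
    ; idˡ   = λ x → trans (φ.cong (G.trans (G.∙-congʳ (element-to _)) (G.identityˡ _))) (to-element x)
    ; idʳ   = λ x → trans (φ.cong (G.trans (G.∙-congˡ (element-to _)) (G.identityʳ _))) (to-element x)
    ; invˡ  = λ x → φ.cong (G.trans (G.∙-congʳ (element-to _)) (G.inverseˡ _))
    ; invʳ  = λ x → φ.cong (G.trans (G.∙-congˡ (element-to _)) (G.inverseʳ _)) }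

  to-∙ : ∀ g h → φ.to (g G.∙ h) ≡ FinGroup._∙_ finGroup (φ.to g) (φ.to h)
  to-∙ g h = φ.cong (G.∙-cong (G.sym (element-to g)) (G.sym (element-to h)))

record Symmetric (k : ℕ) {n} (G : FinGroup n) (A : Set) : Set₁ where
  open FinGroup G
  field
    act      : Fin n → A → A
    act-ε    : ∀ x → act ε x ≡ x
    act-∙    : ∀ g h x → act (g ∙ h) x ≡ act g (act h x)
    faithful : ∀ {g h} → (∀ x → act g x ≡ act h x) → g ≡ h
    decomp   : Decomp k A _≢_
  open Decomp decomp
  field
    move     : ∀ g i → Σ Index λ j → ∀ p → block j p ≡ act g (block i p)

  act-inverseˡ : ∀ g x → act (g ⁻¹) (act g x) ≡ x
  act-inverseˡ g x = trans (sym (act-∙ (g ⁻¹) g x)) (trans (cong (λ h → act h x) (invˡ g)) (act-ε x))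

  act-inverseʳ : ∀ g x → act g (act (g ⁻¹) x) ≡ x
  act-inverseʳ g x = trans (sym (act-∙ g (g ⁻¹) x)) (trans (cong (λ h → act h x) (invʳ g)) (act-ε x))

symmetric-iso : ∀ {k n} {G : FinGroup n} {A B : Set} → A ↔ B → Symmetric k G A → Symmetric k G B
symmetric-iso {k} {n} {G} {A} {B} f S = record
  { act      = λ g x → to (act g (from x))
  ; act-ε    = λ x → trans (cong to (act-ε (from x))) (strictlyInverseˡ x)
  ; act-∙    = λ g h x → cong to (trans (act-∙ g h (from x)) (cong (act g) (sym (strictlyInverseʳ (act h (from x))))))
  ; faithful = λ {g} {h} e → faithful λ x → trans (sym (strictlyInverseʳ _)) (trans (cong from
      (subst (λ y → to (act g y) ≡ to (act h y)) (strictlyInverseʳ x) (e (to x)))) (strictlyInverseʳ _))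
  ; decomp   = complete-iso f decomp
  ; move     = λ g i → proj₁ (move g i) , λ p → cong to (trans (proj₂ (move g i) p) (cong (act g) (sym (strictlyInverseʳ _)))) }
  where
  open Inverse f
  open Symmetric S

∣tabulate∣ : ∀ {n} (P : Fin n → Bool) → Sub.∣ tabulate P ∣ ≡ count P
∣tabulate∣ {zero}  P = refl
∣tabulate∣ {suc n} P with P zero
... | true  = cong suc (∣tabulate∣ (P ∘ suc))
... | false = ∣tabulate∣ (P ∘ suc)

module _ {v k : ℕ} where

  support? : (b : Fin k → Fin v) (x : Fin v) → Dec (∃ λ p → b p ≡ x)
  support? b x = Fₚ.any? λ p → b p F.≟ x

  support : (Fin k → Fin v) → Subset v
  support b = tabulate λ x → does (support? b x)

  ∈-support⁺ : ∀ {b x} → (∃ λ p → b p ≡ x) → x ∈ support b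
  ∈-support⁺ {b} {x} h = Vₚ.lookup⇒[]= x _ (trans (Vₚ.lookup∘tabulate _ x) (dec-true (support? b x) h))

  ∈-support⁻ : ∀ {b x} → x ∈ support b → ∃ λ p → b p ≡ x
  ∈-support⁻ {b} {x} m = does⁻¹ (support? b x) (trans (sym (Vₚ.lookup∘tabulate _ x)) (Vₚ.[]=⇒lookup m))

  ∣support∣ : ∀ b → (∀ {p q} → b p ≡ b q → p ≡ q) → Sub.∣ support b ∣ ≡ k
  ∣support∣ b inj = trans (∣tabulate∣ P) (ℕₚ.≤-antisym upper (count-lower P b inj λ p → dec-true (support? b (b p)) (p , refl)))
    where
    P : Fin v → Bool
    P x = does (support? b x)
    upper : count P ≤ k
    upper = count-upper P λ g g-inj t → Fₚ.injective⇒≤ {f = λ i → proj₁ (does⁻¹ (support? b (g i)) (t i))}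
      λ {i} {j} e → g-inj (trans (sym (proj₂ (does⁻¹ (support? b (g i)) (t i)))) (trans (cong b e) (proj₂ (does⁻¹ (support? b (g j)) (t j)))))

  image-support : ∀ (π : Permutation′ v) b → image π (support b) ≡ support (λ p → π ⟨$⟩ʳ b p)
  image-support π b = Vₚ.tabulate-cong λ x → trans (Vₚ.lookup∘tabulate _ (π ⟨$⟩ˡ x))
    (does-⇔ (mk⇔ (λ { (p , e) → p , trans (cong (π ⟨$⟩ʳ_) e) (Perm.inverseʳ π) })
                 (λ { (p , e) → p , trans (sym (Perm.inverseˡ π)) (cong (π ⟨$⟩ˡ_) e) }))
            (support? b (π ⟨$⟩ˡ x)) (support? (λ p → π ⟨$⟩ʳ b p) x))

  design : Decomp k (Fin v) _≢_ → Design v k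
  design D = record
    { IsBlock   = λ B → ∃ λ i → B ≡ support (block i)
    ; blockSize = λ { _ (i , refl) → ∣support∣ (block i) block-injective }
    ; unique2   = unique2 }
    where
    open Decomp D
    unique2 : ∀ x y → ¬ x ≡ y → Σ (Subset v) λ B → (∃ λ i → B ≡ support (block i)) × x ∈ B × y ∈ B ×
              (∀ B′ → (∃ λ i → B′ ≡ support (block i)) → x ∈ B′ → y ∈ B′ → B′ ≡ B)
    unique2 x y x≢y with find x≢y
    ... | i , p , q , p≢q , e₁ , e₂ = support (block i) , (i , refl) , ∈-support⁺ (p , e₁) , ∈-support⁺ (q , e₂) , unique
      where
      unique : ∀ B′ → (∃ λ i → B′ ≡ support (block i)) → x ∈ B′ → y ∈ B′ → B′ ≡ support (block i)
      unique _ (j , refl) x∈ y∈ with ∈-support⁻ x∈ | ∈-support⁻ y∈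
      ... | p′ , refl | q′ , refl = cong (λ z → support (block z)) (sym (uniq p≢q (λ { refl → x≢y refl }) e₁ e₂))

image-inverse : ∀ {v} (π σ : Permutation′ v) → (∀ x → π ⟨$⟩ˡ (σ ⟨$⟩ˡ x) ≡ x) → ∀ B → image σ (image π B) ≡ B
image-inverse π σ e B = trans (Vₚ.tabulate-cong λ x → trans (Vₚ.lookup∘tabulate _ (σ ⟨$⟩ˡ x)) (cong (lookup B) (e x))) (Vₚ.tabulate∘lookup B)

design-with-group : ∀ {c ℓ k v n} (G : Group c ℓ) (finite : FiniteOfOrder G n) → Symmetric k (finGroup G finite) (Fin v) →
                    Σ (Design v k) λ D → GroupEmbeddingIntoAut G D
design-with-group {k = k} {v} {n} G finite S = design decomp , record
  { ρ           = λ g → σ (φ.to g)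
  ; ρ-aut       = λ g B → mk⇔ (forward (φ.to g) B) (backward (φ.to g) B)
  ; ρ-cong      = λ e x → cong (λ h → act h x) (φ.cong e)
  ; ρ-hom       = λ g h x → trans (cong (λ y → act y x) (to-∙ G finite g h)) (act-∙ (φ.to g) (φ.to h) x)
  ; ρ-injective = λ e → φ.injective (faithful e) }
  where
  open Symmetric S
  open Decomp decomp
  module φ = Bijection finite
  open FinGroup (finGroup G finite) using (_⁻¹)
  σ : Fin n → Permutation′ v
  σ g = permutation (act g) (act (g ⁻¹)) (act-inverseʳ g) (act-inverseˡ g)
  moved : ∀ g i → Σ Index λ j → image (σ g) (support (block i)) ≡ support (block j)
  moved g i = proj₁ (move g i) , trans (image-support (σ g) (block i))
    (Vₚ.tabulate-cong λ x → does-⇔ (mk⇔ (λ { (p , e) → p , trans (proj₂ (move g i) p) e }) (λ { (p , e) → p , trans (sym (proj₂ (move g i) p)) e }))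
      (support? (λ p → act g (block i p)) x) (support? (block (proj₁ (move g i))) x))
  forward : ∀ g B → (∃ λ i → B ≡ support (block i)) → ∃ λ i → image (σ g) B ≡ support (block i)
  forward g _ (i , refl) = moved g i
  backward : ∀ g B → (∃ λ i → image (σ g) B ≡ support (block i)) → ∃ λ i → B ≡ support (block i)
  backward g B (i , e) = proj₁ (moved (g ⁻¹) i) , trans (sym (image-inverse (σ g) (σ (g ⁻¹)) (λ x → back x) B))
      (trans (cong (image (σ (g ⁻¹))) e) (proj₂ (moved (g ⁻¹) i)))
    where
    back : ∀ x → act (g ⁻¹) (act ((g ⁻¹) ⁻¹) x) ≡ x
    back = act-inverseʳ (g ⁻¹)

-- Filling the groups of a symmetric group divisible design

module FillSymmetric {k n c N m w : ℕ} {G : FinGroup n} (S : SymmetricGDD k G c N) (T : TD k m)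
                     (I : Incomplete k (Fin N × Fin m) (Fin w)) (D : IsOrder k w) where
  open FinGroup G
  private module S = SymmetricGDD S

  X : Set
  X = Fin n × Fin c

  shift : Fin n → X → X
  shift g (h , y) = g ∙ h , y

  -- In these coordinates the group moves only the first component of a point.
  untwist : (X × Fin N) ↔ (X × Fin N)
  untwist = mk↔ₛ′ (λ (x , a) → x , S.act (proj₁ x ⁻¹) a) (λ (x , a) → x , S.act (proj₁ x) a)
    (λ (x , a) → cong (x ,_) (trans (sym (S.act-∙ _ _ a)) (trans (cong (λ g → S.act g a) (invˡ (proj₁ x))) (S.act-ε a))))
    (λ (x , a) → cong (x ,_) (trans (sym (S.act-∙ _ _ a)) (trans (cong (λ g → S.act g a) (invʳ (proj₁ x))) (S.act-ε a))))

  gdd : Decomp k (X × (Fin N × Fin m)) (λ x y → proj₁ x ≢ proj₁ y)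
  gdd = decomp-iso (mk↔ₛ′ (λ ((x , a) , b) → x , (a , b)) (λ (x , (a , b)) → (x , a) , b) (λ _ → refl) (λ _ → refl)) id id
    (inflate (decomp-iso untwist id id S.decomp) T)

  private module gdd = Decomp gdd

  gdd-move : ∀ g i → Σ gdd.Index λ j → ∀ p → gdd.block j p ≡ (shift g (proj₁ (gdd.block i p)) , proj₂ (gdd.block i p))
  gdd-move g (i , t) = (proj₁ (S.move g i) , t) , λ p →
      trans (cong (λ (x , a) → x , (S.act (proj₁ x ⁻¹) a , TD.at T t p)) (proj₂ (S.move g i) p))
        (cong (λ a → shift g (proj₁ (Decomp.block S.decomp i p)) , (a , TD.at T t p)) (untwisted (proj₁ (proj₁ (Decomp.block S.decomp i p))) (proj₂ (Decomp.block S.decomp i p))))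
    where
    untwisted : ∀ h a → S.act ((g ∙ h) ⁻¹) (S.act g a) ≡ S.act (h ⁻¹) a
    untwisted h a = trans (cong (λ z → S.act z (S.act g a)) (inv-∙ g h)) (trans (S.act-∙ (h ⁻¹) (g ⁻¹) (S.act g a))
      (cong (S.act (h ⁻¹)) (trans (sym (S.act-∙ (g ⁻¹) g a)) (trans (cong (λ z → S.act z a) (invˡ g)) (S.act-ε a)))))

  Point : Set
  Point = (X × (Fin N × Fin m)) ⊎ Fin w

  act : Fin n → Point → Point
  act g (inj₁ (x , b)) = inj₁ (shift g x , b)
  act g (inj₂ z)       = inj₂ z

  _≟X_ : ∀ (x y : X) → Dec (x ≡ y)
  _≟X_ = ≡-dec F._≟_ F._≟_

  filled : Decomp k Point _≢_
  filled = fillAll (gdd-fill _≟X_ gdd I) D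

  move : ∀ g i → Σ (Decomp.Index filled) λ j → ∀ p → Decomp.block filled j p ≡ act g (Decomp.block filled i p)
  move g (true , (inj₁ tt , i)) = (true , (inj₁ tt , proj₁ (gdd-move g i))) , λ p → cong inj₁ (proj₂ (gdd-move g i) p)
  -- In untwisted coordinates every group x carries the same copy of `I`, so `g` maps the filling of
  -- x onto that of `shift g x` and keeps the index i.
  move g (true , (inj₂ x , i))  = (true , (inj₂ (shift g x) , i)) , eq
    where eq : ∀ p → Decomp.block filled (true , (inj₂ (shift g x) , i)) p ≡ act g (Decomp.block filled (true , (inj₂ x , i)) p)
          eq p with Decomp.block I i p
          ... | inj₁ _ = refl
          ... | inj₂ _ = refl
  move g (false , i) = (false , i) , λ _ → refl

  symmetric : Fin c → Fin N → Fin m → Symmetric k G Point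
  symmetric y a b = record
    { act = act ; act-ε = act-ε ; act-∙ = act-∙
    ; faithful = λ {g} {h} e → cancelʳ (cong (proj₁ ∘ proj₁) (inj₁-injective (e (inj₁ ((ε , y) , (a , b))))))
    ; decomp = filled ; move = move }
    where
    act-ε : ∀ x → act ε x ≡ x
    act-ε (inj₁ ((g , y) , b)) = cong (λ z → inj₁ ((z , y) , b)) (idˡ g)
    act-ε (inj₂ _)             = refl
    act-∙ : ∀ g h x → act (g ∙ h) x ≡ act g (act h x)
    act-∙ g h (inj₁ ((f , y) , b)) = cong (λ z → inj₁ ((z , y) , b)) (assoc g h f)
    act-∙ g h (inj₂ _)             = refl

fillSymmetric : ∀ {k n c N m w} {G : FinGroup n} → 0 < c → 0 < N → 0 < m → SymmetricGDD k G c N → TD k m →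
                Incomplete k (Fin (N * m)) (Fin w) → IsOrder k w → Symmetric k G (Fin (n * c * (N * m) + w))
fillSymmetric 0<c 0<N 0<m S T I D = symmetric-iso
    (Inv.↔-trans ((Inv.↔-trans (Inv.↔-sym Fₚ.*↔× ×-↔ Inv.↔-sym Fₚ.*↔×) (Inv.↔-sym Fₚ.*↔×)) ⊎-↔ Inv.↔-refl) (Inv.↔-sym Fₚ.+↔⊎))
    (FillSymmetric.symmetric S T (incomplete-iso Fₚ.*↔× Inv.↔-refl I) D (fromℕ< 0<c) (fromℕ< 0<N) (fromℕ< 0<m))

-- The orders of the symmetric designs

abstract
  block-divides-factorial : ∀ {k} → 2 ≤ k → (k * (k ∸ 1)) ∣ k !
  block-divides-factorial {suc zero}    (s≤s ())
  block-divides-factorial {suc (suc k)} _ = divides (k !) (lemma k (k !))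
    where lemma : ∀ k f → suc (suc k) * (suc k * f) ≡ f * (suc (suc k) * suc k)
          lemma = ℕS.solve-∀

  n≤n! : ∀ n → n ≤ n !
  n≤n! zero    = z≤n
  n≤n! (suc n) = subst (_≤ suc n * n !) (ℕₚ.*-identityʳ (suc n)) (ℕₚ.*-monoʳ-≤ (suc n) (ℕₚ.1≤n! n))

record SymmetricOrders (k : ℕ) {n} (G : FinGroup n) (H w : ℕ) : Set₁ where
  field
    Q L   : ℕ
    0<Q   : 0 < Q
    0<L   : 0 < L
    H∣Q   : H ∣ Q
    order : ∀ x s → k ≤ x → s ≤ x → IsOrder k (s * H + w) → Symmetric k G (Fin (Q * (1 + L * x) + (s * H + w)))

module _ {k n c N : ℕ} {G : FinGroup n} (3≤k : 3 ≤ k) (P : Progression k) (0<n : 0 < n) (0<c : 0 < c) (0<N : 0 < N)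
         (S : SymmetricGDD k G c N) (TN : TD k N) {w : ℕ} (0<w : 0 < w) (Pw : IsOrder k w) where
  open Progression P
  private
    2≤k : 2 ≤ k
    2≤k = ℕₚ.≤-trans (s≤s (s≤s z≤n)) 3≤k

    ^-pos : ∀ {a} e → 0 < a → 0 < a ^ e
    ^-pos {a} e 0<a = ℕₚ.m^n>0 a {{>-nonZero 0<a}} e

    -- The filling from `design-with-hole` has u n′ H points outside its hole and must fill a group
    -- of N n″ points. Here n″ has to carry a transversal design for the inflation, and n′ has to be
    -- a multiple of w carrying one with u + 1 slots. The powers N^(e₁+1), w^(e₂+1) and H^(e+1)
    -- carry such designs, and u is H^e H^(e+1) so that u H is a product of two of them.
    module Step (e e₁ e₂ : ℕ) (TH : TD k (H ^ suc e)) (u : ℕ) (u≡ : u ≡ H ^ e * H ^ suc e)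
                (T₁ : TD (suc u) (N ^ suc e₁)) (T₂ : TD (suc u) (w ^ suc e₂)) where
      k≤H : k ≤ H
      k≤H = ℕₚ.≤-trans (n≤n! k) (Div.∣⇒≤ {{>-nonZero 0<H}} k!∣H)

      k≤u : k ≤ u
      k≤u = ℕₚ.≤-trans (ℕₚ.≤-trans k≤H (ℕₚ.≤-reflexive (lemma H))) (ℕₚ.≤-trans (ℕₚ.*-mono-≤ (^-pos e 0<H) (ℕₚ.*-mono-≤ (ℕₚ.≤-refl {H}) (^-pos e 0<H))) (ℕₚ.≤-reflexive (sym u≡)))
        where lemma : ∀ h → h ≡ 1 * (h * 1)
              lemma = ℕS.solve-∀

      Q₀ : ℕ
      Q₀ = n * c * (N * (H ^ suc e * H ^ suc e * (N ^ e₁ * w ^ suc e₂)))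

      0<Q₀ : 0 < Q₀
      0<Q₀ = ℕₚ.*-mono-≤ (ℕₚ.*-mono-≤ 0<n 0<c) (ℕₚ.*-mono-≤ 0<N (ℕₚ.*-mono-≤ (ℕₚ.*-mono-≤ (^-pos (suc e) 0<H) (^-pos (suc e) 0<H)) (ℕₚ.*-mono-≤ (^-pos e₁ 0<N) (^-pos (suc e₂) 0<w))))

      H∣Q₀ : H ∣ Q₀
      H∣Q₀ = divides (n * c * (N * (H ^ e * H ^ suc e * (N ^ e₁ * w ^ suc e₂)))) (lemma (n * c) N H (H ^ e) (H ^ suc e) (N ^ e₁ * w ^ suc e₂))
        where lemma : ∀ a N h p q b → a * (N * (h * p * q * b)) ≡ a * (N * (p * q * b)) * h
              lemma = ℕS.solve-∀

      module _ (x s : ℕ) (k≤x : k ≤ x) (s≤x : s ≤ x) (D : IsOrder k (s * H + w)) where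
        M m n′ n″ : ℕ
        M  = 1 + u ! * x
        m  = N ^ suc e₁ * w ^ e₂ * M
        n′ = N ^ suc e₁ * w ^ suc e₂ * M
        n″ = H ^ suc e * H ^ suc e * (N ^ e₁ * w ^ suc e₂) * M

        x≤M : x ≤ M
        x≤M = ℕₚ.≤-trans (ℕₚ.≤-trans (ℕₚ.≤-reflexive (sym (ℕₚ.*-identityˡ x))) (ℕₚ.*-monoˡ-≤ x (ℕₚ.1≤n! u))) (ℕₚ.n≤1+n _)

        ≤-times : ∀ {a b} → 0 < b → a ≤ M → a ≤ b * M
        ≤-times {a} {b} 0<b le = ℕₚ.≤-trans le (ℕₚ.≤-trans (ℕₚ.≤-reflexive (sym (ℕₚ.*-identityˡ M))) (ℕₚ.*-monoˡ-≤ M 0<b))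

        k≤m : k ≤ m
        k≤m = ≤-times (ℕₚ.*-mono-≤ (^-pos (suc e₁) 0<N) (^-pos e₂ 0<w)) (ℕₚ.≤-trans k≤x x≤M)

        s≤n′ : s ≤ n′
        s≤n′ = ≤-times (ℕₚ.*-mono-≤ (^-pos (suc e₁) 0<N) (^-pos (suc e₂) 0<w)) (ℕₚ.≤-trans s≤x x≤M)

        n′≡ : n′ ≡ w * m
        n′≡ = lemma (N ^ suc e₁) w (w ^ e₂) M
          where lemma : ∀ a w p M → a * (w * p) * M ≡ w * (a * p * M)
                lemma = ℕS.solve-∀

        size≡ : u * (n′ * H) ≡ N * n″
        size≡ = trans (cong (λ z → z * (n′ * H)) u≡) (lemma (H ^ e) (H ^ suc e) N (N ^ e₁) (w ^ suc e₂) M H)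
          where lemma : ∀ p q N a b M h → p * q * (N * a * b * M * h) ≡ N * (h * p * q * (a * b) * M)
                lemma = ℕS.solve-∀

        I : Incomplete k (Fin (N * n″)) (Fin (s * H + w))
        I = subst (λ z → Incomplete k (Fin z) (Fin (s * H + w))) size≡
              (design-with-hole 2≤k P Pw k≤u (td-product (td-product T₁ T₂) (factorialTD u x)) n′≡ k≤m s≤n′)

        T″ : TD k n″
        T″ = td-product (td-product (td-product TH TH) (td-product (td-power TN e₁) (td-restrict k≤1+u T₂))) (td-restrict k≤1+u (factorialTD u x))
          where k≤1+u : k ≤ suc u
                k≤1+u = ℕₚ.m≤n⇒m≤1+n k≤u

        0<n″ : 0 < n″
        0<n″ = ℕₚ.*-mono-≤ (ℕₚ.*-mono-≤ (ℕₚ.*-mono-≤ (^-pos (suc e) 0<H) (^-pos (suc e) 0<H)) (ℕₚ.*-mono-≤ (^-pos e₁ 0<N) (^-pos (suc e₂) 0<w))) (s≤s z≤n)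

        symmetricOrder : Symmetric k G (Fin (Q₀ * M + (s * H + w)))
        symmetricOrder = subst (λ z → Symmetric k G (Fin (z + (s * H + w)))) (lemma (n * c) N _ M) (fillSymmetric 0<c 0<N 0<n″ S T″ I D)
          where lemma : ∀ a N b M → a * (N * (b * M)) ≡ a * (N * b) * M
                lemma = ℕS.solve-∀

  abstract
    symmetricOrders : SymmetricOrders k G H w
    symmetricOrders with labelledTD k H (ℕₚ.≤-trans (s≤s z≤n) 2≤k) 0<H
    ... | L , e , L≡ with labelledTD (suc (H ^ e * H ^ suc e)) N (s≤s z≤n) 0<N | labelledTD (suc (H ^ e * H ^ suc e)) w (s≤s z≤n) 0<w
    ... | L₁ , e₁ , L₁≡ | L₂ , e₂ , L₂≡ = record { Q = O.Q₀ ; L = u ! ; 0<Q = O.0<Q₀ ; 0<L = ℕₚ.1≤n! u ; H∣Q = O.H∣Q₀ ; order = O.symmetricOrder }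
      where
      u : ℕ
      u = H ^ e * H ^ suc e
      module O = Step e e₁ e₂ (subst (TD k) L≡ (LabelledTD.td L)) u refl
        (subst (TD (suc u)) L₁≡ (LabelledTD.td L₁)) (subst (TD (suc u)) L₂≡ (LabelledTD.td L₂))

eventually-class : ∀ {ℓ} Q → 0 < Q → (A : ℕ → Set ℓ) → (∀ ρ → Σ ℕ λ q₀ → ∀ q → q₀ ≤ q → A (ρ + Q * q)) → Σ ℕ λ v₀ → ∀ v → v₀ ≤ v → A v
eventually-class Q 0<Q A h = eventually-mod Q A λ ρ _ → Q * proj₁ (h ρ) , λ v le e →
    subst A (sym (trans (DM.m≡m%n+[m/n]*n v Q) (cong₂ _+_ e (ℕₚ.*-comm (v / Q) Q))))
      (proj₂ (h ρ) (v / Q) (ℕₚ.≤-trans (ℕₚ.≤-reflexive (sym (trans (cong (_/ Q) (ℕₚ.*-comm Q (proj₁ (h ρ)))) (DM.m*n/n≡m (proj₁ (h ρ)) Q)))) (DM./-monoˡ-≤ Q le)))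
  where instance _ = >-nonZero 0<Q

difference-multiple : ∀ {H w v} i j → w ≤ v → v + H * i ≡ w + H * j → Σ ℕ λ s → s * H + w ≡ v
difference-multiple {H} {w} {v} i j w≤v e with ℕₚ.m≤n⇒∃[o]m+o≡n w≤v
... | t , refl = go (Div.∣m+n∣m⇒∣n (subst (H ∣_) (trans (sym cancelled) (ℕₚ.+-comm t (H * i))) (Div.m∣m*n j)) (Div.m∣m*n i))
  where
  cancelled : t + H * i ≡ H * j
  cancelled = ℕₚ.+-cancelˡ-≡ w (t + H * i) (H * j) (trans (sym (ℕₚ.+-assoc w t (H * i))) e)
  go : H ∣ t → Σ ℕ λ s → s * H + w ≡ w + t
  go (divides s refl) = s , ℕₚ.+-comm (s * H) w

module _ {k n : ℕ} {G : FinGroup n} (3≤k : 3 ≤ k) (P : Progression k) where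
  open Progression P

  private
    K∣H : (k * (k ∸ 1)) ∣ H
    K∣H = Div.∣-trans (block-divides-factorial (ℕₚ.≤-trans (s≤s (s≤s z≤n)) 3≤k)) k!∣H

  Good : ℕ → Set₁
  Good v = Admissible k v → Symmetric k G (Fin v)

  module _ {w ρ a₀ : ℕ} (w≡ : w ≡ ρ + H * a₀) (O : SymmetricOrders k G H w) where
    open SymmetricOrders O renaming (order to symmetric)

    private
      B : ℕ
      B = k + 3 + w

      -- A representative of ρ₁ - Q modulo Q L that is at least k + 2 + w. The subtracted Q
      -- compensates the leading term of Q (1 + L x).
      r : ℕ → ℕ
      r ρ₁ = ρ₁ + Q * ℕ.pred (L * B)

      B≡ : suc (ℕ.pred (L * B)) ≡ L * B
      B≡ = ℕₚ.suc-pred (L * B) {{>-nonZero (ℕₚ.*-mono-≤ 0<L (ℕₚ.≤-trans (s≤s z≤n) (ℕₚ.≤-trans 3≤k (ℕₚ.≤-trans (ℕₚ.m≤m+n k 3) (ℕₚ.m≤m+n (k + 3) w)))))}}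

      r-large : ∀ ρ₁ → k + 2 + w ≤ r ρ₁
      r-large ρ₁ = ℕₚ.≤-trans (ℕₚ.≤-pred (ℕₚ.≤-trans (ℕₚ.≤-trans (ℕₚ.≤-reflexive (lemma k w)) (ℕₚ.*-monoˡ-≤ B 0<L)) (ℕₚ.≤-reflexive (sym B≡))))
          (ℕₚ.≤-trans (ℕₚ.≤-trans (ℕₚ.≤-reflexive (sym (ℕₚ.*-identityˡ _))) (ℕₚ.*-monoˡ-≤ (ℕ.pred (L * B)) 0<Q)) (ℕₚ.m≤n+m _ ρ₁))
        where lemma : ∀ k w → suc (k + 2 + w) ≡ 1 * (k + 3 + w)
              lemma = ℕS.solve-∀

      r+Q : ∀ ρ₁ → r ρ₁ + Q ≡ ρ₁ + Q * L * B
      r+Q ρ₁ = trans (l₁ ρ₁ Q (ℕ.pred (L * B))) (trans (cong (λ z → ρ₁ + Q * z) B≡) (cong (λ z → ρ₁ + z) (sym (ℕₚ.*-assoc Q L B))))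
        where l₁ : ∀ ρ Q p → ρ + Q * p + Q ≡ ρ + Q * suc p
              l₁ = ℕS.solve-∀

    module _ (ρ₁ y : ℕ) (D : IsOrder k (r ρ₁ * (1 + Q * L * y))) where
      private
        w₁ = r ρ₁ * (1 + Q * L * y)
        C = B + r ρ₁ * y

        w₁+Q : w₁ + Q ≡ ρ₁ + Q * L * C
        w₁+Q = trans (l₁ (r ρ₁) (Q * L) y Q) (trans (cong (λ z → z + Q * L * (r ρ₁ * y)) (r+Q ρ₁)) (l₂ ρ₁ (Q * L) B (r ρ₁ * y)))
          where l₁ : ∀ r M y Q → r * (1 + M * y) + Q ≡ (r + Q) + M * (r * y)
                l₁ = ℕS.solve-∀
                l₂ : ∀ ρ M B t → ρ + M * B + M * t ≡ ρ + M * (B + t)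
                l₂ = ℕS.solve-∀

        w≤w₁ : w ≤ w₁
        w≤w₁ = ℕₚ.≤-trans (ℕₚ.≤-trans (ℕₚ.m≤n+m w (k + 2)) (r-large ρ₁)) (ℕₚ.≤-trans (ℕₚ.≤-reflexive (sym (ℕₚ.*-identityʳ (r ρ₁)))) (ℕₚ.*-monoʳ-≤ (r ρ₁) (s≤s z≤n)))

      -- Since w₁ + Q lies in the class of ρ₁ modulo Q L, the order splits as Q (1 + L x) + w₁ with
      -- x growing. As `H` divides `Q`, w₁ is congruent to the order and hence to w modulo `H`; so
      -- w₁ = s H + w, a hole size that truncation provides as soon as s ≤ x.
      symmetric-class : ∀ a q → C + (k + w₁) ≤ q → ρ₁ + Q * L * q ≡ ρ + H * a → Symmetric k G (Fin (ρ₁ + Q * L * q))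
      symmetric-class a q le v≡ with ℕₚ.m≤n⇒∃[o]m+o≡n (ℕₚ.≤-trans (ℕₚ.m≤m+n C (k + w₁)) le)
      ... | x , refl = build H∣Q
        where
        k+w₁≤x : k + w₁ ≤ x
        k+w₁≤x = ℕₚ.+-cancelˡ-≤ C (k + w₁) x le
        size≡ : Q * (1 + L * x) + w₁ ≡ ρ₁ + Q * L * (C + x)
        size≡ = trans (l₁ Q L x w₁) (trans (cong (λ z → z + Q * L * x) w₁+Q) (l₂ ρ₁ (Q * L) C x))
          where l₁ : ∀ Q L x w → Q * (1 + L * x) + w ≡ w + Q + Q * L * x
                l₁ = ℕS.solve-∀
                l₂ : ∀ ρ M C x → ρ + M * C + M * x ≡ ρ + M * (C + x)
                l₂ = ℕS.solve-∀
        build : H ∣ Q → Symmetric k G (Fin (ρ₁ + Q * L * (C + x)))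
        build (divides h Q≡) = fill (difference-multiple (h * (1 + L * x) + a₀) a w≤w₁ congruent)
          where
          congruent : w₁ + H * (h * (1 + L * x) + a₀) ≡ w + H * a
          congruent = trans (l₁ w₁ H h L x a₀) (trans (cong (λ z → z * (1 + L * x) + w₁ + H * a₀) (sym Q≡))
              (trans (cong (λ z → z + H * a₀) (trans size≡ v≡)) (trans (l₂ ρ H a a₀) (cong (λ z → z + H * a) (sym w≡)))))
            where l₁ : ∀ w H h L x a₀ → w + H * (h * (1 + L * x) + a₀) ≡ (h * H) * (1 + L * x) + w + H * a₀
                  l₁ = ℕS.solve-∀
                  l₂ : ∀ ρ H a a₀ → ρ + H * a + H * a₀ ≡ ρ + H * a₀ + H * a
                  l₂ = ℕS.solve-∀
          fill : (Σ ℕ λ s → s * H + w ≡ w₁) → Symmetric k G (Fin (ρ₁ + Q * L * (C + x)))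
          fill (s , e) = subst (λ z → Symmetric k G (Fin z)) (trans (cong (λ z → Q * (1 + L * x) + z) e) size≡)
              (symmetric x s (ℕₚ.≤-trans (ℕₚ.m≤m+n k w₁) k+w₁≤x) (ℕₚ.≤-trans s≤w₁ (ℕₚ.≤-trans (ℕₚ.m≤n+m w₁ k) k+w₁≤x)) (order-≡ (sym e) D))
            where s≤w₁ : s ≤ w₁
                  s≤w₁ = ℕₚ.≤-trans (ℕₚ.≤-trans (ℕₚ.≤-reflexive (sym (ℕₚ.*-identityʳ s))) (ℕₚ.*-monoʳ-≤ s 0<H)) (ℕₚ.≤-trans (ℕₚ.m≤m+n (s * H) w) (ℕₚ.≤-reflexive e))

    abstract
      eventually-class-good : Σ ℕ λ v₀ → ∀ v → v₀ ≤ v → ∀ a → v ≡ ρ + H * a → Good v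
      eventually-class-good = eventually-class (Q * L) (ℕₚ.*-mono-≤ 0<Q 0<L) (λ v → ∀ a → v ≡ ρ + H * a → Good v) λ ρ₁ → class ρ₁ (admissible? k (r ρ₁))
        where
        0<r : ∀ ρ₁ → 0 < r ρ₁
        0<r ρ₁ = ℕₚ.≤-trans (ℕₚ.≤-trans (s≤s z≤n) 3≤k) (ℕₚ.≤-trans (ℕₚ.≤-trans (ℕₚ.m≤m+n k 2) (ℕₚ.m≤m+n (k + 2) w)) (r-large ρ₁))
        class : ∀ ρ₁ → Dec (Admissible k (r ρ₁)) → Σ ℕ λ q₀ → ∀ q → q₀ ≤ q → ∀ a → ρ₁ + Q * L * q ≡ ρ + H * a → Good (ρ₁ + Q * L * q)
        class ρ₁ (no ¬adm) = 1 , λ q 0<q a _ adm → ⊥-elim (¬adm (admissible-transfer {k} (ℕ.pred (L * B)) (L * q) Q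
            (ℕₚ.≤-trans (ℕₚ.*-mono-≤ (ℕₚ.*-mono-≤ 0<Q 0<L) 0<q) (ℕₚ.m≤n+m (Q * L * q) ρ₁)) (0<r ρ₁) (Div.∣-trans K∣H H∣Q) (lemma ρ₁ Q L q (ℕ.pred (L * B))) adm))
          where lemma : ∀ ρ Q L q p → ρ + Q * L * q + Q * p ≡ ρ + Q * p + Q * (L * q)
                lemma = ℕS.solve-∀
        class ρ₁ (yes adm) = from (orders-in-class k 3≤k P (r ρ₁) (ℕₚ.≤-trans (ℕₚ.m≤m+n (k + 2) w) (r-large ρ₁)) adm (Q * L) (ℕₚ.*-mono-≤ 0<Q 0<L))
          where from : (Σ ℕ λ y → IsOrder k (r ρ₁ * (1 + Q * L * y))) → Σ ℕ λ q₀ → ∀ q → q₀ ≤ q → ∀ a → ρ₁ + Q * L * q ≡ ρ + H * a → Good (ρ₁ + Q * L * q)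
                from (y , D) = B + r ρ₁ * y + (k + r ρ₁ * (1 + Q * L * y)) , λ q le a v≡ _ → symmetric-class ρ₁ y D a q le v≡

  abstract
    eventually-good : (∀ {w} → 0 < w → IsOrder k w → SymmetricOrders k G H w) → Σ ℕ λ v₀ → ∀ v → v₀ ≤ v → Good v
    eventually-good orders = eventually-class H 0<H Good λ ρ → class ρ (admissible? k (ρ + H * (k + 2)))
      where
      r-large : ∀ ρ → k + 2 ≤ ρ + H * (k + 2)
      r-large ρ = ℕₚ.≤-trans (ℕₚ.≤-trans (ℕₚ.≤-reflexive (sym (ℕₚ.*-identityˡ (k + 2)))) (ℕₚ.*-monoˡ-≤ (k + 2) 0<H)) (ℕₚ.m≤n+m (H * (k + 2)) ρ)
      0<r : ∀ ρ → 0 < ρ + H * (k + 2)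
      0<r ρ = ℕₚ.≤-trans (ℕₚ.≤-trans (s≤s z≤n) 3≤k) (ℕₚ.≤-trans (ℕₚ.m≤m+n k 2) (r-large ρ))
      class : ∀ ρ → Dec (Admissible k (ρ + H * (k + 2))) → Σ ℕ λ q₀ → ∀ q → q₀ ≤ q → Good (ρ + H * q)
      class ρ (no ¬adm) = 1 , λ q 0<q adm → ⊥-elim (¬adm (admissible-transfer {k} (k + 2) q H
          (ℕₚ.≤-trans (ℕₚ.*-mono-≤ 0<H 0<q) (ℕₚ.m≤n+m (H * q) ρ)) (0<r ρ) K∣H (lemma ρ H q (k + 2)) adm))
        where lemma : ∀ ρ H q p → ρ + H * q + H * p ≡ ρ + H * p + H * q
              lemma = ℕS.solve-∀
      class ρ (yes adm) = from (orders-in-class k 3≤k P (ρ + H * (k + 2)) (r-large ρ) adm H 0<H)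
        where
        from : (Σ ℕ λ y → IsOrder k ((ρ + H * (k + 2)) * (1 + H * y))) → Σ ℕ λ q₀ → ∀ q → q₀ ≤ q → Good (ρ + H * q)
        from (y , D) = proj₁ good , λ q le → proj₂ good (ρ + H * q) (ℕₚ.≤-trans le (ℕₚ.≤-trans
            (ℕₚ.≤-trans (ℕₚ.≤-reflexive (sym (ℕₚ.*-identityˡ q))) (ℕₚ.*-monoˡ-≤ q 0<H)) (ℕₚ.m≤n+m (H * q) ρ))) q refl
          where
          w≡ : (ρ + H * (k + 2)) * (1 + H * y) ≡ ρ + H * (k + 2 + (ρ + H * (k + 2)) * y)
          w≡ = lemma ρ H (k + 2) y
            where lemma : ∀ ρ H b y → (ρ + H * b) * (1 + H * y) ≡ ρ + H * (b + (ρ + H * b) * y)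
                  lemma = ℕS.solve-∀
          good : Σ ℕ λ v₀ → ∀ v → v₀ ≤ v → ∀ a → v ≡ ρ + H * a → Good v
          good = eventually-class-good w≡ (orders (ℕₚ.*-mono-≤ (0<r ρ) (s≤s z≤n)) D)

eventually-symmetric : ∀ k → 3 ≤ k → ∀ {n} (G : FinGroup n) → NoInvolution G → Σ ℕ λ v₀ → ∀ v → v₀ ≤ v → Admissible k v → Symmetric k G (Fin v)
-- With k orbits there are n k ≥ k groups, so blocks exist and every pair of groups is covered a
-- positive number of times.
eventually-symmetric k 3≤k {n} G noInv = from (allBlocks-uniform {k} {n * k} 2≤k k≤nk)
  where
  2≤k : 2 ≤ k
  2≤k = ℕₚ.≤-trans (s≤s (s≤s z≤n)) 3≤k
  0<n : 0 < n
  0<n = ℕₚ.≤-trans (s≤s z≤n) (Fₚ.toℕ<n (FinGroup.ε G))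
  k≤nk : k ≤ n * k
  k≤nk = ℕₚ.≤-trans (ℕₚ.≤-reflexive (sym (ℕₚ.*-identityˡ k))) (ℕₚ.*-monoˡ-≤ k 0<n)
  P : Progression k
  P = progression k 2≤k
  from : (Σ ℕ λ l → 0 < l × (∀ {x y} → x ≢ y → multiplicity (allBlocks {n * k} {k}) x y ≡ l)) →
         Σ ℕ λ v₀ → ∀ v → v₀ ≤ v → Admissible k v → Symmetric k G (Fin v)
  from (l , 0<l , const) = eventually-good 3≤k P
      (symmetricOrders 3≤k P 0<n (ℕₚ.≤-trans (s≤s z≤n) 2≤k) (ℕₚ.m^n>0 (n * l) {{>-nonZero (ℕₚ.*-mono-≤ 0<n 0<l)}} (suc I.exponent)) I.gdd (td-restrict k≤nk I.td))
    where module I = InflatedGDD (inflatedGDD {n} {k} {k} {l} G noInv (ℕₚ.≤-trans 2≤k k≤nk) (allBlocks {n * k} {k}) 0<l const)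

theorem1p1 : ∀ {c ℓ : Level} (k : ℕ) → 3 ≤ k → (G : Group c ℓ) → (n : ℕ) → FiniteOfOrder G n → Odd n →
    Σ ℕ λ v₀ → ∀ (v : ℕ) → v₀ ≤ v → (k ∸ 1) ∣ (v ∸ 1) → (k * (k ∸ 1)) ∣ (v * (v ∸ 1)) →
    Σ (Design v k) λ D → GroupEmbeddingIntoAut G D
theorem1p1 k 3≤k G n finite odd = proj₁ orders , λ v le d₁ d₂ → design-with-group G finite (proj₂ orders v le (d₁ , d₂))
  where
  orders : Σ ℕ λ v₀ → ∀ v → v₀ ≤ v → Admissible k v → Symmetric k (finGroup G finite) (Fin v)
  orders = eventually-symmetric k 3≤k (finGroup G finite) (odd-noInvolution (finGroup G finite) odd)
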